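{- There is a randomized algorithm that takes as input (1) oracles $\mathrm{MQ}(h)$ and $\mathrm{SAMP}(h)$ for some function $h:\{0,1\}^n\to\{0,1\}$, (2) positive integers $r$ and $\mu$, and (3) a distance parameter $\varepsilon$, which makes $\mathrm{poly}(r/\varepsilon,\mu)$ oracle calls and satisfies: (a) if $h$ is an $(r,\mu)$-factored-DNF, it accepts with probability at least $0.9$; and (b) if $\mathrm{reldist}(h,h')>\varepsilon$ for every $(r,\mu)$-factored-DNF $h'$, it rejects with probability at least $0.9$.
   Context: $\mathrm{MQ}(h)$ returns $h(x)$ on query $x$; $\mathrm{SAMP}(h)$ returns an independent uniformly random element of $h^{ -1}(1)$. $\mathrm{reldist}(f,g)=|f^{ -1}(1)\triangle g^{ -1}(1)|/|f^{ -1}(1)|$. A function $h:\{0,1\}^n\to\{0,1\}$ is an $(r,\mu)$-factored-DNF if $h=H\wedge(T_1\vee\cdots\vee T_{r'})$ for some $r'\le r$, where $H$ is a conjunction of literals of arbitrary width, $T_1,\dots,T_{r'}$ are conjunctions of literals, the variables of $H$ are disjoint from the variables appearing in $T_1,\dots,T_{r'}$, and the total number of variables appearing in $T_1,\dots,T_{r'}$ is at most $\mu$. -}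

module Defs where

open import Data.Bool using (Bool; true; false; _∧_; _∨_; not; if_then_else_)
open import Data.Bool.Properties using () renaming (_≟_ to _≟ᵇ_)
open import Data.Nat using (ℕ; zero; suc; _≤_; _<_)
open import Data.Fin using (Fin)
open import Data.Fin.Subset using (Subset; ⁅_⁆; _∪_; ∣_∣; _∩_; Empty) renaming (⊥ to ∅)
open import Data.Vec using (Vec; []; _∷_; lookup)
open import Data.List using (List; []; _∷_; map; length; filter; _++_; foldr; concatMap)
open import Data.Bool.ListAction using (all; any)
open import Data.Integer using (+_)
open import Data.Rational.Unnormalised using (ℚᵘ; 0ℚᵘ; 1ℚᵘ; ½; _+_; _*_; _/_; _÷_; _-_; Positive)
open import Data.Rational.Unnormalised.Properties using (pos⇒nonZero)
open import Data.Product using (Σ; _×_; _,_; proj₁; proj₂)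
open import Relation.Binary.PropositionalEquality using (_≡_)

Point : ℕ → Set
Point n = Vec Bool n

BoolFun : ℕ → Set
BoolFun n = Point n → Bool

allPoints : (n : ℕ) → List (Point n)
allPoints zero    = [] ∷ []
allPoints (suc n) = map (true ∷_) (allPoints n) ++ map (false ∷_) (allPoints n)

support : {n : ℕ} → BoolFun n → List (Point n)
support {n} h = filter (λ x → h x ≟ᵇ true) (allPoints n)

supportSize : {n : ℕ} → BoolFun n → ℕ
supportSize h = length (support h)

-- a / b as an unnormalised rational (0 if b = 0; never used in that case)
divℕ : ℕ → ℕ → ℚᵘ
divℕ a zero    = 0ℚᵘ
divℕ a (suc b) = + a / suc b

xorB : Bool → Bool → Bool
xorB a b = if a then not b else b

reldist : {n : ℕ} → BoolFun n → BoolFun n → ℚᵘ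
reldist f g = divℕ (supportSize (λ x → xorB (f x) (g x))) (supportSize f)

-- a literal: a variable together with the value that satisfies it
Literal : ℕ → Set
Literal n = Fin n × Bool

Conj : ℕ → Set
Conj n = List (Literal n)

evalLit : {n : ℕ} → Literal n → Point n → Bool
evalLit (i , b) x = if b then lookup x i else not (lookup x i)

evalConj : {n : ℕ} → Conj n → Point n → Bool
evalConj C x = all (λ ℓ → evalLit ℓ x) C

evalDNF : {n : ℕ} → List (Conj n) → Point n → Bool
evalDNF Ts x = any (λ T → evalConj T x) Ts

varsConj : {n : ℕ} → Conj n → Subset n
varsConj C = foldr (λ ℓ S → ⁅ proj₁ ℓ ⁆ ∪ S) ∅ C

varsDNF : {n : ℕ} → List (Conj n) → Subset n
varsDNF Ts = foldr (λ T S → varsConj T ∪ S) ∅ Ts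

IsFactoredDNF : {n : ℕ} → ℕ → ℕ → BoolFun n → Set
IsFactoredDNF {n} r μ h =
  Σ (Conj n) λ H → Σ (List (Conj n)) λ Ts →
    (length Ts ≤ r) ×
    Empty (varsConj H ∩ varsDNF Ts) ×
    (∣ varsDNF Ts ∣ ≤ μ) ×
    ((x : Point n) → h x ≡ (evalConj H x ∧ evalDNF Ts x))

-- Randomized oracle algorithms with MQ(h) and SAMP(h) access,
-- as finite decision trees

data Alg (n : ℕ) : Set where
  ret  : Bool → Alg n
  coin : (Bool → Alg n) → Alg n
  mq   : Point n → (Bool → Alg n) → Alg n
  samp : (Point n → Alg n) → Alg n

data CallsWithin {n : ℕ} : ℕ → Alg n → Set where
  ret  : ∀ {q} b → CallsWithin q (ret b)
  coin : ∀ {q k} → (∀ b → CallsWithin q (k b)) → CallsWithin q (coin k)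
  mq   : ∀ {q x k} → (∀ b → CallsWithin q (k b)) → CallsWithin (suc q) (mq x k)
  samp : ∀ {q k} → (∀ x → CallsWithin q (k x)) → CallsWithin (suc q) (samp k)

sumℚ : List ℚᵘ → ℚᵘ
sumℚ = foldr _+_ 0ℚᵘ

-- exact acceptance probability of the algorithm run with oracles for h
-- (SAMP(h) is uniform over h^{-1}(1); only used when it is nonempty)
accProb : {n : ℕ} → Alg n → BoolFun n → ℚᵘ
accProb (ret true)  h = 1ℚᵘ
accProb (ret false) h = 0ℚᵘ
accProb (coin k)    h = ½ * (accProb (k true) h + accProb (k false) h)
accProb (mq x k)    h = accProb (k (h x)) h
accProb (samp k)    h =
  sumℚ (map (λ x → accProb (k x) h) (support h)) * divℕ 1 (supportSize h)

rejProb : {n : ℕ} → Alg n → BoolFun n → ℚᵘ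
rejProb A h = 1ℚᵘ - accProb A h

nineTenths : ℚᵘ
nineTenths = + 9 / 10

_^ᵘ_ : ℚᵘ → ℕ → ℚᵘ
p ^ᵘ zero  = 1ℚᵘ
p ^ᵘ suc k = p * (p ^ᵘ k)

-- the polynomial bound c · (r/ε + μ)^k, which dominates poly(r/ε, μ)
polyBound : ℕ → ℕ → (r μ : ℕ) (ε : ℚᵘ) → .{{Positive ε}} → ℚᵘ
polyBound c k r μ ε =
  (+ c / 1) * ((_÷_ (+ r / 1) ε {{pos⇒nonZero ε}} + (+ μ / 1)) ^ᵘ k)

{-# OPTIONS --safe #-}

-- Let U = h⁻¹(1), and let err v be the number of points of U that translation by v moves out of U; err is subadditive
-- in v. If h is a factored DNF and x, y ∈ U, the part of x ⊕ y away from the variables of the terms Tᵢ has err 0.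
--
-- Split the coordinates into 2^k random blocks. The junta test counts the blocks on which translating a sample by a
-- random part of the difference of two samples ever leaves U, and rejects if there are more than μ of them. If it
-- passes with noticeable probability, a greedy scan of the coordinates yields a set J of at most μ of them, outside of
-- which these differences have small err on average; a random labelling puts the elements of J into distinct blocks.
-- Membership queries then tell, relative to a fixed sample c₀, at which blocks the J-variable of another sample
-- differs from that of c₀. The test learns the smallest r-term DNF over the blocks which is true at many such
-- readings, and verifies it: satisfying assignments, drawn by rejection, are planted into fresh samples, and h must
-- hold at the resulting points.
--
-- Soundness: consistency with the readings bounds the part of U on which the learned function is false, and
-- verification the part of the learned function outside of U, so that h is close to a factored DNF. Completeness:
-- a nearly correct candidate exists, so the smallest consistent one is no larger, and as it covers almost all of U, it
-- has little room outside of U.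
--
-- All random choices and samples are drawn before the first membership query. Probabilities are therefore counts over
-- one product of finite sample spaces, and every estimate is an inequality of natural numbers.

module Submission where

open import Defs
open import Data.Bool using (Bool; true; false; _∧_; _∨_; not; if_then_else_; _xor_)
import Data.Bool
open import Data.Bool.ListAction using (all; any)
open import Data.Bool.Properties using (xor-assoc; xor-comm; xor-same; xor-identityʳ; ∧-distribˡ-xor; ∧-zeroʳ; ∧-comm; ∧-assoc; ∧-identityʳ; ∨-zeroʳ; ∨-assoc) renaming (_≟_ to _≟ᵇ_)
open import Data.Empty using (⊥; ⊥-elim; ⊥-elim-irr)
open import Data.Fin using (Fin; zero; suc; combine; remQuot; toℕ)
open import Data.Fin.Properties using (combine-remQuot; remQuot-combine; toℕ<n) renaming (_≟_ to _≟ᶠ_)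
open import Data.Fin.Subset using (⁅_⁆; _∩_; ∣_∣; Empty)
open import Data.Fin.Subset.Properties using (∉⊥; x∈p∩q⁻; ∣⊥∣≡0)
open import Data.List as List using (List; []; _∷_; map; length; filter; _++_; cartesianProductWith; cartesianProduct; allFin)
open import Data.List.Membership.Propositional using (_∈_)
open import Data.List.Membership.Propositional.Properties using (∈-++⁺ˡ; ∈-++⁺ʳ; ∈-map⁺; ∈-cartesianProductWith⁺)
import Data.List.Properties as List
open import Data.List.Relation.Unary.All as All using (All; []; _∷_)
open import Data.List.Relation.Unary.All.Properties using (all-filter; ++⁺; ++⁻ˡ; ++⁻ʳ; map⁺; map⁻)
open import Data.List.Relation.Unary.Any using (here; there)
open import Data.Maybe using (Maybe; just; nothing; maybe)
open import Data.Nat using (ℕ; zero; suc; _+_; _*_; _^_; _⊔_; _≤_; _<_; z≤n; s≤s; NonZero; >-nonZero; _≡ᵇ_; _≤ᵇ_)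
import Data.Nat.DivMod as ℕ
open import Data.Nat.Properties
open import Data.Nat.Tactic.RingSolver using (solve-∀)
open import Data.Product using (Σ; ∃; _×_; _,_; proj₁; proj₂)
open import Data.Vec as Vec using (Vec; []; _∷_; toList; lookup; zipWith; replicate; tabulate)
open import Data.Vec.Properties using (lookup-zipWith; lookup-map; lookup-replicate; lookup∘tabulate; lookup⇒[]=; []=⇒lookup; map-cong)
open import Function using (_∘_; id)
open import Relation.Binary.PropositionalEquality using (_≡_; _≢_; refl; sym; trans; cong; cong₂; subst; subst₂; module ≡-Reasoning)
open import Relation.Nullary using (Dec; yes; no)

-- The tester never learns where the variables of `J` lie. It can only translate a point by the part
-- of a difference of samples inside a whole block, so every intended flip drags irrelevant
-- coordinates along, the junk. Two facts keep this under control. The error of a translation is not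
-- monotone in the set to which it is restricted, but its average over random subsets is, up to a
-- factor two; hence the random set in each trial. And outside `J` there is a gap: a translation
-- moves either more than half of `h⁻¹(1)` out or almost nothing. So the coordinates of small error
-- span a whole subcube of harmless translations, with no loss that grows with the dimension, while
-- on the remaining coordinates almost all samples agree. Block labels form a group, so the heavy
-- classes of the scan can be relabelled by independent uniform shifts, and soundness of the junta
-- test becomes a birthday bound. Patterns are relative to `c₀` because only differences from a
-- sample can be observed. Coins and computation are free in `CallsWithin`, which permits `2 ^ K`
-- draws per rejection sample and an exhaustive search over the codes.

private
  variable
    A B Ω : Set
    n k κ κ′ : ℕ

-- Finite sums

∑ : List A → (A → ℕ) → ℕ
∑ []      f = 0
∑ (x ∷ L) f = f x + ∑ L f

infix 5 ∑
syntax ∑ L (λ x → e) = ∑[ x ∈ L ] e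

[_]ᵇ : Bool → ℕ
[ true ]ᵇ  = 1
[ false ]ᵇ = 0

∑-mono-All : ∀ {f g : A → ℕ} {L} → All (λ x → f x ≤ g x) L → ∑ L f ≤ ∑ L g
∑-mono-All []       = z≤n
∑-mono-All (p ∷ ps) = +-mono-≤ p (∑-mono-All ps)

∑-mono : ∀ {f g : A → ℕ} L → (∀ x → f x ≤ g x) → ∑ L f ≤ ∑ L g
∑-mono L p = ∑-mono-All (All.universal p L)

∑-cong-All : ∀ {f g : A → ℕ} {L} → All (λ x → f x ≡ g x) L → ∑ L f ≡ ∑ L g
∑-cong-All []       = refl
∑-cong-All (p ∷ ps) = cong₂ _+_ p (∑-cong-All ps)

∑-cong : ∀ {f g : A → ℕ} L → (∀ x → f x ≡ g x) → ∑ L f ≡ ∑ L g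
∑-cong L p = ∑-cong-All (All.universal p L)

+-interchange : ∀ a b c d → (a + b) + (c + d) ≡ (a + c) + (b + d)
+-interchange = solve-∀

∑-+ : ∀ (f g : A → ℕ) L → (∑[ x ∈ L ] (f x + g x)) ≡ ∑ L f + ∑ L g
∑-+ f g []      = refl
∑-+ f g (x ∷ L) = trans (cong (f x + g x +_) (∑-+ f g L)) (+-interchange (f x) (g x) _ _)

∑-*ˡ : ∀ c (f : A → ℕ) L → (∑[ x ∈ L ] (c * f x)) ≡ c * ∑ L f
∑-*ˡ c f []      = sym (*-zeroʳ c)
∑-*ˡ c f (x ∷ L) = trans (cong (c * f x +_) (∑-*ˡ c f L)) (sym (*-distribˡ-+ c (f x) _))

∑-*ʳ : ∀ c (f : A → ℕ) L → (∑[ x ∈ L ] (f x * c)) ≡ ∑ L f * c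
∑-*ʳ c f L = trans (∑-cong L (λ x → *-comm (f x) c)) (trans (∑-*ˡ c f L) (*-comm c _))

∑-const : ∀ c (L : List A) → (∑[ _ ∈ L ] c) ≡ length L * c
∑-const c []      = refl
∑-const c (x ∷ L) = cong (c +_) (∑-const c L)

∑-one : (L : List A) → (∑[ _ ∈ L ] 1) ≡ length L
∑-one L = trans (∑-const 1 L) (*-identityʳ _)

∑-zero : (L : List A) → (∑[ _ ∈ L ] 0) ≡ 0
∑-zero L = trans (∑-const 0 L) (*-zeroʳ (length L))

∑-swap : ∀ (f : A → B → ℕ) L M → (∑[ x ∈ L ] ∑[ y ∈ M ] f x y) ≡ (∑[ y ∈ M ] ∑[ x ∈ L ] f x y)
∑-swap f []      M = sym (∑-zero M)
∑-swap f (x ∷ L) M = trans (cong (∑ M (f x) +_) (∑-swap f L M)) (sym (∑-+ (f x) _ M))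

∑-++ : ∀ (f : A → ℕ) L M → ∑ (L ++ M) f ≡ ∑ L f + ∑ M f
∑-++ f []      M = refl
∑-++ f (x ∷ L) M = trans (cong (f x +_) (∑-++ f L M)) (sym (+-assoc (f x) _ _))

∑-map : ∀ (f : B → ℕ) (g : A → B) L → ∑ (map g L) f ≡ ∑ L (f ∘ g)
∑-map f g []      = refl
∑-map f g (x ∷ L) = cong (f (g x) +_) (∑-map f g L)

∑-cartesian : ∀ (f : Ω → ℕ) (g : A → B → Ω) L M →
  ∑ (cartesianProductWith g L M) f ≡ (∑[ x ∈ L ] ∑[ y ∈ M ] f (g x y))
∑-cartesian f g []      M = refl
∑-cartesian f g (x ∷ L) M =
  trans (∑-++ f (map (g x) M) _) (cong₂ _+_ (∑-map f (g x) M) (∑-cartesian f g L M))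

∑≤length : ∀ (p : A → Bool) L → (∑[ x ∈ L ] [ p x ]ᵇ) ≤ length L
∑≤length p []      = z≤n
∑≤length p (x ∷ L) with p x
... | true  = s≤s (∑≤length p L)
... | false = ≤-trans (∑≤length p L) (n≤1+n _)

vecs : List A → (m : ℕ) → List (Vec A m)
vecs L zero    = [] ∷ []
vecs L (suc m) = cartesianProductWith _∷_ L (vecs L m)

∑-vecs : ∀ L m (f : Vec A (suc m) → ℕ) →
  ∑ (vecs L (suc m)) f ≡ (∑[ x ∈ L ] ∑[ v ∈ vecs L m ] f (x ∷ v))
∑-vecs L m f = ∑-cartesian f _∷_ L (vecs L m)

∑-pairs : ∀ (L : List A) (M : List B) (f : A × B → ℕ) →
  ∑ (cartesianProduct L M) f ≡ (∑[ x ∈ L ] ∑[ y ∈ M ] f (x , y))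
∑-pairs L M f = ∑-cartesian f _,_ L M

length-cartesian : ∀ (g : A → B → Ω) L M → length (cartesianProductWith g L M) ≡ length L * length M
length-cartesian g L M = begin-equality
  length (cartesianProductWith g L M)            ≡⟨ ∑-one (cartesianProductWith g L M) ⟨
  (∑[ _ ∈ cartesianProductWith g L M ] 1)        ≡⟨ ∑-cartesian (λ _ → 1) g L M ⟩
  (∑[ _ ∈ L ] ∑[ _ ∈ M ] 1)                      ≡⟨ ∑-cong L (λ _ → ∑-one M) ⟩
  (∑[ _ ∈ L ] length M)                          ≡⟨ ∑-const _ L ⟩
  length L * length M                            ∎
  where open ≤-Reasoning

length-vecs : ∀ (L : List A) m → length (vecs L m) ≡ length L ^ m
length-vecs L zero    = refl
length-vecs L (suc m) = trans (length-cartesian _∷_ L (vecs L m)) (cong (length L *_) (length-vecs L m))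

-- Linearity of expectation for `m` independent draws. The extra factor `length L` on the left
-- avoids the exponent `m - 1`, which would need a case distinction at zero.
∑-vecs-sum : ∀ (φ : A → ℕ) L m →
  (∑[ v ∈ vecs L m ] ∑ (toList v) φ) * length L ≡ m * length L ^ m * ∑ L φ
∑-vecs-sum φ L zero    = refl
∑-vecs-sum φ L (suc m) = begin-equality
  (∑[ v ∈ vecs L (suc m) ] ∑ (toList v) φ) * ℓ
    ≡⟨ cong (_* ℓ) (∑-vecs L m _) ⟩
  (∑[ x ∈ L ] ∑[ v ∈ vecs L m ] (φ x + ∑ (toList v) φ)) * ℓ
    ≡⟨ cong (_* ℓ) (∑-cong L λ x → ∑-+ (λ _ → φ x) (λ v → ∑ (toList v) φ) (vecs L m)) ⟩
  (∑[ x ∈ L ] ((∑[ _ ∈ vecs L m ] φ x) + S)) * ℓ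
    ≡⟨ cong (_* ℓ) (∑-cong L λ x → cong (_+ S) (trans (∑-const (φ x) (vecs L m)) (cong (_* φ x) (length-vecs L m)))) ⟩
  (∑[ x ∈ L ] (ℓ ^ m * φ x + S)) * ℓ
    ≡⟨ cong (_* ℓ) (trans (∑-+ (λ x → ℓ ^ m * φ x) (λ _ → S) L) (cong₂ _+_ (∑-*ˡ (ℓ ^ m) φ L) (∑-const S L))) ⟩
  (ℓ ^ m * ∑ L φ + ℓ * S) * ℓ
    ≡⟨ alg (ℓ ^ m) (∑ L φ) ℓ S ⟩
  ℓ ^ m * ∑ L φ * ℓ + ℓ * (S * ℓ)
    ≡⟨ cong (λ z → ℓ ^ m * ∑ L φ * ℓ + ℓ * z) (∑-vecs-sum φ L m) ⟩
  ℓ ^ m * ∑ L φ * ℓ + ℓ * (m * ℓ ^ m * ∑ L φ)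
    ≡⟨ alg₂ (ℓ ^ m) (∑ L φ) ℓ m ⟩
  suc m * ℓ ^ suc m * ∑ L φ ∎
  where
  open ≤-Reasoning
  ℓ = length L
  S = ∑[ v ∈ vecs L m ] ∑ (toList v) φ
  alg : ∀ a b l s → (a * b + l * s) * l ≡ a * b * l + l * (s * l)
  alg = solve-∀
  alg₂ : ∀ a b l m → a * b * l + l * (m * a * b) ≡ suc m * (l * a) * b
  alg₂ = solve-∀

∏ : List A → (A → ℕ) → ℕ
∏ []      f = 1
∏ (x ∷ L) f = f x * ∏ L f

∑-vecs-prod : ∀ (φ : A → ℕ) L m → (∑[ v ∈ vecs L m ] ∏ (toList v) φ) ≡ ∑ L φ ^ m
∑-vecs-prod φ L zero    = refl
∑-vecs-prod φ L (suc m) = begin-equality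
  (∑[ v ∈ vecs L (suc m) ] ∏ (toList v) φ)              ≡⟨ ∑-vecs L m _ ⟩
  (∑[ x ∈ L ] ∑[ v ∈ vecs L m ] (φ x * ∏ (toList v) φ)) ≡⟨ ∑-cong L (λ x → ∑-*ˡ (φ x) _ (vecs L m)) ⟩
  (∑[ x ∈ L ] (φ x * (∑[ v ∈ vecs L m ] ∏ (toList v) φ))) ≡⟨ ∑-cong L (λ x → cong (φ x *_) (∑-vecs-prod φ L m)) ⟩
  (∑[ x ∈ L ] (φ x * ∑ L φ ^ m))                         ≡⟨ ∑-*ʳ (∑ L φ ^ m) φ L ⟩
  ∑ L φ * ∑ L φ ^ m                                      ∎
  where open ≤-Reasoning

[all]≡∏ : ∀ (p : A → Bool) L → [ all p L ]ᵇ ≡ ∏ L (λ x → [ p x ]ᵇ)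
[all]≡∏ p []      = refl
[all]≡∏ p (x ∷ L) with p x
... | true  = trans ([all]≡∏ p L) (sym (+-identityʳ _))
... | false = refl

-- Independence: the indicator of `all` is a product of indicators, and summing a product over all
-- vectors gives a power.
∑-vecs-all : ∀ (p : A → Bool) L m →
  (∑[ v ∈ vecs L m ] [ all p (toList v) ]ᵇ) ≡ (∑[ x ∈ L ] [ p x ]ᵇ) ^ m
∑-vecs-all p L m = trans (∑-cong (vecs L m) (λ v → [all]≡∏ p (toList v))) (∑-vecs-prod _ L m)

[not-all]≤∑ : ∀ (p : A → Bool) L → [ not (all p L) ]ᵇ ≤ (∑[ x ∈ L ] [ not (p x) ]ᵇ)
[not-all]≤∑ p []      = z≤n
[not-all]≤∑ p (x ∷ L) with p x
... | true  = [not-all]≤∑ p L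
... | false = s≤s z≤n

[not]-∑ : ∀ (p : A → Bool) L → (∑[ x ∈ L ] [ p x ]ᵇ) + (∑[ x ∈ L ] [ not (p x) ]ᵇ) ≡ length L
[not]-∑ p L = trans (sym (∑-+ _ _ L)) (trans (∑-cong L (λ x → lem (p x))) (∑-one L))
  where
  lem : ∀ b → [ b ]ᵇ + [ not b ]ᵇ ≡ 1
  lem true  = refl
  lem false = refl

∑≡0⇒All : ∀ (f : A → ℕ) L → ∑ L f ≡ 0 → All (λ x → f x ≡ 0) L
∑≡0⇒All f []      _  = []
∑≡0⇒All f (x ∷ L) eq = m+n≡0⇒m≡0 (f x) eq ∷ ∑≡0⇒All f L (m+n≡0⇒n≡0 (f x) eq)

∃-≤-average : ∀ (f : A → ℕ) {P : A → Set} {L} → All P L → 0 < length L →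
  ∃ λ x → P x × length L * f x ≤ ∑ L f
∃-≤-average f {P} {x ∷ []} (px ∷ []) _ = x , px , ≤-refl
∃-≤-average f {P} {x ∷ L@(_ ∷ _)} (px ∷ ps) _ with ∃-≤-average f ps (s≤s z≤n)
... | y , py , h with f x ≤? f y
...   | yes le = x , px , +-monoʳ-≤ (f x) (≤-trans (*-monoʳ-≤ (length L) le) h)
...   | no nle = y , py , +-mono-≤ (<⇒≤ (≰⇒> nle)) h

-- (1 - e/u)^w ≤ 1 / (1 + w e/u), in a form free of division.
bernoulli : ∀ d e w → d ^ w * (d + e + w * e) ≤ (d + e) ^ suc w
bernoulli d e zero    = ≤-reflexive (lem d e)
  where
  lem : ∀ d e → 1 * (d + e + 0) ≡ (d + e) * 1
  lem = solve-∀
bernoulli d e (suc w) = begin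
  d * d ^ w * (d + e + (e + w * e))              ≤⟨ m≤m+n _ (e * (e + w * e) * d ^ w) ⟩
  d * d ^ w * (d + e + (e + w * e)) + e * (e + w * e) * d ^ w ≡⟨ lem d (d ^ w) e w ⟩
  (d + e) * (d ^ w * (d + e + w * e))            ≤⟨ *-monoʳ-≤ (d + e) (bernoulli d e w) ⟩
  (d + e) * (d + e) ^ suc w                      ∎
  where
  open ≤-Reasoning
  lem : ∀ d a e w → d * a * (d + e + (e + w * e)) + e * (e + w * e) * a ≡ (d + e) * (a * (d + e + w * e))
  lem = solve-∀

-- If the failure fraction e/u is at least 1/T, then w trials all succeed with probability at most T/(T+w).
bernoulli-fraction : ∀ {d e u t} w → d + e ≡ u → u ≤ t * e → 0 < u → d ^ w * (t + w) ≤ u ^ w * t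
bernoulli-fraction {d} {e} {u} {t} w refl u≤te 0<u = *-cancelˡ-≤ u {{>-nonZero 0<u}} (begin
  u * (d ^ w * (t + w))        ≡⟨ l1 u (d ^ w) t w ⟩
  d ^ w * (t * u + w * u)      ≤⟨ *-monoʳ-≤ (d ^ w) (+-monoʳ-≤ (t * u) (*-monoʳ-≤ w u≤te)) ⟩
  d ^ w * (t * u + w * (t * e)) ≡⟨ l2 (d ^ w) t u w e ⟩
  t * (d ^ w * (u + w * e))    ≤⟨ *-monoʳ-≤ t (bernoulli d e w) ⟩
  t * (u * u ^ w)              ≡⟨ l3 t u (u ^ w) ⟩
  u * (u ^ w * t)              ∎)
  where
  open ≤-Reasoning
  l1 : ∀ u a t w → u * (a * (t + w)) ≡ a * (t * u + w * u)
  l1 = solve-∀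
  l2 : ∀ a t u w e → a * (t * u + w * (t * e)) ≡ t * (a * (u + w * e))
  l2 = solve-∀
  l3 : ∀ t u a → t * (u * a) ≡ u * (a * t)
  l3 = solve-∀

All-vecs : ∀ {P : A → Set} {L} → All P L → ∀ m → All (λ v → All P (toList v)) (vecs L m)
All-vecs {A = A} {P} {L} ps zero    = [] ∷ []
All-vecs {A = A} {P} {L} ps (suc m) = go ps
  where
  go : ∀ {M} → All P M → All (λ v → All P (toList v)) (cartesianProductWith _∷_ M (vecs L m))
  go []       = []
  go (q ∷ qs) = ++⁺ (map⁺ (All.map (q ∷_) (All-vecs ps m))) (go qs)

All-pairs : ∀ {P : A → Set} {Q : B → Set} {L M} → All P L → All Q M →
  All (λ xy → P (proj₁ xy) × Q (proj₂ xy)) (cartesianProduct L M)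
All-pairs []       qs = []
All-pairs (p ∷ ps) qs = ++⁺ (map⁺ (All.map (p ,_) qs)) (All-pairs ps qs)

-- The Boolean cube

infixl 6 _⊕_
infixl 7 _⊙_

_⊕_ : Point n → Point n → Point n
_⊕_ = zipWith _xor_

_⊙_ : Point n → Point n → Point n
_⊙_ = zipWith _∧_

𝟎 : Point n
𝟎 = replicate _ false

∁ : Point n → Point n
∁ = Vec.map not

𝐞 : Fin n → Point n
𝐞 zero    = true ∷ 𝟎
𝐞 (suc i) = false ∷ 𝐞 i

lookup-⊕ : ∀ (x y : Point n) i → lookup (x ⊕ y) i ≡ lookup x i xor lookup y i
lookup-⊕ x y i = lookup-zipWith _xor_ i x y

lookup-⊙ : ∀ (x y : Point n) i → lookup (x ⊙ y) i ≡ lookup x i ∧ lookup y i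
lookup-⊙ x y i = lookup-zipWith _∧_ i x y

lookup-∁ : ∀ (x : Point n) i → lookup (∁ x) i ≡ not (lookup x i)
lookup-∁ x i = lookup-map i not x

lookup-𝟎 : ∀ (i : Fin n) → lookup 𝟎 i ≡ false
lookup-𝟎 i = lookup-replicate i false

lookup-𝐞-same : ∀ (i : Fin n) → lookup (𝐞 i) i ≡ true
lookup-𝐞-same zero    = refl
lookup-𝐞-same (suc i) = lookup-𝐞-same i

lookup-𝐞-diff : ∀ {i j : Fin n} → i ≢ j → lookup (𝐞 i) j ≡ false
lookup-𝐞-diff {i = zero}  {zero}  ne = ⊥-elim (ne refl)
lookup-𝐞-diff {i = zero}  {suc j} ne = lookup-𝟎 j
lookup-𝐞-diff {i = suc i} {zero}  ne = refl
lookup-𝐞-diff {i = suc i} {suc j} ne = lookup-𝐞-diff (ne ∘ cong suc)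

ext : ∀ {x y : Vec A n} → (∀ i → lookup x i ≡ lookup y i) → x ≡ y
ext {x = []}    {[]}    p = refl
ext {x = a ∷ x} {b ∷ y} p = cong₂ _∷_ (p zero) (ext (p ∘ suc))

⊕-assoc : ∀ (x y z : Point n) → (x ⊕ y) ⊕ z ≡ x ⊕ (y ⊕ z)
⊕-assoc []      []      []      = refl
⊕-assoc (a ∷ x) (b ∷ y) (c ∷ z) = cong₂ _∷_ (xor-assoc a b c) (⊕-assoc x y z)

⊕-comm : ∀ (x y : Point n) → x ⊕ y ≡ y ⊕ x
⊕-comm []      []      = refl
⊕-comm (a ∷ x) (b ∷ y) = cong₂ _∷_ (xor-comm a b) (⊕-comm x y)

⊕-self : ∀ (x : Point n) → x ⊕ x ≡ 𝟎
⊕-self []      = refl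
⊕-self (a ∷ x) = cong₂ _∷_ (xor-same a) (⊕-self x)

⊕-identityʳ : ∀ (x : Point n) → x ⊕ 𝟎 ≡ x
⊕-identityʳ []      = refl
⊕-identityʳ (a ∷ x) = cong₂ _∷_ (xor-identityʳ a) (⊕-identityʳ x)

⊕-identityˡ : ∀ (x : Point n) → 𝟎 ⊕ x ≡ x
⊕-identityˡ x = trans (⊕-comm 𝟎 x) (⊕-identityʳ x)

⊕-cancelʳ : ∀ (x y : Point n) → (x ⊕ y) ⊕ y ≡ x
⊕-cancelʳ x y = trans (⊕-assoc x y y) (trans (cong (x ⊕_) (⊕-self y)) (⊕-identityʳ x))

⊙-𝟎ʳ : ∀ (x : Point n) → x ⊙ 𝟎 ≡ 𝟎
⊙-𝟎ʳ []      = refl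
⊙-𝟎ʳ (a ∷ x) = cong₂ _∷_ (∧-zeroʳ a) (⊙-𝟎ʳ x)

⊙-𝟎ˡ : ∀ (x : Point n) → 𝟎 ⊙ x ≡ 𝟎
⊙-𝟎ˡ []      = refl
⊙-𝟎ˡ (a ∷ x) = cong (false ∷_) (⊙-𝟎ˡ x)

⊙-distribˡ : ∀ (x y z : Point n) → x ⊙ (y ⊕ z) ≡ (x ⊙ y) ⊕ (x ⊙ z)
⊙-distribˡ []      []      []      = refl
⊙-distribˡ (a ∷ x) (b ∷ y) (c ∷ z) = cong₂ _∷_ (∧-distribˡ-xor a b c) (⊙-distribˡ x y z)

⊙-comm : ∀ (x y : Point n) → x ⊙ y ≡ y ⊙ x
⊙-comm []      []      = refl
⊙-comm (a ∷ x) (b ∷ y) = cong₂ _∷_ (∧-comm a b) (⊙-comm x y)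

⊙-assoc : ∀ (x y z : Point n) → (x ⊙ y) ⊙ z ≡ x ⊙ (y ⊙ z)
⊙-assoc []      []      []      = refl
⊙-assoc (a ∷ x) (b ∷ y) (c ∷ z) = cong₂ _∷_ (∧-assoc a b c) (⊙-assoc x y z)

⊙-distribʳ : ∀ (x y z : Point n) → (x ⊕ y) ⊙ z ≡ (x ⊙ z) ⊕ (y ⊙ z)
⊙-distribʳ x y z = trans (⊙-comm (x ⊕ y) z) (trans (⊙-distribˡ z x y) (cong₂ _⊕_ (⊙-comm z x) (⊙-comm z y)))

∁-split : ∀ (x A : Point n) → (x ⊙ A) ⊕ (x ⊙ ∁ A) ≡ x
∁-split []      []      = refl
∁-split (a ∷ x) (true ∷ A) = cong₂ _∷_ (lem a) (∁-split x A)
  where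
  lem : ∀ a → (a ∧ true) xor (a ∧ false) ≡ a
  lem true = refl
  lem false = refl
∁-split (a ∷ x) (false ∷ A) = cong₂ _∷_ (lem a) (∁-split x A)
  where
  lem : ∀ a → (a ∧ false) xor (a ∧ true) ≡ a
  lem true = refl
  lem false = refl

∑-allPoints : ∀ (f : Point (suc n) → ℕ) →
  ∑ (allPoints (suc n)) f ≡ (∑[ x ∈ allPoints n ] f (true ∷ x)) + (∑[ x ∈ allPoints n ] f (false ∷ x))
∑-allPoints {n} f = trans (∑-++ f (map (true ∷_) (allPoints n)) _) (cong₂ _+_ (∑-map f _ (allPoints n)) (∑-map f _ (allPoints n)))

length-allPoints : ∀ n → length (allPoints n) ≡ 2 ^ n
length-allPoints zero    = refl
length-allPoints (suc n) = begin
  length (allPoints (suc n))                               ≡⟨ ∑-one (allPoints (suc n)) ⟨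
  (∑[ _ ∈ allPoints (suc n) ] 1)                           ≡⟨ ∑-allPoints {n} (λ _ → 1) ⟩
  (∑[ _ ∈ allPoints n ] 1) + (∑[ _ ∈ allPoints n ] 1)      ≡⟨ cong (λ z → z + z) (trans (∑-one (allPoints n)) (length-allPoints n)) ⟩
  2 ^ n + 2 ^ n                                            ≡⟨ cong (2 ^ n +_) (+-identityʳ _) ⟨
  2 ^ suc n ∎
  where open ≡-Reasoning

∑-shift : ∀ (v : Point n) (f : Point n → ℕ) → (∑[ x ∈ allPoints n ] f (x ⊕ v)) ≡ ∑ (allPoints n) f
∑-shift []          f = refl
∑-shift {suc n} (true ∷ v)  f = begin
  (∑[ x ∈ allPoints (suc n) ] f (x ⊕ (true ∷ v)))   ≡⟨ ∑-allPoints {n} _ ⟩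
  (∑[ x ∈ allPoints n ] f (false ∷ (x ⊕ v))) + (∑[ x ∈ allPoints n ] f (true ∷ (x ⊕ v)))
    ≡⟨ cong₂ _+_ (∑-shift v (f ∘ (false ∷_))) (∑-shift v (f ∘ (true ∷_))) ⟩
  (∑[ x ∈ allPoints n ] f (false ∷ x)) + (∑[ x ∈ allPoints n ] f (true ∷ x)) ≡⟨ +-comm (∑ (allPoints n) (f ∘ (false ∷_))) _ ⟩
  (∑[ x ∈ allPoints n ] f (true ∷ x)) + (∑[ x ∈ allPoints n ] f (false ∷ x)) ≡⟨ ∑-allPoints {n} f ⟨
  ∑ (allPoints (suc n)) f ∎
  where open ≡-Reasoning
∑-shift {suc n} (false ∷ v) f = begin
  (∑[ x ∈ allPoints (suc n) ] f (x ⊕ (false ∷ v)))   ≡⟨ ∑-allPoints {n} _ ⟩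
  (∑[ x ∈ allPoints n ] f (true ∷ (x ⊕ v))) + (∑[ x ∈ allPoints n ] f (false ∷ (x ⊕ v)))
    ≡⟨ cong₂ _+_ (∑-shift v (f ∘ (true ∷_))) (∑-shift v (f ∘ (false ∷_))) ⟩
  (∑[ x ∈ allPoints n ] f (true ∷ x)) + (∑[ x ∈ allPoints n ] f (false ∷ x)) ≡⟨ ∑-allPoints {n} f ⟨
  ∑ (allPoints (suc n)) f ∎
  where open ≡-Reasoning

All-allPoints : ∀ {P : Point n → Set} → All P (allPoints n) → ∀ x → P x
All-allPoints {zero}  (p ∷ []) [] = p
All-allPoints {suc n} {P} ps (b ∷ x) = go b
  where
  open import Data.List.Relation.Unary.All.Properties using (++⁻ˡ; ++⁻ʳ; map⁻)
  go : ∀ b → P (b ∷ x)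
  go true  = All-allPoints (map⁻ (++⁻ˡ (map (true ∷_) (allPoints n)) ps)) x
  go false = All-allPoints (map⁻ (++⁻ʳ (map (true ∷_) (allPoints n)) ps)) x

∑-allPoints≡0 : ∀ (f : Point n → ℕ) → ∑ (allPoints n) f ≡ 0 → ∀ x → f x ≡ 0
∑-allPoints≡0 f eq = All-allPoints (∑≡0⇒All f _ eq)

infix 4 _≡ᵖ_
_≡ᵖ_ : Point n → Point n → Bool
[]      ≡ᵖ []      = true
(a ∷ x) ≡ᵖ (b ∷ y) = not (a xor b) ∧ (x ≡ᵖ y)

≡ᵖ-refl : ∀ (x : Point n) → (x ≡ᵖ x) ≡ true
≡ᵖ-refl []          = refl
≡ᵖ-refl (true ∷ x)  = ≡ᵖ-refl x
≡ᵖ-refl (false ∷ x) = ≡ᵖ-refl x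

≡ᵖ⇒≡ : ∀ (x y : Point n) → (x ≡ᵖ y) ≡ true → x ≡ y
≡ᵖ⇒≡ []          []          eq = refl
≡ᵖ⇒≡ (true ∷ x)  (true ∷ y)  eq = cong (true ∷_) (≡ᵖ⇒≡ x y eq)
≡ᵖ⇒≡ (false ∷ x) (false ∷ y) eq = cong (false ∷_) (≡ᵖ⇒≡ x y eq)

≡ᵖ-shift : ∀ (x y s : Point n) → (x ⊕ s ≡ᵖ y ⊕ s) ≡ (x ≡ᵖ y)
≡ᵖ-shift []      []      []      = refl
≡ᵖ-shift (a ∷ x) (b ∷ y) (c ∷ s) = cong₂ _∧_ (cong not (lem a b c)) (≡ᵖ-shift x y s)
  where
  lem : ∀ a b c → (a xor c) xor (b xor c) ≡ a xor b
  lem true  true  true  = refl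
  lem true  true  false = refl
  lem true  false true  = refl
  lem true  false false = refl
  lem false true  true  = refl
  lem false true  false = refl
  lem false false true  = refl
  lem false false false = refl

∑-point-mass : ∀ (p : Point n) (f : Point n → ℕ) → (∑[ j ∈ allPoints n ] [ p ≡ᵖ j ]ᵇ * f j) ≡ f p
∑-point-mass []      f = trans (+-identityʳ _) (+-identityʳ _)
∑-point-mass {suc n} (true ∷ p)  f = trans (∑-allPoints {n} _) (trans (cong₂ _+_ (∑-point-mass p (f ∘ (true ∷_))) (∑-zero (allPoints n))) (+-identityʳ _))
∑-point-mass {suc n} (false ∷ p) f = trans (∑-allPoints {n} _) (cong₂ _+_ (∑-zero (allPoints n)) (∑-point-mass p (f ∘ (false ∷_))))

∑-mass : ∀ (p : Point n) → (∑[ j ∈ allPoints n ] [ p ≡ᵖ j ]ᵇ) ≡ 1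
∑-mass {n} p = trans (∑-cong (allPoints n) (λ j → sym (*-identityʳ _))) (∑-point-mass p (λ _ → 1))

mix : Point n → Point n → Point n → Point n
mix A x y = (x ⊙ A) ⊕ (y ⊙ ∁ A)

-- Replacing `y` by `y ⊕ x` turns `mix A x y` into `x ⊕ (y ⊙ ∁ A)`, which for each fixed `y` is a
-- translation of `x`.
∑-mix : ∀ (A : Point n) (f : Point n → ℕ) →
  (∑[ x ∈ allPoints n ] ∑[ y ∈ allPoints n ] f (mix A x y)) ≡ 2 ^ n * ∑ (allPoints n) f
∑-mix {n} A f = begin
  (∑[ x ∈ P ] ∑[ y ∈ P ] f (mix A x y))          ≡⟨ ∑-cong P (λ x → ∑-shift x (λ y → f (mix A x y))) ⟨
  (∑[ x ∈ P ] ∑[ y ∈ P ] f (mix A x (y ⊕ x)))    ≡⟨ ∑-cong P (λ x → ∑-cong P (λ y → cong f (lem x y))) ⟩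
  (∑[ x ∈ P ] ∑[ y ∈ P ] f (x ⊕ (y ⊙ ∁ A)))      ≡⟨ ∑-swap _ P P ⟩
  (∑[ y ∈ P ] ∑[ x ∈ P ] f (x ⊕ (y ⊙ ∁ A)))      ≡⟨ ∑-cong P (λ y → ∑-shift (y ⊙ ∁ A) f) ⟩
  (∑[ y ∈ P ] ∑ P f)                              ≡⟨ ∑-const (∑ P f) P ⟩
  length P * ∑ P f                                ≡⟨ cong (_* ∑ P f) (length-allPoints n) ⟩
  2 ^ n * ∑ P f                                   ∎
  where
  open ≡-Reasoning
  P = allPoints n
  lem : ∀ x y → mix A x (y ⊕ x) ≡ x ⊕ (y ⊙ ∁ A)
  lem x y = begin
    (x ⊙ A) ⊕ ((y ⊕ x) ⊙ ∁ A)                 ≡⟨ cong ((x ⊙ A) ⊕_) (trans (⊙-distribʳ y x (∁ A)) (⊕-comm _ _)) ⟩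
    (x ⊙ A) ⊕ ((x ⊙ ∁ A) ⊕ (y ⊙ ∁ A))         ≡⟨ ⊕-assoc _ _ _ ⟨
    ((x ⊙ A) ⊕ (x ⊙ ∁ A)) ⊕ (y ⊙ ∁ A)         ≡⟨ cong (_⊕ (y ⊙ ∁ A)) (∁-split x A) ⟩
    x ⊕ (y ⊙ ∁ A) ∎

agree : Point n → Point n → Point n → Bool
agree A x y = ((x ⊕ y) ⊙ A) ≡ᵖ 𝟎

-- Resetting the coordinates outside A to those of x₀ is 2^(n-|A|)-to-one onto the points agreeing with x₀ there.
reset-scale : Point n → ℕ
reset-scale []          = 1
reset-scale (true ∷ A)  = reset-scale A
reset-scale (false ∷ A) = 2 * reset-scale A

reset-scale>0 : ∀ (A : Point n) → 0 < reset-scale A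
reset-scale>0 []          = s≤s z≤n
reset-scale>0 (true ∷ A)  = reset-scale>0 A
reset-scale>0 (false ∷ A) = ≤-trans (reset-scale>0 A) (m≤m+n _ _)

∑-reset : ∀ (A x₀ : Point n) (f : Point n → ℕ) →
  (∑[ x ∈ allPoints n ] f (mix A x x₀)) ≡ reset-scale A * (∑[ x ∈ allPoints n ] [ agree (∁ A) x x₀ ]ᵇ * f x)
∑-reset []          []       f = sym (trans (+-identityʳ _) (+-identityʳ _))
∑-reset {suc n} (true ∷ A) (b ∷ x₀) f = begin
  (∑[ x ∈ allPoints (suc n) ] f (mix (true ∷ A) x (b ∷ x₀))) ≡⟨ ∑-allPoints {n} _ ⟩
  (∑[ x ∈ P ] f (mix (true ∷ A) (true ∷ x) (b ∷ x₀))) + (∑[ x ∈ P ] f (mix (true ∷ A) (false ∷ x) (b ∷ x₀)))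
    ≡⟨ cong₂ _+_ (h true) (h false) ⟩
  s * S true + s * S false  ≡⟨ *-distribˡ-+ s (S true) (S false) ⟨
  s * (S true + S false) ≡⟨ cong (s *_) (cong₂ _+_ (h′ true) (h′ false)) ⟩
  s * ((∑[ x ∈ P ] [ agree (false ∷ ∁ A) (true ∷ x) (b ∷ x₀) ]ᵇ * f (true ∷ x)) + (∑[ x ∈ P ] [ agree (false ∷ ∁ A) (false ∷ x) (b ∷ x₀) ]ᵇ * f (false ∷ x)))
    ≡⟨ cong (s *_) (∑-allPoints {n} _) ⟨
  s * (∑[ x ∈ allPoints (suc n) ] [ agree (false ∷ ∁ A) x (b ∷ x₀) ]ᵇ * f x) ∎
  where
  open ≡-Reasoning
  P = allPoints n
  s = reset-scale A
  S : Bool → ℕ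
  S c = ∑[ x ∈ P ] [ agree (∁ A) x x₀ ]ᵇ * f (c ∷ x)
  lem : ∀ c b → (c ∧ true) xor (b ∧ false) ≡ c
  lem true true = refl
  lem true false = refl
  lem false true = refl
  lem false false = refl
  h : ∀ c → (∑[ x ∈ P ] f (mix (true ∷ A) (c ∷ x) (b ∷ x₀))) ≡ s * S c
  h c = trans (∑-cong P (λ x → cong (λ d → f (d ∷ mix A x x₀)) (lem c b))) (∑-reset A x₀ (f ∘ (c ∷_)))
  h′ : ∀ c → S c ≡ (∑[ x ∈ P ] [ agree (false ∷ ∁ A) (c ∷ x) (b ∷ x₀) ]ᵇ * f (c ∷ x))
  h′ c = ∑-cong P (λ x → cong (λ d → [ not (d xor false) ∧ agree (∁ A) x x₀ ]ᵇ * f (c ∷ x)) (sym (∧-zeroʳ (c xor b))))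
∑-reset {suc n} (false ∷ A) (b ∷ x₀) f = begin
  (∑[ x ∈ allPoints (suc n) ] f (mix (false ∷ A) x (b ∷ x₀))) ≡⟨ ∑-allPoints {n} _ ⟩
  (∑[ x ∈ P ] f (mix (false ∷ A) (true ∷ x) (b ∷ x₀))) + (∑[ x ∈ P ] f (mix (false ∷ A) (false ∷ x) (b ∷ x₀)))
    ≡⟨ cong₂ _+_ (h true) (h false) ⟩
  s * S b + s * S b ≡⟨ alg s (S b) ⟩
  2 * s * S b ≡⟨ cong (2 * s *_) (h′ b) ⟩
  2 * s * ((∑[ x ∈ P ] [ agree (true ∷ ∁ A) (true ∷ x) (b ∷ x₀) ]ᵇ * f (true ∷ x)) + (∑[ x ∈ P ] [ agree (true ∷ ∁ A) (false ∷ x) (b ∷ x₀) ]ᵇ * f (false ∷ x)))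
    ≡⟨ cong (2 * s *_) (∑-allPoints {n} _) ⟨
  2 * s * (∑[ x ∈ allPoints (suc n) ] [ agree (true ∷ ∁ A) x (b ∷ x₀) ]ᵇ * f x) ∎
  where
  open ≡-Reasoning
  P = allPoints n
  s = reset-scale A
  S : Bool → ℕ
  S c = ∑[ x ∈ P ] [ agree (∁ A) x x₀ ]ᵇ * f (c ∷ x)
  alg : ∀ s t → s * t + s * t ≡ 2 * s * t
  alg = solve-∀
  lem : ∀ c b → (c ∧ false) xor (b ∧ true) ≡ b
  lem true true = refl
  lem true false = refl
  lem false true = refl
  lem false false = refl
  h : ∀ c → (∑[ x ∈ P ] f (mix (false ∷ A) (c ∷ x) (b ∷ x₀))) ≡ s * S b
  h c = trans (∑-cong P (λ x → cong (λ d → f (d ∷ mix A x x₀)) (lem c b))) (∑-reset A x₀ (f ∘ (b ∷_)))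
  h′ : ∀ b → S b ≡ (∑[ x ∈ P ] [ agree (true ∷ ∁ A) (true ∷ x) (b ∷ x₀) ]ᵇ * f (true ∷ x)) + (∑[ x ∈ P ] [ agree (true ∷ ∁ A) (false ∷ x) (b ∷ x₀) ]ᵇ * f (false ∷ x))
  h′ true  = sym (trans (cong (S true +_) (∑-zero P)) (+-identityʳ _))
  h′ false = sym (trans (cong (_+ S false) (∑-zero P)) refl)

-- Subadditive functions on the cube, blocks and coordinates

record Subadditive (e : Point n → ℕ) : Set where
  field
    at-𝟎  : e 𝟎 ≡ 0
    at-⊕  : ∀ v w → e (v ⊕ w) ≤ e v + e w

open Subadditive public

⨁ : List A → (A → Point n) → Point n
⨁ []      f = 𝟎
⨁ (x ∷ L) f = f x ⊕ ⨁ L f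

subadditive-⨁ : ∀ {e : Point n → ℕ} → Subadditive e → ∀ (L : List A) f → e (⨁ L f) ≤ (∑[ x ∈ L ] e (f x))
subadditive-⨁ S []      f = ≤-reflexive (at-𝟎 S)
subadditive-⨁ S (x ∷ L) f = ≤-trans (at-⊕ S (f x) (⨁ L f)) (+-monoʳ-≤ _ (subadditive-⨁ S L f))

scale : Bool → Point n → Point n
scale b v = if b then v else 𝟎

lookup-scale : ∀ b (v : Point n) i → lookup (scale b v) i ≡ b ∧ lookup v i
lookup-scale true  v i = refl
lookup-scale false v i = lookup-𝟎 i

-- A labelling π of the coordinates by points of {0,1}^k cuts the coordinates into blocks.
block : Vec (Point k) n → Point k → Point n
block π j = Vec.map (_≡ᵖ j) π

lookup-block : ∀ (π : Vec (Point k) n) j i → lookup (block π j) i ≡ (lookup π i ≡ᵖ j)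
lookup-block π j i = lookup-map i (_≡ᵖ j) π

xorSum : List A → (A → Bool) → Bool
xorSum []      f = false
xorSum (x ∷ L) f = f x xor xorSum L f

lookup-⨁ : ∀ (L : List A) (f : A → Point n) i → lookup (⨁ L f) i ≡ xorSum L (λ x → lookup (f x) i)
lookup-⨁ []      f i = lookup-𝟎 i
lookup-⨁ (x ∷ L) f i = trans (lookup-⊕ (f x) _ i) (cong (lookup (f x) i xor_) (lookup-⨁ L f i))

xorSum-cong : ∀ {f g : A → Bool} L → (∀ x → f x ≡ g x) → xorSum L f ≡ xorSum L g
xorSum-cong []      p = refl
xorSum-cong (x ∷ L) p = cong₂ _xor_ (p x) (xorSum-cong L p)

xorSum-++ : ∀ (f : A → Bool) L M → xorSum (L ++ M) f ≡ xorSum L f xor xorSum M f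
xorSum-++ f []      M = refl
xorSum-++ f (x ∷ L) M = trans (cong (f x xor_) (xorSum-++ f L M)) (sym (xor-assoc (f x) _ _))

xorSum-map : ∀ {B : Set} (f : B → Bool) (g : A → B) L → xorSum (map g L) f ≡ xorSum L (f ∘ g)
xorSum-map f g []      = refl
xorSum-map f g (x ∷ L) = cong (f (g x) xor_) (xorSum-map f g L)

xorSum-false : ∀ (L : List A) → xorSum L (λ _ → false) ≡ false
xorSum-false []      = refl
xorSum-false (x ∷ L) = xorSum-false L

xorSum-point-mass : ∀ (p : Point k) (f : Point k → Bool) → xorSum (allPoints k) (λ j → (p ≡ᵖ j) ∧ f j) ≡ f p
xorSum-point-mass []      f = xor-identityʳ (f [])
xorSum-point-mass {suc k} (true ∷ p) f =
  trans (xorSum-++ _ (map (true ∷_) (allPoints k)) _)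
    (trans (cong₂ _xor_ (trans (xorSum-map _ _ (allPoints k)) (xorSum-point-mass p (f ∘ (true ∷_))))
                        (trans (xorSum-map _ _ (allPoints k)) (xorSum-false (allPoints k))))
           (xor-identityʳ _))
xorSum-point-mass {suc k} (false ∷ p) f =
  trans (xorSum-++ _ (map (true ∷_) (allPoints k)) _)
    (cong₂ _xor_ (trans (xorSum-map _ _ (allPoints k)) (xorSum-false (allPoints k)))
                 (trans (xorSum-map _ _ (allPoints k)) (xorSum-point-mass p (f ∘ (false ∷_)))))

-- Each coordinate lies in exactly one block, so at each coordinate the sum picks out the
-- coefficient of its own label.
⨁-blocks : ∀ (π : Vec (Point k) n) (v : Point n) (c : Point k → Bool) →
  ⨁ (allPoints k) (λ j → scale (c j) (v ⊙ block π j)) ≡ Vec.map c π ⊙ v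
⨁-blocks {k} π v c = ext λ i → begin
  lookup (⨁ (allPoints k) (λ j → scale (c j) (v ⊙ block π j))) i     ≡⟨ lookup-⨁ (allPoints k) _ i ⟩
  xorSum (allPoints k) (λ j → lookup (scale (c j) (v ⊙ block π j)) i)
    ≡⟨ xorSum-cong (allPoints k) (λ j → trans (lookup-scale (c j) _ i) (trans (cong (c j ∧_) (trans (lookup-⊙ v _ i) (cong (lookup v i ∧_) (lookup-block π j i)))) (lem (c j) (lookup v i) _))) ⟩
  xorSum (allPoints k) (λ j → (lookup π i ≡ᵖ j) ∧ (c j ∧ lookup v i)) ≡⟨ xorSum-point-mass (lookup π i) _ ⟩
  c (lookup π i) ∧ lookup v i                                          ≡⟨ cong (_∧ lookup v i) (lookup-map i c π) ⟨
  lookup (Vec.map c π) i ∧ lookup v i                                  ≡⟨ lookup-⊙ (Vec.map c π) v i ⟨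
  lookup (Vec.map c π ⊙ v) i                                           ∎
  where
  open ≡-Reasoning
  lem : ∀ a b e → a ∧ (b ∧ e) ≡ e ∧ (a ∧ b)
  lem true  true  e = sym (∧-identityʳ e)
  lem true  false e = sym (∧-zeroʳ e)
  lem false b     e = sym (∧-zeroʳ e)

⨁-all-blocks : ∀ (π : Vec (Point k) n) (v : Point n) → ⨁ (allPoints k) (λ j → v ⊙ block π j) ≡ v
⨁-all-blocks π v = trans (⨁-blocks π v (λ _ → true)) (ext λ i →
  trans (lookup-⊙ (Vec.map _ π) v i) (cong (_∧ lookup v i) (lookup-map i _ π)))

subadditive-blocks : ∀ {e : Point n → ℕ} → Subadditive e → ∀ (π : Vec (Point k) n) v →
  e v ≤ (∑[ j ∈ allPoints k ] e (v ⊙ block π j))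
subadditive-blocks {k = k} {e = e} S π v =
  ≤-trans (≤-reflexive (cong e (sym (⨁-all-blocks π v)))) (subadditive-⨁ S (allPoints k) _)

∑-allFin : ∀ (f : Fin (suc n) → ℕ) → ∑ (allFin (suc n)) f ≡ f zero + (∑[ i ∈ allFin n ] f (suc i))
∑-allFin {n} f = cong (f zero +_) (trans (cong (λ L → ∑ L f) (sym (List.map-tabulate id suc))) (∑-map f suc (allFin n)))

term≤∑-allFin : ∀ (f : Fin n → ℕ) i → f i ≤ ∑ (allFin n) f
term≤∑-allFin {suc n} f zero    = ≤-trans (m≤m+n (f zero) _) (≤-reflexive (sym (∑-allFin f)))
term≤∑-allFin {suc n} f (suc i) = ≤-trans (term≤∑-allFin (f ∘ suc) i) (≤-trans (m≤n+m _ (f zero)) (≤-reflexive (sym (∑-allFin f))))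

∑-allFin-mono : ∀ {f g : Fin n → ℕ} → (∀ i → f i ≤ g i) → ∑ (allFin n) f ≤ ∑ (allFin n) g
∑-allFin-mono {n} = ∑-mono (allFin n)

subadditive-coordinates : ∀ {e : Point n → ℕ} → Subadditive e → ∀ v →
  e v ≤ (∑[ i ∈ allFin n ] [ lookup v i ]ᵇ * e (𝐞 i))
subadditive-coordinates {e = e} S []      = ≤-reflexive (at-𝟎 S)
subadditive-coordinates {suc n} {e} S (b ∷ v) = begin
  e (b ∷ v)                   ≡⟨ cong e (cong₂ _∷_ (xor-identityʳ b) (⊕-identityˡ v)) ⟨
  e ((b ∷ 𝟎) ⊕ (false ∷ v))   ≤⟨ at-⊕ S _ _ ⟩
  e (b ∷ 𝟎) + e (false ∷ v)   ≤⟨ +-mono-≤ (≤-reflexive (lem b)) (subadditive-coordinates S′ v) ⟩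
  [ b ]ᵇ * e (𝐞 zero) + (∑[ i ∈ allFin n ] [ lookup v i ]ᵇ * e (false ∷ 𝐞 i)) ≡⟨ ∑-allFin {n} _ ⟨
  (∑[ i ∈ allFin (suc n) ] [ lookup (b ∷ v) i ]ᵇ * e (𝐞 i)) ∎
  where
  open ≤-Reasoning
  S′ : Subadditive (e ∘ (false ∷_))
  S′ = record { at-𝟎 = at-𝟎 S ; at-⊕ = λ v w → at-⊕ S (false ∷ v) (false ∷ w) }
  lem : ∀ b → e (b ∷ 𝟎) ≡ [ b ]ᵇ * e (true ∷ 𝟎)
  lem true  = sym (+-identityʳ _)
  lem false = at-𝟎 S

-- The unit vectors in `K` span the subcube on `K`. It is used with the translations of small error,
-- which are closed under `⊕` only thanks to the gap.
closed-subcube : ∀ (V : Point n → Set) → V 𝟎 → (∀ {v w} → V v → V w → V (v ⊕ w)) →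
  ∀ K → (∀ i → lookup K i ≡ true → V (𝐞 i)) → ∀ w → V (w ⊙ K)
closed-subcube V z c []      e []      = z
closed-subcube {suc n} V z c (a ∷ K) e (b ∷ w) =
  subst V (cong₂ _∷_ (xor-identityʳ (b ∧ a)) (⊕-identityˡ (w ⊙ K))) (c (head a b (e zero)) (closed-subcube (V ∘ (false ∷_)) z c K (e ∘ suc) w))
  where
  head : ∀ a b → (a ≡ true → V (true ∷ 𝟎)) → V ((b ∧ a) ∷ 𝟎)
  head true  true  e = e refl
  head true  false e = z
  head false true  e = z
  head false false e = z

-- Numbering the labels makes sets of blocks and patterns on blocks into points of `Point (2 ^ k)`,
-- so that the counting lemmas for the cube apply to them as well.
idx : Point k → Fin (2 ^ k)
idx []      = zero
idx {suc k} (true  ∷ x) = combine {2} {2 ^ k} zero (idx x)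
idx {suc k} (false ∷ x) = combine {2} {2 ^ k} (suc zero) (idx x)

unidx : Fin (2 ^ k) → Point k
unidx {zero}  _ = []
unidx {suc k} i with remQuot {2} (2 ^ k) i
... | zero     , j = true ∷ unidx j
... | suc zero , j = false ∷ unidx j

unidx-idx : ∀ (j : Point k) → unidx (idx j) ≡ j
unidx-idx [] = refl
unidx-idx {suc k} (true  ∷ x) rewrite remQuot-combine {2} {2 ^ k} zero (idx x) = cong (true ∷_) (unidx-idx x)
unidx-idx {suc k} (false ∷ x) rewrite remQuot-combine {2} {2 ^ k} (suc zero) (idx x) = cong (false ∷_) (unidx-idx x)

-- Translations of h⁻¹(1) and the junta test

[]≤1 : ∀ b → [ b ]ᵇ ≤ 1
[]≤1 true  = s≤s z≤n
[]≤1 false = z≤n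

∑-filter : ∀ (h : BoolFun n) (f : Point n → ℕ) L →
  ∑ (filter (λ x → h x ≟ᵇ true) L) f ≡ (∑[ x ∈ L ] [ h x ]ᵇ * f x)
∑-filter h f []      = refl
∑-filter h f (x ∷ L) with h x
... | true  = cong₂ _+_ (sym (+-identityʳ (f x))) (∑-filter h f L)
... | false = ∑-filter h f L

size : Point n → ℕ
size []      = 0
size (b ∷ J) = [ b ]ᵇ + size J

∃-≥-average : ∀ (f : A → ℕ) L → 0 < length L → ∃ λ x → ∑ L f ≤ length L * f x
∃-≥-average f (x ∷ []) _ = x , ≤-refl
∃-≥-average f (x ∷ L@(_ ∷ _)) _ with ∃-≥-average f L (s≤s z≤n)
... | y , h with f x ≤? f y
...   | yes le = y , +-mono-≤ le h
...   | no nle = x , +-monoʳ-≤ (f x) (≤-trans h (*-monoʳ-≤ (length L) (<⇒≤ (≰⇒> nle))))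

module Error {n : ℕ} (h : BoolFun n) where

  P U : List (Point n)
  P = allPoints n
  U = support h

  u : ℕ
  u = supportSize h

  ∑-support : ∀ f → ∑ U f ≡ (∑[ x ∈ P ] [ h x ]ᵇ * f x)
  ∑-support f = ∑-filter h f P

  U⊆h : All (λ x → h x ≡ true) U
  U⊆h = all-filter (λ x → h x ≟ᵇ true) P

  -- The number of x in h⁻¹(1) that translation by v moves out of h⁻¹(1).
  err : Point n → ℕ
  err v = ∑[ x ∈ U ] [ not (h (x ⊕ v)) ]ᵇ

  err-cube : ∀ v → err v ≡ (∑[ x ∈ P ] [ h x ]ᵇ * [ not (h (x ⊕ v)) ]ᵇ)
  err-cube v = ∑-support _

  err≤u : ∀ v → err v ≤ u
  err≤u v = ∑≤length _ U

  err-𝟎 : err 𝟎 ≡ 0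
  err-𝟎 = trans (∑-cong-All (All.map (λ {x} hx → cong (λ b → [ not b ]ᵇ) (trans (cong h (⊕-identityʳ x)) hx)) U⊆h)) (∑-zero U)

  -- If `x` stays inside under `v` but leaves under `v ⊕ w`, then `x ⊕ v` is a point of `h⁻¹(1)`
  -- that `w` moves out.
  err-⊕ : ∀ v w → err (v ⊕ w) ≤ err v + err w
  err-⊕ v w = begin
    err (v ⊕ w)                                                            ≡⟨ err-cube (v ⊕ w) ⟩
    (∑[ x ∈ P ] [ h x ]ᵇ * [ not (h (x ⊕ (v ⊕ w))) ]ᵇ)                     ≡⟨ ∑-cong P (λ x → cong (λ z → [ h x ]ᵇ * [ not (h z) ]ᵇ) (sym (⊕-assoc x v w))) ⟩
    (∑[ x ∈ P ] [ h x ]ᵇ * [ not (h ((x ⊕ v) ⊕ w)) ]ᵇ)                     ≤⟨ ∑-mono P (λ x → lem (h x) (h (x ⊕ v)) _) ⟩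
    (∑[ x ∈ P ] ([ h x ]ᵇ * [ not (h (x ⊕ v)) ]ᵇ + [ h (x ⊕ v) ]ᵇ * [ not (h ((x ⊕ v) ⊕ w)) ]ᵇ)) ≡⟨ ∑-+ _ _ P ⟩
    (∑[ x ∈ P ] [ h x ]ᵇ * [ not (h (x ⊕ v)) ]ᵇ) + (∑[ x ∈ P ] [ h (x ⊕ v) ]ᵇ * [ not (h ((x ⊕ v) ⊕ w)) ]ᵇ)
      ≡⟨ cong₂ _+_ (sym (err-cube v)) (trans (∑-shift v (λ x → [ h x ]ᵇ * [ not (h (x ⊕ w)) ]ᵇ)) (sym (err-cube w))) ⟩
    err v + err w ∎
    where
    open ≤-Reasoning
    lem : ∀ a b c → [ a ]ᵇ * [ not c ]ᵇ ≤ [ a ]ᵇ * [ not b ]ᵇ + [ b ]ᵇ * [ not c ]ᵇ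
    lem true  true  c = ≤-refl
    lem true  false c = ≤-trans (≤-reflexive (+-identityʳ _)) ([]≤1 (not c))
    lem false b     c = z≤n

  err-subadditive : Subadditive err
  err-subadditive = record { at-𝟎 = err-𝟎 ; at-⊕ = err-⊕ }

  -- Translation by `v` is an involution, so as many points enter `h⁻¹(1)` as leave it.
  changes : ∀ v → (∑[ y ∈ P ] [ h y xor h (y ⊕ v) ]ᵇ) ≡ 2 * err v
  changes v = begin
    (∑[ y ∈ P ] [ h y xor h (y ⊕ v) ]ᵇ) ≡⟨ ∑-cong P (λ y → lem (h y) (h (y ⊕ v))) ⟩
    (∑[ y ∈ P ] ([ h y ]ᵇ * [ not (h (y ⊕ v)) ]ᵇ + [ h (y ⊕ v) ]ᵇ * [ not (h y) ]ᵇ)) ≡⟨ ∑-+ _ _ P ⟩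
    (∑[ y ∈ P ] [ h y ]ᵇ * [ not (h (y ⊕ v)) ]ᵇ) + (∑[ y ∈ P ] [ h (y ⊕ v) ]ᵇ * [ not (h y) ]ᵇ)
      ≡⟨ cong₂ _+_ (sym (err-cube v)) (trans (∑-cong P (λ y → cong (λ z → [ h (y ⊕ v) ]ᵇ * [ not (h z) ]ᵇ) (sym (⊕-cancelʳ y v)))) (trans (∑-shift v (λ y → [ h y ]ᵇ * [ not (h (y ⊕ v)) ]ᵇ)) (trans (sym (err-cube v)) (sym (+-identityʳ _))))) ⟩
    2 * err v ∎
    where
    open ≡-Reasoning
    lem : ∀ a b → [ a xor b ]ᵇ ≡ [ a ]ᵇ * [ not b ]ᵇ + [ b ]ᵇ * [ not a ]ᵇ
    lem true  true  = refl
    lem true  false = refl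
    lem false true  = refl
    lem false false = refl

  ∑U≤∑P : ∀ (f : Point n → ℕ) → ∑ U f ≤ ∑ P f
  ∑U≤∑P f = ≤-trans (≤-reflexive (∑-support f)) (∑-mono P (λ x → ≤-trans (*-monoˡ-≤ (f x) ([]≤1 (h x))) (≤-reflexive (*-identityˡ (f x)))))

  -- The point `w ⊕ a` need not lie in `h⁻¹(1)`, so both directions of change are counted, over the
  -- whole cube.
  changes-from : ∀ a v → (∑[ w ∈ U ] [ h (w ⊕ a) xor h ((w ⊕ a) ⊕ v) ]ᵇ) ≤ 2 * err v
  changes-from a v = ≤-trans (∑U≤∑P _) (≤-reflexive (trans (∑-shift a (λ y → [ h y xor h (y ⊕ v) ]ᵇ)) (changes v)))

  -- For all but `err v` samples the translate lies in `h⁻¹(1)` again, and translation is injective: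
  -- a change of measure that costs at most `err v`.
  translate-events : ∀ (ev : Point n → Bool) v → (∑[ f ∈ U ] [ ev (f ⊕ v) ]ᵇ) ≤ (∑[ f ∈ U ] [ ev f ]ᵇ) + err v
  translate-events ev v = begin
    (∑[ f ∈ U ] [ ev (f ⊕ v) ]ᵇ)                        ≡⟨ ∑-support _ ⟩
    (∑[ f ∈ P ] [ h f ]ᵇ * [ ev (f ⊕ v) ]ᵇ)             ≡⟨ ∑-shift v (λ f → [ h f ]ᵇ * [ ev (f ⊕ v) ]ᵇ) ⟨
    (∑[ f ∈ P ] [ h (f ⊕ v) ]ᵇ * [ ev ((f ⊕ v) ⊕ v) ]ᵇ) ≡⟨ ∑-cong P (λ f → cong (λ z → [ h (f ⊕ v) ]ᵇ * [ ev z ]ᵇ) (⊕-cancelʳ f v)) ⟩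
    (∑[ f ∈ P ] [ h (f ⊕ v) ]ᵇ * [ ev f ]ᵇ)             ≤⟨ ∑-mono P (λ f → lem (h f) (h (f ⊕ v)) (ev f)) ⟩
    (∑[ f ∈ P ] ([ h f ]ᵇ * [ ev f ]ᵇ + [ h (f ⊕ v) ]ᵇ * [ not (h f) ]ᵇ)) ≡⟨ ∑-+ _ _ P ⟩
    (∑[ f ∈ P ] [ h f ]ᵇ * [ ev f ]ᵇ) + (∑[ f ∈ P ] [ h (f ⊕ v) ]ᵇ * [ not (h f) ]ᵇ)
      ≡⟨ cong₂ _+_ (sym (∑-support _)) (trans (sym (∑-shift v _)) (trans (∑-cong P (λ f → cong (λ z → [ h z ]ᵇ * [ not (h (f ⊕ v)) ]ᵇ) (⊕-cancelʳ f v))) (sym (err-cube v)))) ⟩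
    (∑[ f ∈ U ] [ ev f ]ᵇ) + err v                      ∎
    where
    open ≤-Reasoning
    lem : ∀ a b c → [ b ]ᵇ * [ c ]ᵇ ≤ [ a ]ᵇ * [ c ]ᵇ + [ b ]ᵇ * [ not a ]ᵇ
    lem a     false c = z≤n
    lem true  true  c = m≤m+n _ _
    lem false true  c = ≤-trans (≤-reflexive (+-identityʳ _)) ([]≤1 c)

  -- Trials of the junta test: for x, y, z in h⁻¹(1) and a random set B, a trial fails on A when z changes value
  -- after it is moved by x ⊕ y inside A ∩ B.
  Trial : Set
  Trial = Point n × Point n × Point n × Point n

  trials : List Trial
  trials = cartesianProduct U (cartesianProduct U (cartesianProduct U P))

  fails : Point n → Trial → Bool
  fails A (x , y , z , B) = not (h (z ⊕ ((x ⊕ y) ⊙ (A ⊙ B))))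

  failures : Point n → ℕ
  failures A = ∑[ t ∈ trials ] [ fails A t ]ᵇ

  restricted-err : Point n → Point n → ℕ
  restricted-err v A = ∑[ B ∈ P ] err (v ⊙ (A ⊙ B))

  failures-err : ∀ A → failures A ≡ (∑[ x ∈ U ] ∑[ y ∈ U ] restricted-err (x ⊕ y) A)
  failures-err A =
    trans (∑-pairs U _ _) (∑-cong U λ x → trans (∑-pairs U _ _) (∑-cong U λ y → trans (∑-pairs U P _) (∑-swap _ U P)))

  length-trials : length trials ≡ u * (u * (u * 2 ^ n))
  length-trials = trans (length-cartesian _,_ U _) (cong (u *_) (trans (length-cartesian _,_ U _) (cong (u *_) (trans (length-cartesian _,_ U P) (cong (u *_) (length-allPoints n))))))

  failures-subadditive : Subadditive failures
  failures-subadditive = record { at-𝟎 = z ; at-⊕ = s }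
    where
    z : failures 𝟎 ≡ 0
    z = trans (failures-err 𝟎) (trans (∑-cong U λ x → trans (∑-cong U λ y → trans (∑-cong P (λ B → trans (cong err (trans (cong ((x ⊕ y) ⊙_) (⊙-𝟎ˡ B)) (⊙-𝟎ʳ (x ⊕ y)))) err-𝟎)) (∑-zero P)) (∑-zero U)) (∑-zero U))
    s : ∀ v w → failures (v ⊕ w) ≤ failures v + failures w
    s v w = begin
      failures (v ⊕ w)                                              ≡⟨ failures-err (v ⊕ w) ⟩
      (∑[ x ∈ U ] ∑[ y ∈ U ] restricted-err (x ⊕ y) (v ⊕ w))
        ≤⟨ (∑-mono U λ x → ∑-mono U λ y → step (x ⊕ y)) ⟩
      (∑[ x ∈ U ] ∑[ y ∈ U ] (restricted-err (x ⊕ y) v + restricted-err (x ⊕ y) w))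
        ≡⟨ trans (∑-cong U λ x → ∑-+ _ _ U) (∑-+ _ _ U) ⟩
      (∑[ x ∈ U ] ∑[ y ∈ U ] restricted-err (x ⊕ y) v) + (∑[ x ∈ U ] ∑[ y ∈ U ] restricted-err (x ⊕ y) w)
        ≡⟨ cong₂ _+_ (failures-err v) (failures-err w) ⟨
      failures v + failures w ∎
      where
      open ≤-Reasoning
      step : ∀ d → restricted-err d (v ⊕ w) ≤ restricted-err d v + restricted-err d w
      step d = ≤-trans (∑-mono P λ B → ≤-trans (≤-reflexive (cong err (trans (cong (d ⊙_) (⊙-distribʳ v w B)) (⊙-distribˡ d _ _)))) (err-⊕ _ _)) (≤-reflexive (∑-+ _ _ P))

  -- A uniformly random B and its translate B ⊕ B′ are both uniform, and their contributions add up to that of B′.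
  err≤restricted-err : ∀ v A B′ → B′ ⊙ A ≡ B′ → 2 ^ n * err (v ⊙ B′) ≤ 2 * restricted-err v A
  err≤restricted-err v A B′ sub = begin
    2 ^ n * err (v ⊙ B′)                ≡⟨ cong (_* err (v ⊙ B′)) (length-allPoints n) ⟨
    length P * err (v ⊙ B′)             ≡⟨ ∑-const _ P ⟨
    (∑[ B ∈ P ] err (v ⊙ B′))           ≤⟨ ∑-mono P step ⟩
    (∑[ B ∈ P ] (err (v ⊙ (A ⊙ B)) + err (v ⊙ (A ⊙ (B ⊕ B′))))) ≡⟨ ∑-+ _ _ P ⟩
    restricted-err v A + (∑[ B ∈ P ] err (v ⊙ (A ⊙ (B ⊕ B′))))
      ≡⟨ cong (restricted-err v A +_) (trans (∑-shift B′ (λ B → err (v ⊙ (A ⊙ B)))) (sym (+-identityʳ _))) ⟩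
    2 * restricted-err v A ∎
    where
    open ≤-Reasoning
    split : ∀ B → v ⊙ B′ ≡ (v ⊙ (A ⊙ B)) ⊕ (v ⊙ (A ⊙ (B ⊕ B′)))
    split B = sym (trans (sym (⊙-distribˡ v _ _)) (cong (v ⊙_) (trans (sym (⊙-distribˡ A _ _))
      (trans (cong (A ⊙_) (trans (⊕-comm B _) (trans (cong (_⊕ B) (⊕-comm B B′)) (⊕-cancelʳ B′ B)))) (trans (⊙-comm A B′) sub)))))
    step : ∀ B → err (v ⊙ B′) ≤ err (v ⊙ (A ⊙ B)) + err (v ⊙ (A ⊙ (B ⊕ B′)))
    step B = ≤-trans (≤-reflexive (cong err (split B))) (err-⊕ _ _)

  -- `err` may drop when more coordinates are flipped, since further flips can move a point back.
  -- Averaging over `B` makes restriction monotone up to a factor two, so that the failures of a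
  -- piece of a class can be charged to the block around it.
  failures-mono : ∀ A A′ → A′ ⊙ A ≡ A′ → failures A′ ≤ 2 * failures A
  failures-mono A A′ sub = begin
    failures A′                                              ≡⟨ failures-err A′ ⟩
    (∑[ x ∈ U ] ∑[ y ∈ U ] restricted-err (x ⊕ y) A′)        ≤⟨ (∑-mono U λ x → ∑-mono U λ y → step (x ⊕ y)) ⟩
    (∑[ x ∈ U ] ∑[ y ∈ U ] (2 * restricted-err (x ⊕ y) A))   ≡⟨ trans (∑-cong U λ x → ∑-*ˡ 2 _ U) (∑-*ˡ 2 _ U) ⟩
    2 * (∑[ x ∈ U ] ∑[ y ∈ U ] restricted-err (x ⊕ y) A)     ≡⟨ cong (2 *_) (failures-err A) ⟨
    2 * failures A ∎
    where
    open ≤-Reasoning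
    step : ∀ v → restricted-err v A′ ≤ 2 * restricted-err v A
    step v = *-cancelˡ-≤ (2 ^ n) {{m^n≢0 2 n}} (begin
      2 ^ n * restricted-err v A′                  ≡⟨ ∑-*ˡ (2 ^ n) _ P ⟨
      (∑[ B ∈ P ] 2 ^ n * err (v ⊙ (A′ ⊙ B)))      ≤⟨ ∑-mono P (λ B → err≤restricted-err v A (A′ ⊙ B) (trans (trans (⊙-assoc A′ B A) (trans (cong (A′ ⊙_) (⊙-comm B A)) (sym (⊙-assoc A′ A B)))) (cong (_⊙ B) sub))) ⟩
      (∑[ B ∈ P ] 2 * restricted-err v A)          ≡⟨ trans (∑-const _ P) (cong (_* (2 * restricted-err v A)) (length-allPoints n)) ⟩
      2 ^ n * (2 * restricted-err v A) ∎)

-- Greedy scan of the coordinates from left to right, cutting off a class as soon as its value exceeds δ.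
-- J collects the last coordinate of each completed class; f is the set function with the pending class added, g the plain one.
class : Vec ℕ n → ℕ → Point n
class lab t = Vec.map (_≡ᵇ t) lab

record Scan (f g : Point n → ℕ) (δ : ℕ) : Set where
  field
    cuts     : Point n
    labels   : Vec ℕ n
    rest     : f (∁ cuts) ≤ suc (size cuts) * δ
    first    : 0 < size cuts → δ < f (class labels 0)
    further  : ∀ t → suc t < size cuts → δ < g (class labels (suc t))

-- In the recursion `f` has the pending class already filled in, whereas `g` starts a new class at
-- the current position. Thus `f 𝟎 ≤ δ` says that the pending class is still light.
scan : ∀ (f g : Point n → ℕ) δ → f 𝟎 ≤ δ → g 𝟎 ≤ δ →
  (∀ v w → f (v ⊕ w) ≤ f v + g w) → (∀ v w → g (v ⊕ w) ≤ g v + g w) → Scan f g δ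
scan {zero} f g δ f₀ g₀ fg gg = record
  { cuts = [] ; labels = [] ; rest = ≤-trans f₀ (m≤m+n δ 0) ; first = λ () ; further = λ _ () }
scan {suc n} f g δ f₀ g₀ fg gg with f (true ∷ 𝟎) ≤? δ
... | yes le = record
  { cuts    = false ∷ cuts
  ; labels  = 0 ∷ labels
  ; rest    = rest
  ; first   = first
  ; further = further }
  where open Scan (scan (f ∘ (true ∷_)) (g ∘ (false ∷_)) δ le g₀ (λ v w → fg (true ∷ v) (false ∷ w)) (λ v w → gg (false ∷ v) (false ∷ w)))
... | no nle = record
  { cuts    = true ∷ cuts
  -- The cut coordinate closes class 0, and all classes found later move up by one.
  ; labels  = 0 ∷ Vec.map suc labels
  -- A class without its last coordinate was still light, with value `f 𝟎` here. So each of the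
  -- `suc (size cuts)` pieces between the cuts contributes at most `δ`.
  ; rest    = begin
      f (false ∷ ∁ cuts)                      ≡⟨ cong f (⊕-identityˡ (false ∷ ∁ cuts)) ⟨
      f (𝟎 ⊕ (false ∷ ∁ cuts))                ≤⟨ fg 𝟎 (false ∷ ∁ cuts) ⟩
      f 𝟎 + g (false ∷ ∁ cuts)                ≤⟨ +-mono-≤ f₀ rest ⟩
      δ + suc (size cuts) * δ                 ∎
  ; first   = λ _ → ≤-trans (≰⇒> nle) (≤-reflexive (cong (λ C → f (true ∷ C)) (sym (none labels))))
  ; further = λ t lt → ≤-trans (later t (≤-pred lt)) (≤-reflexive (cong (λ C → g (false ∷ C)) (sym (shifted t labels)))) }
  where
  open ≤-Reasoning
  open Scan (scan (g ∘ (false ∷_)) (g ∘ (false ∷_)) δ g₀ g₀ (λ v w → gg (false ∷ v) (false ∷ w)) (λ v w → gg (false ∷ v) (false ∷ w)))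
  none : ∀ {m} (lab : Vec ℕ m) → class (Vec.map suc lab) 0 ≡ 𝟎
  none []        = refl
  none (l ∷ lab) = cong (false ∷_) (none lab)
  shifted : ∀ {m} t (lab : Vec ℕ m) → class (Vec.map suc lab) (suc t) ≡ class lab t
  shifted t []        = refl
  shifted t (l ∷ lab) = cong ((l ≡ᵇ t) ∷_) (shifted t lab)
  later : ∀ t → t < size cuts → δ < g (false ∷ class labels t)
  later zero    lt = first lt
  later (suc t) lt = further t lt

-- Labellings that separate a set of coordinates

hits : Point n → Vec (Point k) n → Point k → ℕ
hits []      []      j = 0
hits (b ∷ J) (x ∷ π) j = [ b ]ᵇ * [ x ≡ᵖ j ]ᵇ + hits J π j

separates : Point n → Vec (Point k) n → Bool
separates []          []      = true
separates (true ∷ J)  (x ∷ π) = (hits J π x ≡ᵇ 0) ∧ separates J π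
separates (false ∷ J) (x ∷ π) = separates J π

∑-hits : ∀ (J : Point n) (π : Vec (Point k) n) → ∑ (allPoints k) (hits J π) ≡ size J
∑-hits {k = k} []      []      = ∑-zero (allPoints k)
∑-hits {k = k} (b ∷ J) (x ∷ π) = trans (∑-+ _ _ (allPoints k))
  (cong₂ _+_ (trans (∑-*ˡ [ b ]ᵇ _ (allPoints k)) (trans (cong ([ b ]ᵇ *_) (∑-mass x)) (*-identityʳ _))) (∑-hits J π))

hit : ∀ (J : Point n) (π : Vec (Point k) n) i → lookup J i ≡ true → 0 < hits J π (lookup π i)
hit (true ∷ J) (x ∷ π) zero    refl rewrite ≡ᵖ-refl x = s≤s z≤n
hit (b ∷ J)    (x ∷ π) (suc i) eq = ≤-trans (hit J π i eq) (m≤n+m _ _)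

hit⁻¹ : ∀ (J : Point n) (π : Vec (Point k) n) j → 0 < hits J π j → ∃ λ i → lookup J i ≡ true × lookup π i ≡ j
hit⁻¹ []         []      j ()
hit⁻¹ (true ∷ J) (x ∷ π) j lt with x ≡ᵖ j in eq
... | true  = zero , refl , ≡ᵖ⇒≡ x j eq
... | false with hit⁻¹ J π j lt
...   | i , Ji , πi = suc i , Ji , πi
hit⁻¹ (false ∷ J) (x ∷ π) j lt with hit⁻¹ J π j lt
... | i , Ji , πi = suc i , Ji , πi

∧-true : ∀ {a b} → a ∧ b ≡ true → a ≡ true × b ≡ true
∧-true {true} {true} _ = refl , refl

private
  ≡ᵇ0 : ∀ m → (m ≡ᵇ 0) ≡ true → m ≡ 0
  ≡ᵇ0 zero _ = refl

separates⇒hits≤1 : ∀ (J : Point n) (π : Vec (Point k) n) j → separates J π ≡ true → hits J π j ≤ 1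
separates⇒hits≤1 []          []      j eq = z≤n
separates⇒hits≤1 (false ∷ J) (x ∷ π) j eq = separates⇒hits≤1 J π j eq
separates⇒hits≤1 (true ∷ J)  (x ∷ π) j eq with ∧-true {hits J π x ≡ᵇ 0} eq
... | z , s with x ≡ᵖ j in xj
...   | false = separates⇒hits≤1 J π j s
...   | true  = ≤-reflexive (cong suc (trans (cong (hits J π) (sym (≡ᵖ⇒≡ x j xj))) (≡ᵇ0 _ z)))

separates⇒injective : ∀ (J : Point n) (π : Vec (Point k) n) → separates J π ≡ true →
  ∀ i i′ → lookup J i ≡ true → lookup J i′ ≡ true → lookup π i ≡ lookup π i′ → i ≡ i′
separates⇒injective (b ∷ J) (x ∷ π) s zero    zero     Ji Ji′ e = refl
separates⇒injective (true ∷ J) (x ∷ π) s zero (suc i′) Ji Ji′ refl with ∧-true {hits J π x ≡ᵇ 0} s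
... | z , _ = ⊥-elim (<-irrefl (sym (≡ᵇ0 _ z)) (hit J π i′ Ji′))
separates⇒injective (true ∷ J) (x ∷ π) s (suc i) zero Ji Ji′ refl with ∧-true {hits J π x ≡ᵇ 0} s
... | z , _ = ⊥-elim (<-irrefl (sym (≡ᵇ0 _ z)) (hit J π i Ji))
separates⇒injective (true ∷ J) (x ∷ π) s (suc i) (suc i′) Ji Ji′ e =
  cong suc (separates⇒injective J π (proj₂ (∧-true {hits J π x ≡ᵇ 0} s)) i i′ Ji Ji′ e)
separates⇒injective (false ∷ J) (x ∷ π) s (suc i) (suc i′) Ji Ji′ e = cong suc (separates⇒injective J π s i i′ Ji Ji′ e)

separated-size≤ : ∀ (J : Point n) (π : Vec (Point k) n) (M : Point k → Bool) → separates J π ≡ true →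
  (∀ i → lookup J i ≡ true → M (lookup π i) ≡ true) → size J ≤ (∑[ j ∈ allPoints k ] [ M j ]ᵇ)
separated-size≤ {k = k} J π M s JM = ≤-trans (≤-reflexive (sym (∑-hits J π))) (∑-mono (allPoints k) step)
  where
  step : ∀ j → hits J π j ≤ [ M j ]ᵇ
  step j with M j in Mj
  ... | true = separates⇒hits≤1 J π j s
  ... | false with hits J π j in eq
  ...   | zero = z≤n
  ...   | suc _ with hit⁻¹ J π j (≤-trans (s≤s z≤n) (≤-reflexive (sym eq)))
  ...     | i , Ji , refl with trans (sym Mj) (JM i Ji)
  ...       | ()

∑≤hits-size : ∀ (J : Point n) (π : Vec (Point k) n) (M : Point k → Bool) →
  (∀ j → M j ≡ true → 0 < hits J π j) → (∑[ j ∈ allPoints k ] [ M j ]ᵇ) ≤ size J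
∑≤hits-size {k = k} J π M Mh = ≤-trans (∑-mono (allPoints k) step) (≤-reflexive (∑-hits J π))
  where
  step : ∀ j → [ M j ]ᵇ ≤ hits J π j
  step j with M j in Mj
  ... | true  = Mh j Mj
  ... | false = z≤n

length-labellings : ∀ k n → length (vecs (allPoints k) n) ≡ (2 ^ k) ^ n
length-labellings k n = trans (length-vecs (allPoints k) n) (cong (_^ n) (length-allPoints k))

-- Birthday bound, one coordinate at a time: whatever the other labels are, a new element of `J`
-- meets one of them with probability at most `size J` over `2 ^ k`.
collisions : ∀ k (J : Point n) →
  2 ^ k * (∑[ π ∈ vecs (allPoints k) n ] [ not (separates J π) ]ᵇ) ≤ size J * size J * (2 ^ k) ^ n
collisions {zero}  k []      = ≤-reflexive (*-zeroʳ (2 ^ k))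
collisions {suc n} k (b ∷ J) = begin
  K * (∑[ π ∈ vecs L (suc n) ] [ not (separates (b ∷ J) π) ]ᵇ)                 ≡⟨ cong (K *_) (trans (∑-vecs L n _) (∑-swap _ L (vecs L n))) ⟩
  K * (∑[ π ∈ vecs L n ] ∑[ x ∈ L ] [ not (separates (b ∷ J) (x ∷ π)) ]ᵇ)
    ≤⟨ *-monoʳ-≤ K (∑-mono (vecs L n) λ π → ≤-trans (∑-mono L λ x → step b x π) (≤-reflexive (per π))) ⟩
  K * (∑[ π ∈ vecs L n ] ([ b ]ᵇ * size J + K * [ not (separates J π) ]ᵇ))
    ≡⟨ cong (K *_) (trans (∑-+ _ _ (vecs L n)) (cong₂ _+_ (trans (∑-const _ (vecs L n)) (cong (_* ([ b ]ᵇ * size J)) (length-labellings k n))) (∑-*ˡ K _ (vecs L n)))) ⟩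
  K * (K ^ n * ([ b ]ᵇ * size J) + K * (∑[ π ∈ vecs L n ] [ not (separates J π) ]ᵇ))
    ≤⟨ *-monoʳ-≤ K (+-monoʳ-≤ (K ^ n * ([ b ]ᵇ * size J)) (collisions k J)) ⟩
  K * (K ^ n * ([ b ]ᵇ * size J) + size J * size J * K ^ n)                     ≤⟨ m≤m+n _ _ ⟩
  K * (K ^ n * ([ b ]ᵇ * size J) + size J * size J * K ^ n) + ([ b ]ᵇ * [ b ]ᵇ + [ b ]ᵇ * size J) * (K * K ^ n)
    ≡⟨ alg K (K ^ n) [ b ]ᵇ (size J) ⟩
  ([ b ]ᵇ + size J) * ([ b ]ᵇ + size J) * (K * K ^ n)                           ∎
  where
  open ≤-Reasoning
  K = 2 ^ k
  L = allPoints k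
  alg : ∀ K a b s → K * (a * (b * s) + s * s * a) + (b * b + b * s) * (K * a) ≡ (b + s) * (b + s) * (K * a)
  alg = solve-∀
  step : ∀ b x π → [ not (separates (b ∷ J) (x ∷ π)) ]ᵇ ≤ [ b ]ᵇ * hits J π x + [ not (separates J π) ]ᵇ
  step false x π = ≤-refl
  step true  x π with hits J π x
  ... | zero  = ≤-refl
  ... | suc _ = s≤s z≤n
  per : ∀ π → (∑[ x ∈ L ] ([ b ]ᵇ * hits J π x + [ not (separates J π) ]ᵇ)) ≡ [ b ]ᵇ * size J + K * [ not (separates J π) ]ᵇ
  per π = trans (∑-+ _ _ L) (cong₂ _+_ (trans (∑-*ˡ [ b ]ᵇ _ L) (cong ([ b ]ᵇ *_) (∑-hits J π))) (trans (∑-const _ L) (cong (_* [ not (separates J π) ]ᵇ) (length-allPoints k))))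

∑-vecs-shift : ∀ (r : Vec (Point k) n) (f : Vec (Point k) n → ℕ) →
  (∑[ π ∈ vecs (allPoints k) n ] f (zipWith _⊕_ π r)) ≡ ∑ (vecs (allPoints k) n) f
∑-vecs-shift [] f = refl
∑-vecs-shift {k = k} {n = suc n} (x ∷ r) f = begin
  (∑[ π ∈ vecs L (suc n) ] f (zipWith _⊕_ π (x ∷ r)))                  ≡⟨ ∑-vecs L n _ ⟩
  (∑[ y ∈ L ] ∑[ π ∈ vecs L n ] f ((y ⊕ x) ∷ zipWith _⊕_ π r))          ≡⟨ ∑-cong L (λ y → ∑-vecs-shift r (λ π → f ((y ⊕ x) ∷ π))) ⟩
  (∑[ y ∈ L ] ∑[ π ∈ vecs L n ] f ((y ⊕ x) ∷ π))                        ≡⟨ ∑-shift x (λ y → ∑[ π ∈ vecs L n ] f (y ∷ π)) ⟩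
  (∑[ y ∈ L ] ∑[ π ∈ vecs L n ] f (y ∷ π))                              ≡⟨ ∑-vecs L n f ⟨
  ∑ (vecs L (suc n)) f                                                  ∎
  where
  open ≡-Reasoning
  L = allPoints k

[≤ᵇ] : ∀ a b → (a ≤ᵇ b) ≡ true → a ≤ b
[≤ᵇ] a b eq = ≤ᵇ⇒≤ a b (subst Data.Bool.T (sym eq) _)

size-full : ∀ n → size (replicate n true) ≡ n
size-full zero    = refl
size-full (suc n) = cong suc (size-full n)

all≤∑ : ∀ (f : Fin n → Bool) → (∑[ i ∈ allFin n ] [ not (f i) ]ᵇ) ≡ 0 → ∀ i → f i ≡ true
all≤∑ f eq i with f i in fi
... | true  = refl
... | false = ⊥-elim (<-irrefl (sym eq) (≤-trans (≤-reflexive (cong (λ b → [ not b ]ᵇ) (sym fi))) (term≤∑-allFin (λ i → [ not (f i) ]ᵇ) i)))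

∑-any-never : ∀ (p : A → Bool) L m →
  (∑[ v ∈ vecs L m ] [ not (any p (toList v)) ]ᵇ) ≡ (∑[ x ∈ L ] [ not (p x) ]ᵇ) ^ m
∑-any-never p L m = trans (∑-cong (vecs L m) (λ v → cong [_]ᵇ (deMorgan (toList v)))) (∑-vecs-all (not ∘ p) L m)
  where
  deMorgan : ∀ M → not (any p M) ≡ all (not ∘ p) M
  deMorgan []      = refl
  deMorgan (x ∷ M) with p x
  ... | true  = refl
  ... | false = deMorgan M

-- Soundness of the junta test

at : ∀ {m} → Vec (Point k) m → ℕ → Point k
-- The default leaves the labels of all classes beyond the first `suc μ` as they are.
at []      l       = 𝟎
at (x ∷ s) zero    = x
at (x ∷ s) (suc l) = at s l

at-toℕ : ∀ {m} (s : Vec (Point k) m) t → at s (toℕ t) ≡ lookup s t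
at-toℕ (x ∷ s) zero    = refl
at-toℕ (x ∷ s) (suc t) = at-toℕ s t

module JuntaTest {n : ℕ} (h : BoolFun n) (k N₁ μ : ℕ) where
  open Error h

  marked : Vec (Point k) n → Vec Trial N₁ → Point k → Bool
  marked π tr j = any (fails (block π j)) (toList tr)

  passes : Vec (Point k) n → Vec Trial N₁ → Bool
  passes π tr = (∑[ j ∈ allPoints k ] [ marked π tr j ]ᵇ) ≤ᵇ μ

  private
    K q Tot : ℕ
    K = 2 ^ k
    q = suc μ
    Tot = length trials
    labellings : ∀ m → List (Vec (Point k) m)
    labellings = vecs (allPoints k)
    TR = vecs trials N₁

    ≡ᵇ⇒≡′ : ∀ l t → (l ≡ᵇ t) ≡ true → l ≡ t
    ≡ᵇ⇒≡′ l t eq = ≡ᵇ⇒≡ l t (subst Data.Bool.T (sym eq) _)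

  module _ (D : ℕ) (0<D : 0 < D) (0<u : 0 < u) (labels : Vec ℕ n)
           (heavy : ∀ t → t < q → Tot < D * failures (class labels t))
           (K-large : 100 * (q * q) ≤ K) (N₁-large : 100 * q * (D * (K * 2)) ≤ N₁) where

    private
      H : ℕ
      H = D * (K * 2)

      -- Shifts all labels of class `t` by the entry `t` of `s`. For fixed `s` this is a bijection
      -- of labellings, so a uniform labelling may be replaced by a uniform `π` moved by an
      -- independent uniform `s`.
      moved : Vec (Point k) n → Vec (Point k) q → Vec (Point k) n
      moved π s = zipWith _⊕_ π (Vec.map (at s) labels)

      -- By subadditivity, one of the `K` pieces into which `π` cuts a class has at least a `K`-th
      -- of its failures. The choice depends on `π` only and is thus independent of the shift.
      target : ∀ π (t : Fin q) → ∃ λ j → failures (class labels (toℕ t)) ≤ K * failures (class labels (toℕ t) ⊙ block π j)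
      target π t with ∃-≥-average (λ j → failures (class labels (toℕ t) ⊙ block π j)) (allPoints k)
                        (≤-trans (m^n>0 2 k) (≤-reflexive (sym (length-allPoints k))))
      ... | j , le = j , ≤-trans (subadditive-blocks failures-subadditive π _) (≤-trans le (≤-reflexive (cong (_* failures (class labels (toℕ t) ⊙ block π j)) (length-allPoints k))))

      targets : Vec (Point k) n → Vec (Point k) q
      targets π = tabulate (proj₁ ∘ target π)

      goal : Vec (Point k) n → Vec (Point k) q → Fin q → Point k
      goal π s t = lookup (zipWith _⊕_ s (targets π)) t

      -- Inside one class the relabelling is a common translation, so the pieces of the class are
      -- kept and only their labels change.
      class-moved : ∀ π s t j → class labels (toℕ t) ⊙ block (moved π s) (lookup s t ⊕ j) ≡ class labels (toℕ t) ⊙ block π j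
      class-moved π s t j = ext λ i → begin
        lookup (C ⊙ block (moved π s) (lookup s t ⊕ j)) i  ≡⟨ trans (lookup-⊙ C _ i) (cong₂ _∧_ (lookup-map i _ labels) (lookup-block (moved π s) _ i)) ⟩
        (lookup labels i ≡ᵇ toℕ t) ∧ (lookup (moved π s) i ≡ᵖ lookup s t ⊕ j)
          ≡⟨ cong (λ p → (lookup labels i ≡ᵇ toℕ t) ∧ (p ≡ᵖ lookup s t ⊕ j)) (trans (lookup-zipWith _⊕_ i π _) (cong (lookup π i ⊕_) (lookup-map i (at s) labels))) ⟩
        (lookup labels i ≡ᵇ toℕ t) ∧ (lookup π i ⊕ at s (lookup labels i) ≡ᵖ lookup s t ⊕ j)
          ≡⟨ lem (lookup labels i) (lookup π i) ⟩
        (lookup labels i ≡ᵇ toℕ t) ∧ (lookup π i ≡ᵖ j)     ≡⟨ trans (lookup-⊙ C _ i) (cong₂ _∧_ (lookup-map i _ labels) (lookup-block π j i)) ⟨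
        lookup (C ⊙ block π j) i                            ∎
        where
        open ≡-Reasoning
        C = class labels (toℕ t)
        lem : ∀ l p → (l ≡ᵇ toℕ t) ∧ (p ⊕ at s l ≡ᵖ lookup s t ⊕ j) ≡ (l ≡ᵇ toℕ t) ∧ (p ≡ᵖ j)
        lem l p with l ≡ᵇ toℕ t in eq
        ... | false = refl
        ... | true  = trans (cong₂ _≡ᵖ_ (cong (p ⊕_) (trans (cong (at s) (≡ᵇ⇒≡′ l (toℕ t) eq)) (at-toℕ s t))) (⊕-comm (lookup s t) j)) (≡ᵖ-shift p j (lookup s t))

      -- The three factors of `H`: `D` from the weight of the class, `K` from its heaviest piece,
      -- and 2 for passing from the piece to the surrounding block.
      goal-heavy : ∀ π s t → Tot ≤ H * failures (block (moved π s) (goal π s t))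
      goal-heavy π s t = begin
        Tot                                                        ≤⟨ <⇒≤ (heavy (toℕ t) (toℕ<n t)) ⟩
        D * failures C                                             ≤⟨ *-monoʳ-≤ D (proj₂ (target π t)) ⟩
        D * (K * failures (C ⊙ block π j))                         ≡⟨ cong (λ A → D * (K * failures A)) (class-moved π s t j) ⟨
        D * (K * failures (C ⊙ block (moved π s) (lookup s t ⊕ j))) ≡⟨ cong (λ i → D * (K * failures (C ⊙ block (moved π s) i))) goal≡ ⟨
        D * (K * failures (C ⊙ X))                                 ≤⟨ *-monoʳ-≤ D (*-monoʳ-≤ K (failures-mono X (C ⊙ X) sub)) ⟩
        D * (K * (2 * failures X))                                 ≡⟨ alg D K (failures X) ⟩
        H * failures X                                             ∎
        where
        open ≤-Reasoning
        C = class labels (toℕ t)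
        j = proj₁ (target π t)
        X = block (moved π s) (goal π s t)
        goal≡ : goal π s t ≡ lookup s t ⊕ j
        goal≡ = trans (lookup-zipWith _⊕_ t s (targets π)) (cong (lookup s t ⊕_) (lookup∘tabulate (proj₁ ∘ target π) t))
        ⊙-idem : ∀ {m} (x : Point m) → x ⊙ x ≡ x
        ⊙-idem []          = refl
        ⊙-idem (true ∷ x)  = cong (true ∷_) (⊙-idem x)
        ⊙-idem (false ∷ x) = cong (false ∷_) (⊙-idem x)
        sub : (C ⊙ X) ⊙ X ≡ C ⊙ X
        sub = trans (⊙-assoc C X X) (cong (C ⊙_) (⊙-idem X))
        alg : ∀ D K x → D * (K * (2 * x)) ≡ D * (K * 2) * x
        alg = solve-∀

      full : Point q
      full = replicate q true

      -- `suc μ` distinct marked blocks make the test reject, so passing requires two goals in the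
      -- same block or an unmarked goal.
      pass-bound : ∀ π s tr → [ passes (moved π s) tr ]ᵇ ≤
        [ not (separates full (zipWith _⊕_ s (targets π))) ]ᵇ + (∑[ t ∈ allFin q ] [ not (marked (moved π s) tr (goal π s t)) ]ᵇ)
      pass-bound π s tr with passes (moved π s) tr in pass
      ... | false = z≤n
      ... | true with separates full (zipWith _⊕_ s (targets π)) in sep
      ...   | false = s≤s z≤n
      ...   | true with (∑[ t ∈ allFin q ] [ not (marked (moved π s) tr (goal π s t)) ]ᵇ) in eq
      ...     | suc _ = s≤s z≤n
      ...     | zero  = ⊥-elim (<-irrefl refl (begin-strict
        μ                                                ≡⟨ refl ⟩
        μ                                                <⟨ n<1+n μ ⟩
        q                                                ≡⟨ size-full q ⟨
        size full                                        ≤⟨ separated-size≤ full (zipWith _⊕_ s (targets π)) (marked (moved π s) tr) sep (λ t _ → all≤∑ _ eq t) ⟩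
        (∑[ j ∈ allPoints k ] [ marked (moved π s) tr j ]ᵇ) ≤⟨ [≤ᵇ] _ μ pass ⟩
        μ                                                ∎))
        where open ≤-Reasoning

      length-TR : length TR ≡ Tot ^ N₁
      length-TR = length-vecs trials N₁

      0<Tot : 0 < Tot
      0<Tot = ≤-trans (*-mono-≤ 0<u (*-mono-≤ 0<u (*-mono-≤ 0<u (m^n>0 2 n)))) (≤-reflexive (sym length-trials))

      unmarked : ∀ π s t → 100 * q * (∑[ tr ∈ TR ] [ not (marked (moved π s) tr (goal π s t)) ]ᵇ) ≤ Tot ^ N₁
      unmarked π s t = *-cancelʳ-≤ _ _ (H + N₁) {{>-nonZero (≤-trans 0<H (m≤m+n H N₁))}} (begin
        100 * q * (∑[ tr ∈ TR ] [ not (any p (toList tr)) ]ᵇ) * (H + N₁)  ≡⟨ cong (λ z → 100 * q * z * (H + N₁)) (∑-any-never p trials N₁) ⟩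
        100 * q * d ^ N₁ * (H + N₁)                                       ≡⟨ *-assoc (100 * q) (d ^ N₁) (H + N₁) ⟩
        100 * q * (d ^ N₁ * (H + N₁))                                     ≤⟨ *-monoʳ-≤ (100 * q) (bernoulli-fraction N₁ (trans (+-comm d _) ([not]-∑ p trials)) (goal-heavy π s t) 0<Tot) ⟩
        100 * q * (Tot ^ N₁ * H)                                          ≡⟨ alg (100 * q) (Tot ^ N₁) H ⟩
        Tot ^ N₁ * (100 * q * H)                                          ≤⟨ *-monoʳ-≤ (Tot ^ N₁) (≤-trans N₁-large (m≤n+m N₁ H)) ⟩
        Tot ^ N₁ * (H + N₁)                                               ∎)
        where
        open ≤-Reasoning
        p = fails (block (moved π s) (goal π s t))
        d = ∑[ x ∈ trials ] [ not (p x) ]ᵇ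
        0<H : 0 < H
        0<H = *-mono-≤ 0<D (*-mono-≤ (m^n>0 2 k) (s≤s z≤n))
        alg : ∀ a b c → a * (b * c) ≡ b * (a * c)
        alg = solve-∀

      per-shift : ∀ π s → 100 * (∑[ tr ∈ TR ] [ passes (moved π s) tr ]ᵇ) ≤
        100 * [ not (separates full (zipWith _⊕_ s (targets π))) ]ᵇ * Tot ^ N₁ + Tot ^ N₁
      per-shift π s = begin
        100 * (∑[ tr ∈ TR ] [ passes (moved π s) tr ]ᵇ)         ≤⟨ *-monoʳ-≤ 100 (∑-mono TR (pass-bound π s)) ⟩
        100 * (∑[ tr ∈ TR ] (c + (∑[ t ∈ allFin q ] X t tr)))
          ≡⟨ cong (100 *_) (trans (∑-+ _ _ TR) (cong₂ _+_ (trans (∑-const c TR) (cong (_* c) length-TR)) (∑-swap _ TR (allFin q)))) ⟩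
        100 * (Tot ^ N₁ * c + (∑[ t ∈ allFin q ] ∑ TR (X t)))   ≡⟨ alg (Tot ^ N₁) c _ ⟩
        100 * c * Tot ^ N₁ + 100 * (∑[ t ∈ allFin q ] ∑ TR (X t)) ≤⟨ +-monoʳ-≤ (100 * c * Tot ^ N₁) rest ⟩
        100 * c * Tot ^ N₁ + Tot ^ N₁ ∎
        where
        open ≤-Reasoning
        c = [ not (separates full (zipWith _⊕_ s (targets π))) ]ᵇ
        X = λ t tr → [ not (marked (moved π s) tr (goal π s t)) ]ᵇ
        alg : ∀ a c x → 100 * (a * c + x) ≡ 100 * c * a + 100 * x
        alg = solve-∀
        alg₂ : ∀ q x → q * (100 * x) ≡ 100 * q * x
        alg₂ = solve-∀
        rest : 100 * (∑[ t ∈ allFin q ] ∑ TR (X t)) ≤ Tot ^ N₁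
        rest = *-cancelˡ-≤ q (begin
          q * (100 * (∑[ t ∈ allFin q ] ∑ TR (X t)))    ≡⟨ trans (alg₂ q _) (sym (∑-*ˡ (100 * q) _ (allFin q))) ⟩
          (∑[ t ∈ allFin q ] 100 * q * ∑ TR (X t))      ≤⟨ ∑-mono (allFin q) (unmarked π s) ⟩
          (∑[ t ∈ allFin q ] Tot ^ N₁)                  ≡⟨ trans (∑-const (Tot ^ N₁) (allFin q)) (cong (_* Tot ^ N₁) (List.length-tabulate {n = q} id)) ⟩
          q * Tot ^ N₁                                  ∎)

      -- For fixed `π` the goals are `s` translated by a fixed vector, hence `q` independent uniform
      -- labels.
      collision-bound : ∀ π → 100 * (∑[ s ∈ labellings q ] [ not (separates full (zipWith _⊕_ s (targets π))) ]ᵇ) ≤ K ^ q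
      collision-bound π = *-cancelˡ-≤ K {{m^n≢0 2 k}} (begin
        K * (100 * S)             ≡⟨ alg K S′ S (∑-vecs-shift (targets π) (λ s → [ not (separates full s) ]ᵇ)) ⟩
        100 * (K * S′)            ≤⟨ *-monoʳ-≤ 100 (collisions k full) ⟩
        100 * (size full * size full * K ^ q) ≡⟨ cong (λ z → 100 * (z * z * K ^ q)) (size-full q) ⟩
        100 * (q * q * K ^ q)     ≡⟨ *-assoc 100 (q * q) (K ^ q) ⟨
        100 * (q * q) * K ^ q     ≤⟨ *-monoˡ-≤ (K ^ q) K-large ⟩
        K * K ^ q                 ∎)
        where
        open ≤-Reasoning
        S  = ∑[ s ∈ labellings q ] [ not (separates full (zipWith _⊕_ s (targets π))) ]ᵇ
        S′ = ∑[ s ∈ labellings q ] [ not (separates full s) ]ᵇ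
        alg : ∀ K S′ S → S ≡ S′ → K * (100 * S) ≡ 100 * (K * S′)
        alg K S′ S refl = lem K S
          where
          lem : ∀ K S → K * (100 * S) ≡ 100 * (K * S)
          lem = solve-∀

      per-labelling : ∀ π → 100 * (∑[ s ∈ labellings q ] ∑[ tr ∈ TR ] [ passes (moved π s) tr ]ᵇ) ≤ 2 * (K ^ q * Tot ^ N₁)
      per-labelling π = begin
        100 * (∑[ s ∈ labellings q ] ∑[ tr ∈ TR ] [ passes (moved π s) tr ]ᵇ)  ≡⟨ ∑-*ˡ 100 _ (labellings q) ⟨
        (∑[ s ∈ labellings q ] 100 * (∑[ tr ∈ TR ] [ passes (moved π s) tr ]ᵇ)) ≤⟨ ∑-mono (labellings q) (per-shift π) ⟩
        (∑[ s ∈ labellings q ] (100 * c s * Tot ^ N₁ + Tot ^ N₁))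
          ≡⟨ trans (∑-+ _ _ (labellings q)) (cong₂ _+_ (trans (∑-*ʳ (Tot ^ N₁) _ (labellings q)) (cong (_* Tot ^ N₁) (∑-*ˡ 100 c (labellings q))))
                                                       (trans (∑-const (Tot ^ N₁) (labellings q)) (cong (_* Tot ^ N₁) (length-labellings k q)))) ⟩
        100 * ∑ (labellings q) c * Tot ^ N₁ + K ^ q * Tot ^ N₁  ≤⟨ +-monoˡ-≤ (K ^ q * Tot ^ N₁) (*-monoˡ-≤ (Tot ^ N₁) (collision-bound π)) ⟩
        K ^ q * Tot ^ N₁ + K ^ q * Tot ^ N₁                     ≡⟨ cong (K ^ q * Tot ^ N₁ +_) (+-identityʳ _) ⟨
        2 * (K ^ q * Tot ^ N₁) ∎
        where
        open ≤-Reasoning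
        c = λ s → [ not (separates full (zipWith _⊕_ s (targets π))) ]ᵇ

    -- For each `π` both causes of a pass have probability at most 1/100 over the shifts and trials,
    -- and averaging over the shifts does not change the sum over all labellings.
    junta-test-sound : 50 * (∑[ π ∈ labellings n ] ∑[ tr ∈ TR ] [ passes π tr ]ᵇ) ≤ length (labellings n) * length TR
    junta-test-sound = *-cancelˡ-≤ (2 * K ^ q) {{m*n≢0 2 (K ^ q) {{_}} {{m^n≢0 K q {{m^n≢0 2 k}}}}}} (begin
      2 * K ^ q * (50 * ∑ (labellings n) F)                          ≡⟨ alg (K ^ q) (∑ (labellings n) F) ⟩
      100 * (K ^ q * ∑ (labellings n) F)
        ≡⟨ cong (100 *_) (trans (cong (_* ∑ (labellings n) F) (sym (length-labellings k q))) (trans (sym (∑-const _ (labellings q)))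
             (trans (∑-cong (labellings q) (λ s → sym (∑-vecs-shift (Vec.map (at s) labels) F))) (∑-swap _ (labellings q) (labellings n))))) ⟩
      100 * (∑[ π ∈ labellings n ] ∑[ s ∈ labellings q ] F (moved π s)) ≡⟨ ∑-*ˡ 100 _ (labellings n) ⟨
      (∑[ π ∈ labellings n ] 100 * (∑[ s ∈ labellings q ] F (moved π s))) ≤⟨ ∑-mono (labellings n) per-labelling ⟩
      (∑[ π ∈ labellings n ] 2 * (K ^ q * Tot ^ N₁))                  ≡⟨ ∑-const _ (labellings n) ⟩
      length (labellings n) * (2 * (K ^ q * Tot ^ N₁))                ≡⟨ cong (λ z → length (labellings n) * (2 * (K ^ q * z))) length-TR ⟨
      length (labellings n) * (2 * (K ^ q * length TR))               ≡⟨ alg₂ (length (labellings n)) (K ^ q) (length TR) ⟩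
      2 * K ^ q * (length (labellings n) * length TR)                 ∎)
      where
      open ≤-Reasoning
      F = λ π → ∑[ tr ∈ TR ] [ passes π tr ]ᵇ
      alg : ∀ a b → 2 * a * (50 * b) ≡ 100 * (a * b)
      alg = solve-∀
      alg₂ : ∀ l a t → l * (2 * (a * t)) ≡ 2 * a * (l * t)
      alg₂ = solve-∀

-- The structure of h⁻¹(1)

⊙-idem : ∀ (x : Point n) → x ⊙ x ≡ x
⊙-idem []          = refl
⊙-idem (true ∷ x)  = cong (true ∷_) (⊙-idem x)
⊙-idem (false ∷ x) = cong (false ∷_) (⊙-idem x)

⊙-∁ : ∀ (x : Point n) → x ⊙ ∁ x ≡ 𝟎
⊙-∁ []          = refl
⊙-∁ (true ∷ x)  = cong (false ∷_) (⊙-∁ x)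
⊙-∁ (false ∷ x) = cong (false ∷_) (⊙-∁ x)

infixl 6 _∪ᵖ_
_∪ᵖ_ : Point n → Point n → Point n
_∪ᵖ_ = zipWith _∨_

lookup-∪ᵖ : ∀ (x y : Point n) i → lookup (x ∪ᵖ y) i ≡ lookup x i ∨ lookup y i
lookup-∪ᵖ x y i = lookup-zipWith _∨_ i x y

single : ∀ (x : Point n) i → lookup x i ≡ true → x ⊙ 𝐞 i ≡ 𝐞 i
single (true ∷ x) zero    refl = cong (true ∷_) (⊙-𝟎ʳ x)
single (b ∷ x)    (suc i) eq   = cong₂ _∷_ (∧-zeroʳ b) (single x i eq)

≢𝟎⇒∃ : ∀ (x : Point n) → (x ≡ᵖ 𝟎) ≡ false → ∃ λ i → lookup x i ≡ true
≢𝟎⇒∃ (true ∷ x)  eq = zero , refl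
≢𝟎⇒∃ (false ∷ x) eq with ≢𝟎⇒∃ x eq
... | i , xi = suc i , xi

-- h⁻¹(1) is almost invariant under flips inside `free` and almost constant outside J ∪ free.
record Core {n : ℕ} (h : BoolFun n) (J : Point n) (D : ℕ) : Set where
  field
    free x₀     : Point n
    free∩J      : ∀ i → lookup free i ≡ true → lookup J i ≡ false
    err-free    : ∀ w → D * Error.err h (w ⊙ free) ≤ 4 * supportSize h
    base-agrees : D * (∑[ y ∈ support h ] [ not (agree (∁ (J ∪ᵖ free)) y x₀) ]ᵇ) ≤ 2 * supportSize h

-- `bound x y` dominates the error of every part of `x ⊕ y` outside `J` at once. It stays abstract
-- so that it can come from the variables of a DNF as well as from the cuts of the scan, with a
-- contribution of undetected variables added.
module Structure {n : ℕ} (h : BoolFun n) (0<u : 0 < supportSize h) (J : Point n)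
                 (bound : Point n → Point n → ℕ)
                 (err≤bound : ∀ x y B → Error.err h ((x ⊕ y) ⊙ (B ⊙ ∁ J)) ≤ bound x y)
                 (D : ℕ) (16≤D : 16 ≤ D)
                 (small : D * (∑[ x ∈ support h ] ∑[ y ∈ support h ] bound x y) ≤ supportSize h * (supportSize h * supportSize h)) where
  open Error h

  private
    M : ℕ
    M = ∑[ x ∈ U ] ∑[ y ∈ U ] bound x y
    instance
      u≢0 : NonZero u
      u≢0 = >-nonZero 0<u

    -- From M/u³ ≤ 1/D.
    rescale : ∀ c x → u * (u * x) ≤ c * M → D * x ≤ c * u
    rescale c x le = *-cancelˡ-≤ (u * u) {{m*n≢0 u u}} (begin
      u * u * (D * x)          ≡⟨ l1 u D x ⟩
      D * (u * (u * x))        ≤⟨ *-monoʳ-≤ D le ⟩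
      D * (c * M)              ≡⟨ l2 D c M ⟩
      c * (D * M)              ≤⟨ *-monoʳ-≤ c small ⟩
      c * (u * (u * u))        ≡⟨ l3 c u ⟩
      u * u * (c * u)          ∎)
      where
      open ≤-Reasoning
      l1 : ∀ u D x → u * u * (D * x) ≡ D * (u * (u * x))
      l1 = solve-∀
      l2 : ∀ D c M → D * (c * M) ≡ c * (D * M)
      l2 = solve-∀
      l3 : ∀ c u → c * (u * (u * u)) ≡ u * u * (c * u)
      l3 = solve-∀

  -- Translations outside J are either bad for more than half of h⁻¹(1) or good for almost all of it:
  -- w is the sum of the J-free parts of x ⊕ y and (x ⊕ w) ⊕ y.
  gap : ∀ w → w ⊙ ∁ J ≡ w → 2 * err w ≤ u → D * err w ≤ 4 * u
  gap w w⊆ 2e≤u = rescale 4 (err w) (begin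
    u * (u * err w)                      ≤⟨ *-monoˡ-≤ (u * err w) u≤2g ⟩
    2 * g * (u * err w)                  ≡⟨ l1 g u (err w) ⟩
    2 * (g * (u * err w))                ≤⟨ *-monoʳ-≤ 2 main ⟩
    2 * (M + M)                          ≡⟨ l2 M ⟩
    4 * M                                ∎)
    where
    open ≤-Reasoning
    l1 : ∀ g u e → 2 * g * (u * e) ≡ 2 * (g * (u * e))
    l1 = solve-∀
    l2 : ∀ m → 2 * (m + m) ≡ 4 * m
    l2 = solve-∀
    g = ∑[ x ∈ U ] [ h (x ⊕ w) ]ᵇ
    g+e : g + err w ≡ u
    g+e = [not]-∑ (λ x → h (x ⊕ w)) U
    u≤2g : u ≤ 2 * g
    u≤2g = +-cancelʳ-≤ (2 * err w) u (2 * g) (begin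
      u + 2 * err w        ≤⟨ +-monoʳ-≤ u 2e≤u ⟩
      u + u                ≡⟨ cong (u +_) (+-identityʳ u) ⟨
      2 * u                ≡⟨ cong (2 *_) g+e ⟨
      2 * (g + err w)      ≡⟨ *-distribˡ-+ 2 g (err w) ⟩
      2 * g + 2 * err w    ∎)
    full = ∁ J
    restricted : ∀ x y → err ((x ⊕ y) ⊙ ∁ J) ≤ bound x y
    restricted x y = ≤-trans (≤-reflexive (cong (λ B → err ((x ⊕ y) ⊙ B)) (sym (⊙-idem (∁ J))))) (err≤bound x y (∁ J))
    split : ∀ x y → w ≡ ((x ⊕ y) ⊙ ∁ J) ⊕ (((x ⊕ w) ⊕ y) ⊙ ∁ J)
    split x y = sym (trans (sym (⊙-distribʳ (x ⊕ y) ((x ⊕ w) ⊕ y) (∁ J))) (trans (cong (_⊙ ∁ J) lem) w⊆))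
      where
      lem : (x ⊕ y) ⊕ ((x ⊕ w) ⊕ y) ≡ w
      lem = trans (cong ((x ⊕ y) ⊕_) (trans (cong (_⊕ y) (⊕-comm x w)) (⊕-assoc w x y))) (trans (⊕-comm (x ⊕ y) _) (⊕-cancelʳ w (x ⊕ y)))
    point : ∀ x y → [ h (x ⊕ w) ]ᵇ * err w ≤ bound x y + [ h (x ⊕ w) ]ᵇ * bound (x ⊕ w) y
    point x y with h (x ⊕ w)
    ... | false = z≤n
    ... | true  = begin
      err w + 0                                                  ≡⟨ +-identityʳ _ ⟩
      err w                                                      ≡⟨ cong err (split x y) ⟩
      err (((x ⊕ y) ⊙ ∁ J) ⊕ (((x ⊕ w) ⊕ y) ⊙ ∁ J))              ≤⟨ err-⊕ _ _ ⟩
      err ((x ⊕ y) ⊙ ∁ J) + err (((x ⊕ w) ⊕ y) ⊙ ∁ J)            ≤⟨ +-mono-≤ (restricted x y) (restricted (x ⊕ w) y) ⟩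
      bound x y + bound (x ⊕ w) y                                ≡⟨ cong (bound x y +_) (+-identityʳ _) ⟨
      bound x y + (bound (x ⊕ w) y + 0)                          ∎
    main : g * (u * err w) ≤ M + M
    main = begin
      g * (u * err w)                                            ≡⟨ ∑-*ʳ (u * err w) _ U ⟨
      (∑[ x ∈ U ] [ h (x ⊕ w) ]ᵇ * (u * err w))                  ≡⟨ ∑-cong U (λ x → trans (sym (l3 u [ h (x ⊕ w) ]ᵇ (err w))) (sym (∑-const _ U))) ⟩
      (∑[ x ∈ U ] ∑[ y ∈ U ] [ h (x ⊕ w) ]ᵇ * err w)             ≤⟨ (∑-mono U λ x → ∑-mono U (point x)) ⟩
      (∑[ x ∈ U ] ∑[ y ∈ U ] (bound x y + [ h (x ⊕ w) ]ᵇ * bound (x ⊕ w) y))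
        ≡⟨ trans (∑-cong U (λ x → ∑-+ _ _ U)) (∑-+ _ _ U) ⟩
      M + (∑[ x ∈ U ] ∑[ y ∈ U ] [ h (x ⊕ w) ]ᵇ * bound (x ⊕ w) y)
        ≡⟨ cong (M +_) (∑-cong U (λ x → ∑-*ˡ [ h (x ⊕ w) ]ᵇ _ U)) ⟩
      M + (∑[ x ∈ U ] [ h (x ⊕ w) ]ᵇ * (∑[ y ∈ U ] bound (x ⊕ w) y)) ≤⟨ +-monoʳ-≤ M (∑U≤∑P _) ⟩
      M + (∑[ x ∈ P ] [ h (x ⊕ w) ]ᵇ * (∑[ y ∈ U ] bound (x ⊕ w) y))
        ≡⟨ cong (M +_) (trans (∑-shift w (λ x → [ h x ]ᵇ * (∑[ y ∈ U ] bound x y))) (sym (∑-support _))) ⟩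
      M + M ∎
      where
      l3 : ∀ u b e → u * (b * e) ≡ b * (u * e)
      l3 = solve-∀

  -- The threshold `u / 2` is that of `gap`: below it a coordinate is almost harmless, above it a
  -- flip expels a majority of `h⁻¹(1)`.
  free : Point n
  free = tabulate λ i → not (lookup J i) ∧ (2 * err (𝐞 i) ≤ᵇ u)

  private
    lookup-free : ∀ i → lookup free i ≡ not (lookup J i) ∧ (2 * err (𝐞 i) ≤ᵇ u)
    lookup-free = lookup∘tabulate _

  free∩J : ∀ i → lookup free i ≡ true → lookup J i ≡ false
  free∩J i eq with lookup J i | trans (sym (lookup-free i)) eq
  ... | false | _ = refl

  private
    record Harmless (w : Point n) : Set where
      constructor harmless
      field
        outside : w ⊙ ∁ J ≡ w
        low     : D * err w ≤ 4 * u

    -- Subadditivity gives the error `8 u / D`, which is at most `u / 2`, and the gap brings it back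
    -- to `4 u / D`. Hence errors do not accumulate, however many coordinates are combined.
    harmless-⊕ : ∀ {v w} → Harmless v → Harmless w → Harmless (v ⊕ w)
    harmless-⊕ {v} {w} (harmless v⊆ v≤) (harmless w⊆ w≤) = harmless vw⊆ (gap (v ⊕ w) vw⊆ (*-cancelˡ-≤ 8 (begin
      8 * (2 * err (v ⊕ w))      ≡⟨ l1 (err (v ⊕ w)) ⟩
      16 * err (v ⊕ w)           ≤⟨ *-monoˡ-≤ (err (v ⊕ w)) 16≤D ⟩
      D * err (v ⊕ w)            ≤⟨ *-monoʳ-≤ D (err-⊕ v w) ⟩
      D * (err v + err w)        ≡⟨ *-distribˡ-+ D (err v) (err w) ⟩
      D * err v + D * err w      ≤⟨ +-mono-≤ v≤ w≤ ⟩
      4 * u + 4 * u              ≡⟨ l2 u ⟩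
      8 * u                      ∎)))
      where
      open ≤-Reasoning
      vw⊆ = trans (⊙-distribʳ v w (∁ J)) (cong₂ _⊕_ v⊆ w⊆)
      l1 : ∀ x → 8 * (2 * x) ≡ 16 * x
      l1 = solve-∀
      l2 : ∀ x → 4 * x + 4 * x ≡ 8 * x
      l2 = solve-∀

    harmless-𝐞 : ∀ i → lookup free i ≡ true → Harmless (𝐞 i)
    harmless-𝐞 i eq = harmless e⊆ (gap (𝐞 i) e⊆ le)
      where
      e⊆ : 𝐞 i ⊙ ∁ J ≡ 𝐞 i
      e⊆ = trans (⊙-comm (𝐞 i) (∁ J)) (single (∁ J) i (trans (lookup-∁ J i) (cong not (free∩J i eq))))
      le : 2 * err (𝐞 i) ≤ u
      le with lookup J i | trans (sym (lookup-free i)) eq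
      ... | false | le = [≤ᵇ] _ _ le

  err-free : ∀ w → D * err (w ⊙ free) ≤ 4 * u
  err-free w = Harmless.low (closed-subcube Harmless (harmless (⊙-𝟎ˡ (∁ J)) (≤-trans (≤-reflexive (trans (cong (D *_) err-𝟎) (*-zeroʳ D))) z≤n)) harmless-⊕ free harmless-𝐞 w)

  fixed : Point n
  fixed = ∁ (J ∪ᵖ free)

  private
    -- At a coordinate outside `J` and `free` a flip expels more than half of `h⁻¹(1)`. If `x` and
    -- `y` differ there, this flip is a part of `x ⊕ y`, so `bound x y` exceeds `u / 2`.
    disagreement : ∀ x y → u * [ not (agree fixed y x) ]ᵇ ≤ 2 * bound x y
    disagreement x y with agree fixed y x in eq
    ... | true  = ≤-trans (≤-reflexive (*-zeroʳ u)) z≤n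
    ... | false with ≢𝟎⇒∃ ((y ⊕ x) ⊙ fixed) eq
    ...   | i , di = begin
      u * 1                                   ≡⟨ *-identityʳ u ⟩
      u                                       ≤⟨ <⇒≤ u< ⟩
      2 * err (𝐞 i)                           ≡⟨ cong (λ v → 2 * err v) e≡ ⟨
      2 * err ((x ⊕ y) ⊙ (𝐞 i ⊙ ∁ J))         ≤⟨ *-monoʳ-≤ 2 (err≤bound x y (𝐞 i)) ⟩
      2 * bound x y                           ∎
      where
      open ≤-Reasoning
      di′ : lookup (y ⊕ x) i ∧ lookup fixed i ≡ true
      di′ = trans (sym (lookup-⊙ (y ⊕ x) fixed i)) di
      xy : lookup (x ⊕ y) i ≡ true
      xy with lookup (y ⊕ x) i in e | di′
      ... | true | _ = trans (cong (λ v → lookup v i) (⊕-comm x y)) e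
      fx : not (lookup J i ∨ lookup free i) ≡ true
      fx with lookup (y ⊕ x) i | di′
      ... | true | f = trans (sym (trans (lookup-∁ (J ∪ᵖ free) i) (cong not (lookup-∪ᵖ J free i)))) f
      notJ : lookup J i ≡ false
      notJ with lookup J i | fx
      ... | false | _ = refl
      u< : u < 2 * err (𝐞 i)
      u< with 2 * err (𝐞 i) ≤? u
      ... | no nle = ≰⇒> nle
      ... | yes le with trans (sym fx) (trans (cong not (cong₂ _∨_ notJ (trans (lookup-free i) (cong₂ _∧_ (cong not notJ) (lem (≤⇒≤ᵇ le)))))) refl)
        where
        lem : ∀ {b} → Data.Bool.T b → b ≡ true
        lem {true} _ = refl
      ...   | ()
      e≡ : (x ⊕ y) ⊙ (𝐞 i ⊙ ∁ J) ≡ 𝐞 i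
      e≡ = trans (cong ((x ⊕ y) ⊙_) (trans (⊙-comm (𝐞 i) (∁ J)) (single (∁ J) i (trans (lookup-∁ J i) (cong not notJ))))) (single (x ⊕ y) i xy)

  base-point : ∃ λ x₀ → D * (∑[ y ∈ U ] [ not (agree fixed y x₀) ]ᵇ) ≤ 2 * u
  base-point with ∃-≤-average (λ x → ∑[ y ∈ U ] [ not (agree fixed y x) ]ᵇ) U⊆h 0<u
  ... | x₀ , _ , avg = x₀ , rescale 2 _ (begin
    u * (u * (∑[ y ∈ U ] [ not (agree fixed y x₀) ]ᵇ))                ≤⟨ *-monoʳ-≤ u avg ⟩
    u * (∑[ x ∈ U ] ∑[ y ∈ U ] [ not (agree fixed y x) ]ᵇ)            ≡⟨ trans (sym (∑-*ˡ u _ U)) (∑-cong U (λ x → sym (∑-*ˡ u _ U))) ⟩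
    (∑[ x ∈ U ] ∑[ y ∈ U ] u * [ not (agree fixed y x) ]ᵇ)            ≤⟨ (∑-mono U λ x → ∑-mono U (disagreement x)) ⟩
    (∑[ x ∈ U ] ∑[ y ∈ U ] 2 * bound x y)                             ≡⟨ trans (∑-cong U (λ x → ∑-*ˡ 2 _ U)) (∑-*ˡ 2 _ U) ⟩
    2 * M ∎)
    where open ≤-Reasoning

  core : Core h J D
  core = record { free = free ; x₀ = proj₁ base-point ; free∩J = free∩J ; err-free = err-free ; base-agrees = proj₂ base-point }

-- Verification of a hypothesis

idx-unidx : ∀ {k} (i : Fin (2 ^ k)) → idx (unidx {k} i) ≡ i
idx-unidx {zero}  zero = refl
idx-unidx {suc k} i with remQuot {2} (2 ^ k) i in eq
... | zero     , j = trans (cong (combine {2} {2 ^ k} zero) (idx-unidx {k} j)) (trans (cong (λ p → combine {2} {2 ^ k} (proj₁ p) (proj₂ p)) (sym eq)) (combine-remQuot {2} (2 ^ k) i))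
... | suc zero , j = trans (cong (combine {2} {2 ^ k} (suc zero)) (idx-unidx {k} j)) (trans (cong (λ p → combine {2} {2 ^ k} (proj₁ p) (proj₂ p)) (sym eq)) (combine-remQuot {2} (2 ^ k) i))

spread : Vec (Point k) n → Point (2 ^ k) → Point n
spread π τ = Vec.map (λ p → lookup τ (idx p)) π

lookup-spread : ∀ (π : Vec (Point k) n) τ i → lookup (spread π τ) i ≡ lookup τ (idx (lookup π i))
lookup-spread π τ i = lookup-map i _ π

disjoint-∁ : ∀ (x A : Point n) → x ⊙ A ≡ 𝟎 → x ⊙ ∁ A ≡ x
disjoint-∁ x A eq = trans (trans (sym (⊕-identityˡ _)) (cong (_⊕ (x ⊙ ∁ A)) (sym eq))) (∁-split x A)

⊙≡⇒lookup : ∀ {A x y : Point n} → A ⊙ x ≡ A ⊙ y → ∀ i → lookup A i ≡ true → lookup x i ≡ lookup y i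
⊙≡⇒lookup {A = A} {x} {y} eq i Ai = trans (sym (red x)) (trans (cong (λ v → lookup v i) eq) (red y))
  where
  red : ∀ z → lookup (A ⊙ z) i ≡ lookup z i
  red z = trans (lookup-⊙ A z i) (cong (_∧ lookup z i) Ai)

lookup⇒⊙≡ : ∀ (A x y : Point n) → (∀ i → lookup A i ≡ true → lookup x i ≡ lookup y i) → A ⊙ x ≡ A ⊙ y
lookup⇒⊙≡ A x y p = ext λ i → trans (lookup-⊙ A x i) (trans (lem i) (sym (lookup-⊙ A y i)))
  where
  lem : ∀ i → lookup A i ∧ lookup x i ≡ lookup A i ∧ lookup y i
  lem i with lookup A i in Ai
  ... | true  = p i Ai
  ... | false = refl

-- A map that moves each point outside J by an amount depending on its J-part only is a bijection.
∑-shear : ∀ (J : Point n) (v : Point n → Point n) →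
  (∀ y → v y ⊙ J ≡ 𝟎) → (∀ y x → x ⊙ J ≡ 𝟎 → v (y ⊕ x) ≡ v y) →
  ∀ f → (∑[ y ∈ allPoints n ] f (y ⊕ v y)) ≡ ∑ (allPoints n) f
∑-shear {n} J v v∩J v-inv f = *-cancelˡ-≡ _ _ (2 ^ n) {{m^n≢0 2 n}} (begin
  2 ^ n * (∑[ y ∈ P ] f (y ⊕ v y))                            ≡⟨ ∑-mix J (λ y → f (y ⊕ v y)) ⟨
  (∑[ x ∈ P ] ∑[ y ∈ P ] f (mix J x y ⊕ v (mix J x y)))       ≡⟨ ∑-cong P (λ x → ∑-cong P (λ y → cong f (lem x y))) ⟩
  (∑[ x ∈ P ] ∑[ y ∈ P ] f (mix J x (y ⊕ v x)))               ≡⟨ ∑-cong P (λ x → ∑-shift (v x) (λ y → f (mix J x y))) ⟩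
  (∑[ x ∈ P ] ∑[ y ∈ P ] f (mix J x y))                       ≡⟨ ∑-mix J f ⟩
  2 ^ n * ∑ P f                                               ∎)
  where
  open ≡-Reasoning
  P = allPoints n
  v-mix : ∀ x y → v (mix J x y) ≡ v x
  v-mix x y = trans (cong v m≡) (v-inv x _ (trans (⊙-assoc _ (∁ J) J) (trans (cong ((x ⊕ y) ⊙_) (trans (⊙-comm (∁ J) J) (⊙-∁ J))) (⊙-𝟎ʳ _))))
    where
    m≡ : mix J x y ≡ x ⊕ ((x ⊕ y) ⊙ ∁ J)
    m≡ = begin
      (x ⊙ J) ⊕ (y ⊙ ∁ J)                              ≡⟨ cong (_⊕ (y ⊙ ∁ J)) (sym (⊕-cancelʳ (x ⊙ J) (x ⊙ ∁ J))) ⟩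
      (((x ⊙ J) ⊕ (x ⊙ ∁ J)) ⊕ (x ⊙ ∁ J)) ⊕ (y ⊙ ∁ J)  ≡⟨ ⊕-assoc _ _ _ ⟩
      ((x ⊙ J) ⊕ (x ⊙ ∁ J)) ⊕ ((x ⊙ ∁ J) ⊕ (y ⊙ ∁ J))  ≡⟨ cong₂ _⊕_ (∁-split x J) (sym (⊙-distribʳ x y (∁ J))) ⟩
      x ⊕ ((x ⊕ y) ⊙ ∁ J)                              ∎
  lem : ∀ x y → mix J x y ⊕ v (mix J x y) ≡ mix J x (y ⊕ v x)
  lem x y = begin
    ((x ⊙ J) ⊕ (y ⊙ ∁ J)) ⊕ v (mix J x y)       ≡⟨ ⊕-assoc _ _ _ ⟩
    (x ⊙ J) ⊕ ((y ⊙ ∁ J) ⊕ v (mix J x y))       ≡⟨ cong (λ z → (x ⊙ J) ⊕ ((y ⊙ ∁ J) ⊕ z)) (trans (v-mix x y) (sym (disjoint-∁ (v x) J (v∩J x)))) ⟩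
    (x ⊙ J) ⊕ ((y ⊙ ∁ J) ⊕ (v x ⊙ ∁ J))         ≡⟨ cong ((x ⊙ J) ⊕_) (⊙-distribʳ y (v x) (∁ J)) ⟨
    mix J x (y ⊕ v x)                           ∎

-- What the tester reads off the samples: β c tells which of the variables J differ from c₀, by block,
-- obs is the set of blocks containing a variable of J, and J ⊕ junk meets each of these blocks in the flip
-- of its variable and of some irrelevant coordinates.
record Reading {n k : ℕ} (π : Vec (Point k) n) (c₀ J : Point n) : Set where
  field
    obs      : Point (2 ^ k)
    β        : Point n → Point (2 ^ k)
    β-J      : ∀ c s → lookup J s ≡ true → lookup (β c) (idx (lookup π s)) ≡ lookup (c ⊕ c₀) s
    obs-J    : ∀ s → lookup J s ≡ true → lookup obs (idx (lookup π s)) ≡ true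
    J-obs    : ∀ j → lookup obs (idx j) ≡ true → ∃ λ s → lookup J s ≡ true × lookup π s ≡ j
    junk     : Point n
    junk∩J   : junk ⊙ J ≡ 𝟎
    junk-obs : ∀ i → lookup junk i ≡ true → lookup obs (idx (lookup π i)) ≡ true

module Verification {n k : ℕ} (h : BoolFun n) (J : Point n) (D : ℕ) (core : Core h J D)
  (π : Vec (Point k) n) (c₀ : Point n) (reading : Reading π c₀ J)
  (g : Point (2 ^ k) → Bool) (g-obs : ∀ σ τ → Reading.obs reading ⊙ σ ≡ Reading.obs reading ⊙ τ → g σ ≡ g τ)
  where
  open Core core
  open Reading reading
  open Error h
  private
    K = 2 ^ k
    S = allPoints K
    fixed = ∁ (J ∪ᵖ free)

  -- Flips the blocks in which the reading of `f` differs from `σ`. Afterwards the variables of `J`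
  -- follow `σ` relative to `c₀`, at the price of the junk in the flipped blocks.
  probe : Point n → Point K → Point n
  probe f σ = f ⊕ (spread π (σ ⊕ β f) ⊙ (J ⊕ junk))

  G : Point n → Bool
  G x = g (β x)

  private
    -- The ideal effect of a probe, with no junk.
    set : Point K → Point n → Point n
    set σ w = w ⊕ (spread π (σ ⊕ β w) ⊙ J)

    obs-ext : ∀ σ τ → (∀ s → lookup J s ≡ true → lookup σ (idx (lookup π s)) ≡ lookup τ (idx (lookup π s))) → obs ⊙ σ ≡ obs ⊙ τ
    obs-ext σ τ p = lookup⇒⊙≡ obs σ τ λ i oi → go i oi
      where
      go : ∀ i → lookup obs i ≡ true → lookup σ i ≡ lookup τ i
      go i oi with J-obs (unidx i) (trans (cong (lookup obs) (idx-unidx {k} i)) oi)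
      ... | s , Js , πs = subst (λ i → lookup σ i ≡ lookup τ i) (trans (cong idx πs) (idx-unidx {k} i)) (p s Js)

    spread-on : ∀ (A : Point n) → (∀ i → lookup A i ≡ true → lookup obs (idx (lookup π i)) ≡ true) →
      ∀ σ τ → obs ⊙ σ ≡ obs ⊙ τ → spread π σ ⊙ A ≡ spread π τ ⊙ A
    spread-on A Ao σ τ eq = trans (⊙-comm _ A) (trans (lookup⇒⊙≡ A _ _ (λ i Ai →
      trans (lookup-spread π σ i) (trans (⊙≡⇒lookup eq _ (Ao i Ai)) (sym (lookup-spread π τ i))))) (⊙-comm A _))

    obs-⊕ʳ : ∀ σ {τ τ′} → obs ⊙ τ ≡ obs ⊙ τ′ → obs ⊙ (σ ⊕ τ) ≡ obs ⊙ (σ ⊕ τ′)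
    obs-⊕ʳ σ eq = trans (⊙-distribˡ obs σ _) (trans (cong ((obs ⊙ σ) ⊕_) eq) (sym (⊙-distribˡ obs σ _)))

    obs-⊕ˡ : ∀ {σ σ′} τ → obs ⊙ σ ≡ obs ⊙ σ′ → obs ⊙ (σ ⊕ τ) ≡ obs ⊙ (σ′ ⊕ τ)
    obs-⊕ˡ τ eq = trans (⊙-distribˡ obs _ τ) (trans (cong (_⊕ (obs ⊙ τ)) eq) (sym (⊙-distribˡ obs _ τ)))

    β-local : ∀ x y → (∀ s → lookup J s ≡ true → lookup x s ≡ lookup y s) → obs ⊙ β x ≡ obs ⊙ β y
    β-local x y p = obs-ext _ _ λ s Js → trans (β-J x s Js) (trans (trans (lookup-⊕ x c₀ s) (trans (cong (_xor lookup c₀ s) (p s Js)) (sym (lookup-⊕ y c₀ s)))) (sym (β-J y s Js)))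

    ⊙J≡𝟎⇒ : ∀ x → x ⊙ J ≡ 𝟎 → ∀ s → lookup J s ≡ true → lookup x s ≡ false
    ⊙J≡𝟎⇒ x eq s Js = trans (sym (trans (lookup-⊙ x J s) (trans (cong (lookup x s ∧_) Js) (∧-identityʳ _)))) (trans (cong (λ v → lookup v s) eq) (lookup-𝟎 s))

    β-shift : ∀ y x → x ⊙ J ≡ 𝟎 → obs ⊙ β (y ⊕ x) ≡ obs ⊙ β y
    β-shift y x eq = β-local _ _ λ s Js → trans (lookup-⊕ y x s) (trans (cong (lookup y s xor_) (⊙J≡𝟎⇒ x eq s Js)) (xor-identityʳ _))

    lookup-set-J : ∀ σ w s → lookup J s ≡ true → lookup (set σ w) s ≡ lookup σ (idx (lookup π s)) xor lookup c₀ s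
    lookup-set-J σ w s Js = begin
      lookup (set σ w) s                                                ≡⟨ lookup-⊕ w (spread π (σ ⊕ β w) ⊙ J) s ⟩
      lookup w s xor lookup (spread π (σ ⊕ β w) ⊙ J) s                  ≡⟨ cong (lookup w s xor_) (trans (lookup-⊙ (spread π (σ ⊕ β w)) J s) (trans (cong (lookup (spread π (σ ⊕ β w)) s ∧_) Js) (∧-identityʳ _))) ⟩
      lookup w s xor lookup (spread π (σ ⊕ β w)) s                      ≡⟨ cong (lookup w s xor_) (trans (lookup-spread π (σ ⊕ β w) s) (lookup-⊕ σ (β w) p)) ⟩
      lookup w s xor (lookup σ p xor lookup (β w) p)                    ≡⟨ cong (λ b → lookup w s xor (lookup σ p xor b)) (trans (β-J w s Js) (lookup-⊕ w c₀ s)) ⟩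
      lookup w s xor (lookup σ p xor (lookup w s xor lookup c₀ s))      ≡⟨ lem (lookup w s) (lookup σ p) (lookup c₀ s) ⟩
      lookup σ p xor lookup c₀ s                                        ∎
      where
      open ≡-Reasoning
      p = idx (lookup π s)
      lem : ∀ a b c → a xor (b xor (a xor c)) ≡ b xor c
      lem true  true  true  = refl
      lem true  true  false = refl
      lem true  false true  = refl
      lem true  false false = refl
      lem false b     c     = refl

    lookup-set-rest : ∀ σ w s → lookup J s ≡ false → lookup (set σ w) s ≡ lookup w s
    lookup-set-rest σ w s Js = trans (lookup-⊕ w (spread π (σ ⊕ β w) ⊙ J) s) (trans (cong (lookup w s xor_) (trans (lookup-⊙ (spread π (σ ⊕ β w)) J s) (trans (cong (lookup (spread π (σ ⊕ β w)) s ∧_) Js) (∧-zeroʳ _)))) (xor-identityʳ _))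

    β-set : ∀ σ w → obs ⊙ β (set σ w) ≡ obs ⊙ σ
    β-set σ w = obs-ext _ _ λ s Js → trans (β-J (set σ w) s Js) (trans (lookup-⊕ (set σ w) c₀ s)
      (trans (cong (_xor lookup c₀ s) (lookup-set-J σ w s Js)) (trans (xor-assoc (lookup σ (idx (lookup π s))) (lookup c₀ s) (lookup c₀ s)) (trans (cong (lookup σ (idx (lookup π s)) xor_) (xor-same (lookup c₀ s))) (xor-identityʳ _)))))

    -- Overwriting the J-coordinates by a uniform pattern keeps the uniform distribution.
    resample : ∀ (φ : Point n → ℕ) → (∑[ σ ∈ S ] ∑[ w ∈ P ] φ (set σ w)) ≡ 2 ^ K * ∑ P φ
    resample φ = begin
      (∑[ σ ∈ S ] ∑[ w ∈ P ] φ (set σ w))                   ≡⟨ ∑-swap _ S P ⟩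
      (∑[ w ∈ P ] ∑[ σ ∈ S ] φ (set σ w))                   ≡⟨ ∑-cong P (λ w → ∑-shift (β w) (λ σ → φ (set σ w))) ⟨
      (∑[ w ∈ P ] ∑[ σ ∈ S ] φ (set (σ ⊕ β w) w))           ≡⟨ ∑-cong P (λ w → ∑-cong S (λ σ → cong (λ z → φ (w ⊕ (spread π z ⊙ J))) (⊕-cancelʳ σ (β w)))) ⟩
      (∑[ w ∈ P ] ∑[ σ ∈ S ] φ (w ⊕ (spread π σ ⊙ J)))      ≡⟨ ∑-swap _ P S ⟩
      (∑[ σ ∈ S ] ∑[ w ∈ P ] φ (w ⊕ (spread π σ ⊙ J)))      ≡⟨ ∑-cong S (λ σ → ∑-shift (spread π σ ⊙ J) φ) ⟩
      (∑[ σ ∈ S ] ∑ P φ)                                    ≡⟨ trans (∑-const _ S) (cong (_* ∑ P φ) (length-allPoints K)) ⟩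
      2 ^ K * ∑ P φ                                         ∎
      where open ≡-Reasoning

    -- Projection to the subcube through `x₀` with directions `J` and `free`. By `base-agrees` it
    -- contains almost all of `h⁻¹(1)`.
    pr : Point n → Point n
    pr w = mix (J ∪ᵖ free) w x₀

    Sc = reset-scale (J ∪ᵖ free)

    lookup-pr : ∀ w i → lookup (pr w) i ≡ (if lookup J i ∨ lookup free i then lookup w i else lookup x₀ i)
    lookup-pr w i = trans (lookup-⊕ (w ⊙ F) (x₀ ⊙ ∁ F) i) (trans (cong₂ _xor_
      (trans (lookup-⊙ w F i) (cong (lookup w i ∧_) (lookup-∪ᵖ J free i)))
      (trans (lookup-⊙ x₀ (∁ F) i) (cong (lookup x₀ i ∧_) (trans (lookup-∁ F i) (cong not (lookup-∪ᵖ J free i)))))) (lem (lookup J i ∨ lookup free i) (lookup w i) (lookup x₀ i)))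
      where
      F = J ∪ᵖ free
      lem : ∀ c a b → (a ∧ c) xor (b ∧ not c) ≡ (if c then a else b)
      lem true  a b = trans (cong₂ _xor_ (∧-identityʳ a) (∧-zeroʳ b)) (xor-identityʳ a)
      lem false a b = trans (cong₂ _xor_ (∧-zeroʳ a) (∧-identityʳ b)) refl

    β-pr : ∀ w → obs ⊙ β (pr w) ≡ obs ⊙ β w
    β-pr w = β-local _ _ λ s Js → trans (lookup-pr w s) (cong (λ b → if b ∨ lookup free s then lookup w s else lookup x₀ s) Js)

  -- In the subcube through `x₀`, `total` counts the points accepted by the hypothesis and `bad`
  -- those of them outside `h⁻¹(1)`. `drift` bounds the number of points whose value changes under
  -- junk flips that are governed by the `J`-part.
  count total bad drift : ℕ
  count = ∑[ σ ∈ S ] [ g σ ]ᵇ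
  total = ∑[ y ∈ P ] [ agree fixed y x₀ ]ᵇ * [ G y ]ᵇ
  bad   = ∑[ y ∈ P ] [ agree fixed y x₀ ]ᵇ * ([ G y ]ᵇ * [ not (h y) ]ᵇ)
  drift = ∑[ j ∈ allPoints k ] 2 * err (junk ⊙ block π j)

  -- Planting a uniform pattern into a uniform point keeps it uniform. So the satisfying fraction of
  -- the patterns equals the accepted fraction of the subcube, and the same scaling applies to every
  -- hypothesis.
  count-total : count * 2 ^ n ≡ 2 ^ K * (Sc * total)
  count-total = begin
    count * 2 ^ n                             ≡⟨ ∑-*ʳ (2 ^ n) _ S ⟨
    (∑[ σ ∈ S ] [ g σ ]ᵇ * 2 ^ n)             ≡⟨ ∑-cong S (λ σ → trans (*-comm [ g σ ]ᵇ (2 ^ n)) (trans (cong (_* [ g σ ]ᵇ) (sym (length-allPoints n))) (sym (∑-const _ P)))) ⟩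
    (∑[ σ ∈ S ] ∑[ w ∈ P ] [ g σ ]ᵇ)          ≡⟨ ∑-cong S (λ σ → ∑-cong P (λ w → cong [_]ᵇ (g-obs σ _ (sym (β-set σ w))))) ⟩
    (∑[ σ ∈ S ] ∑[ w ∈ P ] [ G (set σ w) ]ᵇ)  ≡⟨ resample (λ w → [ G w ]ᵇ) ⟩
    2 ^ K * (∑[ w ∈ P ] [ G w ]ᵇ)             ≡⟨ cong (2 ^ K *_) (∑-cong P (λ w → cong [_]ᵇ (g-obs _ _ (sym (β-pr w))))) ⟩
    2 ^ K * (∑[ w ∈ P ] [ G (pr w) ]ᵇ)        ≡⟨ cong (2 ^ K *_) (∑-reset (J ∪ᵖ free) x₀ (λ y → [ G y ]ᵇ)) ⟩
    2 ^ K * (Sc * total)                      ∎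
    where open ≡-Reasoning

  private
    junk-shift : Point K → Point n
    junk-shift τ = spread π τ ⊙ junk

    -- The junk translation is undone one block at a time; each partial translation is a shear.
    path : ∀ (τ : Point n → Point K) → (∀ y x → x ⊙ J ≡ 𝟎 → τ (y ⊕ x) ≡ τ y) → ∀ L →
      (∑[ y ∈ P ] [ h (y ⊕ ⨁ L (λ j → scale (lookup (τ y) (idx j)) (junk ⊙ block π j))) xor h y ]ᵇ) ≤ (∑[ j ∈ L ] 2 * err (junk ⊙ block π j))
    path τ τ-inv []      = ≤-reflexive (trans (∑-cong P (λ y → cong [_]ᵇ (trans (cong (λ z → h z xor h y) (⊕-identityʳ y)) (xor-same (h y))))) (∑-zero P))
    path τ τ-inv (j ∷ L) = begin
      (∑[ y ∈ P ] [ h (y ⊕ (scale (t y) a ⊕ v y)) xor h y ]ᵇ)   ≤⟨ ∑-mono P step ⟩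
      (∑[ y ∈ P ] ([ h (y ⊕ v y) xor h ((y ⊕ v y) ⊕ a) ]ᵇ + [ h (y ⊕ v y) xor h y ]ᵇ)) ≡⟨ ∑-+ _ _ P ⟩
      (∑[ y ∈ P ] [ h (y ⊕ v y) xor h ((y ⊕ v y) ⊕ a) ]ᵇ) + (∑[ y ∈ P ] [ h (y ⊕ v y) xor h y ]ᵇ)
        ≡⟨ cong (_+ (∑[ y ∈ P ] [ h (y ⊕ v y) xor h y ]ᵇ)) (trans (∑-shear J v v∩J v-inv (λ y → [ h y xor h (y ⊕ a) ]ᵇ)) (changes a)) ⟩
      2 * err a + (∑[ y ∈ P ] [ h (y ⊕ v y) xor h y ]ᵇ)         ≤⟨ +-monoʳ-≤ (2 * err a) (path τ τ-inv L) ⟩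
      2 * err a + (∑[ j ∈ L ] 2 * err (junk ⊙ block π j))       ∎
      where
      open ≤-Reasoning
      a = junk ⊙ block π j
      t = λ y → lookup (τ y) (idx j)
      v = λ y → ⨁ L (λ j → scale (lookup (τ y) (idx j)) (junk ⊙ block π j))
      v-inv : ∀ y x → x ⊙ J ≡ 𝟎 → v (y ⊕ x) ≡ v y
      v-inv y x eq = cong (λ z → ⨁ L (λ j → scale (lookup z (idx j)) (junk ⊙ block π j))) (τ-inv y x eq)
      v∩J : ∀ y → v y ⊙ J ≡ 𝟎
      v∩J y = go L
        where
        part : ∀ j b → scale b (junk ⊙ block π j) ⊙ J ≡ 𝟎
        part j true  = trans (⊙-assoc junk _ J) (trans (cong (junk ⊙_) (⊙-comm _ J)) (trans (sym (⊙-assoc junk J _)) (trans (cong (_⊙ block π j) junk∩J) (⊙-𝟎ˡ _))))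
        part j false = ⊙-𝟎ˡ J
        go : ∀ M → ⨁ M (λ j → scale (lookup (τ y) (idx j)) (junk ⊙ block π j)) ⊙ J ≡ 𝟎
        go []      = ⊙-𝟎ˡ J
        go (j ∷ M) = trans (⊙-distribʳ _ _ J) (trans (cong₂ _⊕_ (part j (lookup (τ y) (idx j))) (go M)) (⊕-identityʳ 𝟎))
      lem : ∀ a b c → [ a xor b ]ᵇ ≤ [ c xor a ]ᵇ + [ c xor b ]ᵇ
      lem true  true  c     = z≤n
      lem false false c     = z≤n
      lem true  false true  = s≤s z≤n
      lem true  false false = s≤s z≤n
      lem false true  true  = s≤s z≤n
      lem false true  false = s≤s z≤n
      step : ∀ y → [ h (y ⊕ (scale (t y) a ⊕ v y)) xor h y ]ᵇ ≤ [ h (y ⊕ v y) xor h ((y ⊕ v y) ⊕ a) ]ᵇ + [ h (y ⊕ v y) xor h y ]ᵇ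
      step y with t y
      ... | true  = ≤-trans (≤-reflexive (cong (λ z → [ h z xor h y ]ᵇ) (trans (cong (y ⊕_) (⊕-comm a (v y))) (sym (⊕-assoc y (v y) a))))) (lem (h ((y ⊕ v y) ⊕ a)) (h y) (h (y ⊕ v y)))
      ... | false = ≤-trans (≤-reflexive (cong (λ z → [ h (y ⊕ z) xor h y ]ᵇ) (⊕-identityˡ (v y)))) (m≤n+m _ _)

    module _ (b : Point K) where
      displaced : Point n → Point n
      displaced w = junk-shift (β w ⊕ b)

      private
        τ : Point n → Point K
        -- The `J`-part determines `β` only on `obs`. The mask makes `τ` invariant under all
        -- translations outside `J`, as `path` demands.
        τ y = obs ⊙ (β y ⊕ b)
        displaced-blocks : ∀ y → ⨁ (allPoints k) (λ j → scale (lookup (τ y) (idx j)) (junk ⊙ block π j)) ≡ displaced y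
        displaced-blocks y = trans (⨁-blocks π junk (λ j → lookup (τ y) (idx j)))
          (spread-on junk junk-obs (τ y) (β y ⊕ b) (trans (sym (⊙-assoc obs obs _)) (cong (_⊙ (β y ⊕ b)) (⊙-idem obs))))

      displaced-pr : ∀ w → displaced w ≡ displaced (pr w)
      displaced-pr w = spread-on junk junk-obs _ _ (obs-⊕ˡ b (sym (β-pr w)))

      moved-changes : (∑[ w ∈ P ] [ h (pr w ⊕ displaced w) xor h (pr w) ]ᵇ) ≤ Sc * drift
      moved-changes = begin
        (∑[ w ∈ P ] [ h (pr w ⊕ displaced w) xor h (pr w) ]ᵇ)      ≡⟨ ∑-cong P (λ w → cong (λ d → [ h (pr w ⊕ d) xor h (pr w) ]ᵇ) (displaced-pr w)) ⟩
        (∑[ w ∈ P ] [ h (pr w ⊕ displaced (pr w)) xor h (pr w) ]ᵇ) ≡⟨ ∑-reset (J ∪ᵖ free) x₀ (λ y → [ h (y ⊕ displaced y) xor h y ]ᵇ) ⟩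
        Sc * (∑[ y ∈ P ] [ agree fixed y x₀ ]ᵇ * [ h (y ⊕ displaced y) xor h y ]ᵇ)
          ≤⟨ *-monoʳ-≤ Sc (∑-mono P (λ y → ≤-trans (*-monoˡ-≤ _ ([]≤1 (agree fixed y x₀))) (≤-reflexive (*-identityˡ _)))) ⟩
        Sc * (∑[ y ∈ P ] [ h (y ⊕ displaced y) xor h y ]ᵇ)         ≡⟨ cong (Sc *_) (∑-cong P (λ y → cong (λ d → [ h (y ⊕ d) xor h y ]ᵇ) (sym (displaced-blocks y)))) ⟩
        Sc * (∑[ y ∈ P ] [ h (y ⊕ ⨁ (allPoints k) (λ j → scale (lookup (τ y) (idx j)) (junk ⊙ block π j))) xor h y ]ᵇ)
          ≤⟨ *-monoʳ-≤ Sc (path τ (λ y x eq → obs-⊕ˡ b (β-shift y x eq)) (allPoints k)) ⟩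
        Sc * drift                                                 ∎
        where open ≤-Reasoning

      moved-bad : ℕ
      moved-bad = ∑[ w ∈ P ] [ G w ]ᵇ * [ not (h (pr w ⊕ displaced w)) ]ᵇ

      private
        bad-P : (∑[ w ∈ P ] [ G w ]ᵇ * [ not (h (pr w)) ]ᵇ) ≡ Sc * bad
        bad-P = trans (∑-cong P (λ w → cong (λ z → [ z ]ᵇ * [ not (h (pr w)) ]ᵇ) (g-obs _ _ (sym (β-pr w))))) (∑-reset (J ∪ᵖ free) x₀ (λ y → [ G y ]ᵇ * [ not (h y) ]ᵇ))

        tri : ∀ a b c → [ a ]ᵇ * [ not b ]ᵇ ≤ [ a ]ᵇ * [ not c ]ᵇ + [ b xor c ]ᵇ
        tri false b     c     = z≤n
        tri true  true  c     = z≤n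
        tri true  false true  = s≤s z≤n
        tri true  false false = s≤s z≤n

      moved-bad≤ : moved-bad ≤ Sc * (bad + drift)
      moved-bad≤ = begin
        moved-bad ≤⟨ ∑-mono P (λ w → tri (G w) (h (pr w ⊕ displaced w)) (h (pr w))) ⟩
        (∑[ w ∈ P ] ([ G w ]ᵇ * [ not (h (pr w)) ]ᵇ + [ h (pr w ⊕ displaced w) xor h (pr w) ]ᵇ)) ≡⟨ ∑-+ _ _ P ⟩
        (∑[ w ∈ P ] [ G w ]ᵇ * [ not (h (pr w)) ]ᵇ) + (∑[ w ∈ P ] [ h (pr w ⊕ displaced w) xor h (pr w) ]ᵇ) ≤⟨ +-mono-≤ (≤-reflexive bad-P) moved-changes ⟩
        Sc * bad + Sc * drift ≡⟨ *-distribˡ-+ Sc bad drift ⟨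
        Sc * (bad + drift) ∎
        where open ≤-Reasoning

      bad≤moved-bad : Sc * bad ≤ moved-bad + Sc * drift
      bad≤moved-bad = begin
        Sc * bad ≡⟨ bad-P ⟨
        (∑[ w ∈ P ] [ G w ]ᵇ * [ not (h (pr w)) ]ᵇ) ≤⟨ ∑-mono P (λ w → ≤-trans (tri (G w) (h (pr w)) (h (pr w ⊕ displaced w))) (+-monoʳ-≤ ([ G w ]ᵇ * [ not (h (pr w ⊕ displaced w)) ]ᵇ) (≤-reflexive (cong [_]ᵇ (xor-comm (h (pr w)) _))))) ⟩
        (∑[ w ∈ P ] ([ G w ]ᵇ * [ not (h (pr w ⊕ displaced w)) ]ᵇ + [ h (pr w ⊕ displaced w) xor h (pr w) ]ᵇ)) ≡⟨ ∑-+ _ _ P ⟩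
        moved-bad + (∑[ w ∈ P ] [ h (pr w ⊕ displaced w) xor h (pr w) ]ᵇ) ≤⟨ +-monoʳ-≤ moved-bad moved-changes ⟩
        moved-bad + Sc * drift ∎
        where open ≤-Reasoning

  rejections : ℕ
  rejections = ∑[ σ ∈ S ] [ g σ ]ᵇ * (∑[ f ∈ U ] [ not (h (probe f σ)) ]ᵇ)

  private
    -- Randomises a sample along `free`. By `err-free` this hardly changes the law of the sample,
    -- yet it spreads the probe over the whole subcube.
    nudge : Point n → Point n → Point n
    nudge w f = f ⊕ (w ⊙ free)

    ev : Point K → Point n → Bool
    ev σ f = not (h (probe f σ))

    spreadings : Point n → ℕ
    spreadings f = ∑[ σ ∈ S ] [ g σ ]ᵇ * (∑[ w ∈ P ] [ ev σ (nudge w f) ]ᵇ)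

    J⊕junk-obs : ∀ i → lookup (J ⊕ junk) i ≡ true → lookup obs (idx (lookup π i)) ≡ true
    J⊕junk-obs i eq with lookup J i in Ji | lookup junk i in ji | trans (sym (lookup-⊕ J junk i)) eq
    ... | true  | _    | _ = obs-J i Ji
    ... | false | true | _ = junk-obs i ji

    free⊙J : ∀ w → (w ⊙ free) ⊙ J ≡ 𝟎
    free⊙J w = ext λ i → trans (lookup-⊙ (w ⊙ free) J i) (trans (cong (_∧ lookup J i) (lookup-⊙ w free i)) (trans (lem i) (sym (lookup-𝟎 i))))
      where
      lem : ∀ i → (lookup w i ∧ lookup free i) ∧ lookup J i ≡ false
      lem i with lookup free i in fi
      ... | false = cong (_∧ lookup J i) (∧-zeroʳ (lookup w i))
      ... | true  = trans (cong ((lookup w i ∧ true) ∧_) (free∩J i fi)) (∧-zeroʳ _)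

    probe-nudge : ∀ σ w f → probe (nudge w f) σ ≡ (set σ f ⊕ (w ⊙ free)) ⊕ junk-shift (σ ⊕ β f)
    probe-nudge σ w f = begin
      nudge w f ⊕ (spread π (σ ⊕ β (nudge w f)) ⊙ (J ⊕ junk))     ≡⟨ cong (nudge w f ⊕_) (spread-on (J ⊕ junk) J⊕junk-obs _ _ (obs-⊕ʳ σ (β-shift f (w ⊙ free) (free⊙J w)))) ⟩
      nudge w f ⊕ (s ⊙ (J ⊕ junk))                                ≡⟨ cong (nudge w f ⊕_) (⊙-distribˡ s J junk) ⟩
      nudge w f ⊕ ((s ⊙ J) ⊕ (s ⊙ junk))                          ≡⟨ ⊕-assoc _ _ _ ⟨
      ((f ⊕ (w ⊙ free)) ⊕ (s ⊙ J)) ⊕ (s ⊙ junk)                   ≡⟨ cong (_⊕ (s ⊙ junk)) (trans (⊕-assoc f _ _) (trans (cong (f ⊕_) (⊕-comm _ _)) (sym (⊕-assoc f _ _)))) ⟩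
      (set σ f ⊕ (w ⊙ free)) ⊕ (s ⊙ junk)                         ∎
      where
      open ≡-Reasoning
      s = spread π (σ ⊕ β f)

    agree-lookup : ∀ f → agree fixed f x₀ ≡ true → ∀ i → lookup J i ∨ lookup free i ≡ false → lookup f i ≡ lookup x₀ i
    agree-lookup f ag i out = lem (lookup f i) (lookup x₀ i) (begin
      lookup f i xor lookup x₀ i                             ≡⟨ ∧-identityʳ _ ⟨
      (lookup f i xor lookup x₀ i) ∧ true                    ≡⟨ cong₂ _∧_ (lookup-⊕ f x₀ i) (trans (lookup-∁ (J ∪ᵖ free) i) (cong not (trans (lookup-∪ᵖ J free i) out))) ⟨
      lookup (f ⊕ x₀) i ∧ lookup fixed i                     ≡⟨ lookup-⊙ (f ⊕ x₀) fixed i ⟨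
      lookup ((f ⊕ x₀) ⊙ fixed) i                            ≡⟨ cong (λ v → lookup v i) (≡ᵖ⇒≡ ((f ⊕ x₀) ⊙ fixed) 𝟎 ag) ⟩
      lookup 𝟎 i                                             ≡⟨ lookup-𝟎 i ⟩
      false                                                  ∎)
      where
      open ≡-Reasoning
      lem : ∀ a b → a xor b ≡ false → a ≡ b
      lem true  true  _ = refl
      lem false false _ = refl

    nudged-set : ∀ σ w f → agree fixed f x₀ ≡ true → set σ f ⊕ ((w ⊕ set σ f) ⊙ free) ≡ pr (set σ w)
    nudged-set σ w f ag = ext λ i → trans (lookup-⊕ y _ i) (trans (cong (lookup y i xor_) (trans (lookup-⊙ (w ⊕ y) free i) (cong (_∧ lookup free i) (lookup-⊕ w y i)))) (trans (lem i) (sym (lookup-pr (set σ w) i))))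
      where
      y = set σ f
      cancel : ∀ a b → a xor ((b xor a) ∧ true) ≡ b
      cancel true  true  = refl
      cancel true  false = refl
      cancel false true  = refl
      cancel false false = refl
      lem : ∀ i → lookup y i xor ((lookup w i xor lookup y i) ∧ lookup free i) ≡ (if lookup J i ∨ lookup free i then lookup (set σ w) i else lookup x₀ i)
      lem i with lookup J i in Ji | lookup free i in fi
      ... | true  | true  with trans (sym Ji) (free∩J i fi)
      ...   | ()
      lem i | true  | false = trans (cong (lookup y i xor_) (∧-zeroʳ _)) (trans (xor-identityʳ _) (trans (lookup-set-J σ f i Ji) (sym (lookup-set-J σ w i Ji))))
      lem i | false | true  = trans (cancel (lookup y i) (lookup w i)) (sym (lookup-set-rest σ w i Ji))
      lem i | false | false = trans (cong (lookup y i xor_) (∧-zeroʳ _)) (trans (xor-identityʳ _) (trans (lookup-set-rest σ f i Ji) (agree-lookup f ag i (cong₂ _∨_ Ji fi))))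

    -- A sample that agrees with `x₀` outside `J` and `free`, given a uniform pattern on `J` and
    -- uniform values on `free`, becomes a uniform point of the subcube. Only the junk displaces it,
    -- by an amount that depends on the new `J`-part and on the fixed reading `β f`.
    spreadings-agree : ∀ f → agree fixed f x₀ ≡ true → spreadings f ≡ 2 ^ K * moved-bad (β f)
    spreadings-agree f ag = begin
      (∑[ σ ∈ S ] [ g σ ]ᵇ * (∑[ w ∈ P ] [ not (h (probe (nudge w f) σ)) ]ᵇ))
        ≡⟨ ∑-cong S (λ σ → cong ([ g σ ]ᵇ *_) (begin
          (∑[ w ∈ P ] [ not (h (probe (nudge w f) σ)) ]ᵇ)                            ≡⟨ ∑-cong P (λ w → cong (λ z → [ not (h z) ]ᵇ) (probe-nudge σ w f)) ⟩
          (∑[ w ∈ P ] [ not (h ((set σ f ⊕ (w ⊙ free)) ⊕ junk-shift (σ ⊕ β f))) ]ᵇ)  ≡⟨ ∑-shift (set σ f) (λ w → [ not (h ((set σ f ⊕ (w ⊙ free)) ⊕ junk-shift (σ ⊕ β f))) ]ᵇ) ⟨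
          (∑[ w ∈ P ] [ not (h ((set σ f ⊕ ((w ⊕ set σ f) ⊙ free)) ⊕ junk-shift (σ ⊕ β f))) ]ᵇ)
            ≡⟨ ∑-cong P (λ w → cong₂ (λ z d → [ not (h (z ⊕ d)) ]ᵇ) (nudged-set σ w f ag) (spread-on junk junk-obs _ _ (obs-⊕ˡ (β f) (sym (β-set σ w))))) ⟩
          (∑[ w ∈ P ] [ not (h (pr (set σ w) ⊕ displaced (β f) (set σ w))) ]ᵇ) ∎)) ⟩
      (∑[ σ ∈ S ] [ g σ ]ᵇ * (∑[ w ∈ P ] [ not (h (pr (set σ w) ⊕ displaced (β f) (set σ w))) ]ᵇ))
        ≡⟨ ∑-cong S (λ σ → trans (sym (∑-*ˡ [ g σ ]ᵇ _ P)) (∑-cong P (λ w → cong (λ b → [ b ]ᵇ * [ not (h (pr (set σ w) ⊕ displaced (β f) (set σ w))) ]ᵇ) (g-obs σ _ (sym (β-set σ w)))))) ⟩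
      (∑[ σ ∈ S ] ∑[ w ∈ P ] [ G (set σ w) ]ᵇ * [ not (h (pr (set σ w) ⊕ displaced (β f) (set σ w))) ]ᵇ)
        ≡⟨ resample (λ w → [ G w ]ᵇ * [ not (h (pr w ⊕ displaced (β f) w)) ]ᵇ) ⟩
      2 ^ K * moved-bad (β f) ∎
      where open ≡-Reasoning

    spreadings≤ : ∀ f → spreadings f ≤ count * 2 ^ n
    spreadings≤ f = ≤-trans (∑-mono S (λ σ → *-monoʳ-≤ [ g σ ]ᵇ (≤-trans (∑≤length _ P) (≤-reflexive (length-allPoints n))))) (≤-reflexive (∑-*ʳ (2 ^ n) _ S))

    ∑-spreadings : ∑ U spreadings ≡ (∑[ σ ∈ S ] [ g σ ]ᵇ * (∑[ w ∈ P ] ∑[ f ∈ U ] [ ev σ (nudge w f) ]ᵇ))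
    ∑-spreadings = trans (∑-swap _ U S) (∑-cong S (λ σ → trans (∑-*ˡ [ g σ ]ᵇ _ U) (cong ([ g σ ]ᵇ *_) (∑-swap _ U P))))

    still : (∑[ σ ∈ S ] [ g σ ]ᵇ * (∑[ w ∈ P ] ∑[ f ∈ U ] [ ev σ f ]ᵇ)) ≡ 2 ^ n * rejections
    still = trans (∑-cong S (λ σ → trans (cong ([ g σ ]ᵇ *_) (trans (∑-const _ P) (cong (_* ∑ U (λ f → [ ev σ f ]ᵇ)) (length-allPoints n)))) (lem [ g σ ]ᵇ (2 ^ n) _))) (∑-*ˡ (2 ^ n) _ S)
      where
      lem : ∀ a b c → a * (b * c) ≡ b * (a * c)
      lem = solve-∀

    compare : ∀ (X Y : Point K → Point n → ℕ) → (∀ σ w → D * X σ w ≤ D * Y σ w + 4 * u) →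
      D * (∑[ σ ∈ S ] [ g σ ]ᵇ * (∑[ w ∈ P ] X σ w)) ≤ D * (∑[ σ ∈ S ] [ g σ ]ᵇ * (∑[ w ∈ P ] Y σ w)) + count * 2 ^ n * (4 * u)
    compare X Y le = begin
      D * (∑[ σ ∈ S ] [ g σ ]ᵇ * ∑ P (X σ))                  ≡⟨ ∑-*ˡ D _ S ⟨
      (∑[ σ ∈ S ] D * ([ g σ ]ᵇ * ∑ P (X σ)))                ≤⟨ ∑-mono S per ⟩
      (∑[ σ ∈ S ] (D * ([ g σ ]ᵇ * ∑ P (Y σ)) + [ g σ ]ᵇ * (2 ^ n * (4 * u)))) ≡⟨ ∑-+ _ _ S ⟩
      (∑[ σ ∈ S ] D * ([ g σ ]ᵇ * ∑ P (Y σ))) + (∑[ σ ∈ S ] [ g σ ]ᵇ * (2 ^ n * (4 * u)))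
        ≡⟨ cong₂ _+_ (∑-*ˡ D _ S) (trans (∑-*ʳ (2 ^ n * (4 * u)) _ S) (sym (*-assoc count (2 ^ n) (4 * u)))) ⟩
      D * (∑[ σ ∈ S ] [ g σ ]ᵇ * ∑ P (Y σ)) + count * 2 ^ n * (4 * u) ∎
      where
      open ≤-Reasoning
      l1 : ∀ D b x → D * (b * x) ≡ b * (D * x)
      l1 = solve-∀
      per : ∀ σ → D * ([ g σ ]ᵇ * ∑ P (X σ)) ≤ D * ([ g σ ]ᵇ * ∑ P (Y σ)) + [ g σ ]ᵇ * (2 ^ n * (4 * u))
      per σ = begin
        D * ([ g σ ]ᵇ * ∑ P (X σ))                          ≡⟨ trans (l1 D [ g σ ]ᵇ _) (cong ([ g σ ]ᵇ *_) (sym (∑-*ˡ D _ P))) ⟩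
        [ g σ ]ᵇ * (∑[ w ∈ P ] D * X σ w)                   ≤⟨ *-monoʳ-≤ [ g σ ]ᵇ (∑-mono P (le σ)) ⟩
        [ g σ ]ᵇ * (∑[ w ∈ P ] (D * Y σ w + 4 * u))
          ≡⟨ cong ([ g σ ]ᵇ *_) (trans (∑-+ _ _ P) (cong₂ _+_ (∑-*ˡ D _ P) (trans (∑-const _ P) (cong (_* (4 * u)) (length-allPoints n))))) ⟩
        [ g σ ]ᵇ * (D * ∑ P (Y σ) + 2 ^ n * (4 * u))        ≡⟨ trans (*-distribˡ-+ [ g σ ]ᵇ _ _) (cong (_+ [ g σ ]ᵇ * (2 ^ n * (4 * u))) (sym (l1 D [ g σ ]ᵇ _))) ⟩
        D * ([ g σ ]ᵇ * ∑ P (Y σ)) + [ g σ ]ᵇ * (2 ^ n * (4 * u)) ∎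

    scaled-translate : ∀ (ev : Point n → Bool) w → D * (∑[ f ∈ U ] [ ev (nudge w f) ]ᵇ) ≤ D * (∑[ f ∈ U ] [ ev f ]ᵇ) + 4 * u
    scaled-translate ev w = ≤-trans (*-monoʳ-≤ D (translate-events ev (w ⊙ free))) (≤-trans (≤-reflexive (*-distribˡ-+ D _ _)) (+-monoʳ-≤ (D * _) (err-free w)))

    spread-to-still : D * ∑ U spreadings ≤ D * (2 ^ n * rejections) + count * 2 ^ n * (4 * u)
    spread-to-still = ≤-trans (≤-reflexive (cong (D *_) ∑-spreadings)) (≤-trans
      (compare (λ σ w → ∑[ f ∈ U ] [ ev σ (nudge w f) ]ᵇ) (λ σ w → ∑[ f ∈ U ] [ ev σ f ]ᵇ) (λ σ w → scaled-translate (ev σ) w))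
      (≤-reflexive (cong (λ z → D * z + count * 2 ^ n * (4 * u)) still)))

    still-to-spread : D * (2 ^ n * rejections) ≤ D * ∑ U spreadings + count * 2 ^ n * (4 * u)
    still-to-spread = ≤-trans (≤-reflexive (cong (D *_) (sym still))) (≤-trans
      (compare (λ σ w → ∑[ f ∈ U ] [ ev σ f ]ᵇ) (λ σ w → ∑[ f ∈ U ] [ ev σ (nudge w f) ]ᵇ)
        (λ σ w → ≤-trans (≤-reflexive (cong (D *_) (∑-cong U (λ f → cong (λ z → [ ev σ z ]ᵇ) (sym (⊕-cancelʳ f (w ⊙ free)))))))
                         (scaled-translate (λ f → ev σ (nudge w f)) w)))
      (≤-reflexive (cong (λ z → D * z + count * 2 ^ n * (4 * u)) (sym ∑-spreadings))))

    agreeing disagreeing : ℕ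
    agreeing    = ∑[ f ∈ U ] [ agree fixed f x₀ ]ᵇ
    disagreeing = ∑[ f ∈ U ] [ not (agree fixed f x₀) ]ᵇ

  -- In terms of rates: a probe fails about as often as an accepted point of the subcube is bad.
  -- Lost are the junk, the samples that disagree with `x₀`, and `4 / D` for removing the nudge.
  rejections-lower : D * agreeing * count * bad ≤ total * (D * rejections + count * (4 * u)) + D * agreeing * count * drift
  rejections-lower = *-cancelˡ-≤ (2 ^ n) {{m^n≢0 2 n}} (begin
    2 ^ n * (D * a * count * bad)                                   ≡⟨ l1 (2 ^ n) D a count bad ⟩
    D * (a * ((count * 2 ^ n) * bad))                               ≡⟨ cong (λ z → D * (a * (z * bad))) count-total ⟩
    D * (a * ((2 ^ K * (Sc * total)) * bad))                        ≡⟨ l2 D a (2 ^ K) Sc total bad ⟩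
    total * (D * (a * (2 ^ K * (Sc * bad))))                        ≤⟨ *-monoʳ-≤ total (*-monoʳ-≤ D per-sample) ⟩
    total * (D * (∑ U spreadings + a * (2 ^ K * (Sc * drift))))     ≡⟨ cong (total *_) (*-distribˡ-+ D _ _) ⟩
    total * (D * ∑ U spreadings + D * (a * (2 ^ K * (Sc * drift)))) ≤⟨ *-monoʳ-≤ total (+-monoˡ-≤ _ spread-to-still) ⟩
    total * (D * (2 ^ n * rejections) + count * 2 ^ n * (4 * u) + D * (a * (2 ^ K * (Sc * drift)))) ≡⟨ l3 total D (2 ^ n) rejections count u a (2 ^ K) Sc drift ⟩
    2 ^ n * (total * (D * rejections + count * (4 * u))) + D * a * drift * (2 ^ K * (Sc * total)) ≡⟨ cong (λ z → 2 ^ n * (total * (D * rejections + count * (4 * u))) + D * a * drift * z) count-total ⟨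
    2 ^ n * (total * (D * rejections + count * (4 * u))) + D * a * drift * (count * 2 ^ n) ≡⟨ l4 (2 ^ n) (total * (D * rejections + count * (4 * u))) D a drift count ⟩
    2 ^ n * (total * (D * rejections + count * (4 * u)) + D * a * count * drift) ∎)
    where
    open ≤-Reasoning
    a = agreeing
    l1 : ∀ p D a c b → p * (D * a * c * b) ≡ D * (a * ((c * p) * b))
    l1 = solve-∀
    l2 : ∀ D a k s t b → D * (a * ((k * (s * t)) * b)) ≡ t * (D * (a * (k * (s * b))))
    l2 = solve-∀
    l3 : ∀ t D p r c u a k s d → t * (D * (p * r) + c * p * (4 * u) + D * (a * (k * (s * d)))) ≡ p * (t * (D * r + c * (4 * u))) + D * a * d * (k * (s * t))
    l3 = solve-∀
    l4 : ∀ p x D a d c → p * x + D * a * d * (c * p) ≡ p * (x + D * a * c * d)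
    l4 = solve-∀
    pointwise : ∀ f → [ agree fixed f x₀ ]ᵇ * (2 ^ K * (Sc * bad)) ≤ spreadings f + [ agree fixed f x₀ ]ᵇ * (2 ^ K * (Sc * drift))
    pointwise f with agree fixed f x₀ in ag
    ... | false = z≤n
    ... | true  = begin
      2 ^ K * (Sc * bad) + 0                             ≡⟨ +-identityʳ _ ⟩
      2 ^ K * (Sc * bad)                                 ≤⟨ *-monoʳ-≤ (2 ^ K) (bad≤moved-bad (β f)) ⟩
      2 ^ K * (moved-bad (β f) + Sc * drift)             ≡⟨ *-distribˡ-+ (2 ^ K) _ _ ⟩
      2 ^ K * moved-bad (β f) + 2 ^ K * (Sc * drift)     ≡⟨ cong₂ _+_ (sym (spreadings-agree f ag)) (sym (+-identityʳ _)) ⟩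
      spreadings f + (2 ^ K * (Sc * drift) + 0)          ∎
    per-sample : a * (2 ^ K * (Sc * bad)) ≤ ∑ U spreadings + a * (2 ^ K * (Sc * drift))
    per-sample = ≤-trans (≤-reflexive (sym (∑-*ʳ _ _ U))) (≤-trans (∑-mono U pointwise) (≤-reflexive (trans (∑-+ _ _ U) (cong (∑ U spreadings +_) (∑-*ʳ _ _ U)))))

  -- The converse estimate. Samples that disagree with `x₀` may always fail, so their `2 / D` joins
  -- the `4 / D` of the nudge.
  rejections-upper : D * total * rejections ≤ D * u * count * (bad + drift) + total * count * (6 * u)
  rejections-upper = *-cancelˡ-≤ (2 ^ n) {{m^n≢0 2 n}} (begin
    2 ^ n * (D * total * rejections)                                          ≡⟨ l1 (2 ^ n) D total rejections ⟩
    total * (D * (2 ^ n * rejections))                                        ≤⟨ *-monoʳ-≤ total (≤-trans still-to-spread (+-monoˡ-≤ _ (*-monoʳ-≤ D per-sample))) ⟩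
    total * (D * (u * (2 ^ K * (Sc * (bad + drift))) + ā * X) + X * (4 * u))  ≡⟨ l2 total D u (2 ^ K) Sc (bad + drift) ā X ⟩
    D * u * (bad + drift) * (2 ^ K * (Sc * total)) + total * X * (D * ā + 4 * u)
      ≤⟨ +-mono-≤ (≤-reflexive (cong (D * u * (bad + drift) *_) (sym count-total))) (*-monoʳ-≤ (total * X) (+-monoˡ-≤ (4 * u) base-agrees)) ⟩
    D * u * (bad + drift) * X + total * X * (2 * u + 4 * u)                   ≡⟨ l3 D u (bad + drift) count (2 ^ n) total ⟩
    2 ^ n * (D * u * count * (bad + drift) + total * count * (6 * u))         ∎)
    where
    open ≤-Reasoning
    ā = disagreeing
    X = count * 2 ^ n
    l1 : ∀ p D t r → p * (D * t * r) ≡ t * (D * (p * r))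
    l1 = solve-∀
    l2 : ∀ t D u k s b a x → t * (D * (u * (k * (s * b)) + a * x) + x * (4 * u)) ≡ D * u * b * (k * (s * t)) + t * x * (D * a + 4 * u)
    l2 = solve-∀
    l3 : ∀ D u b c p t → D * u * b * (c * p) + t * (c * p) * (2 * u + 4 * u) ≡ p * (D * u * c * b + t * c * (6 * u))
    l3 = solve-∀
    pointwise : ∀ f → spreadings f ≤ 2 ^ K * (Sc * (bad + drift)) + [ not (agree fixed f x₀) ]ᵇ * X
    pointwise f with agree fixed f x₀ in ag
    ... | false = ≤-trans (spreadings≤ f) (≤-trans (≤-reflexive (sym (+-identityʳ X))) (m≤n+m (X + 0) (2 ^ K * (Sc * (bad + drift)))))
    ... | true  = ≤-trans (≤-reflexive (spreadings-agree f ag)) (≤-trans (*-monoʳ-≤ (2 ^ K) (moved-bad≤ (β f))) (m≤m+n _ _))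
    per-sample : ∑ U spreadings ≤ u * (2 ^ K * (Sc * (bad + drift))) + ā * X
    per-sample = ≤-trans (∑-mono U pointwise) (≤-reflexive (trans (∑-+ _ _ U) (cong₂ _+_ (∑-const _ U) (∑-*ʳ X _ U))))

-- The second phase of the test

Bool-≡ : ∀ {a b} → (a ≡ true → b ≡ true) → (b ≡ true → a ≡ true) → a ≡ b
Bool-≡ {true}  {b}     f g = sym (f refl)
Bool-≡ {false} {true}  f g = g refl
Bool-≡ {false} {false} f g = refl

≡𝟎⇒ : ∀ (x : Point n) → (x ≡ᵖ 𝟎) ≡ true → ∀ i → lookup x i ≡ false
≡𝟎⇒ x eq i = trans (cong (λ v → lookup v i) (≡ᵖ⇒≡ x 𝟎 eq)) (lookup-𝟎 i)

⇒≡𝟎 : ∀ (x : Point n) → (∀ i → lookup x i ≡ false) → (x ≡ᵖ 𝟎) ≡ true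
⇒≡𝟎 {n} x p = trans (cong (_≡ᵖ 𝟎) (ext {x = x} {𝟎} (λ i → trans (p i) (sym (lookup-𝟎 i))))) (≡ᵖ-refl (𝟎 {n}))

not-≡𝟎⇒ : ∀ (x : Point n) → not (x ≡ᵖ 𝟎) ≡ true → ∃ λ i → lookup x i ≡ true
not-≡𝟎⇒ x eq with x ≡ᵖ 𝟎 in e
... | false = ≢𝟎⇒∃ x e

⇒not-≡𝟎 : ∀ (x : Point n) i → lookup x i ≡ true → not (x ≡ᵖ 𝟎) ≡ true
⇒not-≡𝟎 x i xi with x ≡ᵖ 𝟎 in e
... | false = refl
... | true with trans (sym xi) (≡𝟎⇒ x e i)
...   | ()

any-⇒ : ∀ (p : A → Bool) {m} (v : Vec A m) → any p (toList v) ≡ true → ∃ λ i → p (lookup v i) ≡ true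
any-⇒ p (x ∷ v) eq with p x in px
... | true  = zero , px
... | false with any-⇒ p v eq
...   | i , q = suc i , q

any-cong : ∀ {p q : A → Bool} {L} → All (λ x → p x ≡ q x) L → any p L ≡ any q L
any-cong []       = refl
any-cong (e ∷ es) = cong₂ _∨_ e (any-cong es)

all-cong : ∀ {p q : A → Bool} {L} → All (λ x → p x ≡ q x) L → all p L ≡ all q L
all-cong []       = refl
all-cong (e ∷ es) = cong₂ _∧_ e (all-cong es)

bitsBy : (Point k → Bool) → Point (2 ^ k)
bitsBy f = Vec.map f (tabulate unidx)

lookup-bitsBy : ∀ (f : Point k → Bool) j → lookup (bitsBy f) (idx j) ≡ f j
lookup-bitsBy f j = trans (lookup-map (idx j) f (tabulate unidx)) (cong f (trans (lookup∘tabulate unidx (idx j)) (unidx-idx j)))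

bitsBy-cong : ∀ {f g : Point k → Bool} → (∀ j → f j ≡ g j) → bitsBy f ≡ bitsBy g
bitsBy-cong {f = f} {g} p = ext λ i → trans (lookup-map i f (tabulate unidx)) (trans (p _) (sym (lookup-map i g (tabulate unidx))))

union : ∀ {m} → Vec (Point n) m → Point n
union []       = 𝟎
union (x ∷ xs) = x ∪ᵖ union xs

union-⇒ : ∀ {m} (xs : Vec (Point n) m) i → lookup (union xs) i ≡ true → ∃ λ a → lookup (lookup xs a) i ≡ true
union-⇒ []       i eq with trans (sym eq) (lookup-𝟎 i)
... | ()
union-⇒ (x ∷ xs) i eq with lookup x i in xi | trans (sym (lookup-∪ᵖ x (union xs) i)) eq
... | true  | _ = zero , xi
... | false | e with union-⇒ xs i e
...   | a , xa = suc a , xa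

union-⇐ : ∀ {m} (xs : Vec (Point n) m) i a → lookup (lookup xs a) i ≡ true → lookup (union xs) i ≡ true
union-⇐ (x ∷ xs) i zero    eq = trans (lookup-∪ᵖ x (union xs) i) (cong (_∨ lookup (union xs) i) eq)
union-⇐ (x ∷ xs) i (suc a) eq = trans (lookup-∪ᵖ x (union xs) i) (trans (cong (lookup x i ∨_) (union-⇐ xs i a eq)) (∨-zeroʳ _))

-- A block takes its content from the first detection sample whose reading is set there. Blocks that
-- are never seen fall back to `c₀`, whose difference from `c₀` is zero.
content : ∀ {K m} → Point n → Vec (Point n) m → Vec (Point K) m → Fin K → Point n
content c₀ []       []       i = c₀
content c₀ (d ∷ ds) (b ∷ bs) i = if lookup b i then d else content c₀ ds bs i

data Content {K m} (c₀ : Point n) (ds : Vec (Point n) m) (bs : Vec (Point K) m) (i : Fin K) : Set where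
  seen   : ∀ a → lookup (lookup bs a) i ≡ true → content c₀ ds bs i ≡ lookup ds a → Content c₀ ds bs i
  unseen : lookup (union bs) i ≡ false → content c₀ ds bs i ≡ c₀ → Content c₀ ds bs i

content-spec : ∀ {K m} (c₀ : Point n) (ds : Vec (Point n) m) (bs : Vec (Point K) m) i → Content c₀ ds bs i
content-spec c₀ []       []       i = unseen (lookup-𝟎 i) refl
content-spec c₀ (d ∷ ds) (b ∷ bs) i with lookup b i in bi
... | true  = seen zero bi (cong (λ c → if c then d else content c₀ ds bs i) bi)
... | false with content-spec c₀ ds bs i
...   | seen a ba eq = seen (suc a) ba (trans (cong (λ c → if c then d else content c₀ ds bs i) bi) eq)
...   | unseen u eq  = unseen (trans (lookup-∪ᵖ b (union bs) i) (cong₂ _∨_ bi u)) (trans (cong (λ c → if c then d else content c₀ ds bs i) bi) eq)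

-- Flipping `carrier` on the block j flips (among the relevant variables) exactly the one of block j.
carrier : ∀ {m} → Vec (Point k) n → Point n → Vec (Point n) m → Vec (Point (2 ^ k)) m → Point n
carrier π c₀ ds bs = tabulate λ i → lookup (content c₀ ds bs (idx (lookup π i)) ⊕ c₀) i

-- Candidate hypotheses: r optional terms over the blocks, given by their positive and negative literals.
Code : ℕ → ℕ → Set
Code K r = Vec (Bool × Point K × Point K) r

codes : (K r : ℕ) → List (Code K r)
codes K r = vecs (cartesianProduct (true ∷ false ∷ []) (cartesianProduct (allPoints K) (allPoints K))) r

module _ {K : ℕ} (obs : Point K) where
  -- The mask `obs` makes the value depend only on blocks with an observed variable, where readings
  -- can be trusted.
  evalTerm : Bool × Point K × Point K → Point K → Bool
  evalTerm (p , A , B) σ = p ∧ ((((obs ⊙ A) ⊙ ∁ σ) ≡ᵖ 𝟎) ∧ (((obs ⊙ B) ⊙ σ) ≡ᵖ 𝟎))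

  eval : ∀ {r} → Code K r → Point K → Bool
  eval g σ = any (λ t → evalTerm t σ) (toList g)

  eval-obs : ∀ {r} (g : Code K r) σ τ → obs ⊙ σ ≡ obs ⊙ τ → eval g σ ≡ eval g τ
  eval-obs g σ τ eq = any-cong (All.universal (λ { (p , A , B) → cong (p ∧_) (cong₂ _∧_ (cong (_≡ᵖ 𝟎) (pos A)) (cong (_≡ᵖ 𝟎) (neg B))) }) (toList g))
    where
    neg : ∀ B → (obs ⊙ B) ⊙ σ ≡ (obs ⊙ B) ⊙ τ
    neg B = trans (flip σ) (trans (cong (_⊙ B) eq) (sym (flip τ)))
      where
      flip : ∀ ρ → (obs ⊙ B) ⊙ ρ ≡ (obs ⊙ ρ) ⊙ B
      flip ρ = trans (⊙-assoc obs B ρ) (trans (cong (obs ⊙_) (⊙-comm B ρ)) (sym (⊙-assoc obs ρ B)))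
    pos : ∀ A → (obs ⊙ A) ⊙ ∁ σ ≡ (obs ⊙ A) ⊙ ∁ τ
    pos A = trans (flip σ) (trans (cong (_⊙ A) (lookup⇒⊙≡ obs (∁ σ) (∁ τ) λ i oi → trans (lookup-∁ σ i) (trans (cong not (⊙≡⇒lookup eq i oi)) (sym (lookup-∁ τ i))))) (sym (flip τ)))
      where
      flip : ∀ ρ → (obs ⊙ A) ⊙ ∁ ρ ≡ (obs ⊙ ∁ ρ) ⊙ A
      flip ρ = trans (⊙-assoc obs A (∁ ρ)) (trans (cong (obs ⊙_) (⊙-comm A (∁ ρ))) (sym (⊙-assoc obs (∁ ρ) A)))

best : (A → Bool) → (A → ℕ) → List A → Maybe A
best p f []      = nothing
best p f (x ∷ L) with p x | best p f L
... | false | m       = m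
... | true  | nothing = just x
... | true  | just y  = if f x ≤ᵇ f y then just x else just y

record IsBest (p : A → Bool) (f : A → ℕ) (L : List A) (x : A) : Set where
  constructor is-best
  field
    member   : x ∈ L
    suitable : p x ≡ true
    minimal  : All (λ y → p y ≡ true → f x ≤ f y) L

best-just : ∀ (p : A → Bool) f L {x} → best p f L ≡ just x → IsBest p f L x
best-just p f (y ∷ L) eq with p y in py | best p f L in bL
... | false | m with best-just p f L (trans bL eq)
...   | is-best mem s min = is-best (there mem) s ((λ pt → ⊥-elim (case (trans (sym py) pt))) ∷ min)
  where
  case : false ≡ true → ⊥
  case ()
best-just p f (y ∷ L) refl | true | nothing = is-best (here refl) py ((λ _ → ≤-refl) ∷ none L bL)
  where
  none : ∀ M → best p f M ≡ nothing → All (λ z → p z ≡ true → f y ≤ f z) M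
  none []      _  = []
  none (z ∷ M) eq with p z in pz | best p f M in bM
  ... | false | nothing = (λ pt → ⊥-elim (case (trans (sym pz) pt))) ∷ none M bM
    where
    case : false ≡ true → ⊥
    case ()
  none (z ∷ M) eq | true | just w with f z ≤ᵇ f w
  none (z ∷ M) () | true | just w | true
  none (z ∷ M) () | true | just w | false
best-just p f (y ∷ L) eq | true | just z with f y ≤ᵇ f z in le
best-just p f (y ∷ L) refl | true | just z | true with best-just p f L bL
... | is-best mem s min = is-best (here refl) py ((λ _ → ≤-refl) ∷ All.map (λ m pt → ≤-trans ([≤ᵇ] (f y) (f z) le) (m pt)) min)
best-just p f (y ∷ L) refl | true | just z | false with best-just p f L bL
... | is-best mem s min = is-best (there mem) s ((λ _ → <⇒≤ (≰⇒> (λ yz → case (trans (sym le) (lem (≤⇒≤ᵇ yz)))))) ∷ min)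
  where
  case : false ≡ true → ⊥
  case ()
  lem : ∀ {b} → Data.Bool.T b → b ≡ true
  lem {true} _ = refl

best-nothing : ∀ (p : A → Bool) f L → best p f L ≡ nothing → All (λ y → p y ≡ false) L
best-nothing p f []      _  = []
best-nothing p f (z ∷ M) eq with p z in pz | best p f M in bM
... | false | nothing = pz ∷ best-nothing p f M bM
best-nothing p f (z ∷ M) eq | true | just w with f z ≤ᵇ f w
best-nothing p f (z ∷ M) () | true | just w | true
best-nothing p f (z ∷ M) () | true | just w | false

first : ∀ {m} → (A → Bool) → Vec A m → Maybe A
first p []       = nothing
first p (x ∷ xs) = if p x then just x else first p xs

-- Actual and ideal readings of a sample

module Tester {n : ℕ} (h : BoolFun n) (k r : ℕ) where
  open Error h

  K : ℕ
  K = 2 ^ k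

  -- The second phase, given the bits β c read off each sample c
  module Phase₂ (π : Vec (Point k) n) (obs : Point K) (flipper : Point n) (β : Point n → Point K) where
    consistent : ∀ {N} → Vec (Point n) N → Code K r → Bool
    consistent cs g = all (λ c → eval obs g (β c)) (toList cs)

    learn : ∀ {N} → Vec (Point n) N → Maybe (Code K r)
    learn cs = best (consistent cs) (λ g → ∑[ σ ∈ allPoints K ] [ eval obs g σ ]ᵇ) (codes K r)

    probe : Point n → Maybe (Point K) → Bool
    -- A probe without a satisfying draw passes. Soundness tolerates this, since a draw succeeds
    -- with probability at least 1/2.
    probe f nothing  = true
    probe f (just σ) = h (f ⊕ (spread π (σ ⊕ β f) ⊙ flipper))

    verdict : Code K r → Point n × Vec (Point K) (2 ^ K) → Bool
    verdict g (f , seeds) = probe f (first (eval obs g) seeds)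

    verify : ∀ {N₂} → Maybe (Code K r) → Vec (Point n × Vec (Point K) (2 ^ K)) N₂ → Bool
    verify nothing  fs = false
    verify (just g) fs = all (verdict g) (toList fs)

    outcome : ∀ {N N₂} → Vec (Point n) N → Vec (Point n × Vec (Point K) (2 ^ K)) N₂ → Bool
    outcome cs = verify (learn cs)

  sensitive-in : ∀ {W} → Point n → Vec (Point n) W → Point n
  sensitive-in J ws = tabulate λ s → lookup J s ∧ any (λ w → not (h (w ⊕ 𝐞 s))) (toList ws)

  lookup-sensitive-in : ∀ {W} J (ws : Vec (Point n) W) s → lookup (sensitive-in J ws) s ≡ lookup J s ∧ any (λ w → not (h (w ⊕ 𝐞 s))) (toList ws)
  lookup-sensitive-in J ws = lookup∘tabulate _

  module _ {W : ℕ} (π : Vec (Point k) n) (c₀ : Point n) (ws : Vec (Point n) W) where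
    actual : Point n → Point K
    actual c = bitsBy λ j → any (λ w → not (h (w ⊕ ((c ⊕ c₀) ⊙ block π j)))) (toList ws)

    module _ (J : Point n) where
      private
        sensitive : Point n
        sensitive = sensitive-in J ws
        lookup-sensitive : ∀ s → lookup sensitive s ≡ lookup J s ∧ any (λ w → not (h (w ⊕ 𝐞 s))) (toList ws)
        lookup-sensitive = lookup-sensitive-in J ws

      ideal : Point n → Point K
      ideal c = bitsBy λ j → not (((c ⊕ c₀) ⊙ (block π j ⊙ sensitive)) ≡ᵖ 𝟎)

      -- The flip outside `J` is tested at `w ⊕ a`, not at `w`: this is exactly the step by which
      -- the query of `actual` differs from one that moves the `J`-part alone.
      mismatch : Point n → Point k → Point n → Bool
      mismatch c j w = h (w ⊕ a) xor h ((w ⊕ a) ⊕ ((c ⊕ c₀) ⊙ (block π j ⊙ ∁ J)))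
        where a = (c ⊕ c₀) ⊙ (block π j ⊙ J)

      mismatches : Point n → ℕ
      mismatches c = ∑[ j ∈ allPoints k ] ∑[ w ∈ toList ws ] [ mismatch c j w ]ᵇ

      private
        xor≡0 : ∀ a b → [ a xor b ]ᵇ ≡ 0 → a ≡ b
        xor≡0 true  true  _ = refl
        xor≡0 false false _ = refl

      -- Without mismatches the witnesses react to the `J`-part of the block only. As `π` separates
      -- `J`, this part is zero or a single unit vector; zero expels no witness, and for a unit
      -- vector the test is the definition of sensitivity.
      actual≡ideal : separates J π ≡ true → All (λ w → h w ≡ true) (toList ws) → ∀ c → mismatches c ≡ 0 → actual c ≡ ideal c
      actual≡ideal sep hws c mm = bitsBy-cong bit
        where
        d = c ⊕ c₀
        module _ (j : Point k) where
          X = block π j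
          a = d ⊙ (X ⊙ J)
          matched : All (λ w → h (w ⊕ (d ⊙ X)) ≡ h (w ⊕ a)) (toList ws)
          matched = All.map (λ {w} eq → sym (trans (xor≡0 _ _ eq) (cong h (trans (⊕-assoc w a _) (cong (w ⊕_) (trans (sym (⊙-distribˡ d _ _)) (cong (d ⊙_) (∁-split X J)))))))) (∑≡0⇒All _ _ (∑-allPoints≡0 _ mm j))

          lookup-a : ∀ i → lookup a i ≡ lookup d i ∧ (lookup X i ∧ lookup J i)
          lookup-a i = trans (lookup-⊙ d _ i) (cong (lookup d i ∧_) (lookup-⊙ X J i))

          lookup-s : ∀ i → lookup (d ⊙ (X ⊙ sensitive)) i ≡ lookup d i ∧ (lookup X i ∧ lookup sensitive i)
          lookup-s i = trans (lookup-⊙ d _ i) (cong (lookup d i ∧_) (lookup-⊙ X sensitive i))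

          test : Bool
          test = any (λ w → not (h (w ⊕ (d ⊙ X)))) (toList ws)

          test≡ : test ≡ any (λ w → not (h (w ⊕ a))) (toList ws)
          test≡ = any-cong (All.map (cong not) matched)

          zero-case : (a ≡ᵖ 𝟎) ≡ true → test ≡ not ((d ⊙ (X ⊙ sensitive)) ≡ᵖ 𝟎)
          zero-case eq = trans test≡ (trans (trans (any-cong (All.map (λ {w} hw → cong not (trans (cong h (trans (cong (w ⊕_) (≡ᵖ⇒≡ a 𝟎 eq)) (⊕-identityʳ w))) hw)) hws)) (never (toList ws)))
            (cong not (sym (⇒≡𝟎 (d ⊙ (X ⊙ sensitive)) (λ i → trans (lookup-s i) (lem i))))))
            where
            never : ∀ L → any (λ (w : Point n) → false) L ≡ false
            never []      = refl
            never (w ∷ L) = never L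
            lem : ∀ i → lookup d i ∧ (lookup X i ∧ lookup sensitive i) ≡ false
            lem i with lookup d i | lookup X i | lookup J i in Ji | trans (sym (lookup-a i)) (≡𝟎⇒ a eq i)
            ... | false | _     | _     | _ = refl
            ... | true  | false | _     | _ = refl
            ... | true  | true  | false | _ = trans (lookup-sensitive i) (cong (_∧ _) Ji)

          nonzero-case : (a ≡ᵖ 𝟎) ≡ false → test ≡ not ((d ⊙ (X ⊙ sensitive)) ≡ᵖ 𝟎)
          nonzero-case eq with ≢𝟎⇒∃ a eq
          ... | s , as with ∧-true {lookup d s} (trans (sym (lookup-a s)) as)
          ...   | ds , XJ with ∧-true XJ
          ...     | Xs , Js = trans test≡ (trans (cong (λ v → any (λ w → not (h (w ⊕ v))) (toList ws)) a≡) (trans (sym sens) (Bool-≡ fwd bwd)))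
            where
            πs : lookup π s ≡ j
            πs = ≡ᵖ⇒≡ _ _ (trans (sym (lookup-block π j s)) Xs)
            unique : ∀ i → lookup X i ≡ true → lookup J i ≡ true → s ≡ i
            unique i Xi Ji = separates⇒injective J π sep s i Js Ji (trans πs (sym (≡ᵖ⇒≡ _ _ (trans (sym (lookup-block π j i)) Xi))))
            a≡ : a ≡ 𝐞 s
            a≡ = ext eq-at
              where
              eq-at : ∀ i → lookup a i ≡ lookup (𝐞 s) i
              eq-at i with s ≟ᶠ i
              ... | yes refl = trans as (sym (lookup-𝐞-same s))
              ... | no ne with lookup a i in ai
              ...   | false = sym (lookup-𝐞-diff ne)
              ...   | true with ∧-true {lookup d i} (trans (sym (lookup-a i)) ai)
              ...     | _ , XJi with ∧-true XJi
              ...       | Xi , Ji = ⊥-elim (ne (unique i Xi Ji))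
            sens : lookup sensitive s ≡ any (λ w → not (h (w ⊕ 𝐞 s))) (toList ws)
            sens = trans (lookup-sensitive s) (cong (_∧ _) Js)
            fwd : lookup sensitive s ≡ true → not ((d ⊙ (X ⊙ sensitive)) ≡ᵖ 𝟎) ≡ true
            fwd e = ⇒not-≡𝟎 (d ⊙ (X ⊙ sensitive)) s (trans (lookup-s s) (cong₂ _∧_ ds (cong₂ _∧_ Xs e)))
            bwd : not ((d ⊙ (X ⊙ sensitive)) ≡ᵖ 𝟎) ≡ true → lookup sensitive s ≡ true
            bwd e with not-≡𝟎⇒ (d ⊙ (X ⊙ sensitive)) e
            ... | i , vi with ∧-true {lookup d i} (trans (sym (lookup-s i)) vi)
            ...   | _ , XS with ∧-true XS
            ...     | Xi , Si = subst (λ i → lookup sensitive i ≡ true) (sym (unique i Xi (proj₁ (∧-true (trans (sym (lookup-sensitive i)) Si))))) Si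

        bit : ∀ j → any (λ w → not (h (w ⊕ (d ⊙ block π j)))) (toList ws) ≡ not ((d ⊙ (block π j ⊙ sensitive)) ≡ᵖ 𝟎)
        bit j with (d ⊙ (block π j ⊙ J)) ≡ᵖ 𝟎 in eq
        ... | true  = zero-case j eq
        ... | false = nonzero-case j eq

  module Detected {W Nd : ℕ} (J : Point n) (c₀ : Point n) (ds : Vec (Point n) Nd) (ws : Vec (Point n) W) where

    different : Point n
    different = union (Vec.map (_⊕ c₀) ds)

    private
      sens : Point n
      sens = sensitive-in J ws

    -- Two conditions make a variable usable: a witness notices its flip, so its bit can be read,
    -- and some detection sample differs from `c₀` in it, which supplies a block content that flips
    -- it.
    detected : Point n
    detected = sens ⊙ different

    module _ (π : Vec (Point k) n) (sep : separates J π ≡ true) where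
      private
        β : Point n → Point K
        β = ideal π c₀ ws J

      dbits : Vec (Point K) Nd
      dbits = Vec.map β ds

      obs : Point K
      obs = union dbits

      flipper : Point n
      flipper = carrier π c₀ ds dbits

      private
        lookup-detected : ∀ s → lookup detected s ≡ lookup (sens) s ∧ lookup different s
        lookup-detected = lookup-⊙ (sens) different

        lookup-v : ∀ c j s → lookup ((c ⊕ c₀) ⊙ (block π j ⊙ sens)) s ≡ lookup (c ⊕ c₀) s ∧ ((lookup π s ≡ᵖ j) ∧ lookup (sens) s)
        lookup-v c j s = trans (lookup-⊙ (c ⊕ c₀) _ s) (cong (lookup (c ⊕ c₀) s ∧_) (trans (lookup-⊙ (block π j) (sens) s) (cong (_∧ lookup (sens) s) (lookup-block π j s))))

        sens⇒J : ∀ s → lookup (sens) s ≡ true → lookup J s ≡ true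
        sens⇒J s eq = proj₁ (∧-true (trans (sym (lookup-sensitive-in J ws s)) eq))

        bit-⇒ : ∀ c j → lookup (β c) (idx j) ≡ true → ∃ λ s → lookup (sens) s ≡ true × lookup π s ≡ j × lookup (c ⊕ c₀) s ≡ true
        bit-⇒ c j eq with not-≡𝟎⇒ ((c ⊕ c₀) ⊙ (block π j ⊙ sens)) (trans (sym (lookup-bitsBy (λ j → not (((c ⊕ c₀) ⊙ (block π j ⊙ sens)) ≡ᵖ 𝟎)) j)) eq)
        ... | s , vs with ∧-true {lookup (c ⊕ c₀) s} (trans (sym (lookup-v c j s)) vs)
        ...   | cs , rest with ∧-true {lookup π s ≡ᵖ j} rest
        ...     | πs , ss = s , ss , ≡ᵖ⇒≡ _ _ πs , cs

        bit-⇐ : ∀ c s → lookup (sens) s ≡ true → lookup (c ⊕ c₀) s ≡ true → lookup (β c) (idx {k} (lookup π s)) ≡ true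
        bit-⇐ c s ss cs = trans (lookup-bitsBy (λ j → not (((c ⊕ c₀) ⊙ (block π j ⊙ sens)) ≡ᵖ 𝟎)) (lookup π s))
          (⇒not-≡𝟎 ((c ⊕ c₀) ⊙ (block π (lookup π s) ⊙ sens)) s (trans (lookup-v c (lookup π s) s) (cong₂ _∧_ cs (cong₂ _∧_ (≡ᵖ-refl (lookup π s)) ss))))

      detected⇒J : ∀ s → lookup detected s ≡ true → lookup J s ≡ true
      detected⇒J s eq = sens⇒J s (proj₁ (∧-true (trans (sym (lookup-detected s)) eq)))

      β-J : ∀ c s → lookup detected s ≡ true → lookup (β c) (idx {k} (lookup π s)) ≡ lookup (c ⊕ c₀) s
      β-J c s det = Bool-≡ fwd (bit-⇐ c s ss)
        where
        ss : lookup (sens) s ≡ true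
        ss = proj₁ (∧-true (trans (sym (lookup-detected s)) det))
        fwd : lookup (β c) (idx {k} (lookup π s)) ≡ true → lookup (c ⊕ c₀) s ≡ true
        fwd e =
          let i , si , πi , ci = bit-⇒ c (lookup π s) e
          in subst (λ i → lookup (c ⊕ c₀) i ≡ true) (separates⇒injective J π sep i s (sens⇒J i si) (sens⇒J s ss) πi) ci

      obs-J : ∀ s → lookup detected s ≡ true → lookup obs (idx {k} (lookup π s)) ≡ true
      obs-J s det =
        let ss , di = ∧-true {lookup (sens) s} (trans (sym (lookup-detected s)) det)
            a , da  = union-⇒ (Vec.map (_⊕ c₀) ds) s di
        in union-⇐ dbits (idx (lookup π s)) a
        (trans (cong (λ b → lookup b (idx {k} (lookup π s))) (lookup-map a β ds)) (bit-⇐ (lookup ds a) s ss (trans (cong (λ v → lookup v s) (sym (lookup-map a (_⊕ c₀) ds))) da)))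

      private
        seen-bit : ∀ a j → lookup (lookup dbits a) (idx j) ≡ true → ∃ λ s → lookup detected s ≡ true × lookup π s ≡ j × lookup (lookup ds a ⊕ c₀) s ≡ true
        seen-bit a j ba =
          let s , ss , πs , das = bit-⇒ (lookup ds a) j (trans (cong (λ b → lookup b (idx {k} j)) (sym (lookup-map a β ds))) ba)
          in s , trans (lookup-detected s) (cong₂ _∧_ ss (union-⇐ (Vec.map (_⊕ c₀) ds) s a (trans (cong (λ v → lookup v s) (lookup-map a (_⊕ c₀) ds)) das))) , πs , das

      J-obs : ∀ j → lookup obs (idx j) ≡ true → ∃ λ s → lookup detected s ≡ true × lookup π s ≡ j
      J-obs j oj =
        let a , ba = union-⇒ dbits (idx j) oj
            s , det , πs , _ = seen-bit a j ba
        in s , det , πs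

      private
        chosen : Point k → Point n
        chosen j = content c₀ ds dbits (idx j)

        lookup-flipper : ∀ i → lookup flipper i ≡ lookup (chosen (lookup π i) ⊕ c₀) i
        lookup-flipper = lookup∘tabulate (λ i → lookup (content c₀ ds dbits (idx (lookup π i)) ⊕ c₀) i)

        seen-obs : ∀ a (j : Point k) → lookup (lookup dbits a) (idx j) ≡ true → lookup obs (idx j) ≡ true
        seen-obs a j ba = union-⇐ dbits (idx j) a ba

        self-false : ∀ i → lookup (c₀ ⊕ c₀) i ≡ false
        self-false i = trans (cong (λ v → lookup v i) (⊕-self c₀)) (lookup-𝟎 i)

        -- A block with a set reading contains a detected variable, which by separation is its only
        -- element of `J`, and the chosen sample differs from `c₀` in it. In a block without one the
        -- content is `c₀`, which flips nothing.
        flipper∩J : ∀ s → lookup J s ≡ true → lookup flipper s ≡ lookup detected s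
        flipper∩J s Js = trans (lookup-flipper s) (go (content-spec c₀ ds dbits (idx (lookup π s))))
          where
          go : Content c₀ ds dbits (idx (lookup π s)) → lookup (chosen (lookup π s) ⊕ c₀) s ≡ lookup detected s
          go (seen a ba eq) =
            let i , det , πi , dai = seen-bit a (lookup π s) ba
            in trans (cong (λ v → lookup (v ⊕ c₀) s) eq)
                (subst (λ s → lookup (lookup ds a ⊕ c₀) s ≡ lookup detected s) (separates⇒injective J π sep i s (detected⇒J i det) Js πi) (trans dai (sym det)))
          go (unseen uo eq) = trans (cong (λ v → lookup (v ⊕ c₀) s) eq) (trans (self-false s) (sym lem))
            where
            lem : lookup detected s ≡ false
            lem with lookup detected s in det
            ... | false = refl
            ... | true with trans (sym uo) (obs-J s det)
            ...   | ()

      junk : Point n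
      junk = flipper ⊙ ∁ J

      flipper≡ : flipper ≡ detected ⊕ junk
      flipper≡ = trans (sym (∁-split flipper J)) (cong (_⊕ junk) (ext λ s → trans (lookup-⊙ flipper J s) (lem s)))
        where
        lem : ∀ s → lookup flipper s ∧ lookup J s ≡ lookup detected s
        lem s with lookup J s in Js
        ... | true = trans (∧-identityʳ _) (flipper∩J s Js)
        ... | false with lookup detected s in det
        ...   | false = ∧-zeroʳ _
        ...   | true with trans (sym Js) (detected⇒J s det)
        ...     | ()

      lookup-junk : ∀ i → lookup junk i ≡ lookup flipper i ∧ not (lookup J i)
      lookup-junk i = trans (lookup-⊙ flipper (∁ J) i) (cong (lookup flipper i ∧_) (lookup-∁ J i))

      junk∩J : junk ⊙ detected ≡ 𝟎
      junk∩J = ext λ s → trans (lookup-⊙ junk detected s) (trans (lem s) (sym (lookup-𝟎 s)))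
        where
        lem : ∀ s → lookup junk s ∧ lookup detected s ≡ false
        lem s with lookup detected s in det
        ... | false = ∧-zeroʳ _
        ... | true  = cong (_∧ true) (trans (lookup-junk s) (trans (cong (λ b → lookup flipper s ∧ not b) (detected⇒J s det)) (∧-zeroʳ _)))

      junk-obs : ∀ i → lookup junk i ≡ true → lookup obs (idx (lookup π i)) ≡ true
      junk-obs i ji with content-spec c₀ ds dbits (idx (lookup π i))
      ... | seen a ba eq = seen-obs a (lookup π i) ba
      ... | unseen uo eq with trans (sym (proj₁ (∧-true (trans (sym (lookup-junk i)) ji)))) (trans (lookup-flipper i) (trans (cong (λ v → lookup (v ⊕ c₀) i) eq) (self-false i)))
      ...   | ()

      -- On a block, the junk of the flipper is that of a single detection sample.
      err-junk : ∀ (bound : Point n → Point n → ℕ) → (∀ x y B → err ((x ⊕ y) ⊙ (B ⊙ ∁ J)) ≤ bound x y) →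
        ∀ j → err (junk ⊙ block π j) ≤ (∑[ d ∈ toList ds ] bound d c₀)
      err-junk bound err≤ j = go (content-spec c₀ ds dbits (idx j))
        where
        at-block : ∀ v → chosen j ≡ v → junk ⊙ block π j ≡ (v ⊕ c₀) ⊙ (block π j ⊙ ∁ J)
        at-block v eq = ext λ i → trans (lookup-⊙ junk (block π j) i) (trans (cong₂ _∧_ (lookup-junk i) (lookup-block π j i)) (trans (lem i)
          (sym (trans (lookup-⊙ (v ⊕ c₀) _ i) (cong (lookup (v ⊕ c₀) i ∧_) (trans (lookup-⊙ (block π j) (∁ J) i) (cong₂ _∧_ (lookup-block π j i) (lookup-∁ J i))))))))
          where
          lem : ∀ i → (lookup flipper i ∧ not (lookup J i)) ∧ (lookup π i ≡ᵖ j) ≡ lookup (v ⊕ c₀) i ∧ ((lookup π i ≡ᵖ j) ∧ not (lookup J i))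
          lem i with lookup π i ≡ᵖ j in πi
          ... | false = trans (∧-zeroʳ _) (sym (∧-zeroʳ _))
          ... | true  = trans (∧-identityʳ _) (cong (_∧ not (lookup J i)) (trans (lookup-flipper i) (cong (λ z → lookup (z ⊕ c₀) i) (trans (cong chosen (≡ᵖ⇒≡ (lookup π i) j πi)) eq))))
        member : ∀ {m} (v : Vec (Point n) m) a → bound (lookup v a) c₀ ≤ (∑[ d ∈ toList v ] bound d c₀)
        member (d ∷ v) zero    = m≤m+n _ _
        member (d ∷ v) (suc a) = ≤-trans (member v a) (m≤n+m _ (bound d c₀))
        go : Content c₀ ds dbits (idx j) → err (junk ⊙ block π j) ≤ (∑[ d ∈ toList ds ] bound d c₀)
        go (seen a ba eq) = ≤-trans (≤-reflexive (cong err (at-block _ eq))) (≤-trans (err≤ (lookup ds a) c₀ (block π j)) (member ds a))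
        go (unseen uo eq) = ≤-trans (≤-reflexive (trans (cong err (trans (at-block _ eq) (trans (cong (_⊙ (block π j ⊙ ∁ J)) (⊕-self c₀)) (⊙-𝟎ˡ _)))) err-𝟎)) z≤n

      reading : Reading π c₀ detected
      reading = record { obs = obs ; β = β ; β-J = β-J ; obs-J = obs-J ; J-obs = J-obs ; junk = junk ; junk∩J = junk∩J ; junk-obs = junk-obs }

-- Factored DNFs

⁅⁆≡𝐞 : ∀ (i : Fin n) → ⁅ i ⁆ ≡ 𝐞 i
⁅⁆≡𝐞 zero    = refl
⁅⁆≡𝐞 (suc i) = cong (false ∷_) (⁅⁆≡𝐞 i)

∣∣≡size : ∀ (p : Point n) → ∣ p ∣ ≡ size p
∣∣≡size []          = refl
∣∣≡size (true ∷ p)  = cong suc (∣∣≡size p)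
∣∣≡size (false ∷ p) = ∣∣≡size p

size-mono : ∀ (p q : Point n) → (∀ i → lookup p i ≡ true → lookup q i ≡ true) → size p ≤ size q
size-mono []          []      pq = z≤n
size-mono (true ∷ p)  (b ∷ q) pq with pq zero refl
... | refl = s≤s (size-mono p q (pq ∘ suc))
size-mono (false ∷ p) (b ∷ q) pq = ≤-trans (size-mono p q (pq ∘ suc)) (m≤n+m _ [ b ]ᵇ)

evalLit-ext : ∀ (ℓ : Literal n) x y → lookup x (proj₁ ℓ) ≡ lookup y (proj₁ ℓ) → evalLit ℓ x ≡ evalLit ℓ y
evalLit-ext (i , true)  x y eq = eq
evalLit-ext (i , false) x y eq = cong not eq

evalLit≡ : ∀ (i : Fin n) b x → evalLit (i , b) x ≡ not (lookup x i xor b)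
evalLit≡ i true  x = lem (lookup x i)
  where
  lem : ∀ a → a ≡ not (a xor true)
  lem true  = refl
  lem false = refl
evalLit≡ i false x = cong not (sym (xor-identityʳ _))

private
  head-var : ∀ (ℓ : Literal n) C → lookup (varsConj (ℓ ∷ C)) (proj₁ ℓ) ≡ true
  head-var (i , b) C = trans (lookup-∪ᵖ ⁅ i ⁆ (varsConj C) i) (cong (_∨ lookup (varsConj C) i) (trans (cong (λ v → lookup v i) (⁅⁆≡𝐞 i)) (lookup-𝐞-same i)))

  tail-var : ∀ (ℓ : Literal n) C i → lookup (varsConj C) i ≡ true → lookup (varsConj (ℓ ∷ C)) i ≡ true
  tail-var (j , b) C i eq = trans (lookup-∪ᵖ ⁅ j ⁆ (varsConj C) i) (trans (cong (lookup ⁅ j ⁆ i ∨_) eq) (∨-zeroʳ _))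

evalConj-ext : ∀ (C : Conj n) x y → (∀ i → lookup (varsConj C) i ≡ true → lookup x i ≡ lookup y i) → evalConj C x ≡ evalConj C y
evalConj-ext []      x y p = refl
evalConj-ext (ℓ ∷ C) x y p = cong₂ _∧_ (evalLit-ext ℓ x y (p _ (head-var ℓ C))) (evalConj-ext C x y (λ i v → p i (tail-var ℓ C i v)))

evalDNF-ext : ∀ (Ts : List (Conj n)) x y → (∀ i → lookup (varsDNF Ts) i ≡ true → lookup x i ≡ lookup y i) → evalDNF Ts x ≡ evalDNF Ts y
evalDNF-ext []       x y p = refl
evalDNF-ext (C ∷ Ts) x y p = cong₂ _∨_
  (evalConj-ext C x y (λ i v → p i (trans (lookup-∪ᵖ (varsConj C) (varsDNF Ts) i) (cong (_∨ lookup (varsDNF Ts) i) v))))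
  (evalDNF-ext Ts x y (λ i v → p i (trans (lookup-∪ᵖ (varsConj C) (varsDNF Ts) i) (trans (cong (lookup (varsConj C) i ∨_) v) (∨-zeroʳ _)))))

satisfied⇒agree : ∀ (C : Conj n) x y → evalConj C x ≡ true → evalConj C y ≡ true → ∀ i → lookup (varsConj C) i ≡ true → lookup x i ≡ lookup y i
satisfied⇒agree []            x y cx cy i v with trans (sym v) (lookup-𝟎 i)
... | ()
satisfied⇒agree ((j , b) ∷ C) x y cx cy i v with ∧-true {evalLit (j , b) x} cx | ∧-true {evalLit (j , b) y} cy
... | lx , Cx | ly , Cy with j ≟ᶠ i
...   | yes refl = lit b lx ly
  where
  lit : ∀ b → evalLit (j , b) x ≡ true → evalLit (j , b) y ≡ true → lookup x j ≡ lookup y j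
  lit true  p q = trans p (sym q)
  lit false p q with lookup x j | lookup y j
  ... | false | false = refl
...   | no ne = satisfied⇒agree C x y Cx Cy i (trans (sym (trans (lookup-∪ᵖ ⁅ j ⁆ (varsConj C) i) (cong (_∨ lookup (varsConj C) i) (trans (cong (λ v → lookup v i) (⁅⁆≡𝐞 j)) (lookup-𝐞-diff ne))))) v)

-- The conjunction satisfied by the points that agree with the second argument on the mask given by
-- the first.
literals : Point n → Point n → Conj n
literals []      []      = []
literals (a ∷ m) (b ∷ v) = (if a then (zero , b) ∷ [] else []) ++ map (λ ℓ → suc (proj₁ ℓ) , proj₂ ℓ) (literals m v)

evalConj-++ : ∀ (C C′ : Conj n) x → evalConj (C ++ C′) x ≡ evalConj C x ∧ evalConj C′ x
evalConj-++ []      C′ x = refl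
evalConj-++ (ℓ ∷ C) C′ x = trans (cong (evalLit ℓ x ∧_) (evalConj-++ C C′ x)) (sym (∧-assoc (evalLit ℓ x) _ _))

private
  evalConj-suc : ∀ (C : Conj n) a x → evalConj (map (λ ℓ → suc (proj₁ ℓ) , proj₂ ℓ) C) (a ∷ x) ≡ evalConj C x
  evalConj-suc []                a x = refl
  evalConj-suc ((i , true) ∷ C)  a x = cong (lookup x i ∧_) (evalConj-suc C a x)
  evalConj-suc ((i , false) ∷ C) a x = cong (not (lookup x i) ∧_) (evalConj-suc C a x)

  varsConj-suc : ∀ (C : Conj n) i → lookup (varsConj (map (λ ℓ → suc (proj₁ ℓ) , proj₂ ℓ) C)) (suc i) ≡ lookup (varsConj C) i
  varsConj-suc []            i = refl
  varsConj-suc ((j , b) ∷ C) i = trans (lookup-∪ᵖ ⁅ suc j ⁆ (varsConj (map (λ ℓ → suc (proj₁ ℓ) , proj₂ ℓ) C)) (suc i))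
    (trans (cong (lookup ⁅ j ⁆ i ∨_) (varsConj-suc C i)) (sym (lookup-∪ᵖ ⁅ j ⁆ (varsConj C) i)))

  varsConj-suc-zero : ∀ (C : Conj n) → lookup (varsConj (map (λ ℓ → suc (proj₁ ℓ) , proj₂ ℓ) C)) zero ≡ false
  varsConj-suc-zero []            = refl
  varsConj-suc-zero ((j , b) ∷ C) = trans (lookup-∪ᵖ ⁅ suc j ⁆ (varsConj (map (λ ℓ → suc (proj₁ ℓ) , proj₂ ℓ) C)) zero) (varsConj-suc-zero C)

eval-literals : ∀ (m v x : Point n) → evalConj (literals m v) x ≡ (((x ⊕ v) ⊙ m) ≡ᵖ 𝟎)
eval-literals []          []      []      = refl
eval-literals (true ∷ m)  (b ∷ v) (c ∷ x) = cong₂ _∧_ (trans (evalLit≡ zero b (c ∷ x)) (cong not (sym (trans (xor-identityʳ _) (∧-identityʳ _))))) (trans (evalConj-suc (literals m v) c x) (eval-literals m v x))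
eval-literals (false ∷ m) (b ∷ v) (c ∷ x) = trans (evalConj-suc (literals m v) c x) (trans (eval-literals m v x)
  (cong (λ d → not (d xor false) ∧ (((x ⊕ v) ⊙ m) ≡ᵖ 𝟎)) (sym (∧-zeroʳ (c xor b)))))

vars-literals : ∀ (m v : Point n) i → lookup (varsConj (literals m v)) i ≡ lookup m i
vars-literals (true ∷ m)  (b ∷ v) zero    = head-var (zero , b) (map (λ ℓ → suc (proj₁ ℓ) , proj₂ ℓ) (literals m v))
vars-literals (false ∷ m) (b ∷ v) zero    = varsConj-suc-zero (literals m v)
vars-literals (true ∷ m)  (b ∷ v) (suc i) = trans (lookup-∪ᵖ ⁅ zero ⁆ (varsConj (map (λ ℓ → suc (proj₁ ℓ) , proj₂ ℓ) (literals m v))) (suc i))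
  (trans (cong (_∨ lookup (varsConj (map (λ ℓ → suc (proj₁ ℓ) , proj₂ ℓ) (literals m v))) (suc i)) (lookup-𝟎 i)) (trans (varsConj-suc (literals m v) i) (vars-literals m v i)))
vars-literals (false ∷ m) (b ∷ v) (suc i) = trans (varsConj-suc (literals m v) i) (vars-literals m v i)

varsConj-++ : ∀ (C C′ : Conj n) i → lookup (varsConj (C ++ C′)) i ≡ lookup (varsConj C) i ∨ lookup (varsConj C′) i
varsConj-++ []            C′ i = cong (_∨ lookup (varsConj C′) i) (sym (lookup-𝟎 i))
varsConj-++ ((j , b) ∷ C) C′ i = trans (lookup-∪ᵖ ⁅ j ⁆ (varsConj (C ++ C′)) i) (trans (cong (lookup ⁅ j ⁆ i ∨_) (varsConj-++ C C′ i))
  (trans (sym (∨-assoc (lookup ⁅ j ⁆ i) _ _)) (cong (_∨ lookup (varsConj C′) i) (sym (lookup-∪ᵖ ⁅ j ⁆ (varsConj C) i)))))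
  where open import Data.Bool.Properties using (∨-assoc)

lookup-mix : ∀ (A x y : Point n) i → lookup (mix A x y) i ≡ (if lookup A i then lookup x i else lookup y i)
lookup-mix A x y i = trans (lookup-⊕ (x ⊙ A) (y ⊙ ∁ A) i) (trans (cong₂ _xor_ (lookup-⊙ x A i) (trans (lookup-⊙ y (∁ A) i) (cong (lookup y i ∧_) (lookup-∁ A i)))) (lem (lookup A i) (lookup x i) (lookup y i)))
  where
  lem : ∀ c a b → (a ∧ c) xor (b ∧ not c) ≡ (if c then a else b)
  lem true  a b = trans (cong₂ _xor_ (∧-identityʳ a) (∧-zeroʳ b)) (xor-identityʳ a)
  lem false a b = trans (cong₂ _xor_ (∧-zeroʳ a) (∧-identityʳ b)) refl

-- From codes over the blocks to factored DNFs and back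

module Translation {n k : ℕ} (π : Vec (Point k) n) (c₀ J : Point n) (reading : Reading π c₀ J) where
  open Reading reading

  private
    K = 2 ^ k

    termOf : Bool × Point K × Point K → List (Conj n)
    termOf (false , A , B) = []
    -- Bits are relative to `c₀`: a positive literal of the code asks for a difference from `c₀`,
    -- that is, for agreement with `∁ c₀`.
    termOf (true  , A , B) = (literals (J ⊙ spread π A) (∁ c₀) ++ literals (J ⊙ spread π B) c₀) ∷ []

    termsOf : ∀ {r} → Code K r → List (Conj n)
    termsOf []      = []
    termsOf (t ∷ g) = termOf t ++ termsOf g

    length-termsOf : ∀ {r} (g : Code K r) → length (termsOf g) ≤ r
    length-termsOf []                    = z≤n
    length-termsOf ((false , A , B) ∷ g) = ≤-trans (length-termsOf g) (n≤1+n _)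
    length-termsOf ((true  , A , B) ∷ g) = s≤s (length-termsOf g)

    -- A clash of x with the literals in A: at a variable on one side, at its block on the other.
    clash : ∀ (A y : Point K) (v : Point n) → (∀ s → lookup J s ≡ true → lookup v s ≡ lookup y (idx (lookup π s))) →
      ((v ⊙ (J ⊙ spread π A)) ≡ᵖ 𝟎) ≡ (((obs ⊙ A) ⊙ y) ≡ᵖ 𝟎)
    clash A y v vy = Bool-≡ (λ e → ⇒≡𝟎 ((obs ⊙ A) ⊙ y) (fwd e)) (λ e → ⇒≡𝟎 (v ⊙ (J ⊙ spread π A)) (bwd e))
      where
      atv : ∀ s → lookup (v ⊙ (J ⊙ spread π A)) s ≡ lookup v s ∧ (lookup J s ∧ lookup A (idx (lookup π s)))
      atv s = trans (lookup-⊙ v (J ⊙ spread π A) s) (cong (lookup v s ∧_) (trans (lookup-⊙ J (spread π A) s) (cong (lookup J s ∧_) (lookup-spread π A s))))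
      aty : ∀ q → lookup ((obs ⊙ A) ⊙ y) q ≡ (lookup obs q ∧ lookup A q) ∧ lookup y q
      aty q = trans (lookup-⊙ (obs ⊙ A) y q) (cong (_∧ lookup y q) (lookup-⊙ obs A q))
      fwd : ((v ⊙ (J ⊙ spread π A)) ≡ᵖ 𝟎) ≡ true → ∀ q → lookup ((obs ⊙ A) ⊙ y) q ≡ false
      fwd e q with lookup obs q in oq
      ... | false = trans (aty q) (cong (λ b → (b ∧ lookup A q) ∧ lookup y q) oq)
      ... | true with J-obs (unidx q) (trans (cong (lookup obs) (idx-unidx {k} q)) oq)
      ...   | s , Js , πs = trans (aty q) (trans (cong (λ b → (b ∧ lookup A q) ∧ lookup y q) oq) (trans (∧-comm (lookup A q) (lookup y q)) (trans eq (trans (sym (atv s)) (≡𝟎⇒ (v ⊙ (J ⊙ spread π A)) e s)))))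
        where
        q≡ : idx {k} (lookup π s) ≡ q
        q≡ = trans (cong idx πs) (idx-unidx {k} q)
        eq : lookup y q ∧ lookup A q ≡ lookup v s ∧ (lookup J s ∧ lookup A (idx (lookup π s)))
        eq = cong₂ _∧_ (trans (cong (lookup y) (sym q≡)) (sym (vy s Js))) (trans (cong (lookup A) (sym q≡)) (sym (cong (_∧ lookup A (idx (lookup π s))) Js)))
      bwd : (((obs ⊙ A) ⊙ y) ≡ᵖ 𝟎) ≡ true → ∀ s → lookup (v ⊙ (J ⊙ spread π A)) s ≡ false
      bwd e s with lookup J s in Js
      ... | false = trans (atv s) (trans (cong (λ b → lookup v s ∧ (b ∧ lookup A (idx (lookup π s)))) Js) (∧-zeroʳ _))
      ... | true  = trans (atv s) (trans (cong₂ _∧_ (vy s Js) (cong (_∧ lookup A q) Js)) (trans (∧-comm (lookup y q) (lookup A q))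
            (trans (sym (trans (aty q) (cong (λ b → (b ∧ lookup A q) ∧ lookup y q) (obs-J s Js)))) (≡𝟎⇒ ((obs ⊙ A) ⊙ y) e q))))
        where q = idx {k} (lookup π s)

    eval-termsOf : ∀ {r} (g : Code K r) x → evalDNF (termsOf g) x ≡ eval obs g (β x)
    eval-termsOf []                    x = refl
    eval-termsOf ((false , A , B) ∷ g) x = eval-termsOf g x
    eval-termsOf ((true  , A , B) ∷ g) x = cong₂ _∨_
      (trans (evalConj-++ (literals (J ⊙ spread π A) (∁ c₀)) _ x) (cong₂ _∧_
        (trans (eval-literals _ (∁ c₀) x) (clash A (∁ (β x)) (x ⊕ ∁ c₀) (λ s Js → trans (lookup-⊕ x (∁ c₀) s) (trans (cong (lookup x s xor_) (lookup-∁ c₀ s)) (trans (xor-not (lookup x s) (lookup c₀ s)) (trans (cong not (sym (trans (β-J x s Js) (lookup-⊕ x c₀ s)))) (sym (lookup-∁ (β x) _))))))))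
        (trans (eval-literals _ c₀ x) (clash B (β x) (x ⊕ c₀) (λ s Js → sym (β-J x s Js))))))
      (eval-termsOf g x)
      where
      xor-not : ∀ a b → a xor not b ≡ not (a xor b)
      xor-not true  true  = refl
      xor-not true  false = refl
      xor-not false b     = refl

    vars-termsOf : ∀ {r} (g : Code K r) i → lookup (varsDNF (termsOf g)) i ≡ true → lookup J i ≡ true
    vars-termsOf []                    i eq with trans (sym eq) (lookup-𝟎 i)
    ... | ()
    vars-termsOf ((false , A , B) ∷ g) i eq = vars-termsOf g i eq
    vars-termsOf ((true  , A , B) ∷ g) i eq with lookup (varsConj (literals (J ⊙ spread π A) (∁ c₀) ++ literals (J ⊙ spread π B) c₀)) i in vi
      | trans (sym (lookup-∪ᵖ (varsConj (literals (J ⊙ spread π A) (∁ c₀) ++ literals (J ⊙ spread π B) c₀)) (varsDNF (termsOf g)) i)) eq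
    ... | false | e = vars-termsOf g i e
    ... | true  | _ = lem (trans (sym (trans (varsConj-++ (literals (J ⊙ spread π A) (∁ c₀)) (literals (J ⊙ spread π B) c₀) i)
        (cong₂ _∨_ (trans (vars-literals (J ⊙ spread π A) (∁ c₀) i) (lookup-⊙ J (spread π A) i)) (trans (vars-literals (J ⊙ spread π B) c₀ i) (lookup-⊙ J (spread π B) i))))) vi)
      where
      lem : ∀ {a b} → (lookup J i ∧ a) ∨ (lookup J i ∧ b) ≡ true → lookup J i ≡ true
      lem e with lookup J i
      ... | true = refl

  factored : ∀ {r μ} (g : Code K r) (fixed x₀ : Point n) → size J ≤ μ → (∀ i → lookup J i ≡ true → lookup fixed i ≡ false) →
    IsFactoredDNF r μ (λ x → agree fixed x x₀ ∧ eval obs g (β x))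
  factored {r} {μ} g fixed x₀ J≤μ disjoint = literals fixed x₀ , termsOf g , length-termsOf g , empty , vars≤ ,
    λ x → cong₂ _∧_ (sym (eval-literals fixed x₀ x)) (sym (eval-termsOf g x))
    where
    empty : Empty (varsConj (literals fixed x₀) ∩ varsDNF (termsOf g))
    empty (i , mem) with ∧-true {lookup (varsConj (literals fixed x₀)) i} (trans (sym (lookup-⊙ (varsConj (literals fixed x₀)) (varsDNF (termsOf g)) i)) ([]=⇒lookup mem))
    ... | fi , vi with trans (sym (trans (sym (vars-literals fixed x₀ i)) fi)) (disjoint i (vars-termsOf g i vi))
    ...   | ()
    vars≤ : ∣ varsDNF (termsOf g) ∣ ≤ μ
    vars≤ = ≤-trans (≤-reflexive (∣∣≡size (varsDNF (termsOf g)))) (≤-trans (size-mono (varsDNF (termsOf g)) J (vars-termsOf g)) J≤μ)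

  private
    combine-terms : Bool × Point K × Point K → Bool × Point K × Point K → Bool × Point K × Point K
    combine-terms (p , A , B) (p′ , A′ , B′) = p ∧ p′ , A ∪ᵖ A′ , B ∪ᵖ B′

    ∪ᵖ-zero : ∀ {m} (o A A′ y : Point m) → (((o ⊙ (A ∪ᵖ A′)) ⊙ y) ≡ᵖ 𝟎) ≡ (((o ⊙ A) ⊙ y) ≡ᵖ 𝟎) ∧ (((o ⊙ A′) ⊙ y) ≡ᵖ 𝟎)
    ∪ᵖ-zero []      []      []        []      = refl
    ∪ᵖ-zero (o ∷ O) (a ∷ A) (a′ ∷ A′) (b ∷ y) = trans (cong₂ _∧_ (lem o a a′ b) (∪ᵖ-zero O A A′ y)) (inter (not (((o ∧ a) ∧ b) xor false)) (not (((o ∧ a′) ∧ b) xor false)) (((O ⊙ A) ⊙ y) ≡ᵖ 𝟎) (((O ⊙ A′) ⊙ y) ≡ᵖ 𝟎))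
      where
      lem : ∀ o a a′ b → not (((o ∧ (a ∨ a′)) ∧ b) xor false) ≡ not (((o ∧ a) ∧ b) xor false) ∧ not (((o ∧ a′) ∧ b) xor false)
      lem false a     a′    b     = refl
      lem true  true  true  true  = refl
      lem true  true  true  false = refl
      lem true  true  false true  = refl
      lem true  true  false false = refl
      lem true  false a′    b     = refl
      inter : ∀ a b c d → (a ∧ b) ∧ (c ∧ d) ≡ (a ∧ c) ∧ (b ∧ d)
      inter true  true  c d = refl
      inter true  false c d = sym (∧-zeroʳ c)
      inter false b     c d = refl

    eval-combine : ∀ s t σ → evalTerm obs (combine-terms s t) σ ≡ evalTerm obs s σ ∧ evalTerm obs t σ
    eval-combine (p , A , B) (p′ , A′ , B′) σ = trans (cong₂ (λ a b → (p ∧ p′) ∧ (a ∧ b)) (∪ᵖ-zero obs A A′ (∁ σ)) (∪ᵖ-zero obs B B′ σ)) (lem p p′ (((obs ⊙ A) ⊙ ∁ σ) ≡ᵖ 𝟎) (((obs ⊙ A′) ⊙ ∁ σ) ≡ᵖ 𝟎) (((obs ⊙ B) ⊙ σ) ≡ᵖ 𝟎) (((obs ⊙ B′) ⊙ σ) ≡ᵖ 𝟎))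
      where
      lem : ∀ p q a b c d → (p ∧ q) ∧ ((a ∧ b) ∧ (c ∧ d)) ≡ (p ∧ (a ∧ c)) ∧ (q ∧ (b ∧ d))
      lem false q     a     b     c     d = refl
      lem true  false true  b     true  d = refl
      lem true  false true  b     false d = refl
      lem true  false false b     c     d = refl
      lem true  true  true  true  true  d = refl
      lem true  true  true  true  false d = refl
      lem true  true  true  false true  d = refl
      lem true  true  true  false false d = refl
      lem true  true  false b     c     d = refl

    empty-zero : ∀ {m} (o y : Point m) → (((o ⊙ 𝟎) ⊙ y) ≡ᵖ 𝟎) ≡ true
    empty-zero o y = ⇒≡𝟎 ((o ⊙ 𝟎) ⊙ y) (λ i → trans (lookup-⊙ (o ⊙ 𝟎) y i) (cong (_∧ lookup y i) (trans (lookup-⊙ o 𝟎 i) (trans (cong (lookup o i ∧_) (lookup-𝟎 i)) (∧-zeroʳ _)))))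

    unit-zero : ∀ {m} (o y : Point m) q → lookup o q ≡ true → (((o ⊙ 𝐞 q) ⊙ y) ≡ᵖ 𝟎) ≡ not (lookup y q)
    unit-zero o y q oq = trans (cong (λ v → (v ⊙ y) ≡ᵖ 𝟎) (single o q oq)) (go y q)
      where
      go : ∀ {m} (y : Point m) q → ((𝐞 q ⊙ y) ≡ᵖ 𝟎) ≡ not (lookup y q)
      go {suc m} (b ∷ y) zero    = trans (cong (λ v → not (b xor false) ∧ (v ≡ᵖ 𝟎)) (⊙-𝟎ˡ y)) (trans (cong (not (b xor false) ∧_) (≡ᵖ-refl (𝟎 {m}))) (trans (∧-identityʳ _) (cong not (xor-identityʳ b))))
      go (b ∷ y) (suc q) = go y q

  module Encode {r : ℕ} (z : Point n) where
    private
      litCode : Literal n → Bool × Point K × Point K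
      -- A literal on `J` is positive in the code if it asks for a value other than that of `c₀`. A
      -- literal outside `J` is decided by `z` and goes into the presence flag of the term.
      litCode (i , b) = if lookup J i then (if b xor lookup c₀ i then (true , 𝐞 (idx (lookup π i)) , 𝟎) else (true , 𝟎 , 𝐞 (idx (lookup π i))))
                                     else (evalLit (i , b) z , 𝟎 , 𝟎)

      eval-litCode : ∀ ℓ x → evalTerm obs (litCode ℓ) (β x) ≡ evalLit ℓ (mix J x z)
      eval-litCode (i , b) x with lookup J i in Ji
      ... | false = trans (cong (evalLit (i , b) z ∧_) (cong₂ _∧_ (empty-zero obs _) (empty-zero obs _))) (trans (∧-identityʳ _)
              (evalLit-ext (i , b) z (mix J x z) (sym (trans (lookup-mix J x z i) (cong (λ c → if c then lookup x i else lookup z i) Ji)))))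
      ... | true with b xor lookup c₀ i in bc
      ...   | true  = trans (cong₂ _∧_ (trans (unit-zero obs (∁ (β x)) _ (obs-J i Ji)) (cong not (lookup-∁ (β x) _))) (empty-zero obs _))
                (trans (∧-identityʳ _) (trans (cong (λ c → not (not c)) (trans (β-J x i Ji) (lookup-⊕ x c₀ i))) (trans (lem (lookup x i) b (lookup c₀ i) bc) (sym lit))))
        where
        lit : evalLit (i , b) (mix J x z) ≡ not (lookup x i xor b)
        lit = trans (evalLit≡ i b (mix J x z)) (cong (λ c → not (c xor b)) (trans (lookup-mix J x z i) (cong (λ c → if c then lookup x i else lookup z i) Ji)))
        lem : ∀ x b c → b xor c ≡ true → not (not (x xor c)) ≡ not (x xor b)
        lem true  true  false _ = refl
        lem true  false true  _ = refl
        lem false true  false _ = refl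
        lem false false true  _ = refl
      ...   | false = trans (cong₂ _∧_ (empty-zero obs _) (unit-zero obs (β x) _ (obs-J i Ji)))
                (trans (cong not (trans (β-J x i Ji) (lookup-⊕ x c₀ i))) (trans (lem (lookup x i) b (lookup c₀ i) bc) (sym lit)))
        where
        lit : evalLit (i , b) (mix J x z) ≡ not (lookup x i xor b)
        lit = trans (evalLit≡ i b (mix J x z)) (cong (λ c → not (c xor b)) (trans (lookup-mix J x z i) (cong (λ c → if c then lookup x i else lookup z i) Ji)))
        lem : ∀ x b c → b xor c ≡ false → not (x xor c) ≡ not (x xor b)
        lem x true  true  _ = refl
        lem x false false _ = refl

      conjCode : Conj n → Bool × Point K × Point K
      conjCode []      = true , 𝟎 , 𝟎
      conjCode (ℓ ∷ C) = combine-terms (litCode ℓ) (conjCode C)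

      eval-conjCode : ∀ C x → evalTerm obs (conjCode C) (β x) ≡ evalConj C (mix J x z)
      eval-conjCode []      x = cong₂ _∧_ (empty-zero obs _) (empty-zero obs _)
      eval-conjCode (ℓ ∷ C) x = trans (eval-combine (litCode ℓ) (conjCode C) (β x)) (cong₂ _∧_ (eval-litCode ℓ x) (eval-conjCode C x))

      encode : ∀ {r} (Ts : List (Conj n)) → length Ts ≤ r → Code K r
      encode {zero}  []       le       = []
      encode {suc r} []       le       = (false , 𝟎 , 𝟎) ∷ encode {r} [] z≤n
      encode {suc r} (C ∷ Ts) (s≤s le) = conjCode C ∷ encode Ts le

      eval-encode : ∀ {r} (Ts : List (Conj n)) (le : length Ts ≤ r) x → eval obs (encode Ts le) (β x) ≡ evalDNF Ts (mix J x z)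
      eval-encode {zero}  []       le       x = refl
      eval-encode {suc r} []       le       x = eval-encode {r} [] z≤n x
      eval-encode {suc r} (C ∷ Ts) (s≤s le) x = cong₂ _∨_ (eval-conjCode C x) (eval-encode Ts le x)

    -- As `J` consists of variables of the terms, the head `H` does not see it and is decided by `z`
    -- alone. If `H` fails there, the restriction is zero and the code without terms serves.
    restriction : ∀ {μ} (h : BoolFun n) ((H , Ts , _) : IsFactoredDNF r μ h) →
      (∀ i → lookup J i ≡ true → lookup (varsDNF Ts) i ≡ true) →
      ∃ λ (g : Code K r) → ∀ x → eval obs g (β x) ≡ h (mix J x z)
    restriction h (H , Ts , Ts≤r , empty , _ , h≡) J⊆ with evalConj H z in Hz
    ... | true  = encode Ts Ts≤r , λ x → trans (eval-encode Ts Ts≤r x) (trans (cong (_∧ evalDNF Ts (mix J x z)) (sym (trans (sameH x) Hz))) (sym (h≡ (mix J x z))))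
      where
      sameH : ∀ x → evalConj H (mix J x z) ≡ evalConj H z
      sameH x = evalConj-ext H (mix J x z) z λ i vi → trans (lookup-mix J x z i) (lem i vi)
        where
        lem : ∀ i → lookup (varsConj H) i ≡ true → (if lookup J i then lookup x i else lookup z i) ≡ lookup z i
        lem i vi with lookup J i in Ji
        ... | false = refl
        ... | true  = ⊥-elim (empty (i , lookup⇒[]= i _ (trans (lookup-⊙ (varsConj H) (varsDNF Ts) i) (cong₂ _∧_ vi (J⊆ i Ji)))))
    ... | false = encode {r} [] z≤n , λ x → trans (eval-encode {r} [] z≤n x) (sym (trans (h≡ (mix J x z)) (cong (_∧ evalDNF Ts (mix J x z)) (trans (sameH x) Hz))))
      where
      sameH : ∀ x → evalConj H (mix J x z) ≡ evalConj H z
      sameH x = evalConj-ext H (mix J x z) z λ i vi → trans (lookup-mix J x z i) (lem i vi)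
        where
        lem : ∀ i → lookup (varsConj H) i ≡ true → (if lookup J i then lookup x i else lookup z i) ≡ lookup z i
        lem i vi with lookup J i in Ji
        ... | false = refl
        ... | true  = ⊥-elim (empty (i , lookup⇒[]= i _ (trans (lookup-⊙ (varsConj H) (varsDNF Ts) i) (cong₂ _∧_ vi (J⊆ i Ji)))))

module FactoredDNF {n r μ : ℕ} (h : BoolFun n) (factored : IsFactoredDNF r μ h) where
  private
    H  = proj₁ factored
    Ts = proj₁ (proj₂ factored)

    h≡ : ∀ x → h x ≡ evalConj H x ∧ evalDNF Ts x
    h≡ = proj₂ (proj₂ (proj₂ (proj₂ (proj₂ factored))))

  vars : Point n
  vars = varsDNF Ts

  -- Both `x` and `y` satisfy the head, so they agree on its variables and `x ⊕ y` vanishes there;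
  -- the mask `v` keeps the move away from the variables of the terms.
  move : ∀ x y z v → h x ≡ true → h y ≡ true → h z ≡ true → v ⊙ vars ≡ 𝟎 → h (z ⊕ ((x ⊕ y) ⊙ v)) ≡ true
  move x y z v hx hy hz v∩ = trans (h≡ _) (trans (cong₂ _∧_ (evalConj-ext H (z ⊕ ((x ⊕ y) ⊙ v)) z onH) (evalDNF-ext Ts (z ⊕ ((x ⊕ y) ⊙ v)) z onTs)) (trans (sym (h≡ z)) hz))
    where
    H-true : ∀ w → h w ≡ true → evalConj H w ≡ true
    H-true w hw = proj₁ (∧-true (trans (sym (h≡ w)) hw))
    at-move : ∀ i → lookup (z ⊕ ((x ⊕ y) ⊙ v)) i ≡ lookup z i xor ((lookup x i xor lookup y i) ∧ lookup v i)
    at-move i = trans (lookup-⊕ z _ i) (cong (lookup z i xor_) (trans (lookup-⊙ (x ⊕ y) v i) (cong (_∧ lookup v i) (lookup-⊕ x y i))))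
    onH : ∀ i → lookup (varsConj H) i ≡ true → lookup (z ⊕ ((x ⊕ y) ⊙ v)) i ≡ lookup z i
    onH i vi = trans (at-move i) (trans (cong (λ b → lookup z i xor (b ∧ lookup v i)) (trans (cong (_xor lookup y i) (satisfied⇒agree H x y (H-true x hx) (H-true y hy) i vi)) (xor-same (lookup y i)))) (xor-identityʳ _))
    onTs : ∀ i → lookup vars i ≡ true → lookup (z ⊕ ((x ⊕ y) ⊙ v)) i ≡ lookup z i
    onTs i vi = trans (at-move i) (trans (cong (λ b → lookup z i xor ((lookup x i xor lookup y i) ∧ b)) vi0) (trans (cong (lookup z i xor_) (∧-zeroʳ _)) (xor-identityʳ _)))
      where
      vi0 : lookup v i ≡ false
      vi0 = trans (sym (trans (lookup-⊙ v vars i) (trans (cong (lookup v i ∧_) vi) (∧-identityʳ _)))) (≡𝟎⇒ (v ⊙ vars) (trans (cong (_≡ᵖ 𝟎) v∩) (≡ᵖ-refl (𝟎 {n}))) i)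

-- Rejection sampling, learning, and detection of variables

-- Rejection sampling: the first of R uniform draws satisfying p, if any, is uniform among the points satisfying p.
module RejectionSampling {A : Set} (p : A → Bool) (L : List A) where
  private
    ℓ = length L

  good failed : ℕ
  good   = ∑[ x ∈ L ] [ p x ]ᵇ
  failed = ∑[ x ∈ L ] [ not (p x) ]ᵇ

  -- The number of sequences of `R` draws whose first success is one given good point: the sum of
  -- `ℓ ^ (R - 1 - i) * failed ^ i` over `i < R`.
  weight : ℕ → ℕ
  weight zero    = 0
  weight (suc R) = ℓ ^ R + failed * weight R

  ∑-first : ∀ (ψ : A → ℕ) R → (∑[ v ∈ vecs L R ] maybe ψ 0 (first p v)) ≡ weight R * (∑[ x ∈ L ] [ p x ]ᵇ * ψ x)
  ∑-first ψ zero    = refl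
  ∑-first ψ (suc R) = begin
    (∑[ v ∈ vecs L (suc R) ] maybe ψ 0 (first p v))                   ≡⟨ ∑-vecs L R _ ⟩
    (∑[ x ∈ L ] ∑[ v ∈ vecs L R ] maybe ψ 0 (first p (x ∷ v)))        ≡⟨ ∑-cong L step ⟩
    (∑[ x ∈ L ] (ℓ ^ R * ([ p x ]ᵇ * ψ x) + [ not (p x) ]ᵇ * rest))   ≡⟨ trans (∑-+ _ _ L) (cong₂ _+_ (∑-*ˡ (ℓ ^ R) _ L) (∑-*ʳ rest _ L)) ⟩
    ℓ ^ R * target + failed * rest                                    ≡⟨ cong (λ z → ℓ ^ R * target + failed * z) (∑-first ψ R) ⟩
    ℓ ^ R * target + failed * (weight R * target)                     ≡⟨ lem (ℓ ^ R) target failed (weight R) ⟩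
    weight (suc R) * target                                           ∎
    where
    open ≡-Reasoning
    target = ∑[ x ∈ L ] [ p x ]ᵇ * ψ x
    rest = ∑[ v ∈ vecs L R ] maybe ψ 0 (first p v)
    lem : ∀ a t f w → a * t + f * (w * t) ≡ (a + f * w) * t
    lem = solve-∀
    step : ∀ x → (∑[ v ∈ vecs L R ] maybe ψ 0 (first p (x ∷ v))) ≡ ℓ ^ R * ([ p x ]ᵇ * ψ x) + [ not (p x) ]ᵇ * rest
    step x with p x
    ... | true  = trans (∑-const (ψ x) (vecs L R)) (trans (cong (_* ψ x) (length-vecs L R)) (sym (trans (+-identityʳ _) (cong (ℓ ^ R *_) (+-identityʳ _)))))
    ... | false = sym (trans (cong (_+ (rest + 0)) (*-zeroʳ (ℓ ^ R))) (+-identityʳ rest))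

  good+failed : good + failed ≡ ℓ
  good+failed = [not]-∑ p L

  good*weight : ∀ R → good * weight R + failed ^ R ≡ ℓ ^ R
  good*weight zero    = cong (_+ 1) (*-zeroʳ good)
  good*weight (suc R) = begin
    good * (ℓ ^ R + failed * weight R) + failed * failed ^ R         ≡⟨ lem good (ℓ ^ R) failed (weight R) (failed ^ R) ⟩
    good * ℓ ^ R + failed * (good * weight R + failed ^ R)           ≡⟨ cong (λ z → good * ℓ ^ R + failed * z) (good*weight R) ⟩
    good * ℓ ^ R + failed * ℓ ^ R                                    ≡⟨ *-distribʳ-+ (ℓ ^ R) good failed ⟨
    (good + failed) * ℓ ^ R                                          ≡⟨ cong (_* ℓ ^ R) good+failed ⟩
    ℓ * ℓ ^ R                                                        ∎
    where
    open ≡-Reasoning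
    lem : ∀ g l f w x → g * (l + f * w) + f * x ≡ g * l + f * (g * w + x)
    lem = solve-∀

  good*weight≤ : ∀ R → good * weight R ≤ ℓ ^ R
  good*weight≤ R = ≤-trans (m≤m+n _ _) (≤-reflexive (good*weight R))

  -- With one good point and as many draws as there are points, all draws fail with probability at
  -- most 1/2: the Bernoulli bound `t / (t + w)` at `t = w = ℓ`.
  good*weight≥ : 0 < good → ℓ ^ ℓ ≤ 2 * (good * weight ℓ)
  good*weight≥ 0<good = +-cancelʳ-≤ (ℓ ^ ℓ) _ _ (begin
    ℓ ^ ℓ + ℓ ^ ℓ                                  ≡⟨ cong (ℓ ^ ℓ +_) (+-identityʳ _) ⟨
    2 * ℓ ^ ℓ                                      ≡⟨ cong (2 *_) (good*weight ℓ) ⟨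
    2 * (good * weight ℓ + failed ^ ℓ)             ≡⟨ *-distribˡ-+ 2 (good * weight ℓ) (failed ^ ℓ) ⟩
    2 * (good * weight ℓ) + 2 * failed ^ ℓ         ≤⟨ +-monoʳ-≤ (2 * (good * weight ℓ)) half ⟩
    2 * (good * weight ℓ) + ℓ ^ ℓ                  ∎)
    where
    open ≤-Reasoning
    0<ℓ : 0 < ℓ
    0<ℓ = ≤-trans 0<good (≤-trans (m≤m+n good failed) (≤-reflexive good+failed))
    half : 2 * failed ^ ℓ ≤ ℓ ^ ℓ
    half = *-cancelʳ-≤ _ _ ℓ {{>-nonZero 0<ℓ}} (begin
      2 * failed ^ ℓ * ℓ           ≡⟨ lem (failed ^ ℓ) ℓ ⟩
      failed ^ ℓ * (ℓ + ℓ)         ≤⟨ bernoulli-fraction {failed} {good} {ℓ} {ℓ} ℓ (trans (+-comm failed good) good+failed) (≤-trans (≤-reflexive (sym (*-identityʳ ℓ))) (*-monoʳ-≤ ℓ 0<good)) 0<ℓ ⟩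
      ℓ ^ ℓ * ℓ                    ∎)
      where
      lem : ∀ a l → 2 * a * l ≡ a * (l + l)
      lem = solve-∀

^-distribʳ-* : ∀ m a b → a ^ m * b ^ m ≡ (a * b) ^ m
^-distribʳ-* zero    a b = refl
^-distribʳ-* (suc m) a b = trans (lem a (a ^ m) b (b ^ m)) (cong (a * b *_) (^-distribʳ-* m a b))
  where
  lem : ∀ a x b y → a * x * (b * y) ≡ a * b * (x * y)
  lem = solve-∀

-- (1 - e/u)^(M L) ≤ 2^(-L) if e/u ≥ 1/M.
halving : ∀ {d e u} M L → d + e ≡ u → u ≤ M * e → 0 < u → 2 ^ L * d ^ (M * L) ≤ u ^ (M * L)
halving {d} {e} {u} M L eq le 0<u = begin
  2 ^ L * d ^ (M * L)         ≡⟨ cong (2 ^ L *_) (^-*-assoc d M L) ⟨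
  2 ^ L * (d ^ M) ^ L         ≡⟨ ^-distribʳ-* L 2 (d ^ M) ⟩
  (2 * d ^ M) ^ L             ≤⟨ ^-monoˡ-≤ L half ⟩
  (u ^ M) ^ L                 ≡⟨ ^-*-assoc u M L ⟩
  u ^ (M * L)                 ∎
  where
  open ≤-Reasoning
  positive : ∀ M → u ≤ M * e → 0 < M
  positive zero    u≤0 = ⊥-elim (<-irrefl refl (≤-trans 0<u u≤0))
  positive (suc _) _   = s≤s z≤n
  0<M : 0 < M
  0<M = positive M le
  half : 2 * d ^ M ≤ u ^ M
  half = *-cancelʳ-≤ _ _ M {{>-nonZero 0<M}} (begin
    2 * d ^ M * M        ≡⟨ lem (d ^ M) M ⟩
    d ^ M * (M + M)      ≤⟨ bernoulli-fraction M eq le 0<u ⟩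
    u ^ M * M            ∎)
    where
    lem : ∀ a l → 2 * a * l ≡ a * (l + l)
    lem = solve-∀

-- A union bound over the candidates: one that is inconsistent with a 1/M fraction of the samples
-- survives M L of them with probability at most 2^(-L).
module Occam {A C : Set} (p : C → A → Bool) (U : List A) (0<u : 0 < length U) (𝒞 : List C) (M L : ℕ) where
  private
    u = length U

  wrong : C → ℕ
  wrong g = ∑[ x ∈ U ] [ not (p g x) ]ᵇ

  misled : Vec A (M * L) → ℕ
  misled v = ∑[ g ∈ 𝒞 ] [ u ≤ᵇ M * wrong g ]ᵇ * [ all (p g) (toList v) ]ᵇ

  occam : 2 ^ L * (∑[ v ∈ vecs U (M * L) ] misled v) ≤ length 𝒞 * u ^ (M * L)
  occam = begin
    2 ^ L * (∑[ v ∈ vecs U (M * L) ] misled v)   ≡⟨ cong (2 ^ L *_) (trans (∑-swap _ (vecs U (M * L)) 𝒞) (∑-cong 𝒞 (λ g → trans (∑-*ˡ [ u ≤ᵇ M * wrong g ]ᵇ _ (vecs U (M * L))) (cong ([ u ≤ᵇ M * wrong g ]ᵇ *_) (∑-vecs-all (p g) U (M * L)))))) ⟩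
    2 ^ L * (∑[ g ∈ 𝒞 ] [ u ≤ᵇ M * wrong g ]ᵇ * right g ^ (M * L)) ≡⟨ ∑-*ˡ (2 ^ L) _ 𝒞 ⟨
    (∑[ g ∈ 𝒞 ] 2 ^ L * ([ u ≤ᵇ M * wrong g ]ᵇ * right g ^ (M * L))) ≤⟨ ∑-mono 𝒞 per ⟩
    (∑[ g ∈ 𝒞 ] u ^ (M * L))                     ≡⟨ ∑-const _ 𝒞 ⟩
    length 𝒞 * u ^ (M * L)                       ∎
    where
    open ≤-Reasoning
    right : C → ℕ
    right g = ∑[ x ∈ U ] [ p g x ]ᵇ
    per : ∀ g → 2 ^ L * ([ u ≤ᵇ M * wrong g ]ᵇ * right g ^ (M * L)) ≤ u ^ (M * L)
    per g with u ≤ᵇ M * wrong g in le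
    ... | false = ≤-trans (≤-reflexive (*-zeroʳ (2 ^ L))) z≤n
    ... | true  = ≤-trans (≤-reflexive (cong (2 ^ L *_) (+-identityʳ _))) (halving M L ([not]-∑ (p g) U) ([≤ᵇ] u _ le) 0<u)

  not-misled : ∀ v → misled v ≡ 0 → ∀ {g} → g ∈ 𝒞 → all (p g) (toList v) ≡ true → M * wrong g < u
  not-misled v eq {g} mem cons with u ≤? M * wrong g
  ... | no nle = ≰⇒> nle
  ... | yes le with trans (sym (cong₂ (λ a b → [ a ]ᵇ * [ b ]ᵇ) (lem (≤⇒≤ᵇ le)) cons)) (All.lookup (∑≡0⇒All _ 𝒞 eq) mem)
    where
    lem : ∀ {b} → Data.Bool.T b → b ≡ true
    lem {true} _ = refl
  ...   | ()

-- Variables that escape detection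

module Detection {n : ℕ} (h : BoolFun n) (0<u : 0 < supportSize h) (k r : ℕ) (J : Point n)
  (bound : Point n → Point n → ℕ)
  (err≤bound : ∀ x y B → Error.err h ((x ⊕ y) ⊙ (B ⊙ ∁ J)) ≤ bound x y)
  (D′ : ℕ) (bound-small : D′ * (∑[ x ∈ support h ] ∑[ y ∈ support h ] bound x y) ≤ supportSize h * (supportSize h * supportSize h))
  (T W : ℕ) where
  open Error h
  open Tester h k r

  private
    Us = vecs U W
    M = ∑[ x ∈ U ] ∑[ y ∈ U ] bound x y

  length-Us : length Us ≡ u ^ W
  length-Us = length-vecs U W

  insensitive : Vec (Point n) W → Fin n → Bool
  insensitive ws s = all (λ w → h (w ⊕ 𝐞 s)) (toList ws)

  constant : Point n → Vec (Point n) W → Fin n → Bool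
  constant c₀ ds s = all (λ d → not (lookup (d ⊕ c₀) s)) (toList ds)

  differing : Point n → Fin n → ℕ
  differing c₀ s = ∑[ x ∈ U ] [ lookup (x ⊕ c₀) s ]ᵇ

  -- Only failures that matter are counted: an influential variable that no witness notices, or one
  -- that often differs from `c₀` but does so in no detection sample. Missing other variables is
  -- harmless.
  missed : Point n → Vec (Point n) W → Vec (Point n) W → ℕ
  missed c₀ ds ws = ∑[ s ∈ allFin n ] [ lookup J s ]ᵇ *
    ([ insensitive ws s ]ᵇ * [ u ≤ᵇ T * err (𝐞 s) ]ᵇ + [ constant c₀ ds s ]ᵇ * [ u ≤ᵇ T * differing c₀ s ]ᵇ)

  private
    gated : ∀ (p : Point n → Bool) e → (∑[ x ∈ U ] [ p x ]ᵇ) + e ≡ u →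
      (T + W) * (∑[ v ∈ Us ] [ all p (toList v) ]ᵇ * [ u ≤ᵇ T * e ]ᵇ) ≤ u ^ W * T
    gated p e eq with u ≤ᵇ T * e in le
    ... | false = ≤-trans (≤-reflexive (trans (cong ((T + W) *_) (trans (∑-*ʳ 0 (λ v → [ all p (toList v) ]ᵇ) Us) (*-zeroʳ (∑ Us (λ v → [ all p (toList v) ]ᵇ))))) (*-zeroʳ (T + W)))) z≤n
    ... | true  = ≤-trans (≤-reflexive (trans (cong ((T + W) *_) (trans (∑-*ʳ 1 _ Us) (trans (*-identityʳ _) (∑-vecs-all p U W)))) (*-comm (T + W) _)))
                    (bernoulli-fraction W eq ([≤ᵇ] u _ le) 0<u)

  ∑-missed : (T + W) * (∑[ c₀ ∈ U ] ∑[ ds ∈ Us ] ∑[ ws ∈ Us ] missed c₀ ds ws) ≤ size J * (2 * T) * (u * (u ^ W * u ^ W))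
  ∑-missed = begin
    (T + W) * (∑[ c₀ ∈ U ] ∑[ ds ∈ Us ] ∑[ ws ∈ Us ] missed c₀ ds ws)
      ≡⟨ cong ((T + W) *_) (∑-cong U λ c₀ → trans (∑-cong Us (λ ds → ∑-swap _ Us (allFin n))) (∑-swap _ Us (allFin n))) ⟩
    (T + W) * (∑[ c₀ ∈ U ] ∑[ s ∈ allFin n ] ∑[ ds ∈ Us ] ∑[ ws ∈ Us ] [ lookup J s ]ᵇ * (a ws s + b c₀ ds s))
      ≡⟨ trans (sym (∑-*ˡ (T + W) _ U)) (∑-cong U (λ c₀ → sym (∑-*ˡ (T + W) _ (allFin n)))) ⟩
    (∑[ c₀ ∈ U ] ∑[ s ∈ allFin n ] (T + W) * (∑[ ds ∈ Us ] ∑[ ws ∈ Us ] [ lookup J s ]ᵇ * (a ws s + b c₀ ds s)))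
      ≤⟨ (∑-mono U λ c₀ → ∑-mono (allFin n) (per c₀)) ⟩
    (∑[ c₀ ∈ U ] ∑[ s ∈ allFin n ] [ lookup J s ]ᵇ * (2 * T * (u ^ W * u ^ W)))
      ≡⟨ trans (∑-const _ U) (cong (u *_) (trans (∑-*ʳ _ _ (allFin n)) (cong (_* (2 * T * (u ^ W * u ^ W))) (∑-size J)))) ⟩
    u * (size J * (2 * T * (u ^ W * u ^ W)))  ≡⟨ l1 u (size J) T (u ^ W * u ^ W) ⟩
    size J * (2 * T) * (u * (u ^ W * u ^ W))  ∎
    where
    open ≤-Reasoning
    l1 : ∀ u j t x → u * (j * (2 * t * x)) ≡ j * (2 * t) * (u * x)
    l1 = solve-∀
    l2 : ∀ p y j a b → p * (j * (y * a + y * b)) ≡ j * (y * (p * a) + y * (p * b))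
    l2 = solve-∀
    l3 : ∀ y t → y * (y * t) + y * (y * t) ≡ 2 * t * (y * y)
    l3 = solve-∀
    a = λ ws s → [ insensitive ws s ]ᵇ * [ u ≤ᵇ T * err (𝐞 s) ]ᵇ
    b = λ c₀ ds s → [ constant c₀ ds s ]ᵇ * [ u ≤ᵇ T * differing c₀ s ]ᵇ
    ∑-size : ∀ {m} (J : Point m) → (∑[ s ∈ allFin m ] [ lookup J s ]ᵇ) ≡ size J
    ∑-size []      = refl
    ∑-size (c ∷ J) = trans (∑-allFin (λ s → [ lookup (c ∷ J) s ]ᵇ)) (cong ([ c ]ᵇ +_) (∑-size J))
    per : ∀ c₀ s → (T + W) * (∑[ ds ∈ Us ] ∑[ ws ∈ Us ] [ lookup J s ]ᵇ * (a ws s + b c₀ ds s)) ≤ [ lookup J s ]ᵇ * (2 * T * (u ^ W * u ^ W))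
    per c₀ s = begin
      (T + W) * (∑[ ds ∈ Us ] ∑[ ws ∈ Us ] j * (a ws s + b c₀ ds s))
        ≡⟨ cong ((T + W) *_) (trans (∑-cong Us (λ ds → trans (∑-*ˡ j _ Us) (cong (j *_) (trans (∑-+ _ _ Us) (cong (∑ Us (λ ws → a ws s) +_) (∑-const _ Us)))))) (∑-*ˡ j _ Us)) ⟩
      (T + W) * (j * (∑[ ds ∈ Us ] (∑ Us (λ ws → a ws s) + length Us * b c₀ ds s)))
        ≡⟨ cong (λ z → (T + W) * (j * z)) (trans (∑-+ _ _ Us) (cong₂ _+_ (∑-const _ Us) (∑-*ˡ (length Us) _ Us))) ⟩
      (T + W) * (j * (length Us * ∑ Us (λ ws → a ws s) + length Us * ∑ Us (λ ds → b c₀ ds s)))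
        ≡⟨ l2 (T + W) (length Us) j (∑ Us (λ ws → a ws s)) (∑ Us (λ ds → b c₀ ds s)) ⟩
      j * (length Us * ((T + W) * ∑ Us (λ ws → a ws s)) + length Us * ((T + W) * ∑ Us (λ ds → b c₀ ds s)))
        ≤⟨ *-monoʳ-≤ j (+-mono-≤ (*-monoʳ-≤ (length Us) (gated (λ w → h (w ⊕ 𝐞 s)) (err (𝐞 s)) ([not]-∑ _ U)))
             (*-monoʳ-≤ (length Us) (gated (λ d → not (lookup (d ⊕ c₀) s)) (differing c₀ s) (trans (+-comm _ (differing c₀ s)) ([not]-∑ _ U))))) ⟩
      j * (length Us * (u ^ W * T) + length Us * (u ^ W * T)) ≡⟨ cong (λ z → j * (z * (u ^ W * T) + z * (u ^ W * T))) length-Us ⟩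
      j * (u ^ W * (u ^ W * T) + u ^ W * (u ^ W * T))         ≡⟨ cong (j *_) (l3 (u ^ W) T) ⟩
      j * (2 * T * (u ^ W * u ^ W)) ∎
      where j = [ lookup J s ]ᵇ

  module _ (c₀ : Point n) (ds ws : Vec (Point n) W) where
    open Detected {W} {W} J c₀ ds ws

    undetected : Fin n → Bool
    undetected s = lookup J s ∧ not (lookup detected s)

    -- Undetected variables are demoted to coordinates outside the set. Each one adds its own error
    -- at the pairs that differ in it.
    bound′ : Point n → Point n → ℕ
    bound′ x y = bound x y + (∑[ s ∈ allFin n ] [ undetected s ]ᵇ * ([ lookup (x ⊕ y) s ]ᵇ * err (𝐞 s)))

    err≤bound′ : ∀ x y B → err ((x ⊕ y) ⊙ (B ⊙ ∁ detected)) ≤ bound′ x y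
    err≤bound′ x y B = begin
      err v                                        ≡⟨ cong err (∁-split v (∁ J)) ⟨
      err ((v ⊙ ∁ J) ⊕ (v ⊙ ∁ (∁ J)))              ≤⟨ err-⊕ _ _ ⟩
      err (v ⊙ ∁ J) + err (v ⊙ ∁ (∁ J))            ≤⟨ +-mono-≤ (≤-trans (≤-reflexive (cong err (⊙-assoc (x ⊕ y) _ (∁ J)))) (err≤bound x y (B ⊙ ∁ detected))) (≤-trans (subadditive-coordinates err-subadditive _) (∑-allFin-mono per)) ⟩
      bound′ x y                                   ∎
      where
      open ≤-Reasoning
      v = (x ⊕ y) ⊙ (B ⊙ ∁ detected)
      lookup-v : ∀ s → lookup (v ⊙ ∁ (∁ J)) s ≡ (lookup (x ⊕ y) s ∧ (lookup B s ∧ not (lookup detected s))) ∧ not (not (lookup J s))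
      lookup-v s = trans (lookup-⊙ v (∁ (∁ J)) s) (cong₂ _∧_ (trans (lookup-⊙ (x ⊕ y) (B ⊙ ∁ detected) s) (cong (lookup (x ⊕ y) s ∧_) (trans (lookup-⊙ B (∁ detected) s) (cong (lookup B s ∧_) (lookup-∁ detected s)))))
        (trans (lookup-∁ (∁ J) s) (cong not (lookup-∁ J s))))
      lem : ∀ a b c d e → [ (a ∧ (b ∧ not c)) ∧ not (not d) ]ᵇ * e ≤ [ d ∧ not c ]ᵇ * ([ a ]ᵇ * e)
      lem false b     c     d     e = z≤n
      lem true  false c     d     e = z≤n
      lem true  true  true  d     e = z≤n
      lem true  true  false false e = z≤n
      lem true  true  false true  e = ≤-reflexive (sym (+-identityʳ _))
      per : ∀ s → [ lookup (v ⊙ ∁ (∁ J)) s ]ᵇ * err (𝐞 s) ≤ [ undetected s ]ᵇ * ([ lookup (x ⊕ y) s ]ᵇ * err (𝐞 s))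
      per s = ≤-trans (≤-reflexive (cong (λ b → [ b ]ᵇ * err (𝐞 s)) (lookup-v s))) (lem (lookup (x ⊕ y) s) (lookup B s) (lookup detected s) (lookup J s) (err (𝐞 s)))

    module _ (none : missed c₀ ds ws ≡ 0) where
      private
        gate : ∀ {a b c} → a ≡ true → [ a ]ᵇ * ([ b ]ᵇ * [ c ]ᵇ) ≡ 0 → b ≡ true → c ≡ false
        gate {true} {true} {false} _ _ _ = refl

        >ᵇ : ∀ {a b} → (a ≤ᵇ b) ≡ false → b < a
        >ᵇ {a} {b} eq with a ≤? b
        ... | no nle = ≰⇒> nle
        ... | yes le with trans (sym eq) (lem (≤⇒≤ᵇ le))
          where
          lem : ∀ {b} → Data.Bool.T b → b ≡ true
          lem {true} _ = refl
        ...   | ()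

        all-from-none : ∀ (p : Point n → Bool) {m} (v : Vec (Point n) m) → any (not ∘ p) (toList v) ≡ false → all p (toList v) ≡ true
        all-from-none p []      _ = refl
        all-from-none p (x ∷ v) eq with p x
        ... | true = all-from-none p v eq

        constant-from : ∀ {m} (v : Vec (Point n) m) s → lookup (union (Vec.map (_⊕ c₀) v)) s ≡ false → all (λ d → not (lookup (d ⊕ c₀) s)) (toList v) ≡ true
        constant-from []      s _ = refl
        constant-from (d ∷ v) s eq with lookup (d ⊕ c₀) s | trans (sym (lookup-∪ᵖ (d ⊕ c₀) (union (Vec.map (_⊕ c₀) v)) s)) eq
        ... | false | e = constant-from v s e

        at-s : ∀ s → [ lookup J s ]ᵇ * ([ insensitive ws s ]ᵇ * [ u ≤ᵇ T * err (𝐞 s) ]ᵇ + [ constant c₀ ds s ]ᵇ * [ u ≤ᵇ T * differing c₀ s ]ᵇ) ≡ 0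
        at-s s = n≤0⇒n≡0 (≤-trans (term≤∑-allFin _ s) (≤-reflexive none))

        split-J : ∀ j x y → [ j ]ᵇ * (x + y) ≡ 0 → [ j ]ᵇ * x ≡ 0 × [ j ]ᵇ * y ≡ 0
        split-J j x y eq = m+n≡0⇒m≡0 ([ j ]ᵇ * x) e , m+n≡0⇒n≡0 ([ j ]ᵇ * x) e
          where e = trans (sym (*-distribˡ-+ [ j ]ᵇ x y)) eq

        pairs-differ : ∀ s → ℕ
        pairs-differ s = ∑[ x ∈ U ] ∑[ y ∈ U ] [ lookup (x ⊕ y) s ]ᵇ

        pairs-differ≤u² : ∀ s → pairs-differ s ≤ u * u
        pairs-differ≤u² s = ≤-trans (∑-mono U (λ x → ∑≤length _ U)) (≤-reflexive (∑-const u U))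

        pairs-differ≤ : ∀ s → pairs-differ s ≤ 2 * (u * differing c₀ s)
        pairs-differ≤ s = begin
          (∑[ x ∈ U ] ∑[ y ∈ U ] [ lookup (x ⊕ y) s ]ᵇ)                                       ≤⟨ (∑-mono U λ x → ∑-mono U λ y → tri x y) ⟩
          (∑[ x ∈ U ] ∑[ y ∈ U ] ([ lookup (x ⊕ c₀) s ]ᵇ + [ lookup (y ⊕ c₀) s ]ᵇ))           ≡⟨ trans (∑-cong U (λ x → trans (∑-+ _ _ U) (cong (_+ differing c₀ s) (∑-const _ U)))) (trans (∑-+ _ _ U) (cong₂ _+_ (∑-*ˡ u _ U) (∑-const _ U))) ⟩
          u * differing c₀ s + u * differing c₀ s                                             ≡⟨ cong (u * differing c₀ s +_) (+-identityʳ _) ⟨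
          2 * (u * differing c₀ s)                                                            ∎
          where
          open ≤-Reasoning
          lem : ∀ a b c → [ a xor b ]ᵇ ≤ [ a xor c ]ᵇ + [ b xor c ]ᵇ
          lem true  true  c     = z≤n
          lem false false c     = z≤n
          lem true  false true  = s≤s z≤n
          lem true  false false = s≤s z≤n
          lem false true  true  = s≤s z≤n
          lem false true  false = s≤s z≤n
          tri : ∀ x y → [ lookup (x ⊕ y) s ]ᵇ ≤ [ lookup (x ⊕ c₀) s ]ᵇ + [ lookup (y ⊕ c₀) s ]ᵇ
          tri x y = ≤-trans (≤-reflexive (cong [_]ᵇ (lookup-⊕ x y s))) (≤-trans (lem (lookup x s) (lookup y s) (lookup c₀ s)) (≤-reflexive (cong₂ (λ a b → [ a ]ᵇ + [ b ]ᵇ) (sym (lookup-⊕ x c₀ s)) (sym (lookup-⊕ y c₀ s)))))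

        -- An undetected variable either has error below `u / T`, or it differs from `c₀` in fewer
        -- than `u / T` samples, so that fewer than `2 u² / T` pairs differ in it. The product is at
        -- most `2 u³ / T` in both cases.
        contribution : ∀ s → T * ([ undetected s ]ᵇ * (pairs-differ s * err (𝐞 s))) ≤ [ lookup J s ]ᵇ * (2 * (u * (u * u)))
        contribution s with lookup J s in Js | lookup detected s in ds′
        ... | false | _    = ≤-trans (≤-reflexive (*-zeroʳ T)) z≤n
        ... | true  | true = ≤-trans (≤-reflexive (*-zeroʳ T)) z≤n
        ... | true  | false with lookup (sensitive-in J ws) s in ss | lookup different s in dfs | trans (sym (lookup-⊙ (sensitive-in J ws) different s)) ds′
        ...   | false | _ | _ = begin
          T * (pairs-differ s * err (𝐞 s) + 0)     ≡⟨ l1 T (pairs-differ s) (err (𝐞 s)) ⟩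
          pairs-differ s * (T * err (𝐞 s))         ≤⟨ *-mono-≤ (pairs-differ≤u² s) (<⇒≤ (>ᵇ {u} {T * err (𝐞 s)} (gate Js (proj₁ (split-J (lookup J s) _ ([ constant c₀ ds s ]ᵇ * [ u ≤ᵇ T * differing c₀ s ]ᵇ) (at-s s))) insens))) ⟩
          u * u * u                                ≤⟨ ≤-trans (m≤m+n (u * u * u) _) (≤-reflexive (l2 u)) ⟩
          2 * (u * (u * u)) + 0                    ∎
          where
          open ≤-Reasoning
          l1 : ∀ t p e → t * (p * e + 0) ≡ p * (t * e)
          l1 = solve-∀
          l2 : ∀ u → u * u * u + u * u * u ≡ 2 * (u * (u * u)) + 0
          l2 = solve-∀
          insens : insensitive ws s ≡ true
          insens = all-from-none (λ w → h (w ⊕ 𝐞 s)) ws (trans (sym (trans (lookup-sensitive-in J ws s) (cong (_∧ any _ (toList ws)) Js))) ss)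
        ...   | true | false | _ = begin
          T * (pairs-differ s * err (𝐞 s) + 0)           ≡⟨ l1 T (pairs-differ s) (err (𝐞 s)) ⟩
          T * pairs-differ s * err (𝐞 s)                 ≤⟨ *-mono-≤ (*-monoʳ-≤ T (pairs-differ≤ s)) (err≤u (𝐞 s)) ⟩
          T * (2 * (u * differing c₀ s)) * u             ≡⟨ l2 T u (differing c₀ s) ⟩
          2 * (u * u) * (T * differing c₀ s)             ≤⟨ *-monoʳ-≤ (2 * (u * u)) (<⇒≤ (>ᵇ {u} {T * differing c₀ s} (gate Js (proj₂ (split-J (lookup J s) ([ insensitive ws s ]ᵇ * [ u ≤ᵇ T * err (𝐞 s) ]ᵇ) _ (at-s s))) (constant-from ds s dfs)))) ⟩
          2 * (u * u) * u                                ≡⟨ l3 u ⟩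
          2 * (u * (u * u)) + 0                          ∎
          where
          open ≤-Reasoning
          l1 : ∀ t p e → t * (p * e + 0) ≡ t * p * e
          l1 = solve-∀
          l2 : ∀ t u r → t * (2 * (u * r)) * u ≡ 2 * (u * u) * (t * r)
          l2 = solve-∀
          l3 : ∀ u → 2 * (u * u) * u ≡ 2 * (u * (u * u)) + 0
          l3 = solve-∀

      -- One half of the budget `1 / D₁` goes to the old `bound`, the other to the at most `size J`
      -- undetected variables.
      bound′-small : ∀ D₁ → 2 * D₁ ≤ D′ → 4 * (size J * D₁) ≤ T → 0 < T →
        D₁ * (∑[ x ∈ U ] ∑[ y ∈ U ] bound′ x y) ≤ u * (u * u)
      bound′-small D₁ D′-large T-large 0<T = *-cancelˡ-≤ (2 * T) {{>-nonZero (*-mono-≤ (s≤s (z≤n {1})) 0<T)}} (begin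
        2 * T * (D₁ * (∑[ x ∈ U ] ∑[ y ∈ U ] bound′ x y))     ≡⟨ cong (λ z → 2 * T * (D₁ * z)) split ⟩
        2 * T * (D₁ * (M + V))                                ≡⟨ l1 T D₁ M V ⟩
        T * (2 * D₁ * M) + 2 * D₁ * (T * V)                   ≤⟨ +-mono-≤ (*-monoʳ-≤ T (≤-trans (*-monoˡ-≤ M D′-large) bound-small)) (*-monoʳ-≤ (2 * D₁) TV) ⟩
        T * (u * (u * u)) + 2 * D₁ * (size J * (2 * (u * (u * u)))) ≡⟨ l2 T D₁ (size J) (u * (u * u)) ⟩
        T * (u * (u * u)) + 4 * (size J * D₁) * (u * (u * u)) ≤⟨ +-monoʳ-≤ (T * (u * (u * u))) (*-monoˡ-≤ (u * (u * u)) T-large) ⟩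
        T * (u * (u * u)) + T * (u * (u * u))                 ≡⟨ l3 T (u * (u * u)) ⟩
        2 * T * (u * (u * u))                                 ∎)
        where
        open ≤-Reasoning
        V = ∑[ s ∈ allFin n ] [ undetected s ]ᵇ * (pairs-differ s * err (𝐞 s))
        l1 : ∀ t d m v → 2 * t * (d * (m + v)) ≡ t * (2 * d * m) + 2 * d * (t * v)
        l1 = solve-∀
        l2 : ∀ t d j u → t * u + 2 * d * (j * (2 * u)) ≡ t * u + 4 * (j * d) * u
        l2 = solve-∀
        l3 : ∀ t u → t * u + t * u ≡ 2 * t * u
        l3 = solve-∀
        split : (∑[ x ∈ U ] ∑[ y ∈ U ] bound′ x y) ≡ M + V
        split = trans (∑-cong U (λ x → ∑-+ _ _ U)) (trans (∑-+ _ _ U) (cong (M +_) (begin-equality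
          (∑[ x ∈ U ] ∑[ y ∈ U ] ∑[ s ∈ allFin n ] [ undetected s ]ᵇ * ([ lookup (x ⊕ y) s ]ᵇ * err (𝐞 s)))
            ≡⟨ trans (∑-cong U (λ x → ∑-swap _ U (allFin n))) (∑-swap _ U (allFin n)) ⟩
          (∑[ s ∈ allFin n ] ∑[ x ∈ U ] ∑[ y ∈ U ] [ undetected s ]ᵇ * ([ lookup (x ⊕ y) s ]ᵇ * err (𝐞 s)))
            ≡⟨ ∑-cong (allFin n) (λ s → trans (∑-cong U (λ x → trans (∑-*ˡ [ undetected s ]ᵇ _ U) (cong ([ undetected s ]ᵇ *_) (∑-*ʳ (err (𝐞 s)) _ U)))) (trans (∑-*ˡ [ undetected s ]ᵇ _ U) (cong ([ undetected s ]ᵇ *_) (∑-*ʳ (err (𝐞 s)) _ U)))) ⟩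
          V ∎)))
        TV : T * V ≤ size J * (2 * (u * (u * u)))
        TV = ≤-trans (≤-reflexive (sym (∑-*ˡ T _ (allFin n)))) (≤-trans (∑-allFin-mono contribution) (≤-reflexive (trans (∑-*ʳ _ _ (allFin n)) (cong (_* (2 * (u * (u * u)))) (∑-size J)))))
          where
          ∑-size : ∀ {m} (J : Point m) → (∑[ s ∈ allFin m ] [ lookup J s ]ᵇ) ≡ size J
          ∑-size []      = refl
          ∑-size (c ∷ J) = trans (∑-allFin (λ s → [ lookup (c ∷ J) s ]ᵇ)) (cong ([ c ]ᵇ +_) (∑-size J))

-- Error estimates

distance : BoolFun n → BoolFun n → ℕ
distance {n} f g = ∑[ x ∈ allPoints n ] [ xorB (f x) (g x) ]ᵇ

agree-lookup : ∀ (A x y : Point n) → agree A x y ≡ true → ∀ i → lookup A i ≡ true → lookup x i ≡ lookup y i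
agree-lookup A x y ag i Ai = lem (lookup x i) (lookup y i) (trans (sym (trans (lookup-⊙ (x ⊕ y) A i) (trans (cong₂ _∧_ (lookup-⊕ x y i) Ai) (∧-identityʳ _)))) (≡𝟎⇒ ((x ⊕ y) ⊙ A) ag i))
  where
  lem : ∀ a b → a xor b ≡ false → a ≡ b
  lem true  true  _ = refl
  lem false false _ = refl

-- If the hypothesis is far from h, then many probes fail: the quantities are those of `Verification`.
module SoundArithmetic (u b c d rej t a off wrong dist e D Q M N₂ kk : ℕ)
  (D-large : 26 * (300 * N₂) ≤ D) (M-large : 2 * (300 * N₂) ≤ M) (Q-large : 4 * kk * (300 * N₂) ≤ Q)
  (N₂-large : 100 * (4 * (1 + 2 * e)) ≤ N₂) (0<e : 0 < e) (0<kk : 0 < kk)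
  (base : D * off ≤ 2 * u) (a+off : a + off ≡ u) (t≤ : t ≤ b + u) (drift≤ : Q * d ≤ 2 * kk * u)
  (dist≤ : dist ≤ off + wrong + b) (mostly-right : M * wrong < u) (far : u < e * dist)
  (lower : D * a * c * b ≤ t * (D * rej + c * (4 * u)) + D * a * c * d) where

  private
    -- From `total ≤ b + u` and `u < 2 e b`: at least one in `τ` points accepted by the hypothesis
    -- is bad.
    τ = 1 + 2 * e

    0<N₂ : 0 < N₂
    0<N₂ = ≤-trans (s≤s z≤n) N₂-large

    16≤D : 16 ≤ D
    16≤D = ≤-trans (*-mono-≤ {16} {26} {1} {300 * N₂} (m≤m+n 16 10) (*-mono-≤ {1} {300} (s≤s z≤n) 0<N₂)) D-large

    16off≤2u : 16 * off ≤ 2 * u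
    16off≤2u = ≤-trans (*-monoˡ-≤ off 16≤D) base

    τ≤N₂ : 400 * τ ≤ N₂
    τ≤N₂ = ≤-trans (≤-reflexive (lem τ)) N₂-large
      where
      lem : ∀ t → 400 * t ≡ 100 * (4 * t)
      lem = solve-∀

    e≤τ : 2 * e ≤ τ
    e≤τ = m≤n+m (2 * e) 1

    64τ≤D : 64 * τ ≤ D
    64τ≤D = ≤-trans (*-monoˡ-≤ τ (m≤m+n 64 336)) (≤-trans τ≤N₂ (≤-trans (m≤m+n N₂ _) (≤-trans (≤-reflexive (lem N₂)) D-large)))
      where
      lem : ∀ N → N + 7799 * N ≡ 26 * (300 * N)
      lem = solve-∀

    4e≤M : 4 * e ≤ M
    4e≤M = ≤-trans (≤-reflexive (l1 e)) (≤-trans (*-monoʳ-≤ 2 e≤τ) (≤-trans (*-monoˡ-≤ τ (m≤m+n 2 398)) (≤-trans τ≤N₂ (≤-trans (m≤m+n N₂ _) (≤-trans (≤-reflexive (l2 N₂)) M-large)))))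
      where
      l1 : ∀ e → 4 * e ≡ 2 * (2 * e)
      l1 = solve-∀
      l2 : ∀ N → N + 599 * N ≡ 2 * (300 * N)
      l2 = solve-∀

    16eK≤Q : 16 * (e * kk) ≤ Q
    16eK≤Q = ≤-trans (≤-reflexive (l1 e kk)) (≤-trans (*-monoʳ-≤ (8 * kk) e≤τ) (≤-trans (≤-reflexive (l2 kk τ)) (≤-trans (*-monoʳ-≤ (4 * kk) (≤-trans (*-monoˡ-≤ τ (m≤m+n 2 398)) (≤-trans τ≤N₂ (m≤m+n N₂ _)))) (≤-trans (≤-reflexive (cong (4 * kk *_) (l3 N₂))) Q-large))))
      where
      l1 : ∀ e k → 16 * (e * k) ≡ 8 * k * (2 * e)
      l1 = solve-∀
      l2 : ∀ k t → 8 * k * t ≡ 4 * k * (2 * t)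
      l2 = solve-∀
      l3 : ∀ N → N + 299 * N ≡ 300 * N
      l3 = solve-∀

    8e≤D : 8 * e ≤ D
    8e≤D = ≤-trans (≤-reflexive (lem e)) (≤-trans (*-monoʳ-≤ 4 e≤τ) (≤-trans (*-monoˡ-≤ τ (m≤m+n 4 60)) 64τ≤D))
      where
      lem : ∀ e → 8 * e ≡ 4 * (2 * e)
      lem = solve-∀

    -- The distance exceeds `u / e`. Samples off the subcube and wrong readings account for at most
    -- `u / 4e` each, so more than `u / 2e` is left for the bad points.
    u<2eb : u < 2 * (e * b)
    u<2eb = *-cancelˡ-< 2 u _ (+-cancelˡ-< (2 * u) _ _ (begin-strict
      2 * u + 2 * u                                         ≡⟨ l1 u ⟩
      4 * u                                                 <⟨ *-monoʳ-< 4 far ⟩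
      4 * (e * dist)                   ≤⟨ *-monoʳ-≤ 4 (*-monoʳ-≤ e dist≤) ⟩
      4 * (e * (off + wrong + b))                       ≡⟨ l2 e off wrong b ⟩
      4 * e * off + 4 * e * wrong + 2 * (2 * (e * b))   ≤⟨ +-monoˡ-≤ _ (+-mono-≤ 4e·off (≤-trans (*-monoˡ-≤ wrong 4e≤M) (<⇒≤ mostly-right))) ⟩
      u + u + 2 * (2 * (e * b))                             ≡⟨ cong (_+ 2 * (2 * (e * b))) (l3 u) ⟩
      2 * u + 2 * (2 * (e * b))                             ∎))
      where
      open ≤-Reasoning
      l1 : ∀ u → 2 * u + 2 * u ≡ 4 * u
      l1 = solve-∀
      l2 : ∀ e o w b → 4 * (e * (o + w + b)) ≡ 4 * e * o + 4 * e * w + 2 * (2 * (e * b))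
      l2 = solve-∀
      l3 : ∀ u → u + u ≡ 2 * u
      l3 = solve-∀
      l4 : ∀ e o → 2 * (4 * e * o) ≡ 8 * e * o
      l4 = solve-∀
      4e·off : 4 * e * off ≤ u
      4e·off = *-cancelˡ-≤ 2 (≤-trans (≤-reflexive (l4 e off)) (≤-trans (*-monoˡ-≤ off 8e≤D) base))

    0<b : 0 < b
    0<b = n≢0⇒n>0 λ { refl → n≮0 (≤-trans u<2eb (≤-reflexive (cong (2 *_) (*-zeroʳ e)))) }

    total≤τb : t ≤ τ * b
    total≤τb = ≤-trans t≤ (≤-trans (+-monoʳ-≤ b (<⇒≤ u<2eb)) (≤-reflexive (lem e b)))
      where
      lem : ∀ e b → b + 2 * (e * b) ≡ (1 + 2 * e) * b
      lem = solve-∀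

    4d≤b : 4 * d ≤ b
    4d≤b = *-cancelˡ-≤ (4 * (e * kk)) {{>-nonZero (*-mono-≤ {1} {4} (s≤s z≤n) (*-mono-≤ 0<e 0<kk))}} (begin
      4 * (e * kk) * (4 * d)       ≡⟨ l1 (e * kk) d ⟩
      16 * (e * kk) * d            ≤⟨ *-monoˡ-≤ d 16eK≤Q ⟩
      Q * d                        ≤⟨ drift≤ ⟩
      2 * kk * u                   ≤⟨ *-monoʳ-≤ (2 * kk) (<⇒≤ u<2eb) ⟩
      2 * kk * (2 * (e * b))       ≡⟨ l2 kk e b ⟩
      4 * (e * kk) * b             ∎)
      where
      open ≤-Reasoning
      l1 : ∀ x d → 4 * x * (4 * d) ≡ 16 * x * d
      l1 = solve-∀
      l2 : ∀ k e b → 2 * k * (2 * (e * b)) ≡ 4 * (e * k) * b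
      l2 = solve-∀

    7u≤8a : 7 * u ≤ 8 * a
    7u≤8a = +-cancelʳ-≤ (8 * off) _ _ (begin
      7 * u + 8 * off       ≤⟨ +-monoʳ-≤ (7 * u) (*-cancelˡ-≤ 2 (≤-trans (≤-reflexive (l1 off)) 16off≤2u)) ⟩
      7 * u + u               ≡⟨ l2 u ⟩
      8 * u                   ≡⟨ cong (8 *_) a+off ⟨
      8 * (a + off)         ≡⟨ *-distribˡ-+ 8 a off ⟩
      8 * a + 8 * off       ∎)
      where
      open ≤-Reasoning
      l1 : ∀ o → 2 * (8 * o) ≡ 16 * o
      l1 = solve-∀
      l2 : ∀ u → 7 * u + u ≡ 8 * u
      l2 = solve-∀

  many-rejections : u * c ≤ 2 * ((1 + 2 * e) * rej)
  -- This is `lower` times 32, with the left side split as 24 + 8. By `24 a ≥ 21 u` the first part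
  -- gives `21 u`, of which 2 pay for the nudge by `64 τ ≤ D`; the second part pays for the junk by
  -- `4 d ≤ b`. What remains is `19 u c ≤ 32 τ rej`.
  many-rejections = *-cancelˡ-≤ 16 (≤-trans (*-monoˡ-≤ (u * c) (m≤m+n 16 3)) (≤-trans (*-cancelˡ-≤ (D * b) {{m*n≢0 D b {{>-nonZero (≤-trans (s≤s z≤n) 16≤D)}} {{>-nonZero 0<b}}}} (+-cancelʳ-≤ (2 * D * a * c * b * 4 + 2 * D * b * c * u) _ _ (begin
    D * b * (19 * (u * c)) + (2 * D * a * c * b * 4 + 2 * D * b * c * u)   ≡⟨ l1 D b u c a ⟩
    3 * (D * b * c) * (7 * u) + 8 * (D * a * c * b)                        ≤⟨ +-monoˡ-≤ (8 * (D * a * c * b)) (*-monoʳ-≤ (3 * (D * b * c)) 7u≤8a) ⟩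
    3 * (D * b * c) * (8 * a) + 8 * (D * a * c * b)                        ≡⟨ l2 D b c a ⟩
    32 * (D * a * c * b)                                                   ≤⟨ *-monoʳ-≤ 32 lower ⟩
    32 * (t * (D * rej + c * (4 * u)) + D * a * c * d)             ≤⟨ *-monoʳ-≤ 32 (+-monoˡ-≤ _ (*-monoˡ-≤ _ total≤τb)) ⟩
    32 * (τ * b * (D * rej + c * (4 * u)) + D * a * c * d)                 ≡⟨ l3 τ b D rej c u a d ⟩
    D * b * (32 * (τ * rej)) + 2 * D * a * c * (4 * (4 * d)) + 2 * (64 * τ) * b * c * u
      ≤⟨ +-mono-≤ (+-monoʳ-≤ (D * b * (32 * (τ * rej))) (*-monoʳ-≤ (2 * D * a * c) (*-monoʳ-≤ 4 4d≤b))) (*-monoˡ-≤ u (*-monoˡ-≤ c (*-monoˡ-≤ b (*-monoʳ-≤ 2 64τ≤D)))) ⟩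
    D * b * (32 * (τ * rej)) + 2 * D * a * c * (4 * b) + 2 * D * b * c * u ≡⟨ l4 D b (τ * rej) a c u ⟩
    D * b * (32 * (τ * rej)) + (2 * D * a * c * b * 4 + 2 * D * b * c * u) ∎))) (≤-reflexive (l5 (τ * rej)))))
    where
    open ≤-Reasoning
    l1 : ∀ D b u c a → D * b * (19 * (u * c)) + (2 * D * a * c * b * 4 + 2 * D * b * c * u) ≡ 3 * (D * b * c) * (7 * u) + 8 * (D * a * c * b)
    l1 = solve-∀
    l2 : ∀ D b c a → 3 * (D * b * c) * (8 * a) + 8 * (D * a * c * b) ≡ 32 * (D * a * c * b)
    l2 = solve-∀
    l3 : ∀ t b D r c u a d → 32 * (t * b * (D * r + c * (4 * u)) + D * a * c * d) ≡ D * b * (32 * (t * r)) + 2 * D * a * c * (4 * (4 * d)) + 2 * (64 * t) * b * c * u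
    l3 = solve-∀
    l4 : ∀ D b x a c u → D * b * (32 * x) + 2 * D * a * c * (4 * b) + 2 * D * b * c * u ≡ D * b * (32 * x) + (2 * D * a * c * b * 4 + 2 * D * b * c * u)
    l4 = solve-∀
    l5 : ∀ x → 32 * x ≡ 16 * (2 * x)
    l5 = solve-∀

  wrong<u : wrong < u
  wrong<u = ≤-trans (s≤s (≤-trans (≤-reflexive (sym (*-identityˡ wrong))) (*-monoˡ-≤ wrong (≤-trans (*-mono-≤ {1} {4} (s≤s z≤n) 0<e) 4e≤M)))) mostly-right

-- A hypothesis no larger than a nearly correct one, and right on almost all of h⁻¹(1), fails few probes.
module CompleteArithmetic (u b c d rej t tm hit near off wrong D Q M N₂ kk : ℕ)
  (D-large : 26 * (300 * N₂) ≤ D) (M-large : 2 * (300 * N₂) ≤ M) (Q-large : 4 * kk * (300 * N₂) ≤ Q)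
  (0<N₂ : 0 < N₂) (0<kk : 0 < kk) (0<u : 0 < u)
  (base : D * off ≤ 2 * u) (near≤ : D * near ≤ 8 * u) (t≡ : t ≡ b + hit) (t≤tm : t ≤ tm) (tm≤ : tm ≤ u + near)
  (u≤ : u ≤ hit + (off + wrong)) (drift≤ : Q * d ≤ 2 * kk * u) (mostly-right : M * wrong < u)
  (upper : D * t * rej ≤ D * u * c * (b + d) + t * c * (6 * u)) where

  private
    Y = 300 * N₂

    16≤D : 16 ≤ D
    16≤D = ≤-trans (*-mono-≤ {16} {26} {1} {300 * N₂} (m≤m+n 16 10) (*-mono-≤ {1} {300} (s≤s z≤n) 0<N₂)) D-large

    16off≤2u : 16 * off ≤ 2 * u
    16off≤2u = ≤-trans (*-monoˡ-≤ off 16≤D) base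

    -- The hypothesis accepts no more of the subcube than the model, at most `u + near` points, and
    -- at least `u - off - wrong` of them lie in `h⁻¹(1)`.
    bad≤ : b ≤ near + (off + wrong)
    bad≤ = +-cancelʳ-≤ (hit) _ _ (begin
      b + hit                                     ≡⟨ t≡ ⟨
      t                                                   ≤⟨ ≤-trans t≤tm tm≤ ⟩
      u + near                                      ≤⟨ +-monoˡ-≤ (near) (u≤) ⟩
      hit + (off + wrong) + near        ≡⟨ lem (hit) (off + wrong) (near) ⟩
      near + (off + wrong) + hit        ∎)
      where
      open ≤-Reasoning
      lem : ∀ a b c → a + b + c ≡ c + b + a
      lem = solve-∀

    4≤M : 4 ≤ M
    4≤M = ≤-trans (*-monoʳ-≤ 2 {2} {Y} (≤-trans (m≤m+n 2 298) (≤-trans (≤-reflexive (sym (*-identityʳ 300))) (*-monoʳ-≤ 300 0<N₂)))) M-large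

    u≤2t : u ≤ 2 * t
    u≤2t = *-cancelˡ-≤ 2 (+-cancelʳ-≤ (4 * (off + wrong)) _ _ (begin
      2 * u + 4 * (off + wrong)          ≡⟨ l1 u off wrong ⟩
      2 * u + (4 * off + 4 * wrong)      ≤⟨ +-monoʳ-≤ (2 * u) (+-mono-≤ 4off≤u (≤-trans (*-monoˡ-≤ wrong 4≤M) (<⇒≤ mostly-right))) ⟩
      2 * u + (u + u)                        ≡⟨ l3 u ⟩
      4 * u                                  ≤⟨ *-monoʳ-≤ 4 (u≤) ⟩
      4 * (hit + (off + wrong))  ≤⟨ *-monoʳ-≤ 4 (+-monoˡ-≤ _ (≤-trans (m≤n+m _ b) (≤-reflexive (sym t≡)))) ⟩
      4 * (t + (off + wrong))            ≡⟨ l4 t (off + wrong) ⟩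
      2 * (2 * t) + 4 * (off + wrong)    ∎))
      where
      open ≤-Reasoning
      l1 : ∀ u o w → 2 * u + 4 * (o + w) ≡ 2 * u + (4 * o + 4 * w)
      l1 = solve-∀
      l2 : ∀ o → 4 * (4 * o) ≡ 16 * o
      l2 = solve-∀
      4off≤u : 4 * off ≤ u
      4off≤u = *-cancelˡ-≤ 4 (≤-trans (≤-reflexive (l2 off)) (≤-trans 16off≤2u (*-monoˡ-≤ u (m≤m+n 2 2))))
      l3 : ∀ u → 2 * u + (u + u) ≡ 4 * u
      l3 = solve-∀
      l4 : ∀ t x → 4 * (t + x) ≡ 2 * (2 * t) + 4 * x
      l4 = solve-∀

    Y·wrong : Y * wrong ≤ t
    Y·wrong = *-cancelˡ-≤ 2 (≤-trans (≤-reflexive (sym (*-assoc 2 Y wrong))) (≤-trans (*-monoˡ-≤ wrong M-large) (≤-trans (<⇒≤ mostly-right) u≤2t)))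

    Y·drift : Y * d ≤ t
    Y·drift = *-cancelˡ-≤ (4 * kk) {{m*n≢0 4 kk {{_}} {{>-nonZero 0<kk}}}} (begin
      4 * kk * (Y * d)     ≡⟨ *-assoc (4 * kk) Y d ⟨
      4 * kk * Y * d       ≤⟨ *-monoˡ-≤ d Q-large ⟩
      Q * d                ≤⟨ drift≤ ⟩
      2 * kk * u           ≤⟨ *-monoʳ-≤ (2 * kk) u≤2t ⟩
      2 * kk * (2 * t)     ≡⟨ lem kk t ⟩
      4 * kk * t           ∎)
      where
      open ≤-Reasoning
      lem : ∀ k t → 2 * k * (2 * t) ≡ 4 * k * t
      lem = solve-∀

    0<t : 0 < t
    0<t = n≢0⇒n>0 λ { refl → <-irrefl refl (≤-trans 0<u u≤2t) }

    Y·rej : Y * rej ≤ 3 * (c * u)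
    -- The constant 26 is 20 + 6: `10 u` from `near` and `off`, doubled by `u ≤ 2 t`, and the direct
    -- loss `6 u`. Together they make one unit `c u`; wrong readings and drift are the other two.
    Y·rej = *-cancelˡ-≤ (D * t) {{m*n≢0 D t {{>-nonZero (≤-trans (s≤s z≤n) 16≤D)}} {{>-nonZero 0<t}}}} (begin
      D * t * (Y * rej)                                               ≡⟨ l1 (D * t) Y rej ⟩
      Y * (D * t * rej)                                               ≤⟨ *-monoʳ-≤ Y upper ⟩
      Y * (D * u * c * (b + d) + t * c * (6 * u))                     ≤⟨ *-monoʳ-≤ Y (+-monoˡ-≤ _ (*-monoʳ-≤ (D * u * c) (+-monoˡ-≤ d bad≤))) ⟩
      Y * (D * u * c * (near + (off + wrong) + d) + t * c * (6 * u)) ≡⟨ l2 Y D u c near off wrong d t ⟩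
      Y * u * c * (D * near + D * off) + D * u * c * (Y * wrong + Y * d) + Y * (t * c * (6 * u))
        ≤⟨ +-monoˡ-≤ _ (+-mono-≤ (*-monoʳ-≤ (Y * u * c) (+-mono-≤ near≤ base)) (*-monoʳ-≤ (D * u * c) (+-mono-≤ Y·wrong Y·drift))) ⟩
      Y * u * c * (8 * u + 2 * u) + D * u * c * (t + t) + Y * (t * c * (6 * u))  ≡⟨ l3 Y u c D t ⟩
      Y * 10 * u * c * u + D * u * c * (t + t) + Y * 6 * t * c * u   ≤⟨ +-monoˡ-≤ _ (+-monoˡ-≤ _ (*-monoʳ-≤ (Y * 10 * u * c) u≤2t)) ⟩
      Y * 10 * u * c * (2 * t) + D * u * c * (t + t) + Y * 6 * t * c * u   ≡⟨ l4 Y u c D t ⟩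
      26 * Y * (u * c * t) + D * (2 * (u * c * t))                    ≤⟨ +-monoˡ-≤ _ (*-monoˡ-≤ (u * c * t) D-large) ⟩
      D * (u * c * t) + D * (2 * (u * c * t))                         ≡⟨ l5 D u c t ⟩
      D * t * (3 * (c * u))                                           ∎)
      where
      open ≤-Reasoning
      l1 : ∀ x Y r → x * (Y * r) ≡ Y * (x * r)
      l1 = solve-∀
      l2 : ∀ Y D u c m o w d t → Y * (D * u * c * (m + (o + w) + d) + t * c * (6 * u)) ≡ Y * u * c * (D * m + D * o) + D * u * c * (Y * w + Y * d) + Y * (t * c * (6 * u))
      l2 = solve-∀
      l3 : ∀ Y u c D t → Y * u * c * (8 * u + 2 * u) + D * u * c * (t + t) + Y * (t * c * (6 * u)) ≡ Y * 10 * u * c * u + D * u * c * (t + t) + Y * 6 * t * c * u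
      l3 = solve-∀
      l4 : ∀ Y u c D t → Y * 10 * u * c * (2 * t) + D * u * c * (t + t) + Y * 6 * t * c * u ≡ 26 * Y * (u * c * t) + D * (2 * (u * c * t))
      l4 = solve-∀
      l5 : ∀ D u c t → D * (u * c * t) + D * (2 * (u * c * t)) ≡ D * t * (3 * (c * u))
      l5 = solve-∀

  few-rejections : 100 * N₂ * rej ≤ c * u
  few-rejections = *-cancelˡ-≤ 3 (≤-trans (≤-reflexive (lem N₂ rej)) Y·rej)
    where
    lem : ∀ N r → 3 * (100 * N * r) ≡ 300 * N * r
    lem = solve-∀

-- Learning and verification with ideal readings

module SecondPhase {n : ℕ} (h : BoolFun n) (0<u : 0 < supportSize h) (k r : ℕ)
  (J : Point n) (D : ℕ) (core : Core h J D) (π : Vec (Point k) n) (c₀ : Point n) (reading : Reading π c₀ J)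
  (Q M N₂ e L : ℕ)
  (D-large : 26 * (300 * N₂) ≤ D) (M-large : 2 * (300 * N₂) ≤ M) (Q-large : 4 * 2 ^ k * (300 * N₂) ≤ Q)
  (N₂-large : 100 * (4 * (1 + 2 * e)) ≤ N₂) (0<e : 0 < e)
  (L-large : 100 * length (codes (2 ^ k) r) ≤ 2 ^ L) (D-larger : 1000 * (M * L) ≤ D)
  (drift≤ : Q * (∑[ j ∈ allPoints k ] 2 * Error.err h (Reading.junk reading ⊙ block π j)) ≤ 2 * 2 ^ k * supportSize h)
  where
  open Error h
  open Tester h k r
  open Core core
  open Reading reading
  open Phase₂ π obs (J ⊕ junk) β

  private
    0<N₂ : 0 < N₂
    0<N₂ = ≤-trans (s≤s z≤n) N₂-large

    fixed : Point n
    fixed = ∁ (J ∪ᵖ free)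

  module V (g : Code K r) = Verification h J D core π c₀ reading (eval obs g) (eval-obs obs g)

  private
    off : ℕ
    off = ∑[ y ∈ U ] [ not (agree fixed y x₀) ]ᵇ

    wrong near : Code K r → ℕ
    wrong g = ∑[ x ∈ U ] [ not (eval obs g (β x)) ]ᵇ
    near g = ∑[ y ∈ P ] [ agree fixed y x₀ ]ᵇ * [ eval obs g (β y) xor h y ]ᵇ

  hypothesis : Code K r → BoolFun n
  hypothesis g x = agree fixed x x₀ ∧ eval obs g (β x)

  hypothesis-factored : ∀ {μ} → size J ≤ μ → ∀ g → IsFactoredDNF r μ (hypothesis g)
  hypothesis-factored J≤μ g = Translation.factored π c₀ J reading g fixed x₀ J≤μ
    (λ i di → trans (lookup-∁ (J ∪ᵖ free) i) (cong not (trans (lookup-∪ᵖ J free i) (cong (_∨ lookup free i) di))))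

  distance≤ : ∀ g → distance h (hypothesis g) ≤ off + wrong g + V.bad g
  distance≤ g = begin
    distance h (hypothesis g)                                                 ≤⟨ ∑-mono P (λ x → lem (h x) (agree fixed x x₀) (eval obs g (β x))) ⟩
    (∑[ x ∈ P ] ([ h x ]ᵇ * [ not (agree fixed x x₀) ]ᵇ + [ h x ]ᵇ * [ not (eval obs g (β x)) ]ᵇ + [ agree fixed x x₀ ]ᵇ * ([ eval obs g (β x) ]ᵇ * [ not (h x) ]ᵇ)))
      ≡⟨ trans (∑-+ _ _ P) (cong (_+ V.bad g) (∑-+ _ _ P)) ⟩
    (∑[ x ∈ P ] [ h x ]ᵇ * [ not (agree fixed x x₀) ]ᵇ) + (∑[ x ∈ P ] [ h x ]ᵇ * [ not (eval obs g (β x)) ]ᵇ) + V.bad g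
      ≡⟨ cong₂ (λ a b → a + b + V.bad g) (sym (∑-support _)) (sym (∑-support _)) ⟩
    off + wrong g + V.bad g ∎
    where
    open ≤-Reasoning
    lem : ∀ a b c → [ xorB a (b ∧ c) ]ᵇ ≤ [ a ]ᵇ * [ not b ]ᵇ + [ a ]ᵇ * [ not c ]ᵇ + [ b ]ᵇ * ([ c ]ᵇ * [ not a ]ᵇ)
    lem true  true  true  = z≤n
    lem true  true  false = s≤s z≤n
    lem true  false c     = s≤s z≤n
    lem false true  true  = s≤s z≤n
    lem false true  false = z≤n
    lem false false c     = z≤n

  private
    hit-total : Code K r → ℕ
    hit-total g = ∑[ y ∈ P ] [ agree fixed y x₀ ]ᵇ * ([ eval obs g (β y) ]ᵇ * [ h y ]ᵇ)

    total-split : ∀ g → V.total g ≡ V.bad g + hit-total g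
    total-split g = trans (∑-cong P (λ y → lem [ agree fixed y x₀ ]ᵇ (eval obs g (β y)) (h y))) (∑-+ _ _ P)
      where
      lem : ∀ a b c → a * [ b ]ᵇ ≡ a * ([ b ]ᵇ * [ not c ]ᵇ) + a * ([ b ]ᵇ * [ c ]ᵇ)
      lem a true  true  = sym (trans (cong (_+ a * 1) (*-zeroʳ a)) refl)
      lem a true  false = sym (trans (cong (a * 1 +_) (*-zeroʳ a)) (+-identityʳ _))
      lem a false c     = trans (*-zeroʳ a) (sym (trans (cong₂ _+_ (*-zeroʳ a) (*-zeroʳ a)) refl))

    hit-total≤u : ∀ g → hit-total g ≤ u
    hit-total≤u g = ≤-trans (∑-mono P (λ y → lem (agree fixed y x₀) (eval obs g (β y)) (h y))) (≤-reflexive (trans (sym (∑-support (λ _ → 1))) (∑-one U)))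
      where
      lem : ∀ a b c → [ a ]ᵇ * ([ b ]ᵇ * [ c ]ᵇ) ≤ [ c ]ᵇ * 1
      lem true  true  true  = ≤-refl
      lem true  true  false = z≤n
      lem true  false c     = z≤n
      lem false b     c     = z≤n

    total≤ : ∀ g → V.total g ≤ V.bad g + u
    total≤ g = ≤-trans (≤-reflexive (total-split g)) (+-monoʳ-≤ (V.bad g) (hit-total≤u g))

    u≤hit-total : ∀ g → u ≤ hit-total g + (off + wrong g)
    u≤hit-total g = begin
      u                                                   ≡⟨ trans (sym (∑-one U)) (∑-support (λ _ → 1)) ⟩
      (∑[ y ∈ P ] [ h y ]ᵇ * 1)                           ≤⟨ ∑-mono P (λ y → lem (agree fixed y x₀) (eval obs g (β y)) (h y)) ⟩
      (∑[ y ∈ P ] ([ agree fixed y x₀ ]ᵇ * ([ eval obs g (β y) ]ᵇ * [ h y ]ᵇ) + ([ h y ]ᵇ * [ not (agree fixed y x₀) ]ᵇ + [ h y ]ᵇ * [ not (eval obs g (β y)) ]ᵇ)))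
        ≡⟨ trans (∑-+ _ _ P) (cong (hit-total g +_) (trans (∑-+ _ _ P) (cong₂ _+_ (sym (∑-support _)) (sym (∑-support _))))) ⟩
      hit-total g + (off + wrong g)                     ∎
      where
      open ≤-Reasoning
      lem : ∀ a b c → [ c ]ᵇ * 1 ≤ [ a ]ᵇ * ([ b ]ᵇ * [ c ]ᵇ) + ([ c ]ᵇ * [ not a ]ᵇ + [ c ]ᵇ * [ not b ]ᵇ)
      lem a     b     false = z≤n
      lem true  true  true  = ≤-refl
      lem true  false true  = ≤-refl
      lem false b     true  = s≤s z≤n

  Probes : List (Point n × Vec (Point K) (2 ^ K))
  Probes = cartesianProduct U (vecs (allPoints K) (2 ^ K))

  private
    rejected-probe : ∀ g f σ → [ not (probe f σ) ]ᵇ ≡ maybe (λ σ → [ not (h (V.probe g f σ)) ]ᵇ) 0 σ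
    rejected-probe g f nothing  = refl
    rejected-probe g f (just σ) = refl

    module R (g : Code K r) = RejectionSampling (eval obs g) (allPoints K)

    rejects : Code K r → ℕ
    rejects g = ∑[ t ∈ Probes ] [ not (verdict g t) ]ᵇ

    rejects≡ : ∀ g → rejects g ≡ R.weight g (2 ^ K) * V.rejections g
    rejects≡ g = begin
      rejects g ≡⟨ ∑-pairs U _ _ ⟩
      (∑[ f ∈ U ] ∑[ seeds ∈ vecs (allPoints K) (2 ^ K) ] [ not (verdict g (f , seeds)) ]ᵇ)
        ≡⟨ ∑-cong U (λ f → trans (∑-cong (vecs (allPoints K) (2 ^ K)) (λ seeds → rejected-probe g f (first (eval obs g) seeds))) (R.∑-first g (λ σ → [ not (h (V.probe g f σ)) ]ᵇ) (2 ^ K))) ⟩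
      (∑[ f ∈ U ] R.weight g (2 ^ K) * (∑[ σ ∈ allPoints K ] [ eval obs g σ ]ᵇ * [ not (h (V.probe g f σ)) ]ᵇ))
        ≡⟨ trans (∑-*ˡ (R.weight g (2 ^ K)) _ U) (cong (R.weight g (2 ^ K) *_) (trans (∑-swap _ U (allPoints K)) (∑-cong (allPoints K) (λ σ → ∑-*ˡ [ eval obs g σ ]ᵇ _ U)))) ⟩
      R.weight g (2 ^ K) * V.rejections g ∎
      where open ≡-Reasoning

    length-seeds : length (vecs (allPoints K) (2 ^ K)) ≡ length (allPoints K) ^ length (allPoints K)
    length-seeds = trans (length-vecs (allPoints K) (2 ^ K)) (cong (length (allPoints K) ^_) (sym (length-allPoints K)))

    length-Probes : length Probes ≡ u * length (allPoints K) ^ length (allPoints K)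
    length-Probes = trans (length-cartesian _,_ U _) (cong (u *_) length-seeds)

    weight≡ : ∀ g → R.weight g (length (allPoints K)) ≡ R.weight g (2 ^ K)
    weight≡ g = cong (R.weight g) (length-allPoints K)

    0<Probes : 0 < length Probes
    0<Probes = ≤-trans (*-mono-≤ 0<u (m^n>0 (length (allPoints K)) {{>-nonZero (≤-trans (m^n>0 2 K) (≤-reflexive (sym (length-allPoints K))))}} (length (allPoints K)))) (≤-reflexive (sym length-Probes))

  FS : List (Vec (Point n × Vec (Point K) (2 ^ K)) N₂)
  FS = vecs Probes N₂

  module Sound (g : Code K r) (mostly-right : M * wrong g < u) (far : u < e * distance h (hypothesis g)) where
    private
      c = V.count g
      rej = V.rejections g
      τ = 1 + 2 * e
      -- One factor two is lost in `many-rejections`, the other because rejection sampling may find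
      -- nothing.
      ν = 4 * τ

      module Ar = SoundArithmetic u (V.bad g) c (V.drift g) rej (V.total g) (∑[ f ∈ U ] [ agree fixed f x₀ ]ᵇ) off (wrong g) (distance h (hypothesis g)) e D Q M N₂ (2 ^ k)
        D-large M-large Q-large N₂-large 0<e (m^n>0 2 k) base-agrees ([not]-∑ _ U) (total≤ g) drift≤ (distance≤ g) mostly-right far (V.rejections-lower g)

      -- An unsatisfiable code is wrong on all of `h⁻¹(1)`, so a mostly right one gives rejection
      -- sampling something to find.
      0<c : 0 < c
      0<c = n≢0⇒n>0 λ c≡0 → <-irrefl (trans (∑-cong U (λ x → cong (λ b → [ not b ]ᵇ) (never c≡0 x))) (∑-one U)) Ar.wrong<u
        where
        never : c ≡ 0 → ∀ x → eval obs g (β x) ≡ false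
        never c≡0 x with eval obs g (β x) | ∑-allPoints≡0 (λ σ → [ eval obs g σ ]ᵇ) c≡0 (β x)
        ... | false | _ = refl

      Probes≤ : length Probes ≤ ν * rejects g
      Probes≤ = begin
        length Probes                                                        ≡⟨ length-Probes ⟩
        u * length (allPoints K) ^ length (allPoints K)                      ≤⟨ *-monoʳ-≤ u (R.good*weight≥ g 0<c) ⟩
        u * (2 * (c * R.weight g (length (allPoints K))))                    ≡⟨ cong (λ z → u * (2 * (c * z))) (weight≡ g) ⟩
        u * (2 * (c * R.weight g (2 ^ K)))                                   ≡⟨ l1 u c (R.weight g (2 ^ K)) ⟩
        u * c * (2 * R.weight g (2 ^ K))                                     ≤⟨ *-monoˡ-≤ (2 * R.weight g (2 ^ K)) Ar.many-rejections ⟩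
        2 * (τ * rej) * (2 * R.weight g (2 ^ K))                             ≡⟨ l2 τ rej (R.weight g (2 ^ K)) ⟩
        4 * τ * (R.weight g (2 ^ K) * rej)                                   ≡⟨ cong (4 * τ *_) (rejects≡ g) ⟨
        ν * rejects g                                                        ∎
        where
        open ≤-Reasoning
        l1 : ∀ u c w → u * (2 * (c * w)) ≡ u * c * (2 * w)
        l1 = solve-∀
        l2 : ∀ t r w → 2 * (t * r) * (2 * w) ≡ 4 * t * (w * r)
        l2 = solve-∀

    sound : 100 * (∑[ fs ∈ FS ] [ all (verdict g) (toList fs) ]ᵇ) ≤ length FS
    sound = *-cancelʳ-≤ _ _ N₂ {{>-nonZero 0<N₂}} (begin
      100 * (∑[ fs ∈ FS ] [ all (verdict g) (toList fs) ]ᵇ) * N₂    ≡⟨ cong (λ z → 100 * z * N₂) (∑-vecs-all (verdict g) Probes N₂) ⟩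
      100 * s ^ N₂ * N₂                                             ≤⟨ *-monoʳ-≤ (100 * s ^ N₂) (m≤n+m N₂ ν) ⟩
      100 * s ^ N₂ * (ν + N₂)                                       ≡⟨ *-assoc 100 (s ^ N₂) (ν + N₂) ⟩
      100 * (s ^ N₂ * (ν + N₂))                                     ≤⟨ *-monoʳ-≤ 100 (bernoulli-fraction N₂ ([not]-∑ (verdict g) Probes) Probes≤ 0<Probes) ⟩
      100 * (length Probes ^ N₂ * ν)                                ≡⟨ lem (length Probes ^ N₂) ν ⟩
      length Probes ^ N₂ * (100 * ν)                                ≤⟨ *-monoʳ-≤ (length Probes ^ N₂) N₂-large ⟩
      length Probes ^ N₂ * N₂                                       ≡⟨ cong (_* N₂) (length-vecs Probes N₂) ⟨
      length FS * N₂                                                ∎)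
      where
      open ≤-Reasoning
      s = ∑[ t ∈ Probes ] [ verdict g t ]ᵇ
      lem : ∀ x v → 100 * (x * v) ≡ x * (100 * v)
      lem = solve-∀

  module Complete (μ : ℕ) (fact : IsFactoredDNF r μ h)
    (J⊆vars : ∀ i → lookup J i ≡ true → lookup (varsDNF (proj₁ (proj₂ fact))) i ≡ true) where
    private
      filled : Point n → Point n
      filled w = mix free w x₀

      -- Averaged over `w`, freezing all coordinates outside `J` is the same as a random translation
      -- along `free`, and `err-free` controls these.
      refill : ∀ y w → agree fixed y x₀ ≡ true → mix J y (filled (w ⊕ y)) ≡ y ⊕ (w ⊙ free)
      refill y w ag = ext λ i → trans (lookup-mix J y (filled (w ⊕ y)) i) (trans (lem i) (sym (trans (lookup-⊕ y (w ⊙ free) i) (cong (lookup y i xor_) (lookup-⊙ w free i)))))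
        where
        swap : ∀ a b → b xor a ≡ a xor (b ∧ true)
        swap a b = trans (xor-comm b a) (cong (a xor_) (sym (∧-identityʳ b)))
        lem : ∀ i → (if lookup J i then lookup y i else lookup (filled (w ⊕ y)) i) ≡ lookup y i xor (lookup w i ∧ lookup free i)
        lem i = cases (lookup J i) (lookup free i) refl refl
         where
         cases : ∀ a b → lookup J i ≡ a → lookup free i ≡ b → (if a then lookup y i else lookup (filled (w ⊕ y)) i) ≡ lookup y i xor (lookup w i ∧ b)
         cases true  true  di fi = ⊥-elim (case (trans (sym di) (free∩J i fi)))
          where
          case : true ≡ false → ⊥
          case ()
         cases true  false di fi = sym (trans (cong (lookup y i xor_) (∧-zeroʳ (lookup w i))) (xor-identityʳ _))
         cases false true  di fi = trans (lookup-mix free (w ⊕ y) x₀ i) (trans (cong (λ b → if b then lookup (w ⊕ y) i else lookup x₀ i) fi) (trans (lookup-⊕ w y i) (swap (lookup y i) (lookup w i))))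
         cases false false di fi = trans (lookup-mix free (w ⊕ y) x₀ i) (trans (cong (λ b → if b then lookup (w ⊕ y) i else lookup x₀ i) fi) (sym (trans (cong (lookup y i xor_) (∧-zeroʳ (lookup w i))) (trans (xor-identityʳ _)
          (agree-lookup fixed y x₀ ag i (trans (lookup-∁ (J ∪ᵖ free) i) (cong not (trans (lookup-∪ᵖ J free i) (cong₂ _∨_ di fi)))))))))

      gap-at : Point n → ℕ
      gap-at w = ∑[ y ∈ P ] [ agree fixed y x₀ ]ᵇ * [ h (mix J y (filled w)) xor h y ]ᵇ

      average-gap : D * ∑ P gap-at ≤ length P * (8 * u)
      average-gap = begin
        D * ∑ P gap-at
          ≡⟨ cong (D *_) (trans (∑-swap _ P P) (∑-cong P (λ y → sym (∑-shift y (λ w → [ agree fixed y x₀ ]ᵇ * [ h (mix J y (filled w)) xor h y ]ᵇ))))) ⟩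
        D * (∑[ y ∈ P ] ∑[ w ∈ P ] [ agree fixed y x₀ ]ᵇ * [ h (mix J y (filled (w ⊕ y))) xor h y ]ᵇ)
          ≤⟨ *-monoʳ-≤ D (∑-mono P λ y → ∑-mono P (step y)) ⟩
        D * (∑[ y ∈ P ] ∑[ w ∈ P ] [ h y xor h (y ⊕ (w ⊙ free)) ]ᵇ)     ≡⟨ cong (D *_) (trans (∑-swap _ P P) (∑-cong P (λ w → changes (w ⊙ free)))) ⟩
        D * (∑[ w ∈ P ] 2 * err (w ⊙ free))                             ≡⟨ ∑-*ˡ D _ P ⟨
        (∑[ w ∈ P ] D * (2 * err (w ⊙ free)))                           ≤⟨ ∑-mono P (λ w → ≤-trans (≤-reflexive (l1 D (err (w ⊙ free)))) (≤-trans (*-monoʳ-≤ 2 (err-free w)) (≤-reflexive (l2 u)))) ⟩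
        (∑[ w ∈ P ] 8 * u)                                                ≡⟨ ∑-const _ P ⟩
        length P * (8 * u)                                                ∎
        where
        open ≤-Reasoning
        l1 : ∀ d x → d * (2 * x) ≡ 2 * (d * x)
        l1 = solve-∀
        l2 : ∀ u → 2 * (4 * u) ≡ 8 * u
        l2 = solve-∀
        step : ∀ y w → [ agree fixed y x₀ ]ᵇ * [ h (mix J y (filled (w ⊕ y))) xor h y ]ᵇ ≤ [ h y xor h (y ⊕ (w ⊙ free)) ]ᵇ
        step y w = cases (agree fixed y x₀) refl
          where
          cases : ∀ a → agree fixed y x₀ ≡ a → [ a ]ᵇ * [ h (mix J y (filled (w ⊕ y))) xor h y ]ᵇ ≤ [ h y xor h (y ⊕ (w ⊙ free)) ]ᵇ
          cases false ag = z≤n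
          cases true  ag = ≤-reflexive (trans (+-identityʳ _) (cong [_]ᵇ (trans (cong (λ z → h z xor h y) (refill y w ag)) (xor-comm _ (h y)))))

      0<P : 0 < length P
      0<P = ≤-trans (m^n>0 2 n) (≤-reflexive (sym (length-allPoints n)))

      chosen : ∃ λ w → length P * gap-at w ≤ ∑ P gap-at
      chosen = let w , _ , le = ∃-≤-average gap-at (All.universal {P = λ _ → Data.Bool.T true} (λ _ → _) P) 0<P in w , le

      encoded : ∃ λ (g : Code K r) → ∀ x → eval obs g (β x) ≡ h (mix J x (filled (proj₁ chosen)))
      encoded = Translation.Encode.restriction π c₀ J reading {r} (filled (proj₁ chosen)) h fact J⊆vars

    -- The restriction of `h` to `J` over a base point whose free part is chosen such that the gap
    -- to `h` is at most average.
    model : Code K r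
    model = proj₁ encoded

    private
      near-model : D * near model ≤ 8 * u
      near-model = *-cancelˡ-≤ (length P) {{>-nonZero 0<P}} (begin
        length P * (D * near model)                  ≡⟨ lem (length P) D (near model) ⟩
        D * (length P * near model)                  ≡⟨ cong (λ z → D * (length P * z)) (∑-cong P (λ y → cong (λ b → [ agree fixed y x₀ ]ᵇ * [ b xor h y ]ᵇ) (proj₂ encoded y))) ⟩
        D * (length P * gap-at (proj₁ chosen))       ≤⟨ *-monoʳ-≤ D (proj₂ chosen) ⟩
        D * ∑ P gap-at                               ≤⟨ average-gap ⟩
        length P * (8 * u)                           ∎)
        where
        open ≤-Reasoning
        lem : ∀ p d x → p * (d * x) ≡ d * (p * x)
        lem = solve-∀

      total-model : V.total model ≤ u + near model
      total-model = ≤-trans (∑-mono P (λ y → lem (agree fixed y x₀) (eval obs model (β y)) (h y)))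
        (≤-reflexive (trans (∑-+ _ _ P) (cong (_+ near model) (trans (sym (∑-support (λ _ → 1))) (∑-one U)))))
        where
        lem : ∀ a b c → [ a ]ᵇ * [ b ]ᵇ ≤ [ c ]ᵇ * 1 + [ a ]ᵇ * [ b xor c ]ᵇ
        lem true  true  true  = ≤-refl
        lem true  true  false = ≤-refl
        lem true  false c     = z≤n
        lem false b     c     = z≤n

    wrong-model : D * wrong model ≤ 10 * u
    wrong-model = begin
      D * wrong model                           ≤⟨ *-monoʳ-≤ D split ⟩
      D * (off + near model)              ≡⟨ *-distribˡ-+ D (off) (near model) ⟩
      D * off + D * near model            ≤⟨ +-mono-≤ base-agrees near-model ⟩
      2 * u + 8 * u                             ≡⟨ l u ⟩
      10 * u                                    ∎
      where
      open ≤-Reasoning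
      l : ∀ u → 2 * u + 8 * u ≡ 10 * u
      l = solve-∀
      lem : ∀ a b c → [ c ]ᵇ * [ not b ]ᵇ ≤ [ c ]ᵇ * [ not a ]ᵇ + [ a ]ᵇ * [ b xor c ]ᵇ
      lem a     b     false = z≤n
      lem true  true  true  = z≤n
      lem true  false true  = ≤-refl
      lem false true  true  = z≤n
      lem false false true  = ≤-refl
      split : wrong model ≤ off + near model
      split = begin
        wrong model                                                         ≡⟨ ∑-support _ ⟩
        (∑[ y ∈ P ] [ h y ]ᵇ * [ not (eval obs model (β y)) ]ᵇ)             ≤⟨ ∑-mono P (λ y → lem (agree fixed y x₀) (eval obs model (β y)) (h y)) ⟩
        (∑[ y ∈ P ] ([ h y ]ᵇ * [ not (agree fixed y x₀) ]ᵇ + [ agree fixed y x₀ ]ᵇ * [ eval obs model (β y) xor h y ]ᵇ)) ≡⟨ trans (∑-+ _ _ P) (cong (_+ near model) (sym (∑-support _))) ⟩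
        off + near model                                              ∎

    module _ (g : Code K r) (smaller : V.count g ≤ V.count model) (mostly-right : M * wrong g < u) where
      private
        b = V.bad g
        c = V.count g
        d = V.drift g
        t = V.total g
        rej = V.rejections g
        Y = 300 * N₂
        kk = 2 ^ k

        -- This is what minimality of the learned code is for: in `count-total` the factors are the
        -- same for all codes, so fewer satisfying patterns mean fewer accepted points of the
        -- subcube.
        total≤model : t ≤ V.total model
        total≤model = *-cancelˡ-≤ (2 ^ K * reset-scale (J ∪ᵖ free)) {{m*n≢0 _ _ {{m^n≢0 2 K}} {{>-nonZero (reset-scale>0 (J ∪ᵖ free))}}}} (begin
          2 ^ K * reset-scale (J ∪ᵖ free) * t                ≡⟨ trans (*-assoc (2 ^ K) _ _) (sym (V.count-total g)) ⟩
          c * 2 ^ n                                                   ≤⟨ *-monoˡ-≤ (2 ^ n) smaller ⟩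
          V.count model * 2 ^ n                                       ≡⟨ trans (V.count-total model) (sym (*-assoc (2 ^ K) _ _)) ⟩
          2 ^ K * reset-scale (J ∪ᵖ free) * V.total model    ∎)
          where open ≤-Reasoning

        module Ar = CompleteArithmetic u b c d rej t (V.total model) (hit-total g) (near model) off (wrong g) D Q M N₂ (2 ^ k)
          D-large M-large Q-large 0<N₂ (m^n>0 2 k) 0<u base-agrees near-model (total-split g) total≤model total-model (u≤hit-total g) drift≤ mostly-right (V.rejections-upper g)

        rejects≤ : 100 * N₂ * rejects g ≤ length Probes
        rejects≤ = begin
          100 * N₂ * rejects g                                            ≡⟨ cong (100 * N₂ *_) (rejects≡ g) ⟩
          100 * N₂ * (R.weight g (2 ^ K) * rej)                           ≡⟨ l1 (100 * N₂) (R.weight g (2 ^ K)) rej ⟩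
          R.weight g (2 ^ K) * (100 * N₂ * rej)                           ≤⟨ *-monoʳ-≤ (R.weight g (2 ^ K)) Ar.few-rejections ⟩
          R.weight g (2 ^ K) * (c * u)                                    ≡⟨ l2 (R.weight g (2 ^ K)) c u ⟩
          u * (c * R.weight g (2 ^ K))                                    ≡⟨ cong (λ z → u * (c * z)) (weight≡ g) ⟨
          u * (c * R.weight g (length (allPoints K)))                     ≤⟨ *-monoʳ-≤ u (R.good*weight≤ g (length (allPoints K))) ⟩
          u * length (allPoints K) ^ length (allPoints K)                 ≡⟨ length-Probes ⟨
          length Probes                                                   ∎
          where
          open ≤-Reasoning
          l1 : ∀ a b c → a * (b * c) ≡ b * (a * c)
          l1 = solve-∀
          l2 : ∀ w c u → w * (c * u) ≡ u * (c * w)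
          l2 = solve-∀

      complete : 100 * (∑[ fs ∈ FS ] [ not (all (verdict g) (toList fs)) ]ᵇ) ≤ length FS
      complete = *-cancelʳ-≤ _ _ (length Probes) {{>-nonZero 0<Probes}} (begin
        100 * (∑[ fs ∈ FS ] [ not (all (verdict g) (toList fs)) ]ᵇ) * length Probes
          ≤⟨ *-monoˡ-≤ (length Probes) (*-monoʳ-≤ 100 (∑-mono FS (λ fs → [not-all]≤∑ (verdict g) (toList fs)))) ⟩
        100 * (∑[ fs ∈ FS ] ∑ (toList fs) (λ t → [ not (verdict g t) ]ᵇ)) * length Probes
          ≡⟨ trans (*-assoc 100 (∑[ fs ∈ FS ] ∑ (toList fs) (λ t → [ not (verdict g t) ]ᵇ)) (length Probes)) (cong (100 *_) (∑-vecs-sum (λ t → [ not (verdict g t) ]ᵇ) Probes N₂)) ⟩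
        100 * (N₂ * length Probes ^ N₂ * rejects g)                ≡⟨ lem N₂ (length Probes ^ N₂) (rejects g) ⟩
        length Probes ^ N₂ * (100 * N₂ * rejects g)                ≤⟨ *-monoʳ-≤ (length Probes ^ N₂) rejects≤ ⟩
        length Probes ^ N₂ * length Probes                         ≡⟨ cong (_* length Probes) (length-vecs Probes N₂) ⟨
        length FS * length Probes                                  ∎)
        where
        open ≤-Reasoning
        lem : ∀ N x r → 100 * (N * x * r) ≡ x * (100 * N * r)
        lem = solve-∀

  CS : List (Vec (Point n) (M * L))
  CS = vecs U (M * L)

  private
    module O = Occam (λ g c → eval obs g (β c)) U 0<u (codes K r) M L

    100misled≤ : 100 * ∑ CS O.misled ≤ length CS
    100misled≤ = *-cancelˡ-≤ (2 ^ L) {{m^n≢0 2 L}} (begin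
      2 ^ L * (100 * ∑ CS O.misled)                ≡⟨ lem (2 ^ L) (∑ CS O.misled) ⟩
      100 * (2 ^ L * ∑ CS O.misled)                ≤⟨ *-monoʳ-≤ 100 O.occam ⟩
      100 * (length (codes K r) * u ^ (M * L))     ≡⟨ *-assoc 100 (length (codes K r)) (u ^ (M * L)) ⟨
      100 * length (codes K r) * u ^ (M * L)       ≤⟨ *-monoˡ-≤ (u ^ (M * L)) L-large ⟩
      2 ^ L * u ^ (M * L)                          ≡⟨ cong (2 ^ L *_) (length-vecs U (M * L)) ⟨
      2 ^ L * length CS                            ∎)
      where
      open ≤-Reasoning
      lem : ∀ p x → p * (100 * x) ≡ 100 * (p * x)
      lem = solve-∀

    -- `φ` counts the bad events of the learning samples and takes two of the three hundredths;
    -- verification takes the third.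
    conclude : ∀ (o : Bool → Bool) (φ : Vec (Point n) (M * L) → ℕ) → 100 * ∑ CS φ ≤ 2 * length CS →
      (∀ cs → 100 * (∑[ fs ∈ FS ] [ o (outcome cs fs) ]ᵇ) ≤ length FS + 100 * (length FS * φ cs)) →
      100 * (∑[ cs ∈ CS ] ∑[ fs ∈ FS ] [ o (outcome cs fs) ]ᵇ) ≤ 3 * (length CS * length FS)
    conclude o φ small per = begin
      100 * (∑[ cs ∈ CS ] ∑[ fs ∈ FS ] [ o (outcome cs fs) ]ᵇ)        ≡⟨ ∑-*ˡ 100 _ CS ⟨
      (∑[ cs ∈ CS ] 100 * (∑[ fs ∈ FS ] [ o (outcome cs fs) ]ᵇ))      ≤⟨ ∑-mono CS per ⟩
      (∑[ cs ∈ CS ] (length FS + 100 * (length FS * φ cs)))           ≡⟨ trans (∑-+ _ _ CS) (cong₂ _+_ (∑-const _ CS) (trans (∑-*ˡ 100 _ CS) (cong (100 *_) (∑-*ˡ (length FS) φ CS)))) ⟩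
      length CS * length FS + 100 * (length FS * ∑ CS φ)              ≡⟨ cong (length CS * length FS +_) (l1 (length FS) (∑ CS φ)) ⟩
      length CS * length FS + length FS * (100 * ∑ CS φ)              ≤⟨ +-monoʳ-≤ (length CS * length FS) (*-monoʳ-≤ (length FS) small) ⟩
      length CS * length FS + length FS * (2 * length CS)             ≡⟨ l2 (length CS) (length FS) ⟩
      3 * (length CS * length FS)                                     ∎
      where
      open ≤-Reasoning
      l1 : ∀ f x → 100 * (f * x) ≡ f * (100 * x)
      l1 = solve-∀
      l2 : ∀ c f → c * f + f * (2 * c) ≡ 3 * (c * f)
      l2 = solve-∀

    trivial : ∀ (p : Vec (Point n × Vec (Point K) (2 ^ K)) N₂ → Bool) m → 100 * (∑[ fs ∈ FS ] [ p fs ]ᵇ) ≤ length FS + 100 * (length FS * suc m)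
    trivial p m = ≤-trans (*-monoʳ-≤ 100 (≤-trans (∑≤length p FS) (m≤m*n (length FS) (suc m)))) (m≤n+m _ (length FS))

  sound-run : (∀ g → u < e * distance h (hypothesis g)) →
    100 * (∑[ cs ∈ CS ] ∑[ fs ∈ FS ] [ outcome cs fs ]ᵇ) ≤ 3 * (length CS * length FS)
  sound-run far = conclude id O.misled (≤-trans 100misled≤ (m≤m+n (length CS) _)) per
    where
    per : ∀ cs → 100 * (∑[ fs ∈ FS ] [ outcome cs fs ]ᵇ) ≤ length FS + 100 * (length FS * O.misled cs)
    per cs = cases (O.misled cs) (learn cs) refl refl
      where
      cases : ∀ m result → O.misled cs ≡ m → learn cs ≡ result → 100 * (∑[ fs ∈ FS ] [ verify result fs ]ᵇ) ≤ length FS + 100 * (length FS * m)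
      cases (suc m) result   mis lc = trivial (verify result) m
      cases zero    nothing  mis lc = ≤-trans (≤-reflexive (trans (cong (100 *_) (∑-zero FS)) (*-zeroʳ 100))) z≤n
      cases zero    (just g) mis lc = ≤-trans (Sound.sound g (O.not-misled cs mis (member best-g) (suitable best-g)) (far g)) (m≤m+n _ _)
        where
        open IsBest
        best-g = best-just (consistent cs) V.count (codes K r) lc

  module _ (μ : ℕ) (fact : IsFactoredDNF r μ h)
    (J⊆vars : ∀ i → lookup J i ≡ true → lookup (varsDNF (proj₁ (proj₂ fact))) i ≡ true)
    (codes-complete : ∀ g → g ∈ codes K r) where
    open Complete μ fact J⊆vars

    private
      inconsistent : Vec (Point n) (M * L) → ℕ
      inconsistent cs = ∑[ c ∈ toList cs ] [ not (eval obs model (β c)) ]ᵇ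

      -- The model errs on at most `10 / D` of the samples, and `D-larger` keeps this below 1/100
      -- even when summed over all `M * L` of them.
      100inconsistent≤ : 100 * ∑ CS inconsistent ≤ length CS
      100inconsistent≤ = *-cancelˡ-≤ (D * u) {{m*n≢0 D u {{>-nonZero (≤-trans (*-mono-≤ {1} {26} (s≤s z≤n) (*-mono-≤ {1} {300} (s≤s z≤n) 0<N₂)) D-large)}} {{>-nonZero 0<u}}}} (begin
        D * u * (100 * ∑ CS inconsistent)                       ≡⟨ l1 D u (∑ CS inconsistent) ⟩
        100 * D * (∑ CS inconsistent * u)                       ≡⟨ cong (100 * D *_) (∑-vecs-sum (λ c → [ not (eval obs model (β c)) ]ᵇ) U (M * L)) ⟩
        100 * D * (M * L * u ^ (M * L) * wrong model)           ≡⟨ l2 D (M * L) (u ^ (M * L)) (wrong model) ⟩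
        100 * (M * L) * u ^ (M * L) * (D * wrong model)         ≤⟨ *-monoʳ-≤ (100 * (M * L) * u ^ (M * L)) wrong-model ⟩
        100 * (M * L) * u ^ (M * L) * (10 * u)                  ≡⟨ l3 (M * L) (u ^ (M * L)) u ⟩
        1000 * (M * L) * (u * u ^ (M * L))                      ≤⟨ *-monoˡ-≤ (u * u ^ (M * L)) D-larger ⟩
        D * (u * u ^ (M * L))                                   ≡⟨ trans (sym (*-assoc D u _)) (cong (D * u *_) (sym (length-vecs U (M * L)))) ⟩
        D * u * length CS                                       ∎)
        where
        open ≤-Reasoning
        l1 : ∀ d u x → d * u * (100 * x) ≡ 100 * d * (x * u)
        l1 = solve-∀
        l2 : ∀ d m x w → 100 * d * (m * x * w) ≡ 100 * m * x * (d * w)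
        l2 = solve-∀
        l3 : ∀ m x u → 100 * m * x * (10 * u) ≡ 1000 * m * (u * x)
        l3 = solve-∀

      model-consistent : ∀ cs → inconsistent cs ≡ 0 → consistent cs model ≡ true
      model-consistent cs eq with consistent cs model | [not-all]≤∑ (λ c → eval obs model (β c)) (toList cs)
      ... | true  | _  = refl
      ... | false | le = ⊥-elim (<-irrefl refl (≤-trans le (≤-reflexive eq)))

    complete-run : 100 * (∑[ cs ∈ CS ] ∑[ fs ∈ FS ] [ not (outcome cs fs) ]ᵇ) ≤ 3 * (length CS * length FS)
    complete-run = conclude not (λ cs → O.misled cs + inconsistent cs)
      (≤-trans (≤-reflexive (trans (cong (100 *_) (∑-+ O.misled inconsistent CS)) (*-distribˡ-+ 100 (∑ CS O.misled) _))) (≤-trans (+-mono-≤ 100misled≤ 100inconsistent≤) (≤-reflexive (cong (length CS +_) (sym (+-identityʳ _)))))) per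
      where
      per : ∀ cs → 100 * (∑[ fs ∈ FS ] [ not (outcome cs fs) ]ᵇ) ≤ length FS + 100 * (length FS * (O.misled cs + inconsistent cs))
      per cs = cases (O.misled cs + inconsistent cs) (learn cs) refl refl
        where
        cases : ∀ m result → O.misled cs + inconsistent cs ≡ m → learn cs ≡ result →
          100 * (∑[ fs ∈ FS ] [ not (verify result fs) ]ᵇ) ≤ length FS + 100 * (length FS * m)
        cases (suc m) result   bad lc = trivial (not ∘ verify result) m
        cases zero    nothing  bad lc = ⊥-elim (case (trans (sym (All.lookup (best-nothing (consistent cs) V.count (codes K r) lc) (codes-complete model))) (model-consistent cs (m+n≡0⇒n≡0 (O.misled cs) bad))))
          where
          case : false ≡ true → ⊥
          case ()
        cases zero    (just g) bad lc = ≤-trans (complete g (All.lookup (minimal best-g) (codes-complete model) (model-consistent cs (m+n≡0⇒n≡0 (O.misled cs) bad)))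
          (O.not-misled cs (m+n≡0⇒m≡0 (O.misled cs) bad) (member best-g) (suitable best-g))) (m≤m+n _ _)
          where
          open IsBest
          best-g = best-just (consistent cs) V.count (codes K r) lc

-- `N₁` is the number of trials of the junta test, `W` that of detection samples and of witnesses,
-- `N₂` that of probes. Of the tolerances, `1 / S` belongs to the scan, `1 / D′` to the error
-- outside `J`, `1 / D` to the error after undetected variables are dropped, `1 / T` to detection,
-- `1 / Q` to the junk and `1 / M` to learning, with `L` bits of confidence. The demands can be met
-- in the order `N₂`, `M`, `Q`, `L`, `D`, `T`, `W`, `D′`, `S`, `N₁`.
record Constants (k r μ e : ℕ) : Set where
  field
    N₁ W D′ S T D Q M N₂ L : ℕ
    0<e      : 0 < e
    N₂-large : 100 * (4 * (1 + 2 * e)) ≤ N₂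
    D-large  : 26 * (300 * N₂) ≤ D
    M-large  : 2 * (300 * N₂) ≤ M
    Q-large  : 4 * 2 ^ k * (300 * N₂) ≤ Q
    L-large  : 100 * length (codes (2 ^ k) r) ≤ 2 ^ L
    D-larger : 1000 * (M * L) ≤ D
    D′-large : 2 * D ≤ D′
    T-large  : 4 * (μ * D) ≤ T
    0<T      : 0 < T
    K-large  : 100 * (suc μ * suc μ) ≤ 2 ^ k
    W-large  : 100 * (μ * (2 * T)) ≤ W
    D′-Q     : 100 * (Q * W) ≤ D′
    D′-W     : 200 * (2 ^ k * W * W) ≤ D′
    D′-N     : 200 * (2 ^ k * W * (M * L)) ≤ D′
    D′-N₂    : 200 * (2 ^ k * W * N₂) ≤ D′
    S-large  : D′ * (2 * suc μ) ≤ S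
    0<S      : 0 < S
    N₁-large : 100 * suc μ * (S * (2 ^ k * 2)) ≤ N₁

-- From ideal to actual readings

[not]≡0⇒ : ∀ {b} → [ not b ]ᵇ ≡ 0 → b ≡ true
[not]≡0⇒ {true} _ = refl

best-cong : ∀ {p p′ : A → Bool} (f : A → ℕ) L → (∀ x → p x ≡ p′ x) → best p f L ≡ best p′ f L
best-cong f []      eq = refl
best-cong {p = p} {p′} f (x ∷ L) eq rewrite eq x | best-cong {p = p} {p′} f L eq = refl

module _ {n : ℕ} (h : BoolFun n) (k r : ℕ) where
  open Tester h k r

  module Actual {W : ℕ} (π : Vec (Point k) n) (c₀ : Point n) (ds : Vec (Point n) W) (ws : Vec (Point n) W) where
    bits : Point n → Point K
    bits = actual π c₀ ws

    run₂ : ∀ {N N₂} → Vec (Point n) N → Vec (Point n × Vec (Point K) (2 ^ K)) N₂ → Bool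
    run₂ = Phase₂.outcome π (union (Vec.map bits ds)) (carrier π c₀ ds (Vec.map bits ds)) bits

  module _ (π : Vec (Point k) n) (obs : Point K) (flipper : Point n) {β β′ : Point n → Point K} where
    private
      module P  = Phase₂ π obs flipper β
      module P′ = Phase₂ π obs flipper β′

      learn-cong : ∀ {N} (cs : Vec (Point n) N) → All (λ c → β c ≡ β′ c) (toList cs) → P.learn cs ≡ P′.learn cs
      learn-cong cs ecs = best-cong _ (codes K r) (λ g → all-cong (All.map (λ eq → cong (eval obs g) eq) ecs))

      verdict-cong : ∀ g t → β (proj₁ t) ≡ β′ (proj₁ t) → P.verdict g t ≡ P′.verdict g t
      verdict-cong g (f , seeds) eq = probe-cong (first (eval obs g) seeds)
        where
        probe-cong : ∀ σ → P.probe f σ ≡ P′.probe f σ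
        probe-cong nothing  = refl
        probe-cong (just σ) = cong (λ b → h (f ⊕ (spread π (σ ⊕ b) ⊙ flipper))) eq

      verify-cong : ∀ {N₂} result (fs : Vec (Point n × Vec (Point K) (2 ^ K)) N₂) →
        All (λ t → β (proj₁ t) ≡ β′ (proj₁ t)) (toList fs) → P.verify result fs ≡ P′.verify result fs
      verify-cong nothing  fs efs = refl
      verify-cong (just g) fs efs = all-cong (All.map (λ {t} → verdict-cong g t) efs)

    -- Given `obs` and the flipper, readings are used only at the learning samples and at the probed
    -- samples, so equality there is enough.
    outcome-cong : ∀ {N N₂} (cs : Vec (Point n) N) (fs : Vec (Point n × Vec (Point K) (2 ^ K)) N₂) →
      All (λ c → β c ≡ β′ c) (toList cs) → All (λ t → β (proj₁ t) ≡ β′ (proj₁ t)) (toList fs) → P.outcome cs fs ≡ P′.outcome cs fs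
    outcome-cong cs fs ecs efs = trans (cong (λ result → P.verify result fs) (learn-cong cs ecs)) (verify-cong (P′.learn cs) fs efs)

-- A set J with small `bound` outside of it: for factored DNFs the variables of the DNF, and otherwise the cuts
-- found when the junta test passes.
record Setting {n : ℕ} (h : BoolFun n) (μ D′ : ℕ) : Set where
  field
    J           : Point n
    J≤μ         : size J ≤ μ
    bound       : Point n → Point n → ℕ
    err≤bound   : ∀ x y B → Error.err h ((x ⊕ y) ⊙ (B ⊙ ∁ J)) ≤ bound x y
    bound-small : D′ * (∑[ x ∈ support h ] ∑[ y ∈ support h ] bound x y) ≤ supportSize h * (supportSize h * supportSize h)

module Assembly {n : ℕ} (h : BoolFun n) (0<u : 0 < supportSize h) (k r μ e : ℕ) (constants : Constants k r μ e)
  (setting : Setting h μ (Constants.D′ constants)) where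
  open Constants constants
  open Setting setting
  open Error h
  open Tester h k r

  Labellings : List (Vec (Point k) n)
  Labellings = vecs (allPoints k) n

  Probes : List (Point n × Vec (Point K) (2 ^ K))
  Probes = cartesianProduct U (vecs (allPoints K) (2 ^ K))

  CS : List (Vec (Point n) (M * L))
  CS = vecs U (M * L)

  FS : List (Vec (Point n × Vec (Point K) (2 ^ K)) N₂)
  FS = vecs Probes N₂

  Us : List (Vec (Point n) W)
  Us = vecs U W

  module Det = Detection h 0<u k r J bound err≤bound D′ bound-small T W

  module Run (π : Vec (Point k) n) (c₀ : Point n) (ds ws : Vec (Point n) W) where
    open Actual h k r π c₀ ds ws public
    module Dt = Detected {W} {W} J c₀ ds ws

    readings : Point n → Point K
    readings = ideal π c₀ ws J

    ideal₂ : separates J π ≡ true → Vec (Point n) (M * L) → Vec (Point n × Vec (Point K) (2 ^ K)) N₂ → Bool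
    ideal₂ sep = Phase₂.outcome π (Dt.obs π sep) (Dt.detected ⊕ Dt.junk π sep) readings

    low : Bool
    low = Q * (∑[ d ∈ toList ds ] bound d c₀) ≤ᵇ u

    mis : Point n → ℕ
    mis = mismatches π c₀ ws J

    mm : Vec (Point n) (M * L) → Vec (Point n × Vec (Point K) (2 ^ K)) N₂ → ℕ
    mm cs fs = (∑[ c ∈ toList ds ] mis c) + ((∑[ c ∈ toList cs ] mis c) + (∑[ t ∈ toList fs ] mis (proj₁ t)))

    run₂≡ideal₂ : ∀ (sep : separates J π ≡ true) → All (λ w → h w ≡ true) (toList ws) → ∀ cs fs → mm cs fs ≡ 0 → run₂ cs fs ≡ ideal₂ sep cs fs
    run₂≡ideal₂ sep hws cs fs eq = begin
      run₂ cs fs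
        ≡⟨ cong (λ bs → Phase₂.outcome π (union bs) (carrier π c₀ ds bs) bits cs fs) (map-cong-All ds (good ds (m+n≡0⇒m≡0 _ eq))) ⟩
      Phase₂.outcome π (Dt.obs π sep) (Dt.flipper π sep) bits cs fs
        ≡⟨ cong (λ z → Phase₂.outcome π (Dt.obs π sep) z bits cs fs) (Dt.flipper≡ π sep) ⟩
      Phase₂.outcome π (Dt.obs π sep) (Dt.detected ⊕ Dt.junk π sep) bits cs fs
        ≡⟨ outcome-cong h k r π _ _ cs fs (good cs (m+n≡0⇒m≡0 _ rest)) (All.map (λ {t} e → same (proj₁ t) e) (∑≡0⇒All (mis ∘ proj₁) (toList fs) (m+n≡0⇒n≡0 (∑ (toList cs) mis) rest))) ⟩
      ideal₂ sep cs fs ∎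
      where
      open ≡-Reasoning
      rest = m+n≡0⇒n≡0 (∑ (toList ds) mis) eq
      same : ∀ c → mis c ≡ 0 → bits c ≡ readings c
      same = actual≡ideal π c₀ ws J sep hws
      good : ∀ {m} (v : Vec (Point n) m) → ∑ (toList v) mis ≡ 0 → All (λ c → bits c ≡ readings c) (toList v)
      good v eq = All.map (λ {c} → same c) (∑≡0⇒All mis (toList v) eq)
      map-cong-All : ∀ {m} (v : Vec (Point n) m) → All (λ c → bits c ≡ readings c) (toList v) → Vec.map bits v ≡ Vec.map readings v
      map-cong-All []      []       = refl
      map-cong-All (c ∷ v) (e ∷ es) = cong₂ _∷_ e (map-cong-All v es)

  private
    X w : ℕ
    X = length CS * length FS
    w = length Us

    clashes : Vec (Point k) n → ℕ
    clashes π = [ not (separates J π) ]ᵇ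

    far-drift : Vec (Point k) n → Point n → Vec (Point n) W → Vec (Point n) W → ℕ
    far-drift π c₀ ds ws = [ not (Run.low π c₀ ds ws) ]ᵇ

    total-mm : Vec (Point k) n → Point n → Vec (Point n) W → Vec (Point n) W → ℕ
    total-mm π c₀ ds ws = ∑[ cs ∈ CS ] ∑[ fs ∈ FS ] Run.mm π c₀ ds ws cs fs

    ∑³ : (Point n → Vec (Point n) W → Vec (Point n) W → ℕ) → ℕ
    ∑³ f = ∑[ c₀ ∈ U ] ∑[ ds ∈ Us ] ∑[ ws ∈ Us ] f c₀ ds ws

    ∑³-+ : ∀ f g → ∑³ (λ c₀ ds ws → f c₀ ds ws + g c₀ ds ws) ≡ ∑³ f + ∑³ g
    ∑³-+ f g = trans (∑-cong U (λ c₀ → trans (∑-cong Us (λ ds → ∑-+ (f c₀ ds) (g c₀ ds) Us)) (∑-+ (λ ds → ∑ Us (f c₀ ds)) (λ ds → ∑ Us (g c₀ ds)) Us))) (∑-+ _ _ U)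

    ∑³-*ˡ : ∀ c f → ∑³ (λ c₀ ds ws → c * f c₀ ds ws) ≡ c * ∑³ f
    ∑³-*ˡ c f = trans (∑-cong U (λ c₀ → trans (∑-cong Us (λ ds → ∑-*ˡ c (f c₀ ds) Us)) (∑-*ˡ c (λ ds → ∑ Us (f c₀ ds)) Us))) (∑-*ˡ c _ U)

    ∑³-const : ∀ c → ∑³ (λ _ _ _ → c) ≡ u * (w * (w * c))
    ∑³-const c = trans (∑-cong U (λ _ → trans (∑-cong Us (λ _ → ∑-const c Us)) (∑-const (w * c) Us))) (∑-const (w * (w * c)) U)

    0<D : 0 < D
    0<D = ≤-trans (*-mono-≤ {1} {26} (s≤s z≤n) (*-mono-≤ {1} {300} (s≤s z≤n) (≤-trans (s≤s z≤n) N₂-large))) D-large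

    instance
      u≢0 : NonZero u
      u≢0 = >-nonZero 0<u
      D≢0 : NonZero D
      D≢0 = >-nonZero 0<D
      D′≢0 : NonZero D′
      D′≢0 = >-nonZero (≤-trans (*-mono-≤ {1} {2} (s≤s z≤n) 0<D) D′-large)

    M′ : ℕ
    M′ = ∑[ x ∈ U ] ∑[ y ∈ U ] bound x y

    w≡ : w ≡ u ^ W
    w≡ = length-vecs U W

    clash-sum : 100 * ∑ Labellings clashes ≤ length Labellings
    clash-sum = *-cancelˡ-≤ K {{m^n≢0 2 k}} (begin
      K * (100 * ∑ Labellings clashes)         ≡⟨ l1 K (∑ Labellings clashes) ⟩
      100 * (K * ∑ Labellings clashes)         ≤⟨ *-monoʳ-≤ 100 (collisions k J) ⟩
      100 * (size J * size J * K ^ n)          ≡⟨ *-assoc 100 (size J * size J) (K ^ n) ⟨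
      100 * (size J * size J) * K ^ n          ≤⟨ *-monoˡ-≤ (K ^ n) (≤-trans (*-monoʳ-≤ 100 (*-mono-≤ J≤q J≤q)) K-large) ⟩
      K * K ^ n                                ≡⟨ cong (K *_) (length-labellings k n) ⟨
      K * length Labellings                    ∎)
      where
      open ≤-Reasoning
      J≤q = ≤-trans J≤μ (n≤1+n μ)
      l1 : ∀ a b → a * (100 * b) ≡ 100 * (a * b)
      l1 = solve-∀

    missed-sum : 100 * ∑³ Det.missed ≤ u * (w * w)
    missed-sum = *-cancelˡ-≤ (T + W) {{>-nonZero (≤-trans 0<T (m≤m+n T W))}} (begin
      (T + W) * (100 * ∑³ Det.missed)                     ≡⟨ l1 (T + W) (∑³ Det.missed) ⟩
      100 * ((T + W) * ∑³ Det.missed)                     ≤⟨ *-monoʳ-≤ 100 Det.∑-missed ⟩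
      100 * (size J * (2 * T) * (u * (u ^ W * u ^ W)))    ≡⟨ same w (u ^ W) w≡ ⟨
      100 * (size J * (2 * T) * (u * (w * w)))            ≡⟨ *-assoc 100 (size J * (2 * T)) (u * (w * w)) ⟨
      100 * (size J * (2 * T)) * (u * (w * w))            ≤⟨ *-monoˡ-≤ (u * (w * w)) (≤-trans (*-monoʳ-≤ 100 (*-monoˡ-≤ (2 * T) J≤μ)) (≤-trans W-large (m≤n+m W T))) ⟩
      (T + W) * (u * (w * w))                             ∎)
      where
      open ≤-Reasoning
      same : ∀ a b → a ≡ b → 100 * (size J * (2 * T) * (u * (a * a))) ≡ 100 * (size J * (2 * T) * (u * (b * b)))
      same a .a refl = refl
      l1 : ∀ a b → a * (100 * b) ≡ 100 * (a * b)
      l1 = solve-∀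

    -- Markov's inequality: the expected sum of `bound` over the `W` detection samples is `W` times
    -- its average.
    drift-sum : ∀ π → 100 * ∑³ (far-drift π) ≤ u * (w * w)
    drift-sum π = *-cancelˡ-≤ (D′ * (u * u)) {{m*n≢0 D′ (u * u) {{D′≢0}} {{m*n≢0 u u}}}} (begin
      D′ * (u * u) * (100 * ∑³ (far-drift π))                        ≡⟨ l1 D′ u (∑³ (far-drift π)) ⟩
      100 * D′ * (u * (u * ∑³ (far-drift π)))                        ≤⟨ *-monoʳ-≤ (100 * D′) (*-monoʳ-≤ u markov) ⟩
      100 * D′ * (u * (Q * (w * Σd)))                                ≡⟨ l2 (100 * D′) u Q w Σd ⟩
      100 * D′ * (Q * (w * (Σd * u)))                                ≡⟨ cong (λ z → 100 * D′ * (Q * (w * z))) Σd*u ⟩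
      100 * D′ * (Q * (w * (W * w * M′)))                            ≡⟨ l3 D′ Q w W M′ ⟩
      100 * (Q * W) * (w * w) * (D′ * M′)                            ≤⟨ *-mono-≤ (*-monoˡ-≤ (w * w) D′-Q) bound-small ⟩
      D′ * (w * w) * (u * (u * u))                                   ≡⟨ l4 D′ w u ⟩
      D′ * (u * u) * (u * (w * w))                                   ∎)
      where
      open ≤-Reasoning
      l1 : ∀ d u x → d * (u * u) * (100 * x) ≡ 100 * d * (u * (u * x))
      l1 = solve-∀
      l2 : ∀ d u q w s → d * (u * (q * (w * s))) ≡ d * (q * (w * (s * u)))
      l2 = solve-∀
      l3 : ∀ d q w W m → 100 * d * (q * (w * (W * w * m))) ≡ 100 * (q * W) * (w * w) * (d * m)
      l3 = solve-∀
      l4 : ∀ d w u → d * (w * w) * (u * (u * u)) ≡ d * (u * u) * (u * (w * w))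
      l4 = solve-∀
      Σd = ∑[ c₀ ∈ U ] ∑[ ds ∈ Us ] ∑[ d ∈ toList ds ] bound d c₀
      step : ∀ c₀ ds ws → u * far-drift π c₀ ds ws ≤ Q * (∑[ d ∈ toList ds ] bound d c₀)
      step c₀ ds ws = go (Q * (∑[ d ∈ toList ds ] bound d c₀)) (Q * (∑[ d ∈ toList ds ] bound d c₀) ≤? u)
        where
        go : ∀ y → Dec (y ≤ u) → u * [ not (y ≤ᵇ u) ]ᵇ ≤ y
        go y (yes le) = ≤-trans (≤-reflexive (trans (cong (λ b → u * [ not b ]ᵇ) (lem (≤⇒≤ᵇ le))) (*-zeroʳ u))) z≤n
          where
          lem : ∀ {b} → Data.Bool.T b → b ≡ true
          lem {true} _ = refl
        go y (no nle) = ≤-trans (*-monoʳ-≤ u ([]≤1 (not (y ≤ᵇ u)))) (≤-trans (≤-reflexive (*-identityʳ u)) (<⇒≤ (≰⇒> nle)))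
      markov : u * ∑³ (far-drift π) ≤ Q * (w * Σd)
      markov = begin
        u * ∑³ (far-drift π)                                              ≡⟨ ∑³-*ˡ u (far-drift π) ⟨
        ∑³ (λ c₀ ds ws → u * far-drift π c₀ ds ws)                        ≤⟨ (∑-mono U λ c₀ → ∑-mono Us λ ds → ∑-mono Us λ ws → step c₀ ds ws) ⟩
        ∑³ (λ c₀ ds ws → Q * (∑[ d ∈ toList ds ] bound d c₀))             ≡⟨ ∑³-*ˡ Q _ ⟩
        Q * ∑³ (λ c₀ ds ws → ∑[ d ∈ toList ds ] bound d c₀)               ≡⟨ cong (Q *_) (trans (∑-cong U (λ c₀ → trans (∑-cong Us (λ ds → ∑-const _ Us)) (∑-*ˡ w _ Us))) (∑-*ˡ w _ U)) ⟩
        Q * (w * Σd)                                                      ∎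
      Σd*u : Σd * u ≡ W * w * M′
      Σd*u = trans (sym (∑-*ʳ u _ U)) (trans (∑-cong U (λ c₀ → trans (∑-vecs-sum (λ d → bound d c₀) U W) (cong (λ z → W * z * (∑[ d ∈ U ] bound d c₀)) (sym w≡)))) (trans (∑-*ˡ (W * w) _ U) (cong (W * w *_) (∑-swap (λ c₀ d → bound d c₀) U U))))

    module _ (π : Vec (Point k) n) where
      mis : Point n → Point n → Vec (Point n) W → ℕ
      mis c₀ c ws = mismatches π c₀ ws J c

      -- Expected mismatches over `K` blocks and `W` witnesses. The witness has been moved inside
      -- `J` before the flip, which costs the factor two of `changes-from`.
      mis-bound : ∀ c₀ c → u * (∑[ ws ∈ Us ] mis c₀ c ws) ≤ K * (W * w * (2 * bound c c₀))
      mis-bound c₀ c = begin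
        u * (∑[ ws ∈ Us ] ∑[ j ∈ allPoints k ] ∑[ x ∈ toList ws ] [ mismatch π c₀ ws J c j x ]ᵇ)    ≡⟨ cong (u *_) (∑-swap _ Us (allPoints k)) ⟩
        u * (∑[ j ∈ allPoints k ] ∑[ ws ∈ Us ] ∑[ x ∈ toList ws ] φ j x)                            ≡⟨ ∑-*ˡ u _ (allPoints k) ⟨
        (∑[ j ∈ allPoints k ] u * (∑[ ws ∈ Us ] ∑ (toList ws) (φ j)))                               ≤⟨ ∑-mono (allPoints k) per ⟩
        (∑[ j ∈ allPoints k ] W * w * (2 * bound c c₀))                                             ≡⟨ trans (∑-const _ (allPoints k)) (cong (_* (W * w * (2 * bound c c₀))) (length-allPoints k)) ⟩
        K * (W * w * (2 * bound c c₀))                                                              ∎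
        where
        open ≤-Reasoning
        φ : Point k → Point n → ℕ
        φ j x = [ h (x ⊕ ((c ⊕ c₀) ⊙ (block π j ⊙ J))) xor h ((x ⊕ ((c ⊕ c₀) ⊙ (block π j ⊙ J))) ⊕ ((c ⊕ c₀) ⊙ (block π j ⊙ ∁ J))) ]ᵇ
        per : ∀ j → u * (∑[ ws ∈ Us ] ∑ (toList ws) (φ j)) ≤ W * w * (2 * bound c c₀)
        per j = begin
          u * (∑[ ws ∈ Us ] ∑ (toList ws) (φ j))      ≡⟨ *-comm u _ ⟩
          (∑[ ws ∈ Us ] ∑ (toList ws) (φ j)) * u      ≡⟨ trans (∑-vecs-sum (φ j) U W) (cong (λ z → W * z * ∑ U (φ j)) (sym w≡)) ⟩
          W * w * ∑ U (φ j)                           ≤⟨ *-monoʳ-≤ (W * w) (≤-trans (changes-from _ _) (*-monoʳ-≤ 2 (err≤bound c c₀ (block π j)))) ⟩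
          W * w * (2 * bound c c₀)                    ∎

      Ψ : ℕ
      Ψ = ∑[ c₀ ∈ U ] ∑[ c ∈ U ] ∑[ ws ∈ Us ] mis c₀ c ws

      Ψ-bound : D′ * Ψ ≤ 2 * (K * W * w) * (u * u)
      Ψ-bound = *-cancelˡ-≤ u (begin
        u * (D′ * Ψ)                                               ≡⟨ l1 u D′ Ψ ⟩
        D′ * (u * Ψ)                                               ≡⟨ cong (D′ *_) (trans (sym (∑-*ˡ u _ U)) (∑-cong U (λ c₀ → sym (∑-*ˡ u _ U)))) ⟩
        D′ * (∑[ c₀ ∈ U ] ∑[ c ∈ U ] u * (∑[ ws ∈ Us ] mis c₀ c ws)) ≤⟨ *-monoʳ-≤ D′ (∑-mono U λ c₀ → ∑-mono U λ c → ≤-trans (mis-bound c₀ c) (≤-reflexive (l2 K W w (bound c c₀)))) ⟩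
        D′ * (∑[ c₀ ∈ U ] ∑[ c ∈ U ] 2 * (K * W * w) * bound c c₀) ≡⟨ cong (D′ *_) (trans (∑-cong U (λ c₀ → ∑-*ˡ (2 * (K * W * w)) _ U)) (trans (∑-*ˡ (2 * (K * W * w)) _ U) (cong (2 * (K * W * w) *_) (∑-swap (λ c₀ c → bound c c₀) U U)))) ⟩
        D′ * (2 * (K * W * w) * M′)                                ≡⟨ l1 D′ (2 * (K * W * w)) M′ ⟩
        2 * (K * W * w) * (D′ * M′)                                ≤⟨ *-monoʳ-≤ (2 * (K * W * w)) bound-small ⟩
        2 * (K * W * w) * (u * (u * u))                            ≡⟨ l1 (2 * (K * W * w)) u (u * u) ⟩
        u * (2 * (K * W * w) * (u * u))                            ∎)
        where
        open ≤-Reasoning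
        l1 : ∀ a b c → a * (b * c) ≡ b * (a * c)
        l1 = solve-∀
        l2 : ∀ k W w b → k * (W * w * (2 * b)) ≡ 2 * (k * W * w) * b
        l2 = solve-∀

      -- Common to the three groups of samples that are read, for detection, learning and probing:
      -- `m` draws, from a space with `V` outcomes.
      part-bound : ∀ m P V → P * u ≡ m * V * Ψ → 200 * (K * W * m) ≤ D′ → 100 * P ≤ V * (w * u)
      part-bound m P V eq large = *-cancelˡ-≤ (D′ * u) {{m*n≢0 D′ u}} (begin
        D′ * u * (100 * P)                        ≡⟨ l1 D′ u P ⟩
        100 * D′ * (P * u)                        ≡⟨ cong (100 * D′ *_) eq ⟩
        100 * D′ * (m * V * Ψ)                    ≡⟨ l2 D′ m V Ψ ⟩
        100 * (m * V) * (D′ * Ψ)                  ≤⟨ *-monoʳ-≤ (100 * (m * V)) Ψ-bound ⟩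
        100 * (m * V) * (2 * (K * W * w) * (u * u)) ≡⟨ l3 m V K W w u ⟩
        200 * (K * W * m) * (u * (V * (w * u)))   ≤⟨ *-monoˡ-≤ (u * (V * (w * u))) large ⟩
        D′ * (u * (V * (w * u)))                  ≡⟨ *-assoc D′ u _ ⟨
        D′ * u * (V * (w * u))                    ∎)
        where
        open ≤-Reasoning
        l1 : ∀ d u p → d * u * (100 * p) ≡ 100 * d * (p * u)
        l1 = solve-∀
        l2 : ∀ d m v p → 100 * d * (m * v * p) ≡ 100 * (m * v) * (d * p)
        l2 = solve-∀
        l3 : ∀ m v k W w u → 100 * (m * v) * (2 * (k * W * w) * (u * u)) ≡ 200 * (k * W * m) * (u * (v * (w * u)))
        l3 = solve-∀

      vector-mis : ∀ m → ℕ
      vector-mis m = ∑[ c₀ ∈ U ] ∑[ v ∈ vecs U m ] ∑[ ws ∈ Us ] ∑[ c ∈ toList v ] mis c₀ c ws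

      vector-mis≡ : ∀ m → vector-mis m * u ≡ m * length (vecs U m) * Ψ
      vector-mis≡ m = trans (sym (∑-*ʳ u _ U)) (trans (∑-cong U (λ c₀ → trans (cong (_* u) (∑-cong (vecs U m) (λ v → ∑-swap _ Us (toList v))))
        (trans (∑-vecs-sum (λ c → ∑[ ws ∈ Us ] mis c₀ c ws) U m) (cong (λ z → m * z * (∑[ c ∈ U ] ∑[ ws ∈ Us ] mis c₀ c ws)) (sym (length-vecs U m)))))) (∑-*ˡ (m * length (vecs U m)) _ U))

      probe-mis : ℕ
      probe-mis = ∑[ c₀ ∈ U ] ∑[ fs ∈ FS ] ∑[ ws ∈ Us ] ∑[ t ∈ toList fs ] mis c₀ (proj₁ t) ws

      private
        sd = length (vecs (allPoints K) (2 ^ K))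

        0<sd : 0 < sd
        0<sd = ≤-trans (m^n>0 (2 ^ K) {{m^n≢0 2 K}} (2 ^ K)) (≤-reflexive (sym (trans (length-vecs (allPoints K) (2 ^ K)) (cong (_^ (2 ^ K)) (length-allPoints K)))))

      probe-mis≡ : probe-mis * u ≡ N₂ * length FS * Ψ
      probe-mis≡ = *-cancelʳ-≡ _ _ sd {{>-nonZero 0<sd}} (begin
        probe-mis * u * sd                                 ≡⟨ *-assoc probe-mis u sd ⟩
        probe-mis * (u * sd)                               ≡⟨ cong (probe-mis *_) (sym (length-cartesian _,_ U _)) ⟩
        probe-mis * length Probes                          ≡⟨ ∑-*ʳ (length Probes) _ U ⟨
        (∑[ c₀ ∈ U ] (∑[ fs ∈ FS ] ∑[ ws ∈ Us ] ∑[ t ∈ toList fs ] mis c₀ (proj₁ t) ws) * length Probes)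
          ≡⟨ ∑-cong U (λ c₀ → trans (cong (_* length Probes) (∑-cong FS (λ v → ∑-swap _ Us (toList v))))
               (trans (∑-vecs-sum (λ t → ∑[ ws ∈ Us ] mis c₀ (proj₁ t) ws) Probes N₂) (cong₂ (λ y z → N₂ * y * z) (sym (length-vecs Probes N₂))
                 (trans (∑-pairs U _ _) (trans (∑-cong U (λ c → ∑-const _ (vecs (allPoints K) (2 ^ K)))) (∑-*ˡ sd _ U)))))) ⟩
        (∑[ c₀ ∈ U ] N₂ * length FS * (sd * (∑[ c ∈ U ] ∑[ ws ∈ Us ] mis c₀ c ws)))   ≡⟨ trans (∑-*ˡ (N₂ * length FS) _ U) (cong (N₂ * length FS *_) (∑-*ˡ sd _ U)) ⟩
        N₂ * length FS * (sd * Ψ)                          ≡⟨ lem (N₂ * length FS) sd Ψ ⟩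
        N₂ * length FS * Ψ * sd                            ∎)
        where
        open ≡-Reasoning
        lem : ∀ a s p → a * (s * p) ≡ a * p * s
        lem = solve-∀

      mm-split : ∑³ (total-mm π) ≡ X * vector-mis W + (length FS * (w * vector-mis (M * L)) + length CS * (w * probe-mis))
      mm-split = begin
        ∑³ (total-mm π)                                                      ≡⟨ ∑-cong U (λ c₀ → ∑-cong Us (λ ds → ∑-cong Us (λ ws → inner c₀ ds ws))) ⟩
        ∑³ (λ c₀ ds ws → X * E₁ c₀ ds ws + (length FS * E₂ c₀ ws + length CS * E₃ c₀ ws))
          ≡⟨ trans (∑³-+ _ _) (cong₂ _+_ (∑³-*ˡ X E₁) (trans (∑³-+ _ _) (cong₂ _+_ (∑³-*ˡ (length FS) (λ c₀ _ → E₂ c₀)) (∑³-*ˡ (length CS) (λ c₀ _ → E₃ c₀))))) ⟩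
        X * ∑³ E₁ + (length FS * ∑³ (λ c₀ _ → E₂ c₀) + length CS * ∑³ (λ c₀ _ → E₃ c₀))
          ≡⟨ cong₂ (λ y z → X * vector-mis W + (length FS * y + length CS * z)) (const-ds E₂) (const-ds E₃) ⟩
        X * vector-mis W + (length FS * (w * (∑[ c₀ ∈ U ] ∑ Us (E₂ c₀))) + length CS * (w * (∑[ c₀ ∈ U ] ∑ Us (E₃ c₀))))
          ≡⟨ cong₂ (λ y z → X * vector-mis W + (length FS * (w * y) + length CS * (w * z))) (∑-cong U (λ c₀ → ∑-swap _ Us CS)) (∑-cong U (λ c₀ → ∑-swap _ Us FS)) ⟩
        X * vector-mis W + (length FS * (w * vector-mis (M * L)) + length CS * (w * probe-mis)) ∎
        where
        open ≡-Reasoning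
        E₁ : Point n → Vec (Point n) W → Vec (Point n) W → ℕ
        E₁ c₀ ds ws = ∑[ c ∈ toList ds ] mis c₀ c ws
        E₂ E₃ : Point n → Vec (Point n) W → ℕ
        E₂ c₀ ws = ∑[ cs ∈ CS ] ∑[ c ∈ toList cs ] mis c₀ c ws
        E₃ c₀ ws = ∑[ fs ∈ FS ] ∑[ t ∈ toList fs ] mis c₀ (proj₁ t) ws
        const-ds : ∀ (f : Point n → Vec (Point n) W → ℕ) → ∑³ (λ c₀ _ → f c₀) ≡ w * (∑[ c₀ ∈ U ] ∑ Us (f c₀))
        const-ds f = trans (∑-cong U (λ c₀ → ∑-const (∑ Us (f c₀)) Us)) (∑-*ˡ w _ U)
        inner : ∀ c₀ ds ws → total-mm π c₀ ds ws ≡ X * E₁ c₀ ds ws + (length FS * E₂ c₀ ws + length CS * E₃ c₀ ws)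
        inner c₀ ds ws = trans (∑-cong CS (λ cs → trans (∑-+ _ _ FS) (cong₂ _+_ (∑-const (E₁ c₀ ds ws) FS) (trans (∑-+ _ _ FS) (cong (_+ E₃ c₀ ws) (∑-const _ FS))))))
          (trans (∑-+ _ _ CS) (cong₂ _+_ (trans (∑-const _ CS) (sym (*-assoc (length CS) (length FS) _))) (trans (∑-+ _ _ CS) (cong₂ _+_ (∑-*ˡ (length FS) _ CS) (∑-const (E₃ c₀ ws) CS)))))

      mm-sum : 100 * ∑³ (total-mm π) ≤ 3 * (u * (w * (w * X)))
      mm-sum = begin
        100 * ∑³ (total-mm π)                                                     ≡⟨ cong (100 *_) mm-split ⟩
        100 * (X * vector-mis W + (length FS * (w * vector-mis (M * L)) + length CS * (w * probe-mis)))
          ≡⟨ l1 X (vector-mis W) (length FS) w (vector-mis (M * L)) (length CS) probe-mis ⟩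
        X * (100 * vector-mis W) + (length FS * (w * (100 * vector-mis (M * L))) + length CS * (w * (100 * probe-mis)))
          ≤⟨ +-mono-≤ (*-monoʳ-≤ X (part-bound W (vector-mis W) w (vector-mis≡ W) D′-W))
               (+-mono-≤ (*-monoʳ-≤ (length FS) (*-monoʳ-≤ w (part-bound (M * L) (vector-mis (M * L)) (length CS) (vector-mis≡ (M * L)) D′-N)))
                         (*-monoʳ-≤ (length CS) (*-monoʳ-≤ w (part-bound N₂ probe-mis (length FS) probe-mis≡ D′-N₂)))) ⟩
        X * (w * (w * u)) + (length FS * (w * (length CS * (w * u))) + length CS * (w * (length FS * (w * u)))) ≡⟨ l2 (length CS) (length FS) w u ⟩
        3 * (u * (w * (w * X)))                                                   ∎
        where
        open ≤-Reasoning
        l1 : ∀ X a f w b c d → 100 * (X * a + (f * (w * b) + c * (w * d))) ≡ X * (100 * a) + (f * (w * (100 * b)) + c * (w * (100 * d)))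
        l1 = solve-∀
        l2 : ∀ c f w u → c * f * (w * (w * u)) + (f * (w * (c * (w * u))) + c * (w * (f * (w * u)))) ≡ 3 * (u * (w * (w * (c * f))))
        l2 = solve-∀

  module _ (o : Bool → Bool)
    (ideal-run : ∀ π c₀ ds ws (sep : separates J π ≡ true) → Det.missed c₀ ds ws ≡ 0 → Q * (∑[ d ∈ toList ds ] bound d c₀) ≤ u →
      100 * (∑[ cs ∈ CS ] ∑[ fs ∈ FS ] [ o (Run.ideal₂ π c₀ ds ws sep cs fs) ]ᵇ) ≤ 3 * (length CS * length FS)) where

    private
      wrong-runs : Vec (Point k) n → Point n → Vec (Point n) W → Vec (Point n) W → ℕ
      wrong-runs π c₀ ds ws = ∑[ cs ∈ CS ] ∑[ fs ∈ FS ] [ o (Run.run₂ π c₀ ds ws cs fs) ]ᵇ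

      -- If a collision, a missed variable or large junk occurs, the last summand alone exceeds the
      -- left side. Otherwise a run can differ from its ideal version only through a mismatch, and
      -- each run is charged its number of mismatches.
      per-run : ∀ π c₀ ds ws → All (λ w → h w ≡ true) (toList ws) →
        100 * wrong-runs π c₀ ds ws ≤ 100 * total-mm π c₀ ds ws + (3 * X + X * (100 * (clashes π + (Det.missed c₀ ds ws + far-drift π c₀ ds ws))))
      per-run π c₀ ds ws hws = go (clashes π + (Det.missed c₀ ds ws + far-drift π c₀ ds ws)) refl
        where
        Y = 100 * total-mm π c₀ ds ws
        everything : wrong-runs π c₀ ds ws ≤ X
        everything = ≤-trans (∑-mono CS (λ cs → ∑≤length _ FS)) (≤-reflexive (∑-const _ CS))
        go : ∀ m → clashes π + (Det.missed c₀ ds ws + far-drift π c₀ ds ws) ≡ m → 100 * wrong-runs π c₀ ds ws ≤ Y + (3 * X + X * (100 * m))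
        go (suc m) _   = ≤-trans (*-monoʳ-≤ 100 everything) (≤-trans (≤-reflexive (*-comm 100 X)) (≤-trans (*-monoʳ-≤ X (*-monoʳ-≤ 100 (s≤s (z≤n {m})))) (≤-trans (m≤n+m _ (3 * X)) (m≤n+m _ Y))))
        go zero    bad = ≤-trans (*-monoʳ-≤ 100 (≤-trans (∑-mono CS (λ cs → ∑-mono FS (λ fs → pointwise cs fs (Run.mm π c₀ ds ws cs fs) refl))) (≤-reflexive (trans (∑-cong CS (λ cs → ∑-+ (Run.mm π c₀ ds ws cs) (λ fs → [ o (Run.ideal₂ π c₀ ds ws sep cs fs) ]ᵇ) FS)) (∑-+ (λ cs → ∑ FS (Run.mm π c₀ ds ws cs)) (λ cs → ∑[ fs ∈ FS ] [ o (Run.ideal₂ π c₀ ds ws sep cs fs) ]ᵇ) CS)))))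
            (≤-trans (≤-reflexive (*-distribˡ-+ 100 (total-mm π c₀ ds ws) (∑[ cs ∈ CS ] ∑[ fs ∈ FS ] [ o (Run.ideal₂ π c₀ ds ws sep cs fs) ]ᵇ))) (+-monoʳ-≤ Y (≤-trans (ideal-run π c₀ ds ws sep none low≤) (m≤m+n (3 * X) (X * (100 * 0))))))
          where
          sep : separates J π ≡ true
          sep = [not]≡0⇒ (m+n≡0⇒m≡0 (clashes π) bad)
          rest : Det.missed c₀ ds ws + far-drift π c₀ ds ws ≡ 0
          rest = m+n≡0⇒n≡0 (clashes π) bad
          none : Det.missed c₀ ds ws ≡ 0
          none = m+n≡0⇒m≡0 (Det.missed c₀ ds ws) rest
          low≤ : Q * (∑[ d ∈ toList ds ] bound d c₀) ≤ u
          low≤ = [≤ᵇ] _ u ([not]≡0⇒ (m+n≡0⇒n≡0 (Det.missed c₀ ds ws) rest))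
          pointwise : ∀ cs fs m → Run.mm π c₀ ds ws cs fs ≡ m → [ o (Run.run₂ π c₀ ds ws cs fs) ]ᵇ ≤ m + [ o (Run.ideal₂ π c₀ ds ws sep cs fs) ]ᵇ
          pointwise cs fs (suc m) _  = ≤-trans ([]≤1 (o (Run.run₂ π c₀ ds ws cs fs))) (s≤s z≤n)
          pointwise cs fs zero    eq = ≤-reflexive (cong (λ b → [ o b ]ᵇ) (Run.run₂≡ideal₂ π c₀ ds ws sep hws cs fs eq))

    wrong-total : ℕ
    wrong-total = ∑[ π ∈ Labellings ] ∑[ c₀ ∈ U ] ∑[ ds ∈ Us ] ∑[ ws ∈ Us ] wrong-runs π c₀ ds ws

    -- The budget of errors is nine hundredths: three for mismatches, three for the ideal run, and
    -- one each for collisions, missed variables and junk.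
    wrong-total≤ : 10 * wrong-total ≤ length Labellings * (u * (w * (w * X)))
    wrong-total≤ = *-cancelˡ-≤ 10 (begin
      10 * (10 * wrong-total)                ≡⟨ l0 wrong-total ⟩
      100 * wrong-total                      ≡⟨ ∑-*ˡ 100 _ Labellings ⟨
      (∑[ π ∈ Labellings ] 100 * ∑³ (wrong-runs π)) ≤⟨ ∑-mono Labellings per-labelling ⟩
      (∑[ π ∈ Labellings ] (8 * Z + Z * (100 * clashes π)))  ≡⟨ trans (∑-+ _ _ Labellings) (cong₂ _+_ (∑-const (8 * Z) Labellings) (trans (∑-*ˡ Z _ Labellings) (cong (Z *_) (∑-*ˡ 100 clashes Labellings)))) ⟩
      length Labellings * (8 * Z) + Z * (100 * ∑ Labellings clashes) ≤⟨ +-monoʳ-≤ (length Labellings * (8 * Z)) (*-monoʳ-≤ Z clash-sum) ⟩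
      length Labellings * (8 * Z) + Z * length Labellings            ≤⟨ m≤m+n _ (length Labellings * Z) ⟩
      length Labellings * (8 * Z) + Z * length Labellings + length Labellings * Z  ≡⟨ l1 (length Labellings) Z ⟩
      10 * (length Labellings * Z)           ∎)
      where
      open ≤-Reasoning
      Z = u * (w * (w * X))
      l0 : ∀ x → 10 * (10 * x) ≡ 100 * x
      l0 = solve-∀
      l1 : ∀ p z → p * (8 * z) + z * p + p * z ≡ 10 * (p * z)
      l1 = solve-∀
      l2 : ∀ u w X c m d → 3 * (u * (w * (w * X))) + (u * (w * (w * (3 * X))) + X * (100 * (u * (w * (w * c)) + (m + d)))) ≡ 6 * (u * (w * (w * X))) + u * (w * (w * X)) * (100 * c) + X * (100 * m + 100 * d)
      l2 = solve-∀
      l3 : ∀ u w X c → 6 * (u * (w * (w * X))) + u * (w * (w * X)) * (100 * c) + X * (u * (w * w) + u * (w * w)) ≡ 8 * (u * (w * (w * X))) + u * (w * (w * X)) * (100 * c)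
      l3 = solve-∀
      per-labelling : ∀ π → 100 * ∑³ (wrong-runs π) ≤ 8 * Z + Z * (100 * clashes π)
      per-labelling π = begin
        100 * ∑³ (wrong-runs π)                             ≡⟨ ∑³-*ˡ 100 (wrong-runs π) ⟨
        ∑³ (λ c₀ ds ws → 100 * wrong-runs π c₀ ds ws)       ≤⟨ (∑-mono U λ c₀ → ∑-mono Us λ ds → ∑-mono-All (All.map (λ {ws} → per-run π c₀ ds ws) (All-vecs U⊆h W))) ⟩
        ∑³ (λ c₀ ds ws → 100 * total-mm π c₀ ds ws + (3 * X + X * (100 * (clashes π + (Det.missed c₀ ds ws + far-drift π c₀ ds ws)))))
          ≡⟨ trans (∑³-+ (λ c₀ ds ws → 100 * total-mm π c₀ ds ws) _) (cong₂ _+_ (∑³-*ˡ 100 (total-mm π)) (trans (∑³-+ (λ _ _ _ → 3 * X) _) (cong₂ _+_ (∑³-const (3 * X)) (trans (∑³-*ˡ X _) (cong (X *_)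
               (trans (∑³-*ˡ 100 _) (cong (100 *_) (trans (∑³-+ (λ _ _ _ → clashes π) _) (cong₂ _+_ (∑³-const (clashes π)) (∑³-+ Det.missed (far-drift π)))))))))) ) ⟩
        100 * ∑³ (total-mm π) + (u * (w * (w * (3 * X))) + X * (100 * (u * (w * (w * clashes π)) + (∑³ Det.missed + ∑³ (far-drift π)))))
          ≤⟨ +-monoˡ-≤ _ (mm-sum π) ⟩
        3 * (u * (w * (w * X))) + (u * (w * (w * (3 * X))) + X * (100 * (u * (w * (w * clashes π)) + (∑³ Det.missed + ∑³ (far-drift π)))))
          ≡⟨ l2 u w X (clashes π) (∑³ Det.missed) (∑³ (far-drift π)) ⟩
        6 * Z + Z * (100 * clashes π) + X * (100 * ∑³ Det.missed + 100 * ∑³ (far-drift π))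
          ≤⟨ +-monoʳ-≤ (6 * Z + Z * (100 * clashes π)) (*-monoʳ-≤ X (+-mono-≤ missed-sum (drift-sum π))) ⟩
        6 * Z + Z * (100 * clashes π) + X * (u * (w * w) + u * (w * w))  ≡⟨ l3 u w X (clashes π) ⟩
        8 * Z + Z * (100 * clashes π)                       ∎

-- Completeness and soundness of the whole test

allPoints-complete : ∀ (x : Point n) → x ∈ allPoints n
allPoints-complete []          = here refl
allPoints-complete (true ∷ x)  = ∈-++⁺ˡ (∈-map⁺ (true ∷_) (allPoints-complete x))
allPoints-complete {suc n} (false ∷ x) = ∈-++⁺ʳ (map (true ∷_) (allPoints n)) (∈-map⁺ (false ∷_) (allPoints-complete x))

vecs-complete : ∀ {L : List A} {m} → (∀ x → x ∈ L) → (v : Vec A m) → v ∈ vecs L m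
vecs-complete p []      = here refl
vecs-complete p (x ∷ v) = ∈-cartesianProductWith⁺ _∷_ (p x) (vecs-complete p v)

codes-complete : ∀ {K r} (g : Code K r) → g ∈ codes K r
codes-complete {K} g = vecs-complete (λ { (b , P , Q) → ∈-cartesianProductWith⁺ _,_ (bool b) (∈-cartesianProductWith⁺ _,_ (allPoints-complete P) (allPoints-complete Q)) }) g
  where
  bool : ∀ b → b ∈ (true ∷ false ∷ [])
  bool true  = here refl
  bool false = there (here refl)

-- Factored DNFs: outside the variables of the DNF nothing ever changes.
factored-setting : ∀ {r μ} (h : BoolFun n) → 0 < supportSize h → (fact : IsFactoredDNF r μ h) → ∀ D′ → Setting h μ D′
factored-setting {n} {r} {μ} h 0<u fact D′ = record
  { J = vars ; J≤μ = ≤-trans (≤-reflexive (sym (∣∣≡size vars))) (proj₁ (proj₂ (proj₂ (proj₂ (proj₂ fact)))))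
  ; bound = bound ; err≤bound = err≤ ; bound-small = ≤-trans (≤-reflexive (trans (cong (D′ *_) none) (*-zeroʳ D′))) z≤n }
  where
  open FactoredDNF h fact
  open Error h
  bound : Point n → Point n → ℕ
  -- The bound has to hold for all pairs of points. The trivial `u` outside `h⁻¹(1)` costs nothing,
  -- as only pairs of samples enter the sum.
  bound x y = if h x ∧ h y then 0 else u
  none : (∑[ x ∈ U ] ∑[ y ∈ U ] bound x y) ≡ 0
  none = trans (∑-cong-All (All.map (λ {x} hx → trans (∑-cong-All (All.map (λ {y} hy → cong (λ b → if b then 0 else u) (cong₂ _∧_ hx hy)) U⊆h)) (∑-zero U)) U⊆h)) (∑-zero U)
  err≤ : ∀ x y B → err ((x ⊕ y) ⊙ (B ⊙ ∁ vars)) ≤ bound x y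
  err≤ x y B with h x in hx | h y in hy
  ... | false | _     = err≤u ((x ⊕ y) ⊙ (B ⊙ ∁ vars))
  ... | true  | false = err≤u ((x ⊕ y) ⊙ (B ⊙ ∁ vars))
  ... | true  | true  = ≤-reflexive (trans (∑-cong-All (All.map (λ {z} hz → cong (λ b → [ not b ]ᵇ) (move x y z (B ⊙ ∁ vars) hx hy hz (trans (⊙-assoc B (∁ vars) vars) (trans (cong (B ⊙_) (trans (⊙-comm (∁ vars) vars) (⊙-∁ vars))) (⊙-𝟎ʳ B))))) U⊆h)) (∑-zero U))

cuts-setting : ∀ {μ} (h : BoolFun n) → 0 < supportSize h → ∀ D′ S → D′ * (2 * suc μ) ≤ S → (J : Point n) → size J ≤ μ →
  S * Error.failures h (∁ J) ≤ suc (size J) * length (Error.trials h) → Setting h μ D′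
cuts-setting {n} {μ} h 0<u D′ S S-large J J≤μ few = record
  { J = J ; J≤μ = J≤μ ; bound = bound ; err≤bound = err≤ ; bound-small = small }
  where
  open Error h
  instance
    2^n≢0 : NonZero (2 ^ n)
    2^n≢0 = m^n≢0 2 n
  bound : Point n → Point n → ℕ
  -- Rounding down is safe because the errors to be dominated are integers.
  bound x y = (2 * restricted-err (x ⊕ y) (∁ J)) ℕ./ 2 ^ n
  err≤ : ∀ x y B → err ((x ⊕ y) ⊙ (B ⊙ ∁ J)) ≤ bound x y
  err≤ x y B = ≤-trans (≤-reflexive (sym (ℕ.m*n/n≡m _ (2 ^ n)))) (ℕ./-monoˡ-≤ (2 ^ n) (≤-trans (≤-reflexive (*-comm _ (2 ^ n)))
    (err≤restricted-err (x ⊕ y) (∁ J) (B ⊙ ∁ J) (trans (⊙-assoc B _ _) (cong (B ⊙_) (⊙-idem (∁ J)))))))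
  M = ∑[ x ∈ U ] ∑[ y ∈ U ] bound x y
  sum≤ : 2 ^ n * M ≤ 2 * failures (∁ J)
  sum≤ = begin
    2 ^ n * M                                                    ≡⟨ trans (sym (∑-*ˡ (2 ^ n) _ U)) (∑-cong U (λ x → sym (∑-*ˡ (2 ^ n) _ U))) ⟩
    (∑[ x ∈ U ] ∑[ y ∈ U ] 2 ^ n * bound x y)                    ≤⟨ (∑-mono U λ x → ∑-mono U λ y → ≤-trans (≤-reflexive (*-comm (2 ^ n) _)) (ℕ.m/n*n≤m _ (2 ^ n))) ⟩
    (∑[ x ∈ U ] ∑[ y ∈ U ] 2 * restricted-err (x ⊕ y) (∁ J))     ≡⟨ trans (∑-cong U (λ x → ∑-*ˡ 2 _ U)) (∑-*ˡ 2 _ U) ⟩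
    2 * (∑[ x ∈ U ] ∑[ y ∈ U ] restricted-err (x ⊕ y) (∁ J))     ≡⟨ cong (2 *_) (failures-err (∁ J)) ⟨
    2 * failures (∁ J)                                           ∎
    where open ≤-Reasoning
  small : D′ * M ≤ u * (u * u)
  small = *-cancelˡ-≤ (2 * suc μ * 2 ^ n) {{m*n≢0 (2 * suc μ) (2 ^ n)}} (begin
    2 * suc μ * 2 ^ n * (D′ * M)                     ≡⟨ l1 (suc μ) (2 ^ n) D′ M ⟩
    D′ * (2 * suc μ) * (2 ^ n * M)                   ≤⟨ *-mono-≤ S-large sum≤ ⟩
    S * (2 * failures (∁ J))                         ≡⟨ l2 S (failures (∁ J)) ⟩
    2 * (S * failures (∁ J))                         ≤⟨ *-monoʳ-≤ 2 (≤-trans few (*-monoˡ-≤ (length trials) (s≤s J≤μ))) ⟩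
    2 * (suc μ * length trials)                      ≡⟨ cong (λ z → 2 * (suc μ * z)) length-trials ⟩
    2 * (suc μ * (u * (u * (u * 2 ^ n))))            ≡⟨ l3 (suc μ) u (2 ^ n) ⟩
    2 * suc μ * 2 ^ n * (u * (u * u))                ∎)
    where
    open ≤-Reasoning
    l1 : ∀ q p d m → 2 * q * p * (d * m) ≡ d * (2 * q) * (p * m)
    l1 = solve-∀
    l2 : ∀ s f → s * (2 * f) ≡ 2 * (s * f)
    l2 = solve-∀
    l3 : ∀ q u p → 2 * (q * (u * (u * (u * p)))) ≡ 2 * q * p * (u * (u * u))
    l3 = solve-∀

module Test {n : ℕ} (h : BoolFun n) (0<u : 0 < supportSize h) (k r μ e : ℕ) (constants : Constants k r μ e) where
  open Constants constants
  open Error h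
  open Tester h k r
  open JuntaTest h k N₁ μ using (passes; junta-test-sound)

  private
    Labellings = vecs (allPoints k) n
    TR = vecs trials N₁
    Us = vecs U W
    CS = vecs U (M * L)
    Probes = cartesianProduct U (vecs (allPoints K) (2 ^ K))
    FS = vecs Probes N₂

  Outcomes : Set
  Outcomes = Vec (Point k) n × Vec Trial N₁ × Point n × Vec (Point n) W × Vec (Point n) W × Vec (Point n) (M * L) × Vec (Point n × Vec (Point K) (2 ^ K)) N₂

  outcomes : List Outcomes
  outcomes = cartesianProduct Labellings (cartesianProduct TR (cartesianProduct U (cartesianProduct Us (cartesianProduct Us (cartesianProduct CS FS)))))

  accepts : Outcomes → Bool
  accepts (π , tr , c₀ , ds , ws , cs , fs) = passes π tr ∧ Actual.run₂ h k r π c₀ ds ws cs fs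

  private
    size-outcomes : length outcomes ≡ length Labellings * (length TR * (u * (length Us * (length Us * (length CS * length FS)))))
    size-outcomes = trans (lc Labellings _) (cong (length Labellings *_) (trans (lc TR _) (cong (length TR *_) (trans (lc U _) (cong (u *_) (trans (lc Us _) (cong (length Us *_) (trans (lc Us _) (cong (length Us *_) (lc CS FS))))))))))
      where
      lc : ∀ {A B : Set} (L : List A) (M : List B) → length (cartesianProduct L M) ≡ length L * length M
      lc = length-cartesian _,_

    ∑-outcomes : ∀ (f : Outcomes → ℕ) → ∑ outcomes f ≡
      (∑[ π ∈ Labellings ] ∑[ tr ∈ TR ] ∑[ c₀ ∈ U ] ∑[ ds ∈ Us ] ∑[ ws ∈ Us ] ∑[ cs ∈ CS ] ∑[ fs ∈ FS ] f (π , tr , c₀ , ds , ws , cs , fs))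
    ∑-outcomes f = trans (∑-pairs Labellings _ f) (∑-cong Labellings λ π → trans (∑-pairs TR _ _) (∑-cong TR λ tr → trans (∑-pairs U _ _) (∑-cong U λ c₀ → trans (∑-pairs Us _ _) (∑-cong Us λ ds → trans (∑-pairs Us _ _) (∑-cong Us λ ws → ∑-pairs CS FS _)))))

    All-trials : All (λ t → h (proj₁ t) ≡ true × h (proj₁ (proj₂ t)) ≡ true × h (proj₁ (proj₂ (proj₂ t))) ≡ true × Data.Bool.T true) trials
    All-trials = All-pairs U⊆h (All-pairs U⊆h (All-pairs U⊆h (All.universal (λ _ → _) P)))

    -- The junta test does not interact with the second phase.
    assemble : ∀ (o : Bool → Bool) (wt : ℕ) → (∑[ π ∈ Labellings ] ∑[ c₀ ∈ U ] ∑[ ds ∈ Us ] ∑[ ws ∈ Us ] ∑[ cs ∈ CS ] ∑[ fs ∈ FS ] [ o (Actual.run₂ h k r π c₀ ds ws cs fs) ]ᵇ) ≡ wt →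
      10 * wt ≤ length Labellings * (u * (length Us * (length Us * (length CS * length FS)))) →
      (∀ π → All (λ tr → ∀ b → [ o (passes π tr ∧ b) ]ᵇ ≤ [ o b ]ᵇ) TR) →
      10 * (∑[ ω ∈ outcomes ] [ o (accepts ω) ]ᵇ) ≤ length outcomes
    assemble o wt wt≡ le pass = begin
      10 * (∑[ ω ∈ outcomes ] [ o (accepts ω) ]ᵇ)           ≡⟨ cong (10 *_) (∑-outcomes _) ⟩
      10 * (∑[ π ∈ Labellings ] ∑[ tr ∈ TR ] ∑[ c₀ ∈ U ] ∑[ ds ∈ Us ] ∑[ ws ∈ Us ] ∑[ cs ∈ CS ] ∑[ fs ∈ FS ] [ o (accepts (π , tr , c₀ , ds , ws , cs , fs)) ]ᵇ)
        ≤⟨ *-monoʳ-≤ 10 (∑-mono Labellings λ π → ∑-mono-All (All.map (λ le → ∑-mono U λ c₀ → ∑-mono Us λ ds → ∑-mono Us λ ws → ∑-mono CS λ cs → ∑-mono FS λ fs → le (Actual.run₂ h k r π c₀ ds ws cs fs)) (pass π))) ⟩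
      10 * (∑[ π ∈ Labellings ] ∑[ tr ∈ TR ] ∑[ c₀ ∈ U ] ∑[ ds ∈ Us ] ∑[ ws ∈ Us ] ∑[ cs ∈ CS ] ∑[ fs ∈ FS ] [ o (Actual.run₂ h k r π c₀ ds ws cs fs) ]ᵇ)
        ≡⟨ cong (10 *_) (trans (∑-cong Labellings (λ π → ∑-const _ TR)) (trans (∑-*ˡ (length TR) _ Labellings) (cong (length TR *_) wt≡))) ⟩
      10 * (length TR * wt)                                 ≡⟨ l1 (length TR) wt ⟩
      length TR * (10 * wt)                                 ≤⟨ *-monoʳ-≤ (length TR) le ⟩
      length TR * (length Labellings * (u * (length Us * (length Us * (length CS * length FS))))) ≡⟨ l2 (length TR) (length Labellings) _ ⟩
      length Labellings * (length TR * (u * (length Us * (length Us * (length CS * length FS))))) ≡⟨ size-outcomes ⟨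
      length outcomes                                       ∎
      where
      open ≤-Reasoning
      l1 : ∀ t w → 10 * (t * w) ≡ t * (10 * w)
      l1 = solve-∀
      l2 : ∀ t p x → t * (p * x) ≡ p * (t * x)
      l2 = solve-∀

    module WithSetting (setting : Setting h μ D′) where
      open Setting setting

      module Instance (π : Vec (Point k) n) (c₀ : Point n) (ds ws : Vec (Point n) W) (sep : separates J π ≡ true)
        (none : Detection.missed h 0<u k r J bound err≤bound D′ bound-small T W c₀ ds ws ≡ 0) (low : Q * (∑[ d ∈ toList ds ] bound d c₀) ≤ u) where
        module Det = Detection h 0<u k r J bound err≤bound D′ bound-small T W
        module Dt = Detected {W} {W} J c₀ ds ws

        core : Core h Dt.detected D
        core = Structure.core h 0<u Dt.detected (Det.bound′ c₀ ds ws) (Det.err≤bound′ c₀ ds ws) D 16≤D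
          (Det.bound′-small c₀ ds ws none D D′-large (≤-trans (*-monoʳ-≤ 4 (*-monoˡ-≤ D J≤μ)) T-large) 0<T)
          where
          16≤D : 16 ≤ D
          16≤D = ≤-trans (*-mono-≤ {16} {26} {1} {300 * N₂} (m≤m+n 16 10) (*-mono-≤ {1} {300} (s≤s z≤n) (≤-trans (s≤s z≤n) N₂-large))) D-large

        drift≤ : Q * (∑[ j ∈ allPoints k ] 2 * err (Dt.junk π sep ⊙ block π j)) ≤ 2 * 2 ^ k * u
        drift≤ = begin
          Q * (∑[ j ∈ allPoints k ] 2 * err (Dt.junk π sep ⊙ block π j))    ≤⟨ *-monoʳ-≤ Q (∑-mono (allPoints k) (λ j → *-monoʳ-≤ 2 (Dt.err-junk π sep bound err≤bound j))) ⟩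
          Q * (∑[ j ∈ allPoints k ] 2 * (∑[ d ∈ toList ds ] bound d c₀))    ≡⟨ cong (Q *_) (trans (∑-const _ (allPoints k)) (cong (_* (2 * (∑[ d ∈ toList ds ] bound d c₀))) (length-allPoints k))) ⟩
          Q * (2 ^ k * (2 * (∑[ d ∈ toList ds ] bound d c₀)))               ≡⟨ lem Q (2 ^ k) _ ⟩
          2 * 2 ^ k * (Q * (∑[ d ∈ toList ds ] bound d c₀))                 ≤⟨ *-monoʳ-≤ (2 * 2 ^ k) low ⟩
          2 * 2 ^ k * u                                                     ∎
          where
          open ≤-Reasoning
          lem : ∀ q k x → q * (k * (2 * x)) ≡ 2 * k * (q * x)
          lem = solve-∀

        module SP = SecondPhase h 0<u k r Dt.detected D core π c₀ (Dt.reading π sep) Q M N₂ e L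
          D-large M-large Q-large N₂-large 0<e L-large D-larger drift≤

        detected≤μ : size Dt.detected ≤ μ
        detected≤μ = ≤-trans (size-mono Dt.detected J (Dt.detected⇒J π sep)) J≤μ

      private
        module As = Assembly h 0<u k r μ e constants setting
        total : (o : Bool → Bool) → ℕ
        total o = ∑[ π ∈ Labellings ] ∑[ c₀ ∈ U ] ∑[ ds ∈ Us ] ∑[ ws ∈ Us ] ∑[ cs ∈ CS ] ∑[ fs ∈ FS ] [ o (Actual.run₂ h k r π c₀ ds ws cs fs) ]ᵇ

      complete-total : (fact : IsFactoredDNF r μ h) → (∀ i → lookup J i ≡ true → lookup (varsDNF (proj₁ (proj₂ fact))) i ≡ true) →
        10 * total not ≤ length Labellings * (u * (length Us * (length Us * (length CS * length FS))))
      complete-total fact J⊆vars = As.wrong-total≤ not λ π c₀ ds ws sep none low →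
        Instance.SP.complete-run π c₀ ds ws sep none low μ fact (λ i di → J⊆vars i (Instance.Dt.detected⇒J π c₀ ds ws sep none low π sep i di)) codes-complete

      sound-total : (∀ h′ → IsFactoredDNF r μ h′ → u < e * distance h h′) →
        10 * total id ≤ length Labellings * (u * (length Us * (length Us * (length CS * length FS))))
      sound-total far = As.wrong-total≤ id λ π c₀ ds ws sep none low → Instance.SP.sound-run π c₀ ds ws sep none low
        (λ g → far _ (Instance.SP.hypothesis-factored π c₀ ds ws sep none low (Instance.detected≤μ π c₀ ds ws sep none low) g))

  completeness : IsFactoredDNF r μ h → 10 * (∑[ ω ∈ outcomes ] [ not (accepts ω) ]ᵇ) ≤ length outcomes
  completeness fact = assemble not _ refl (WithSetting.complete-total (factored-setting h 0<u fact D′) fact (λ _ eq → eq))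
    (λ π → All.map (λ {tr} ps b → ≤-reflexive (cong (λ p → [ not (p ∧ b) ]ᵇ) (always π tr ps))) (All-vecs All-trials N₁))
    where
    open FactoredDNF h fact
    vars≤μ : size vars ≤ μ
    vars≤μ = ≤-trans (≤-reflexive (sym (∣∣≡size vars))) (proj₁ (proj₂ (proj₂ (proj₂ (proj₂ fact)))))
    -- A block free of term variables never fails a trial, so every marked block contains one of the
    -- at most `μ` variables, and the junta test passes with certainty.
    always : ∀ π tr → All (λ t → h (proj₁ t) ≡ true × h (proj₁ (proj₂ t)) ≡ true × h (proj₁ (proj₂ (proj₂ t))) ≡ true × Data.Bool.T true) (toList tr) → passes π tr ≡ true
    always π tr ps = T⇒≡ (≤⇒≤ᵇ (≤-trans (∑≤hits-size vars π (JuntaTest.marked h k N₁ μ π tr) marked-hits) vars≤μ))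
      where
      T⇒≡ : ∀ {b} → Data.Bool.T b → b ≡ true
      T⇒≡ {true} _ = refl
      marked-hits : ∀ j → JuntaTest.marked h k N₁ μ π tr j ≡ true → 0 < hits vars π j
      marked-hits j mj = n≢0⇒n>0 λ z → true≢false (trans (sym mj) (trans (any-cong (All.map (λ {t} → unmarked z t) ps)) (never (toList tr))))
        where
        true≢false : true ≢ false
        true≢false ()
        never : ∀ (ts : List Trial) → any (λ _ → false) ts ≡ false
        never []       = refl
        never (_ ∷ ts) = never ts
        unmarked : hits vars π j ≡ 0 → ∀ t → h (proj₁ t) ≡ true × h (proj₁ (proj₂ t)) ≡ true × h (proj₁ (proj₂ (proj₂ t))) ≡ true × Data.Bool.T true → fails (block π j) t ≡ false
        unmarked zr (x , y , z , B) (hx , hy , hz , _) = cong not (move x y z (block π j ⊙ B) hx hy hz (ext λ i → trans (lookup-⊙ (block π j ⊙ B) vars i) (trans (cong (_∧ lookup vars i) (trans (lookup-⊙ (block π j) B i) (cong (_∧ lookup B i) (lookup-block π j i)))) (trans (lem i) (sym (lookup-𝟎 i))))))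
          where
          lem : ∀ i → ((lookup π i ≡ᵖ j) ∧ lookup B i) ∧ lookup vars i ≡ false
          lem i with lookup vars i in vi
          ... | false = ∧-zeroʳ _
          ... | true with lookup π i ≡ᵖ j in πi
          ...   | false = refl
          ...   | true  = ⊥-elim (<-irrefl (sym zr) (subst (λ j → 0 < hits vars π j) (≡ᵖ⇒≡ _ _ πi) (hit vars π i vi)))

  -- A dichotomy on the number of cuts: with at most `μ` of them the second phase is likely to
  -- reject, with more the junta test is. The cuts depend on `h` alone and are never computed by the
  -- tester.
  soundness : (∀ h′ → IsFactoredDNF r μ h′ → u < e * distance h h′) → 10 * (∑[ ω ∈ outcomes ] [ accepts ω ]ᵇ) ≤ length outcomes
  soundness far = by-cuts (size cuts ≤? μ)
    where
    scaled : Subadditive (λ A → S * failures A)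
    scaled = record { at-𝟎 = trans (cong (S *_) (at-𝟎 failures-subadditive)) (*-zeroʳ S)
                    ; at-⊕ = λ v w → ≤-trans (*-monoʳ-≤ S (at-⊕ failures-subadditive v w)) (≤-reflexive (*-distribˡ-+ S (failures v) (failures w))) }
    open Scan (scan (λ A → S * failures A) (λ A → S * failures A) (length trials)
      (≤-trans (≤-reflexive (at-𝟎 scaled)) z≤n) (≤-trans (≤-reflexive (at-𝟎 scaled)) z≤n) (at-⊕ scaled) (at-⊕ scaled)) renaming (first to first-class)
    by-cuts : Dec (size cuts ≤ μ) → 10 * (∑[ ω ∈ outcomes ] [ accepts ω ]ᵇ) ≤ length outcomes
    by-cuts (yes few) = assemble id _ refl (WithSetting.sound-total (cuts-setting h 0<u D′ S S-large cuts few rest) far)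
      (λ π → All.universal (λ tr b → implied (passes π tr) b) TR)
      where
      implied : ∀ p b → [ p ∧ b ]ᵇ ≤ [ b ]ᵇ
      implied true  b = ≤-refl
      implied false b = z≤n
    by-cuts (no many) = begin
      10 * (∑[ ω ∈ outcomes ] [ accepts ω ]ᵇ)               ≡⟨ cong (10 *_) (∑-outcomes _) ⟩
      10 * (∑[ π ∈ Labellings ] ∑[ tr ∈ TR ] ∑[ c₀ ∈ U ] ∑[ ds ∈ Us ] ∑[ ws ∈ Us ] ∑[ cs ∈ CS ] ∑[ fs ∈ FS ] [ accepts (π , tr , c₀ , ds , ws , cs , fs) ]ᵇ)
        ≤⟨ *-monoʳ-≤ 10 (∑-mono Labellings λ π → ∑-mono TR λ tr → ∑-mono U λ c₀ → ∑-mono Us λ ds → ∑-mono Us λ ws → ∑-mono CS λ cs → ∑-mono FS λ fs → implied (passes π tr) (Actual.run₂ h k r π c₀ ds ws cs fs)) ⟩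
      10 * (∑[ π ∈ Labellings ] ∑[ tr ∈ TR ] ∑[ c₀ ∈ U ] ∑[ ds ∈ Us ] ∑[ ws ∈ Us ] ∑[ cs ∈ CS ] ∑[ fs ∈ FS ] [ passes π tr ]ᵇ)
        ≡⟨ cong (10 *_) (∑-cong Labellings (λ π → trans (∑-cong TR (λ tr → constants-out [ passes π tr ]ᵇ)) (∑-*ˡ Z _ TR))) ⟩
      10 * (∑[ π ∈ Labellings ] Z * (∑[ tr ∈ TR ] [ passes π tr ]ᵇ)) ≡⟨ cong (10 *_) (∑-*ˡ Z _ Labellings) ⟩
      10 * (Z * pass-sum)                                   ≤⟨ *-monoˡ-≤ (Z * pass-sum) (m≤m+n 10 40) ⟩
      50 * (Z * pass-sum)                                   ≡⟨ l1 Z pass-sum ⟩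
      Z * (50 * pass-sum)                                   ≤⟨ *-monoʳ-≤ Z (junta-test-sound S 0<S 0<u labels heavy K-large N₁-large) ⟩
      Z * (length Labellings * length TR)                   ≡⟨ l2 Z (length Labellings) (length TR) ⟩
      length Labellings * (length TR * Z)                   ≡⟨ size-outcomes ⟨
      length outcomes                                       ∎
      where
      open ≤-Reasoning
      Z = u * (length Us * (length Us * (length CS * length FS)))
      pass-sum = ∑[ π ∈ Labellings ] ∑[ tr ∈ TR ] [ passes π tr ]ᵇ
      l1 : ∀ z p → 50 * (z * p) ≡ z * (50 * p)
      l1 = solve-∀
      l2 : ∀ z p t → z * (p * t) ≡ p * (t * z)
      l2 = solve-∀
      implied : ∀ p b → [ p ∧ b ]ᵇ ≤ [ p ]ᵇ
      implied true  b = []≤1 b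
      implied false b = z≤n
      constants-out : ∀ c → (∑[ c₀ ∈ U ] ∑[ ds ∈ Us ] ∑[ ws ∈ Us ] ∑[ cs ∈ CS ] ∑[ fs ∈ FS ] c) ≡ Z * c
      constants-out c = trans (∑-cong U λ _ → trans (∑-cong Us λ _ → trans (∑-cong Us λ _ → trans (∑-cong CS λ _ → ∑-const c FS) (∑-const _ CS)) (∑-const _ Us)) (∑-const _ Us)) (trans (∑-const _ U) (l3 u (length Us) (length CS) (length FS) c))
        where
        l3 : ∀ u w a b c → u * (w * (w * (a * (b * c)))) ≡ u * (w * (w * (a * b))) * c
        l3 = solve-∀
      heavy : ∀ t → t < suc μ → length trials < S * failures (class labels t)
      heavy zero    lt = first-class (≤-trans (s≤s z≤n) (≰⇒> many))
      heavy (suc t) lt = further t (≤-trans lt (≰⇒> many))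

-- Imported here because the constructor +_ makes sections of natural addition ambiguous.
open import Data.Integer using (+_; -[1+_])
import Data.Integer as ℤ
import Data.Integer.Properties as ℤ
open import Data.Rational.Unnormalised as ℚ using (ℚᵘ; mkℚᵘ; _/_; Positive; _≃_; *≡*; 1ℚᵘ; ½; _÷_) renaming (_≤_ to _≤ℚ_; _<_ to _<ℚ_)
import Data.Rational.Unnormalised.Properties as ℚ
open import Data.Rational.Unnormalised.Solver using (module +-*-Solver)

-- Randomized oracle algorithms

⟪_⟫ : ℕ → ℚᵘ
⟪ m ⟫ = + m / 1

⟪+⟫ : ∀ a b → ⟪ a + b ⟫ ≃ ⟪ a ⟫ ℚ.+ ⟪ b ⟫
⟪+⟫ a b = *≡* (trans (ℤ.*-identityʳ _) (sym (trans (ℤ.*-identityʳ _) (cong₂ ℤ._+_ (ℤ.*-identityʳ (+ a)) (ℤ.*-identityʳ (+ b))))))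

⟪*⟫ : ∀ a b → ⟪ a * b ⟫ ≃ ⟪ a ⟫ ℚ.* ⟪ b ⟫
⟪*⟫ a b = *≡* (cong (ℤ._* + 1) (ℤ.pos-* a b))

⟪≤⟫ : ∀ {a b} → a ≤ b → ⟪ a ⟫ ≤ℚ ⟪ b ⟫
⟪≤⟫ {a} {b} le = ℚ.*≤* (ℤ.*-monoʳ-≤-nonNeg (+ 1) (ℤ.+≤+ le))

weaken : ∀ {A : Alg n} → κ ≤ κ′ → CallsWithin κ A → CallsWithin κ′ A
weaken le       (ret b)  = ret b
weaken le       (coin c) = coin (λ b → weaken le (c b))
weaken (s≤s le) (mq c)   = mq (λ b → weaken le (c b))
weaken (s≤s le) (samp c) = samp (λ x → weaken le (c x))

-- A source of randomness: a random value of type A, uniform over a list that depends on h.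
record Sampler (n : ℕ) (A : Set) : Set where
  field
    cost  : ℕ
    draw  : (A → Alg n) → Alg n
    els   : BoolFun n → List A
    nonempty : ∀ h → 0 < supportSize h → 0 < length (els h)
    calls : ∀ {κ k} → (∀ x → CallsWithin κ (k x)) → CallsWithin (cost + κ) (draw k)
    -- `d` is a common denominator for the continuations, so laws compose by multiplying
    -- denominators, and probabilities turn into counts with no division.
    law   : ∀ h → 0 < supportSize h → ∀ k (f : A → ℕ) d →
            (∀ x → accProb (k x) h ℚ.* ⟪ d ⟫ ≃ ⟪ f x ⟫) →
            accProb (draw k) h ℚ.* ⟪ d * length (els h) ⟫ ≃ ⟪ ∑ (els h) f ⟫

open Sampler public

pointSampler : Sampler n (Point n)
pointSampler .cost = 1
pointSampler .draw = samp
pointSampler .els  = support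
pointSampler .nonempty h 0<u = 0<u
pointSampler .calls = samp
pointSampler .law h 0<u k f d eq = go (supportSize h) refl 0<u
  where
  open ℚ.≃-Reasoning
  S : List (Point _) → ℚᵘ
  S L = sumℚ (map (λ x → accProb (k x) h) L)
  sum-law : ∀ L → S L ℚ.* ⟪ d ⟫ ≃ ⟪ ∑ L f ⟫
  sum-law []      = ℚ.*-zeroˡ ⟪ d ⟫
  sum-law (x ∷ L) = begin
    (accProb (k x) h ℚ.+ S L) ℚ.* ⟪ d ⟫              ≈⟨ ℚ.*-distribʳ-+ ⟪ d ⟫ (accProb (k x) h) (S L) ⟩
    accProb (k x) h ℚ.* ⟪ d ⟫ ℚ.+ S L ℚ.* ⟪ d ⟫      ≈⟨ ℚ.+-cong (eq x) (sum-law L) ⟩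
    ⟪ f x ⟫ ℚ.+ ⟪ ∑ L f ⟫                            ≈⟨ ⟪+⟫ (f x) (∑ L f) ⟨
    ⟪ f x + ∑ L f ⟫                                  ∎
  inv-law : ∀ u → 0 < u → divℕ 1 u ℚ.* ⟪ u ⟫ ≃ 1ℚᵘ
  inv-law (suc u) _ = *≡* (trans (ℤ.*-identityʳ _) (trans (ℤ.*-identityˡ (+ suc u)) (sym (trans (ℤ.*-identityˡ _) (cong +_ (*-identityʳ (suc u)))))))
  go : ∀ u → u ≡ supportSize h → 0 < u → S (support h) ℚ.* divℕ 1 (supportSize h) ℚ.* ⟪ d * supportSize h ⟫ ≃ ⟪ ∑ (support h) f ⟫
  go u refl 0<u = begin
    S (support h) ℚ.* divℕ 1 u ℚ.* ⟪ d * u ⟫                ≈⟨ ℚ.*-congˡ {x = S (support h) ℚ.* divℕ 1 u} (⟪*⟫ d u) ⟩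
    S (support h) ℚ.* divℕ 1 u ℚ.* (⟪ d ⟫ ℚ.* ⟪ u ⟫)
      ≈⟨ +-*-Solver.solve 4 (λ a b c e → a :* b :* (c :* e) := (a :* c) :* (b :* e)) ℚ.≃-refl (S (support h)) (divℕ 1 u) ⟪ d ⟫ ⟪ u ⟫ ⟩
    S (support h) ℚ.* ⟪ d ⟫ ℚ.* (divℕ 1 u ℚ.* ⟪ u ⟫)        ≈⟨ ℚ.*-cong (sum-law (support h)) (inv-law u 0<u) ⟩
    ⟪ ∑ (support h) f ⟫ ℚ.* 1ℚᵘ                             ≈⟨ ℚ.*-identityʳ _ ⟩
    ⟪ ∑ (support h) f ⟫                                     ∎
    where open +-*-Solver using (_:*_; _:=_)

bitSampler : Sampler n Bool
bitSampler .cost = 0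
bitSampler .draw = coin
bitSampler .els  = λ _ → true ∷ false ∷ []
bitSampler .nonempty h 0<u = s≤s z≤n
bitSampler .calls = coin
bitSampler .law h 0<u k f d eq = begin
  ½ ℚ.* (a ℚ.+ b) ℚ.* ⟪ d * 2 ⟫           ≈⟨ ℚ.*-congˡ {x = ½ ℚ.* (a ℚ.+ b)} (⟪*⟫ d 2) ⟩
  ½ ℚ.* (a ℚ.+ b) ℚ.* (⟪ d ⟫ ℚ.* ⟪ 2 ⟫)
    ≈⟨ +-*-Solver.solve 5 (λ x a b y z → x :* (a :+ b) :* (y :* z) := (x :* z) :* (a :* y :+ b :* y)) ℚ.≃-refl ½ a b ⟪ d ⟫ ⟪ 2 ⟫ ⟩
  ½ ℚ.* ⟪ 2 ⟫ ℚ.* (a ℚ.* ⟪ d ⟫ ℚ.+ b ℚ.* ⟪ d ⟫) ≈⟨ ℚ.*-cong {x = ½ ℚ.* ⟪ 2 ⟫} {1ℚᵘ} (*≡* refl) (ℚ.+-cong (eq true) (eq false)) ⟩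
  1ℚᵘ ℚ.* (⟪ f true ⟫ ℚ.+ ⟪ f false ⟫)    ≈⟨ ℚ.*-identityˡ _ ⟩
  ⟪ f true ⟫ ℚ.+ ⟪ f false ⟫              ≈⟨ ⟪+⟫ (f true) (f false) ⟨
  ⟪ f true + f false ⟫                    ≈⟨ ℚ.≃-reflexive (cong (λ z → ⟪ f true + z ⟫) (sym (+-identityʳ (f false)))) ⟩
  ⟪ f true + (f false + 0) ⟫              ∎
  where
  open ℚ.≃-Reasoning
  open +-*-Solver using (_:*_; _:=_; _:+_)
  a = accProb (k true) h
  b = accProb (k false) h

productSampler : ∀ {C : Set} → (A → B → C) → Sampler n A → Sampler n B → Sampler n C
productSampler g s t .cost = cost s + cost t
productSampler g s t .draw k = draw s λ x → draw t λ y → k (g x y)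
productSampler g s t .els h = cartesianProductWith g (els s h) (els t h)
productSampler g s t .nonempty h 0<u =
  ≤-trans (*-mono-≤ (nonempty s h 0<u) (nonempty t h 0<u)) (≤-reflexive (sym (length-cartesian g (els s h) (els t h))))
productSampler g s t .calls {κ} c =
  weaken (≤-reflexive (sym (+-assoc (cost s) (cost t) κ))) (calls s λ x → calls t λ y → c (g x y))
productSampler g s t .law h 0<u k f d eq = begin
  p ℚ.* ⟪ d * length (els (productSampler g s t) h) ⟫ ≈⟨ ℚ.*-congˡ {x = p} (ℚ.≃-reflexive (cong ⟪_⟫ lem)) ⟩
  p ℚ.* ⟪ d * length (els t h) * length (els s h) ⟫   ≈⟨ law s h 0<u _ _ (d * length (els t h)) (λ x → law t h 0<u _ _ d (λ y → eq (g x y))) ⟩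
  ⟪ (∑[ x ∈ els s h ] ∑[ y ∈ els t h ] f (g x y)) ⟫   ≈⟨ ℚ.≃-reflexive (cong ⟪_⟫ (sym (∑-cartesian f g (els s h) (els t h)))) ⟩
  ⟪ ∑ (els (productSampler g s t) h) f ⟫              ∎
  where
  open ℚ.≃-Reasoning
  p = accProb (draw (productSampler g s t) k) h
  lem : d * length (els (productSampler g s t) h) ≡ d * length (els t h) * length (els s h)
  lem = trans (cong (d *_) (trans (length-cartesian g (els s h) (els t h)) (*-comm (length (els s h)) _))) (sym (*-assoc d _ _))

unitSampler : A → Sampler n A
unitSampler x .cost = 0
unitSampler x .draw k = k x
unitSampler x .els _ = x ∷ []
unitSampler x .nonempty h 0<u = s≤s z≤n
unitSampler x .calls c = c x
unitSampler x .law h 0<u k f d eq =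
  ℚ.≃-trans (ℚ.*-congˡ {x = accProb (k x) h} (ℚ.≃-reflexive (cong ⟪_⟫ (*-identityʳ d))))
    (ℚ.≃-trans (eq x) (ℚ.≃-reflexive (cong ⟪_⟫ (sym (+-identityʳ (f x))))))

infixr 4 _⊗_
_⊗_ : Sampler n A → Sampler n B → Sampler n (A × B)
s ⊗ t = productSampler _,_ s t

vecSampler : Sampler n A → (m : ℕ) → Sampler n (Vec A m)
vecSampler s zero    = unitSampler []
vecSampler s (suc m) = productSampler _∷_ s (vecSampler s m)

els-vecSampler : ∀ (s : Sampler n A) m h → els (vecSampler s m) h ≡ vecs (els s h) m
els-vecSampler s zero    h = refl
els-vecSampler s (suc m) h = cong (cartesianProductWith _∷_ (els s h)) (els-vecSampler s m h)

cost-vecSampler : ∀ (s : Sampler n A) m → cost (vecSampler s m) ≡ m * cost s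
cost-vecSampler s zero    = refl
cost-vecSampler s (suc m) = cong (λ z → cost s + z) (cost-vecSampler s m)

cubeSampler : (k : ℕ) → Sampler n (Point k)
cubeSampler k = vecSampler bitSampler k

els-cubeSampler : ∀ k (h : BoolFun n) → els (cubeSampler k) h ≡ allPoints k
els-cubeSampler zero    h = refl
els-cubeSampler (suc k) h rewrite els-cubeSampler k h = cong (map (true ∷_) (allPoints k) ++_) (List.++-identityʳ _)

cost-cubeSampler : ∀ k → cost (cubeSampler {n} k) ≡ 0
cost-cubeSampler k = trans (cost-vecSampler bitSampler k) (*-zeroʳ k)

-- Deterministic query programs

data Query (n : ℕ) (A : Set) : Set where
  pure : A → Query n A
  ask  : Point n → (Bool → Query n A) → Query n A

run : BoolFun n → Query n A → A
run h (pure a)  = a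
run h (ask x c) = run h (c (h x))

infixl 1 _>>=_
_>>=_ : Query n A → (A → Query n B) → Query n B
pure a  >>= f = f a
ask x c >>= f = ask x (λ b → c b >>= f)

run->>= : ∀ h (p : Query n A) (f : A → Query n B) → run h (p >>= f) ≡ run h (f (run h p))
run->>= h (pure a)  f = refl
run->>= h (ask x c) f = run->>= h (c (h x)) f

data Cost {n : ℕ} {A : Set} : ℕ → Query n A → Set where
  pure : ∀ {κ a} → Cost κ (pure a)
  ask  : ∀ {κ x c} → (∀ b → Cost κ (c b)) → Cost (suc κ) (ask x c)

weaken-Cost : ∀ {p : Query n A} → κ ≤ κ′ → Cost κ p → Cost κ′ p
weaken-Cost le       pure    = pure
weaken-Cost (s≤s le) (ask c) = ask (λ b → weaken-Cost le (c b))

Cost->>= : ∀ {p : Query n A} {f : A → Query n B} → Cost κ p → (∀ a → Cost κ′ (f a)) → Cost (κ + κ′) (p >>= f)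
Cost->>= {κ = κ} pure c = weaken-Cost (m≤n+m _ κ) (c _)
Cost->>= (ask d) c = ask (λ b → Cost->>= (d b) c)

toAlg : Query n Bool → Alg n
toAlg (pure b)  = ret b
toAlg (ask x c) = mq x (λ b → toAlg (c b))

calls-toAlg : ∀ {p : Query n Bool} → Cost κ p → CallsWithin κ (toAlg p)
calls-toAlg pure    = ret _
calls-toAlg (ask c) = mq (λ b → calls-toAlg (c b))

accProb-toAlg : ∀ h (p : Query n Bool) → accProb (toAlg p) h ≡ ⟪ [ run h p ]ᵇ ⟫
accProb-toAlg h (pure true)  = refl
accProb-toAlg h (pure false) = refl
accProb-toAlg h (ask x c)    = accProb-toAlg h (c (h x))

query : Point n → Query n Bool
query x = ask x pure

anyQ : List A → (A → Query n Bool) → Query n Bool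
anyQ []      f = pure false
anyQ (x ∷ L) f = f x >>= λ b → anyQ L f >>= λ c → pure (b ∨ c)

run-anyQ : ∀ h L (f : A → Query n Bool) → run h (anyQ L f) ≡ any (λ x → run h (f x)) L
run-anyQ h []      f = refl
run-anyQ h (x ∷ L) f = trans (run->>= h (f x) _) (trans (run->>= h (anyQ L f) _) (cong (run h (f x) ∨_) (run-anyQ h L f)))

Cost-anyQ : ∀ (L : List A) {f : A → Query n Bool} → (∀ x → Cost κ (f x)) → Cost (length L * κ) (anyQ L f)
Cost-anyQ []      c = pure
Cost-anyQ {κ = κ} (x ∷ L) {f} c = Cost->>= (c x) (λ b → weaken-Cost (≤-reflexive (+-identityʳ _)) (Cost->>= {κ′ = 0} (Cost-anyQ L {f} c) (λ _ → pure)))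

mapQ : ∀ {m} → (A → Query n B) → Vec A m → Query n (Vec B m)
mapQ f []      = pure []
mapQ f (x ∷ v) = f x >>= λ b → mapQ f v >>= λ w → pure (b ∷ w)

run-mapQ : ∀ h {m} (f : A → Query n B) (v : Vec A m) → run h (mapQ f v) ≡ Vec.map (run h ∘ f) v
run-mapQ h f []      = refl
run-mapQ h f (x ∷ v) = trans (run->>= h (f x) _) (trans (run->>= h (mapQ f v) _) (cong (run h (f x) ∷_) (run-mapQ h f v)))

Cost-mapQ : ∀ {m} {f : A → Query n B} (v : Vec A m) → (∀ x → Cost κ (f x)) → Cost (m * κ) (mapQ f v)
Cost-mapQ []      c = pure
Cost-mapQ {f = f} (x ∷ v) c = Cost->>= (c x) (λ b → weaken-Cost (≤-reflexive (+-identityʳ _)) (Cost->>= {κ′ = 0} (Cost-mapQ {f = f} v c) (λ _ → pure)))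

countQ : List A → (A → Query n Bool) → Query n ℕ
countQ []      f = pure 0
countQ (x ∷ L) f = f x >>= λ b → countQ L f >>= λ m → pure ([ b ]ᵇ + m)

run-countQ : ∀ h L (f : A → Query n Bool) → run h (countQ L f) ≡ (∑[ x ∈ L ] [ run h (f x) ]ᵇ)
run-countQ h []      f = refl
run-countQ h (x ∷ L) f = trans (run->>= h (f x) _) (trans (run->>= h (countQ L f) _) (cong (λ z → [ run h (f x) ]ᵇ + z) (run-countQ h L f)))

Cost-countQ : ∀ (L : List A) {f : A → Query n Bool} → (∀ x → Cost κ (f x)) → Cost (length L * κ) (countQ L f)
Cost-countQ []      c = pure
Cost-countQ (x ∷ L) {f} c = Cost->>= (c x) (λ b → weaken-Cost (≤-reflexive (+-identityʳ _)) (Cost->>= {κ′ = 0} (Cost-countQ L {f} c) (λ _ → pure)))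

allQ : List A → (A → Query n Bool) → Query n Bool
allQ []      f = pure true
allQ (x ∷ L) f = f x >>= λ b → allQ L f >>= λ c → pure (b ∧ c)

run-allQ : ∀ h L (f : A → Query n Bool) → run h (allQ L f) ≡ all (λ x → run h (f x)) L
run-allQ h []      f = refl
run-allQ h (x ∷ L) f = trans (run->>= h (f x) _) (trans (run->>= h (allQ L f) _) (cong (run h (f x) ∧_) (run-allQ h L f)))

Cost-allQ : ∀ (L : List A) {f : A → Query n Bool} → (∀ x → Cost κ (f x)) → Cost (length L * κ) (allQ L f)
Cost-allQ []      c = pure
Cost-allQ (x ∷ L) {f} c = Cost->>= (c x) (λ b → weaken-Cost (≤-reflexive (+-identityʳ _)) (Cost->>= {κ′ = 0} (Cost-allQ L {f} c) (λ _ → pure)))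

algorithm : Sampler n A → (A → Query n Bool) → Alg n
algorithm s p = draw s (toAlg ∘ p)

calls-algorithm : ∀ (s : Sampler n A) {p} → (∀ x → Cost κ (p x)) → CallsWithin (cost s + κ) (algorithm s p)
calls-algorithm s c = calls s (λ x → calls-toAlg (c x))

private
  algorithm-law : ∀ (s : Sampler n A) p h → 0 < supportSize h →
    accProb (algorithm s p) h ℚ.* ⟪ length (els s h) ⟫ ≃ ⟪ (∑[ x ∈ els s h ] [ run h (p x) ]ᵇ) ⟫
  algorithm-law s p h 0<u = ℚ.≃-trans
    (ℚ.*-congˡ {x = accProb (algorithm s p) h} (ℚ.≃-reflexive (cong ⟪_⟫ (sym (*-identityˡ (length (els s h)))))))
    (law s h 0<u (toAlg ∘ p) (λ x → [ run h (p x) ]ᵇ) 1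
      (λ x → ℚ.≃-trans (ℚ.*-identityʳ _) (ℚ.≃-reflexive (accProb-toAlg h (p x)))))

  ≤ℚ-from-ratio : ∀ a b c d x → 0 < b → x ℚ.* ⟪ b ⟫ ≃ ⟪ a ⟫ → c * b ≤ suc d * a → + c / suc d ≤ℚ x
  ≤ℚ-from-ratio a (suc b) c d x _ eq le = ℚ.*-cancelʳ-≤-pos ⟪ suc b ⟫ (begin
    (+ c / suc d) ℚ.* ⟪ suc b ⟫ ≤⟨ ℚ.*≤* begin′ ⟩
    ⟪ a ⟫                     ≃⟨ eq ⟨
    x ℚ.* ⟪ suc b ⟫ ∎)
    where
    open ℚ.≤-Reasoning
    begin′ : (+ c ℤ.* + suc b) ℤ.* + 1 ℤ.≤ + a ℤ.* + (suc d * 1)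
    begin′ = ℤ.≤-trans (ℤ.≤-reflexive (trans (ℤ.*-identityʳ _) (sym (ℤ.pos-* c (suc b)))))
      (ℤ.≤-trans (ℤ.+≤+ le) (ℤ.≤-reflexive (trans (ℤ.pos-* (suc d) a) (trans (ℤ.*-comm (+ suc d) (+ a)) (cong (λ z → + a ℤ.* + z) (sym (*-identityʳ (suc d))))))))

  rejection-law : ∀ (s : Sampler n A) p h → 0 < supportSize h →
    rejProb (algorithm s p) h ℚ.* ⟪ length (els s h) ⟫ ≃ ⟪ (∑[ x ∈ els s h ] [ not (run h (p x)) ]ᵇ) ⟫
  rejection-law s p h 0<u = ℚ.+-cancelˡ {⟪ a ⟫} (begin
    ⟪ a ⟫ ℚ.+ (1ℚᵘ ℚ.- P) ℚ.* ⟪ ℓ ⟫           ≈⟨ ℚ.+-congˡ ((1ℚᵘ ℚ.- P) ℚ.* ⟪ ℓ ⟫) (algorithm-law s p h 0<u) ⟨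
    P ℚ.* ⟪ ℓ ⟫ ℚ.+ (1ℚᵘ ℚ.- P) ℚ.* ⟪ ℓ ⟫
      ≈⟨ +-*-Solver.solve 2 (λ x y → x :* y :+ (con 1ℚᵘ :- x) :* y := y) ℚ.≃-refl P ⟪ ℓ ⟫ ⟩
    ⟪ ℓ ⟫                                     ≈⟨ ℚ.≃-reflexive (cong ⟪_⟫ (sym ([not]-∑ (λ x → run h (p x)) (els s h)))) ⟩
    ⟪ a + b ⟫                                 ≈⟨ ⟪+⟫ a b ⟩
    ⟪ a ⟫ ℚ.+ ⟪ b ⟫                           ∎)
    where
    open ℚ.≃-Reasoning
    open +-*-Solver using (_:*_; _:=_; _:+_; _:-_; con)
    P = accProb (algorithm s p) h
    ℓ = length (els s h)
    a = ∑[ x ∈ els s h ] [ run h (p x) ]ᵇ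
    b = ∑[ x ∈ els s h ] [ not (run h (p x)) ]ᵇ

nineTenths≤accProb : ∀ (s : Sampler n A) p h → 0 < supportSize h →
  10 * (∑[ x ∈ els s h ] [ not (run h (p x)) ]ᵇ) ≤ length (els s h) →
  nineTenths ≤ℚ accProb (algorithm s p) h
nineTenths≤accProb s p h 0<u rej = ≤ℚ-from-ratio a ℓ 9 9 _ (nonempty s h 0<u) (algorithm-law s p h 0<u) (+-cancelʳ-≤ ℓ (9 * ℓ) (10 * a) (begin
  9 * ℓ + ℓ          ≡⟨ lem ℓ ⟩
  10 * ℓ             ≡⟨ cong (10 *_) ([not]-∑ (λ x → run h (p x)) (els s h)) ⟨
  10 * (a + b)       ≡⟨ *-distribˡ-+ 10 a b ⟩
  10 * a + 10 * b    ≤⟨ +-monoʳ-≤ (10 * a) rej ⟩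
  10 * a + ℓ         ∎))
  where
  open ≤-Reasoning
  ℓ = length (els s h)
  a = ∑[ x ∈ els s h ] [ run h (p x) ]ᵇ
  b = ∑[ x ∈ els s h ] [ not (run h (p x)) ]ᵇ
  lem : ∀ x → 9 * x + x ≡ 10 * x
  lem = solve-∀

nineTenths≤rejProb : ∀ (s : Sampler n A) p h → 0 < supportSize h →
  10 * (∑[ x ∈ els s h ] [ run h (p x) ]ᵇ) ≤ length (els s h) →
  nineTenths ≤ℚ rejProb (algorithm s p) h
nineTenths≤rejProb s p h 0<u acc = ≤ℚ-from-ratio b ℓ 9 9 _ (nonempty s h 0<u) (rejection-law s p h 0<u) (+-cancelʳ-≤ ℓ (9 * ℓ) (10 * b) (begin
  9 * ℓ + ℓ          ≡⟨ lem ℓ ⟩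
  10 * ℓ             ≡⟨ cong (10 *_) ([not]-∑ (λ x → run h (p x)) (els s h)) ⟨
  10 * (a + b)       ≡⟨ trans (*-distribˡ-+ 10 a b) (+-comm (10 * a) _) ⟩
  10 * b + 10 * a    ≤⟨ +-monoʳ-≤ (10 * b) acc ⟩
  10 * b + ℓ         ∎))
  where
  open ≤-Reasoning
  ℓ = length (els s h)
  a = ∑[ x ∈ els s h ] [ run h (p x) ]ᵇ
  b = ∑[ x ∈ els s h ] [ not (run h (p x)) ]ᵇ
  lem : ∀ x → 9 * x + x ≡ 10 * x
  lem = solve-∀

all-map : ∀ {B : Set} (p : B → Bool) (f : A → B) {m} (v : Vec A m) → all p (toList (Vec.map f v)) ≡ all (λ x → p (f x)) (toList v)
all-map p f []      = refl
all-map p f (x ∷ v) = cong (p (f x) ∧_) (all-map p f v)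

-- The tester as a query program on random inputs

module Program {n : ℕ} (k r μ N₁ W N N₂ : ℕ) where
  private
    K = 2 ^ k
    Trial = Point n × Point n × Point n × Point n

  Input : Set
  Input = Vec (Point k) n × Vec Trial N₁ × Point n × Vec (Point n) W × Vec (Point n) W × Vec (Point n) N × Vec (Point n × Vec (Point K) (2 ^ K)) N₂

  failsQ : Point n → Trial → Query n Bool
  failsQ A (x , y , z , B) = ask (z ⊕ ((x ⊕ y) ⊙ (A ⊙ B))) (pure ∘ not)

  markedQ : Vec (Point k) n → Vec Trial N₁ → Point k → Query n Bool
  markedQ π tr j = anyQ (toList tr) (failsQ (block π j))

  bitsQ : Vec (Point k) n → Point n → Vec (Point n) W → Point n → Query n (Point K)
  bitsQ π c₀ ws c = mapQ (λ j → anyQ (toList ws) (λ w → ask (w ⊕ ((c ⊕ c₀) ⊙ block π j)) (pure ∘ not))) (tabulate unidx)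

  selected : Point K → Vec (Point K) N → Maybe (Code K r)
  selected obs bs = best (λ g → all (eval obs g) (toList bs)) (λ g → ∑[ σ ∈ allPoints K ] [ eval obs g σ ]ᵇ) (codes K r)

  probeQ : Vec (Point k) n → Point n → Point n → Point K → Maybe (Point K) → Query n Bool
  probeQ π flipper f b nothing  = pure true
  probeQ π flipper f b (just σ) = query (f ⊕ (spread π (σ ⊕ b) ⊙ flipper))

  probesQ : Vec (Point k) n → Point n → Vec (Point n) W → Point K → Point n → Vec (Point n × Vec (Point K) (2 ^ K)) N₂ → Maybe (Code K r) → Query n Bool
  probesQ π c₀ ws obs flipper fs nothing  = pure false
  probesQ π c₀ ws obs flipper fs (just g) = allQ (toList fs) λ (f , seeds) → bitsQ π c₀ ws f >>= λ b → probeQ π flipper f b (first (eval obs g) seeds)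

  phase₂Q : Vec (Point k) n → Point n → Vec (Point n) W → Vec (Point n) W → Vec (Point n) N → Vec (Point n × Vec (Point K) (2 ^ K)) N₂ → Query n Bool
  phase₂Q π c₀ ds ws cs fs =
    mapQ (bitsQ π c₀ ws) ds >>= λ dbits →
    mapQ (bitsQ π c₀ ws) cs >>= λ cbits →
    probesQ π c₀ ws (union dbits) (carrier π c₀ ds dbits) fs (selected (union dbits) cbits)

  program : Input → Query n Bool
  program (π , tr , c₀ , ds , ws , cs , fs) =
    countQ (allPoints k) (markedQ π tr) >>= λ m → if m ≤ᵇ μ then phase₂Q π c₀ ds ws cs fs else pure false

  private
    length-toList : ∀ {A : Set} {m} (v : Vec A m) → length (toList v) ≡ m
    length-toList []      = refl
    length-toList (x ∷ v) = cong suc (length-toList v)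

    κ-bits κ₂ : ℕ
    κ-bits = K * (W * 1)
    κ₂ = W * κ-bits + (N * κ-bits + N₂ * (κ-bits + 1))

  queries : ℕ
  queries = K * (N₁ * 1) + κ₂

  private
    Cost-anyQ′ : ∀ {A : Set} {m} (v : Vec A m) {f : A → Query n Bool} {c} → (∀ x → Cost c (f x)) → Cost (m * c) (anyQ (toList v) f)
    Cost-anyQ′ v {c = c} p = weaken-Cost (≤-reflexive (cong (_* c) (length-toList v))) (Cost-anyQ (toList v) p)

    Cost-ask : ∀ x (f : Bool → Bool) → Cost {n} {Bool} 1 (ask x (λ b → pure (f b)))
    Cost-ask x f = ask (λ _ → pure)

    Cost-bits : ∀ π c₀ ws c → Cost κ-bits (bitsQ π c₀ ws c)
    Cost-bits π c₀ ws c = Cost-mapQ (tabulate unidx) (λ j → Cost-anyQ′ ws (λ w → Cost-ask (w ⊕ ((c ⊕ c₀) ⊙ block π j)) not))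

    Cost-probe : ∀ π flipper f b σ → Cost 1 (probeQ π flipper f b σ)
    Cost-probe π flipper f b nothing  = pure
    Cost-probe π flipper f b (just σ) = Cost-ask _ id

    Cost-probes : ∀ π c₀ ws obs flipper fs g → Cost (N₂ * (κ-bits + 1)) (probesQ π c₀ ws obs flipper fs g)
    Cost-probes π c₀ ws obs flipper fs nothing  = pure
    Cost-probes π c₀ ws obs flipper fs (just g) = weaken-Cost (≤-reflexive (cong (_* (κ-bits + 1)) (length-toList fs)))
      (Cost-allQ (toList fs) (λ (f , seeds) → Cost->>= (Cost-bits π c₀ ws f) (λ b → Cost-probe π flipper f b (first (eval obs g) seeds))))

    Cost-if : ∀ b {p : Query n Bool} → Cost κ₂ p → Cost κ₂ (if b then p else pure false)
    Cost-if true  c = c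
    Cost-if false c = pure

  Cost-program : ∀ ω → Cost queries (program ω)
  Cost-program (π , tr , c₀ , ds , ws , cs , fs) = Cost->>=
    (weaken-Cost (≤-reflexive (cong (_* (N₁ * 1)) (length-allPoints k))) (Cost-countQ (allPoints k) (λ j → Cost-anyQ′ tr (λ { (x , y , z , B) → Cost-ask (z ⊕ ((x ⊕ y) ⊙ (block π j ⊙ B))) not }))))
    (λ m → Cost-if (m ≤ᵇ μ) (Cost->>= (Cost-mapQ ds (Cost-bits π c₀ ws)) (λ dbits → Cost->>= (Cost-mapQ cs (Cost-bits π c₀ ws)) (λ cbits →
      Cost-probes π c₀ ws (union dbits) (carrier π c₀ ds dbits) fs (selected (union dbits) cbits)))))

  module _ (h : BoolFun n) where
    open JuntaTest h k N₁ μ using (passes; marked)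
    open Tester h k r using (module Phase₂)

    private
      run-if : ∀ b (p : Query n Bool) → run h (if b then p else pure false) ≡ b ∧ run h p
      run-if true  p = refl
      run-if false p = refl

      run-bits : ∀ π c₀ ws c → run h (bitsQ π c₀ ws c) ≡ Tester.actual h k r π c₀ ws c
      run-bits π c₀ ws c = trans (run-mapQ h _ (tabulate unidx)) (map-cong (λ j → run-anyQ h (toList ws) _) (tabulate unidx))

      run-map-bits : ∀ π c₀ ws {m} (v : Vec (Point n) m) → run h (mapQ (bitsQ π c₀ ws) v) ≡ Vec.map (Tester.actual h k r π c₀ ws) v
      run-map-bits π c₀ ws v = trans (run-mapQ h _ v) (map-cong (run-bits π c₀ ws) v)

      run-marked : ∀ π tr j → run h (markedQ π tr j) ≡ marked π tr j
      run-marked π tr j = run-anyQ h (toList tr) (failsQ (block π j))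

      run-probe : ∀ π c₀ (ws : Vec (Point n) W) obs flipper f σ → run h (probeQ π flipper f (Tester.actual h k r π c₀ ws f) σ) ≡ Phase₂.probe π obs flipper (Tester.actual h k r π c₀ ws) f σ
      run-probe π c₀ ws obs flipper f nothing  = refl
      run-probe π c₀ ws obs flipper f (just σ) = refl

      run-probes : ∀ π c₀ ws obs flipper fs result → run h (probesQ π c₀ ws obs flipper fs result) ≡ Phase₂.verify π obs flipper (Tester.actual h k r π c₀ ws) result fs
      run-probes π c₀ ws obs flipper fs nothing  = refl
      run-probes π c₀ ws obs flipper fs (just g) = trans (run-allQ h (toList fs) _) (all-cong (All.universal one (toList fs)))
        where
        one : ∀ t → run h (bitsQ π c₀ ws (proj₁ t) >>= λ b → probeQ π flipper (proj₁ t) b (first (eval obs g) (proj₂ t))) ≡ Phase₂.verdict π obs flipper (Tester.actual h k r π c₀ ws) g t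
        one (f , seeds) = trans (run->>= h (bitsQ π c₀ ws f) _) (trans (cong (λ b → run h (probeQ π flipper f b (first (eval obs g) seeds))) (run-bits π c₀ ws f))
          (run-probe π c₀ ws obs flipper f (first (eval obs g) seeds)))

      run-phase₂ : ∀ π c₀ ds ws cs fs → run h (phase₂Q π c₀ ds ws cs fs) ≡ Actual.run₂ h k r π c₀ ds ws cs fs
      run-phase₂ π c₀ ds ws cs fs = trans (run->>= h (mapQ (bitsQ π c₀ ws) ds) _)
        (trans (cong (λ dbits → run h (mapQ (bitsQ π c₀ ws) cs >>= λ cbits → probesQ π c₀ ws (union dbits) (carrier π c₀ ds dbits) fs (selected (union dbits) cbits))) (run-map-bits π c₀ ws ds))
        (trans (run->>= h (mapQ (bitsQ π c₀ ws) cs) _)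
        (trans (cong (λ cbits → run h (probesQ π c₀ ws obs flipper fs (selected obs cbits))) (run-map-bits π c₀ ws cs))
        (trans (run-probes π c₀ ws obs flipper fs (selected obs (Vec.map β cs)))
          (cong (λ result → Phase₂.verify π obs flipper β result fs) (best-cong _ (codes K r) (λ g → all-map (eval obs g) β cs)))))))
        where
        β = Tester.actual h k r π c₀ ws
        obs = union (Vec.map β ds)
        flipper = carrier π c₀ ds (Vec.map β ds)

    run-program : ∀ π tr c₀ ds ws cs fs → run h (program (π , tr , c₀ , ds , ws , cs , fs)) ≡ passes π tr ∧ Actual.run₂ h k r π c₀ ds ws cs fs
    run-program π tr c₀ ds ws cs fs = trans (run->>= h (countQ (allPoints k) (markedQ π tr)) _)
      (trans (run-if _ (phase₂Q π c₀ ds ws cs fs)) (cong₂ _∧_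
        (cong (_≤ᵇ μ) (trans (run-countQ h (allPoints k) (markedQ π tr)) (∑-cong (allPoints k) (λ j → cong [_]ᵇ (run-marked π tr j)))))
        (run-phase₂ π c₀ ds ws cs fs)))

  trialSampler : Sampler n Trial
  trialSampler = pointSampler ⊗ pointSampler ⊗ pointSampler ⊗ cubeSampler n

  probeSampler : Sampler n (Point n × Vec (Point K) (2 ^ K))
  probeSampler = pointSampler ⊗ vecSampler (cubeSampler K) (2 ^ K)

  sampler : Sampler n Input
  sampler = vecSampler (cubeSampler k) n ⊗ vecSampler trialSampler N₁ ⊗ pointSampler
    ⊗ vecSampler pointSampler W ⊗ vecSampler pointSampler W ⊗ vecSampler pointSampler N ⊗ vecSampler probeSampler N₂

  -- Labellings, random sets and the seeds of rejection sampling consist of coins and cost nothing;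
  -- a trial costs three samples.
  cost-sampler : cost sampler ≡ N₁ * 3 + (1 + (W + (W + (N + N₂))))
  cost-sampler = cong₂ _+_ (trans (cost-vecSampler (cubeSampler k) n) (trans (cong (n *_) (cost-cubeSampler {n} k)) (*-zeroʳ n)))
    (cong₂ _+_ (trans (cost-vecSampler trialSampler N₁) (cong (λ c → N₁ * (3 + c)) (cost-cubeSampler {n} n)))
    (cong suc (cong₂ _+_ (ones W) (cong₂ _+_ (ones W) (cong₂ _+_ (ones N)
      (trans (cost-vecSampler probeSampler N₂) (trans (cong (λ c → N₂ * (1 + c)) (trans (cost-vecSampler (cubeSampler K) (2 ^ K)) (trans (cong (2 ^ K *_) (cost-cubeSampler {n} K)) (*-zeroʳ (2 ^ K))))) (*-identityʳ N₂))))))))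
    where
    ones : ∀ m → cost (vecSampler (pointSampler {n}) m) ≡ m
    ones m = trans (cost-vecSampler pointSampler m) (*-identityʳ m)

  tester : Alg n
  tester = algorithm sampler program

  calls-tester : CallsWithin (N₁ * 3 + (1 + (W + (W + (N + N₂)))) + queries) tester
  calls-tester = weaken (≤-reflexive (cong (_+ queries) cost-sampler)) (calls-algorithm sampler Cost-program)

module Correctness {n : ℕ} (h : BoolFun n) (0<u : 0 < supportSize h) (k r μ e : ℕ) (constants : Constants k r μ e) where
  open Constants constants
  open Test h 0<u k r μ e constants
  open Program {n} k r μ N₁ W (M * L) N₂

  private
    pair : ∀ {A B : Set} (s : Sampler n A) (t : Sampler n B) {L M} → els s h ≡ L → els t h ≡ M → els (s ⊗ t) h ≡ cartesianProduct L M
    pair s t refl refl = refl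

    vec : ∀ {A : Set} (s : Sampler n A) m {L} → els s h ≡ L → els (vecSampler s m) h ≡ vecs L m
    vec s m refl = els-vecSampler s m h

    els-sampler : els sampler h ≡ outcomes
    els-sampler = pair (vecSampler (cubeSampler k) n) s₁ (vec (cubeSampler k) n (els-cubeSampler k h))
      (pair (vecSampler trialSampler N₁) s₂ (vec trialSampler N₁ els-trial)
      (pair pointSampler s₃ refl
      (pair (vecSampler pointSampler W) s₄ (vec pointSampler W refl)
      (pair (vecSampler pointSampler W) s₅ (vec pointSampler W refl)
      (pair (vecSampler pointSampler (M * L)) (vecSampler probeSampler N₂) (vec pointSampler (M * L) refl) (vec probeSampler N₂ els-probe))))))
      where
      s₅ = vecSampler pointSampler (M * L) ⊗ vecSampler probeSampler N₂
      s₄ = vecSampler pointSampler W ⊗ s₅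
      s₃ = vecSampler pointSampler W ⊗ s₄
      s₂ = pointSampler ⊗ s₃
      s₁ = vecSampler trialSampler N₁ ⊗ s₂
      els-trial : els trialSampler h ≡ Error.trials h
      els-trial = cong (λ L → cartesianProduct (support h) (cartesianProduct (support h) (cartesianProduct (support h) L))) (els-cubeSampler n h)
      els-probe : els probeSampler h ≡ cartesianProduct (support h) (vecs (allPoints (2 ^ k)) (2 ^ (2 ^ k)))
      els-probe = cong (cartesianProduct (support h)) (vec (cubeSampler (2 ^ k)) (2 ^ (2 ^ k)) (els-cubeSampler (2 ^ k) h))

    transfer : ∀ (o : Bool → Bool) → 10 * (∑[ ω ∈ outcomes ] [ o (accepts ω) ]ᵇ) ≤ length outcomes →
      10 * (∑[ ω ∈ els sampler h ] [ o (run h (program ω)) ]ᵇ) ≤ length (els sampler h)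
    transfer o le = ≤-trans (≤-reflexive (cong (10 *_) (trans (∑-cong (els sampler h) (λ { (π , tr , c₀ , ds , ws , cs , fs) → cong (λ b → [ o b ]ᵇ) (run-program h π tr c₀ ds ws cs fs) })) (cong (λ L → ∑[ ω ∈ L ] [ o (accepts ω) ]ᵇ) els-sampler))))
      (≤-trans le (≤-reflexive (cong length (sym els-sampler))))

  tester-complete : IsFactoredDNF r μ h → nineTenths ≤ℚ accProb tester h
  tester-complete fact = nineTenths≤accProb sampler program h 0<u (transfer not (completeness fact))

  tester-sound : (∀ h′ → IsFactoredDNF r μ h′ → supportSize h < e * distance h h′) → nineTenths ≤ℚ rejProb tester h
  tester-sound far = nineTenths≤rejProb sampler program h 0<u (transfer id (soundness far))

-- The choice of the parameters

-- Labels are points of a cube, so the number of blocks has to be a power of two, which costs at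
-- most a factor two.
pow2-between : ∀ x → 0 < x → ∃ λ k → x ≤ 2 ^ k × 2 ^ k ≤ 2 * x
pow2-between (suc zero)    _ = 0 , s≤s z≤n , s≤s z≤n
pow2-between (suc (suc x)) _ with pow2-between (suc x) (s≤s z≤n)
... | k , lo , hi with suc (suc x) ≤? 2 ^ k
...   | yes le = k , le , ≤-trans hi (*-monoʳ-≤ 2 (n≤1+n (suc x)))
...   | no ¬le = suc k , ≤-trans (s≤s lo) (≤-trans (+-monoˡ-≤ (2 ^ k) (m^n>0 2 k)) (≤-reflexive (cong (λ x → 2 ^ k + x) (sym (+-identityʳ (2 ^ k))))))
                       , *-monoʳ-≤ 2 (≤-trans (≤-pred (≰⇒> ¬le)) (n≤1+n (suc x)))

module Parameters (s k r μ e : ℕ) (0<e : 0 < e) (e-small : 10000 * e ≤ s) (r-small : 10000 * suc r ≤ s) (μ-small : 10000 * suc μ ≤ s)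
  (K-large : 100 * (suc μ * suc μ) ≤ 2 ^ k) (K-small : 2 ^ k ≤ 2 * (100 * (suc μ * suc μ))) where
  private
    K = 2 ^ k

    infix 4 _≼_
    -- A calculus of exponents. The base `s` exceeds every numerical constant in the demands, so a
    -- constant factor or a sum costs one exponent.
    record _≼_ (x a : ℕ) : Set where
      constructor bounded
      field bound : x ≤ s ^ a
    open _≼_

    s-large : 10000 ≤ s
    s-large = ≤-trans (*-monoʳ-≤ 10000 0<e) e-small

    instance
      s-nonZero : NonZero s
      s-nonZero = >-nonZero (≤-trans (s≤s z≤n) s-large)

    infixr 7 _⊠_
    infixr 6 _⊞_
    infixr 5 _via_

    _⊠_ : ∀ {x y a b} → x ≼ a → y ≼ b → x * y ≼ a + b
    _⊠_ {a = a} {b} (bounded p) (bounded q) = bounded (≤-trans (*-mono-≤ p q) (≤-reflexive (sym (^-distribˡ-+-* s a b))))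

    lift : ∀ {x a b} → a ≤ b → x ≼ a → x ≼ b
    lift le (bounded p) = bounded (≤-trans p (^-monoʳ-≤ s le))

    _⊞_ : ∀ {x y a b} → x ≼ a → y ≼ b → x + y ≼ suc (a ⊔ b)
    _⊞_ {x} {y} {a} {b} p q = bounded (begin
      x + y                              ≤⟨ +-mono-≤ (bound (lift (m≤m⊔n a b) p)) (bound (lift (m≤n⊔m a b) q)) ⟩
      s ^ (a ⊔ b) + s ^ (a ⊔ b)          ≡⟨ cong (λ x → s ^ (a ⊔ b) + x) (+-identityʳ (s ^ (a ⊔ b))) ⟨
      2 * s ^ (a ⊔ b)                    ≤⟨ *-monoˡ-≤ (s ^ (a ⊔ b)) (≤-trans (≤ᵇ⇒≤ 2 10000 _) s-large) ⟩
      s ^ suc (a ⊔ b)                    ∎)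
      where open ≤-Reasoning

    _via_ : ∀ {x y a} → x ≤ y → y ≼ a → x ≼ a
    le via bounded p = bounded (≤-trans le p)

    power : ∀ a → s ^ a ≼ a
    power a = bounded ≤-refl

    once : ∀ {x} → x ≤ s → x ≼ 1
    once le = bounded (≤-trans le (≤-reflexive (sym (*-identityʳ s))))

    constant : ∀ {c} → c ≤ 10000 → c ≼ 1
    constant le = once (≤-trans le s-large)

    multiple-μ : ∀ {c} → c ≤ 10000 → c * suc μ ≼ 1
    multiple-μ le = once (≤-trans (*-monoˡ-≤ (suc μ) le) μ-small)

    K≼ : K ≼ 2
    K≼ = ≤-trans K-small (≤-reflexive (trans (sym (*-assoc 2 100 (suc μ * suc μ))) (trans (sym (*-assoc 200 (suc μ) (suc μ))) (cong (200 * suc μ *_) (sym (*-identityˡ (suc μ)))))))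
      via multiple-μ (≤ᵇ⇒≤ 200 10000 _) ⊠ multiple-μ (≤ᵇ⇒≤ 1 10000 _)

    L-large′ : 7 + (1 + (K + K)) * r ≼ 3
    L-large′ = (begin
      7 + (1 + (K + K)) * r             ≤⟨ +-mono-≤ (*-monoʳ-≤ 7 (m^n>0 2 k)) (*-monoˡ-≤ r (+-monoˡ-≤ (K + K) (m^n>0 2 k))) ⟩
      7 * K + (K + (K + K)) * r         ≡⟨ lem K r ⟩
      K * (7 + 3 * r)                   ≤⟨ *-monoʳ-≤ K (+-monoʳ-≤ 7 (*-monoˡ-≤ r (s≤s (s≤s (s≤s (z≤n {4})))))) ⟩
      K * (7 + 7 * r)                   ≡⟨ cong (K *_) (*-suc 7 r) ⟨
      K * (7 * suc r)                   ∎)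
      via K≼ ⊠ once (≤-trans (*-monoˡ-≤ (suc r) (≤ᵇ⇒≤ 7 10000 _)) r-small)
      where
      open ≤-Reasoning
      lem : ∀ x y → 7 * x + (x + (x + x)) * y ≡ x * (7 + 3 * y)
      lem = solve-∀

    length-codes : length (codes K r) ≡ 2 ^ ((1 + (K + K)) * r)
    length-codes = trans (length-vecs (cartesianProduct (true ∷ false ∷ []) (cartesianProduct (allPoints K) (allPoints K))) r) (trans (cong (_^ r) base) (^-*-assoc 2 (1 + (K + K)) r))
      where
      base : length (cartesianProduct (true ∷ false ∷ []) (cartesianProduct (allPoints K) (allPoints K))) ≡ 2 ^ (1 + (K + K))
      base = trans (length-cartesian _,_ (true ∷ false ∷ []) (cartesianProduct (allPoints K) (allPoints K))) (cong (2 *_) (trans (length-cartesian _,_ (allPoints K) (allPoints K))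
        (trans (cong₂ _*_ (length-allPoints K) (length-allPoints K)) (sym (^-distribˡ-+-* 2 K K)))))

    swap : ∀ c d x y → c * x * (d * y) ≡ c * d * (x * y)
    swap = solve-∀

    swap′ : ∀ c d x y → c * (x * (d * y)) ≡ c * d * x * y
    swap′ = solve-∀

    swap″ : ∀ c x y z → c * x * (z * (y * 2)) ≡ c * 2 * x * (z * y)
    swap″ = solve-∀

  constants : Constants k r μ e
  constants = record
    -- The exponents follow from the demands together with `K ≤ s ^ 2`: for instance, `D` has to
    -- exceed `1000 * (s ^ 2 * s ^ 3)`, `D′` has to exceed `200 * (K * s ^ 8 * s ^ 8)`, and `N₁`
    -- gets 20 from `S`, 2 from `K` and 1 from `200 * suc μ`.
    { N₁ = s ^ 23; W = s ^ 8; D′ = s ^ 19; S = s ^ 20; T = s ^ 7; D = s ^ 6; Q = s ^ 4; M = s ^ 2; N₂ = s ^ 1; L = s ^ 3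
    ; 0<e = 0<e
    ; N₂-large = bound (N₂-large via once (≤-trans (*-monoˡ-≤ e (≤ᵇ⇒≤ 1200 10000 _)) e-small))
    ; D-large  = bound (lift (≤ᵇ⇒≤ 2 6 _) (≤-reflexive (sym (*-assoc 26 300 (s ^ 1))) via constant (≤ᵇ⇒≤ 7800 10000 _) ⊠ power 1))
    ; M-large  = bound (≤-reflexive (sym (*-assoc 2 300 (s ^ 1))) via constant (≤ᵇ⇒≤ 600 10000 _) ⊠ power 1)
    ; Q-large  = bound (≤-reflexive (swap 4 300 K (s ^ 1)) via constant (≤ᵇ⇒≤ 1200 10000 _) ⊠ K≼ ⊠ power 1)
    ; L-large  = L-large
    ; D-larger = bound (constant (≤ᵇ⇒≤ 1000 10000 _) ⊠ power 2 ⊠ power 3)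
    ; D′-large = bound (lift (≤ᵇ⇒≤ 7 19 _) (constant (≤ᵇ⇒≤ 2 10000 _) ⊠ power 6))
    ; T-large  = bound (≤-trans (*-monoʳ-≤ 4 (*-monoˡ-≤ (s ^ 6) (n≤1+n μ))) (≤-reflexive (sym (*-assoc 4 (suc μ) (s ^ 6)))) via multiple-μ (≤ᵇ⇒≤ 4 10000 _) ⊠ power 6)
    ; 0<T      = m^n>0 s 7
    ; K-large  = K-large
    ; W-large  = bound (≤-trans (*-monoʳ-≤ 100 (*-monoˡ-≤ (2 * s ^ 7) (n≤1+n μ))) (≤-reflexive (swap′ 100 2 (suc μ) (s ^ 7))) via multiple-μ (≤ᵇ⇒≤ 200 10000 _) ⊠ power 7)
    ; D′-Q     = bound (lift (≤ᵇ⇒≤ 13 19 _) (constant (≤ᵇ⇒≤ 100 10000 _) ⊠ power 4 ⊠ power 8))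
    ; D′-W     = bound (constant (≤ᵇ⇒≤ 200 10000 _) ⊠ (K≼ ⊠ power 8) ⊠ power 8)
    ; D′-N     = bound (lift (≤ᵇ⇒≤ 16 19 _) (constant (≤ᵇ⇒≤ 200 10000 _) ⊠ (K≼ ⊠ power 8) ⊠ power 2 ⊠ power 3))
    ; D′-N₂    = bound (lift (≤ᵇ⇒≤ 12 19 _) (constant (≤ᵇ⇒≤ 200 10000 _) ⊠ (K≼ ⊠ power 8) ⊠ power 1))
    ; S-large  = bound (power 19 ⊠ multiple-μ (≤ᵇ⇒≤ 2 10000 _))
    ; 0<S      = m^n>0 s 20
    ; N₁-large = bound (≤-reflexive (swap″ 100 (suc μ) K (s ^ 20)) via multiple-μ (≤ᵇ⇒≤ 200 10000 _) ⊠ power 20 ⊠ K≼)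
    }
    where
    N₂-large : 100 * (4 * (1 + 2 * e)) ≤ 1200 * e
    N₂-large = ≤-trans (*-monoʳ-≤ 100 (*-monoʳ-≤ 4 (+-monoˡ-≤ (2 * e) 0<e))) (≤-reflexive (trans (sym (*-assoc 100 4 (3 * e))) (sym (*-assoc 400 3 e))))
    L-large : 100 * length (codes K r) ≤ 2 ^ (s ^ 3)
    L-large = begin
      100 * length (codes K r)           ≡⟨ cong (100 *_) length-codes ⟩
      100 * 2 ^ ((1 + (K + K)) * r)      ≤⟨ *-monoˡ-≤ (2 ^ ((1 + (K + K)) * r)) (≤ᵇ⇒≤ 100 128 _) ⟩
      2 ^ 7 * 2 ^ ((1 + (K + K)) * r)    ≡⟨ ^-distribˡ-+-* 2 7 ((1 + (K + K)) * r) ⟨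
      2 ^ (7 + (1 + (K + K)) * r)        ≤⟨ ^-monoʳ-≤ 2 (bound L-large′) ⟩
      2 ^ (s ^ 3)                        ∎
      where open ≤-Reasoning

  -- The dominant term is `K * N₁`, at most `s ^ 25`; the two remaining exponents pay for the sums.
  calls≤ : ∀ {n} → s ^ 23 * 3 + (1 + (s ^ 8 + (s ^ 8 + (s ^ 2 * s ^ 3 + s ^ 1)))) + Program.queries {n} k r μ (s ^ 23) (s ^ 8) (s ^ 2 * s ^ 3) (s ^ 1) ≤ s ^ 27
  calls≤ = bound ((power 23 ⊠ constant (≤ᵇ⇒≤ 3 10000 _) ⊞ one ⊞ power 8 ⊞ power 8 ⊞ power 2 ⊠ power 3 ⊞ power 1)
    ⊞ K≼ ⊠ power 23 ⊠ one ⊞ power 8 ⊠ bits ⊞ (power 2 ⊠ power 3) ⊠ bits ⊞ power 1 ⊠ (bits ⊞ one))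
    where
    one : 1 ≼ 0
    one = power 0
    bits : K * (s ^ 8 * 1) ≼ 10
    bits = K≼ ⊠ power 8 ⊠ one

  module _ {n : ℕ} where
    open Constants constants using (N₁; W; M; L; N₂)

    tester : Alg n
    tester = Program.tester k r μ N₁ W (M * L) N₂

    tester-calls : CallsWithin (s ^ 27) tester
    tester-calls = weaken (calls≤ {n}) (Program.calls-tester k r μ N₁ W (M * L) N₂)

    tester-complete : ∀ (h : BoolFun n) → 0 < supportSize h → IsFactoredDNF r μ h → nineTenths ≤ℚ accProb tester h
    tester-complete h 0<u = Correctness.tester-complete h 0<u k r μ e constants

    tester-sound : ∀ (h : BoolFun n) → 0 < supportSize h → (∀ h′ → IsFactoredDNF r μ h′ → supportSize h < e * distance h h′) → nineTenths ≤ℚ rejProb tester h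
    tester-sound h 0<u = Correctness.tester-sound h 0<u k r μ e constants

-- Relative distance and the bound `polyBound`

supportSize-xor : ∀ (f g : BoolFun n) → supportSize (λ x → xorB (f x) (g x)) ≡ distance f g
supportSize-xor {n} f g = trans (sym (∑-one (support differ))) (trans (∑-filter differ (λ _ → 1) (allPoints n)) (∑-cong (allPoints n) (λ x → *-identityʳ [ differ x ]ᵇ)))
  where
  differ : BoolFun n
  differ x = xorB (f x) (g x)

far⇒ : ∀ (f g : BoolFun n) a b → 0 < supportSize f → mkℚᵘ (+ a) b <ℚ reldist f g → a * supportSize f < distance f g * suc b
far⇒ f g a b 0<u lt = go (supportSize f) {distance f g} 0<u (subst (λ d → mkℚᵘ (+ a) b <ℚ divℕ d (supportSize f)) (supportSize-xor f g) lt)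
  where
  go : ∀ u {d} → 0 < u → mkℚᵘ (+ a) b <ℚ divℕ d u → a * u < d * suc b
  go (suc u) {d} _ (ℚ.*<* l) = ℤ.drop‿+<+ (subst₂ ℤ._<_ (sym (ℤ.pos-* a (suc u))) (sym (ℤ.pos-* d (suc b))) l)

zero-factored : ∀ r μ → IsFactoredDNF {n} r μ (λ _ → false)
zero-factored {n} r μ = [] , [] , z≤n , (λ (_ , i∈) → ∉⊥ (proj₁ (x∈p∩q⁻ _ _ i∈))) , ≤-trans (≤-reflexive (∣⊥∣≡0 n)) z≤n , λ _ → refl

distance-zero : ∀ (h : BoolFun n) → distance h (λ _ → false) ≡ supportSize h
distance-zero {n} h = trans (∑-cong (allPoints n) (λ x → trans (cong [_]ᵇ (lem (h x))) (sym (*-identityʳ _)))) (trans (sym (∑-filter h (λ _ → 1) (allPoints n))) (∑-one (support h)))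
  where
  lem : ∀ b → xorB b false ≡ b
  lem true  = refl
  lem false = refl

nonNegative⟪⟫ : ∀ m → ℚ.NonNegative ⟪ m ⟫
nonNegative⟪⟫ m = ℚ.nonNegative {⟪ m ⟫} (⟪≤⟫ z≤n)

^-bound : ∀ s C Y → ⟪ s ⟫ ≤ℚ ⟪ C ⟫ ℚ.* Y → ∀ k → ⟪ s ^ k ⟫ ≤ℚ ⟪ C ^ k ⟫ ℚ.* (Y ^ᵘ k)
^-bound s C Y le zero    = ℚ.≤-reflexive (ℚ.≃-sym (ℚ.*-identityʳ ⟪ 1 ⟫))
^-bound s C Y le (suc k) = begin
  ⟪ s * s ^ k ⟫                                   ≃⟨ ⟪*⟫ s (s ^ k) ⟩
  ⟪ s ⟫ ℚ.* ⟪ s ^ k ⟫                             ≤⟨ ℚ.*-mono-≤-nonNeg {{nonNegative⟪⟫ s}} {{nonNegative⟪⟫ (s ^ k)}} le (^-bound s C Y le k) ⟩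
  ⟪ C ⟫ ℚ.* Y ℚ.* (⟪ C ^ k ⟫ ℚ.* (Y ^ᵘ k))        ≃⟨ +-*-Solver.solve 4 (λ c y d z → c :* y :* (d :* z) := c :* d :* (y :* z)) ℚ.≃-refl ⟪ C ⟫ Y ⟪ C ^ k ⟫ (Y ^ᵘ k) ⟩
  ⟪ C ⟫ ℚ.* ⟪ C ^ k ⟫ ℚ.* (Y ℚ.* (Y ^ᵘ k))        ≃⟨ ℚ.*-congʳ {Y ℚ.* (Y ^ᵘ k)} (⟪*⟫ C (C ^ k)) ⟨
  ⟪ C * C ^ k ⟫ ℚ.* (Y ℚ.* (Y ^ᵘ k))              ∎
  where
  open ℚ.≤-Reasoning
  open +-*-Solver using (_:*_; _:=_)

polyBound-^ : ∀ s C r μ ε .{{_ : Positive ε}} → ⟪ s ⟫ ≤ℚ ⟪ C ⟫ ℚ.* (_÷_ ⟪ r ⟫ ε {{ℚ.pos⇒nonZero ε}} ℚ.+ ⟪ μ ⟫) → ∀ k → ⟪ s ^ k ⟫ ≤ℚ polyBound (C ^ k) k r μ ε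
polyBound-^ s C r μ ε = ^-bound s C (_÷_ ⟪ r ⟫ ε {{ℚ.pos⇒nonZero ε}} ℚ.+ ⟪ μ ⟫)

quotient-bound : ∀ r μ a b s C → s * suc a ≤ C * (r * suc b + μ * suc a) → ⟪ s ⟫ ≤ℚ ⟪ C ⟫ ℚ.* ((⟪ r ⟫ ÷ mkℚᵘ (+ suc a) b) ℚ.+ ⟪ μ ⟫)
quotient-bound r μ a b s C le = ℚ.*-cancelʳ-≤-pos ⟪ suc a ⟫ (begin
  ⟪ s ⟫ ℚ.* ⟪ suc a ⟫                                                    ≃⟨ ⟪*⟫ s (suc a) ⟨
  ⟪ s * suc a ⟫                                                          ≤⟨ ⟪≤⟫ le ⟩
  ⟪ C * (r * suc b + μ * suc a) ⟫                                        ≃⟨ expand ⟩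
  ⟪ C ⟫ ℚ.* (⟪ r ⟫ ℚ.* ⟪ suc b ⟫ ℚ.+ ⟪ μ ⟫ ℚ.* ⟪ suc a ⟫)               ≃⟨ ℚ.*-congˡ {⟪ C ⟫} (ℚ.+-congˡ (⟪ μ ⟫ ℚ.* ⟪ suc a ⟫) (ℚ.*-congˡ {⟪ r ⟫} inverse)) ⟨
  ⟪ C ⟫ ℚ.* (⟪ r ⟫ ℚ.* (mkℚᵘ (+ suc b) a ℚ.* ⟪ suc a ⟫) ℚ.+ ⟪ μ ⟫ ℚ.* ⟪ suc a ⟫)
    ≃⟨ +-*-Solver.solve 5 (λ c r y m z → c :* (r :* (y :* z) :+ m :* z) := c :* (r :* y :+ m) :* z) ℚ.≃-refl ⟪ C ⟫ ⟪ r ⟫ (mkℚᵘ (+ suc b) a) ⟪ μ ⟫ ⟪ suc a ⟫ ⟩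
  ⟪ C ⟫ ℚ.* ((⟪ r ⟫ ÷ mkℚᵘ (+ suc a) b) ℚ.+ ⟪ μ ⟫) ℚ.* ⟪ suc a ⟫         ∎)
  where
  open ℚ.≤-Reasoning
  open +-*-Solver using (_:*_; _:=_; _:+_)
  inverse : mkℚᵘ (+ suc b) a ℚ.* ⟪ suc a ⟫ ≃ ⟪ suc b ⟫
  inverse = *≡* (trans (ℤ.*-identityʳ _) (cong (λ z → + suc b ℤ.* + z) (sym (*-identityʳ (suc a)))))
  expand : ⟪ C * (r * suc b + μ * suc a) ⟫ ≃ ⟪ C ⟫ ℚ.* (⟪ r ⟫ ℚ.* ⟪ suc b ⟫ ℚ.+ ⟪ μ ⟫ ℚ.* ⟪ suc a ⟫)
  expand = ℚ.≃-trans (⟪*⟫ C (r * suc b + μ * suc a)) (ℚ.*-congˡ {⟪ C ⟫} (ℚ.≃-trans (⟪+⟫ (r * suc b) (μ * suc a)) (ℚ.+-cong (⟪*⟫ r (suc b)) (⟪*⟫ μ (suc a)))))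

-- Abstract, so that conversion checking does not expand the powers.
abstract
  exponent : ℕ
  exponent = 27

  exponent≡27 : exponent ≡ 27
  exponent≡27 = refl

-- With `ε = suc a / suc b` below 1 this amounts to `1/ε + r + μ + 3 ≤ 4 (r/ε + μ)`: here `1/ε` and
-- `r` are at most `r/ε`, and 3 is at most `3 μ`.
scale-bound : ∀ c r μ a b → 1 ≤ r → 1 ≤ μ → a < b →
  c * (suc (suc b ℕ./ suc a) + suc r + suc μ) * suc a ≤ c * 4 * (r * suc b + μ * suc a)
scale-bound c r μ a b 1≤r 1≤μ a<b = begin
  c * (suc q + suc r + suc μ) * α                    ≡⟨ expand c q r μ α ⟩
  c * (q * α + (r * α + (μ * α + 3 * (1 * α))))
    ≤⟨ *-monoʳ-≤ c (+-mono-≤ (≤-trans (ℕ.m/n*n≤m (suc b) α) (≤-trans (≤-reflexive (sym (*-identityˡ (suc b)))) (*-monoˡ-≤ (suc b) 1≤r)))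
       (+-mono-≤ (*-monoʳ-≤ r (s≤s (<⇒≤ a<b))) (+-monoʳ-≤ (μ * α) (*-monoʳ-≤ 3 (*-monoˡ-≤ α 1≤μ))))) ⟩
  c * (r * suc b + (r * suc b + (μ * α + 3 * (μ * α))))
    ≤⟨ *-monoʳ-≤ c (m≤m+n _ (2 * (r * suc b))) ⟩
  c * (r * suc b + (r * suc b + (μ * α + 3 * (μ * α))) + 2 * (r * suc b))
    ≡⟨ collect c (r * suc b) (μ * α) ⟩
  c * 4 * (r * suc b + μ * α)                        ∎
  where
  open ≤-Reasoning
  α = suc a
  q = suc b ℕ./ suc a
  expand : ∀ c q x y z → c * (suc q + suc x + suc y) * z ≡ c * (q * z + (x * z + (y * z + 3 * (1 * z))))
  expand = solve-∀
  collect : ∀ c x y → c * (x + (x + (y + 3 * y)) + 2 * x) ≡ c * 4 * (x + y)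
  collect = solve-∀

module Choice (r μ a b : ℕ) where
  e : ℕ
  -- One more than the integer part of `1 / ε`, hence larger than `1 / ε`.
  e = suc (suc b ℕ./ suc a)

  -- Abstract, so that the products with the literal 10000 are never unfolded.
  abstract
    s : ℕ
    -- The factor 10000 covers all numerical constants of `Constants`, of which `26 * 300` is the
    -- largest.
    s = 10000 * (e + suc r + suc μ)

    e-small : 10000 * e ≤ s
    e-small = *-monoʳ-≤ 10000 (≤-trans (m≤m+n e (suc r)) (m≤m+n (e + suc r) (suc μ)))

    r-small : 10000 * suc r ≤ s
    r-small = *-monoʳ-≤ 10000 (≤-trans (m≤n+m (suc r) e) (m≤m+n (e + suc r) (suc μ)))

    μ-small : 10000 * suc μ ≤ s
    μ-small = *-monoʳ-≤ 10000 (m≤n+m (suc μ) (e + suc r))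

    s-small : 1 ≤ r → 1 ≤ μ → a < b → s * suc a ≤ 40000 * (r * suc b + μ * suc a)
    s-small = scale-bound 10000 r μ a b

    width : ∃ λ k → 100 * (suc μ * suc μ) ≤ 2 ^ k × 2 ^ k ≤ 2 * (100 * (suc μ * suc μ))
    width = pow2-between (100 * (suc μ * suc μ)) (s≤s z≤n)

  private
    module Bounds = Parameters s (proj₁ width) r μ e (s≤s z≤n) e-small r-small μ-small (proj₁ (proj₂ width)) (proj₂ (proj₂ width))

  chosen : Alg n
  chosen = Bounds.tester

  chosen-calls : CallsWithin {n} (s ^ exponent) chosen
  chosen-calls {n} = subst (λ m → CallsWithin {n} (s ^ m) chosen) (sym exponent≡27) Bounds.tester-calls

  chosen-complete : ∀ (h : BoolFun n) → 0 < supportSize h → IsFactoredDNF r μ h → nineTenths ≤ℚ accProb chosen h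
  chosen-complete = Bounds.tester-complete

  chosen-sound : ∀ (h : BoolFun n) → 0 < supportSize h → (∀ h′ → IsFactoredDNF r μ h′ → mkℚᵘ (+ suc a) b <ℚ reldist h h′) → nineTenths ≤ℚ rejProb chosen h
  chosen-sound h 0<u far = Bounds.tester-sound h 0<u λ h′ fact → far′ h′ (far⇒ h h′ (suc a) b 0<u (far h′ fact))
    where
    far′ : ∀ h′ → suc a * supportSize h < distance h h′ * suc b → supportSize h < e * distance h h′
    far′ h′ lt = *-cancelˡ-< (suc a) (supportSize h) (e * distance h h′) (begin-strict
      suc a * supportSize h            <⟨ lt ⟩
      distance h h′ * suc b            ≤⟨ *-monoʳ-≤ (distance h h′) (≤-trans (≤-reflexive (ℕ.m≡m%n+[m/n]*n (suc b) (suc a))) (+-monoˡ-≤ (suc b ℕ./ suc a * suc a) (<⇒≤ (ℕ.m%n<n (suc b) (suc a))))) ⟩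
      distance h h′ * (e * suc a)      ≡⟨ *-assoc (distance h h′) e (suc a) ⟨
      distance h h′ * e * suc a        ≡⟨ trans (*-comm (distance h h′ * e) (suc a)) (cong (suc a *_) (*-comm (distance h h′) e)) ⟩
      suc a * (e * distance h h′)      ∎)
      where open ≤-Reasoning

  s≤ : 1 ≤ r → 1 ≤ μ → a < b → ⟪ s ⟫ ≤ℚ ⟪ 40000 ⟫ ℚ.* ((⟪ r ⟫ ÷ mkℚᵘ (+ suc a) b) ℚ.+ ⟪ μ ⟫)
  s≤ 1≤r 1≤μ a<b = quotient-bound r μ a b s 40000 (s-small 1≤r 1≤μ a<b)

select : (r μ a b : ℕ) → Dec (a < b) → Alg n
select r μ a b (yes _) = Choice.chosen r μ a b
select r μ a b (no _)  = ret true

-- For ε ≥ 1 no function is ε-far: the zero function is a factored DNF at relative distance 1.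
testFactoredDNF : (n r μ : ℕ) → ℚᵘ → Alg n
testFactoredDNF n r μ (mkℚᵘ (+ suc a) b) = select r μ a b (a <? b)
testFactoredDNF n r μ _                  = ret true

select-calls : ∀ r μ a b → 1 ≤ r → 1 ≤ μ → (d : Dec (a < b)) →
  Σ ℕ λ q → CallsWithin {n} q (select r μ a b d) × ⟪ q ⟫ ≤ℚ polyBound (40000 ^ exponent) exponent r μ (mkℚᵘ (+ suc a) b)
select-calls r μ a b 1≤r 1≤μ (yes a<b) = Choice.s r μ a b ^ exponent , Choice.chosen-calls r μ a b , polyBound-^ (Choice.s r μ a b) 40000 r μ (mkℚᵘ (+ suc a) b) (Choice.s≤ r μ a b 1≤r 1≤μ a<b) exponent
-- No query is made here, so any number of calls below the bound will do; this one has the form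
-- required by `polyBound-^`.
select-calls r μ a b 1≤r 1≤μ (no _)    = 0 ^ exponent , ret true , polyBound-^ 0 40000 r μ (mkℚᵘ (+ suc a) b) (quotient-bound r μ a b 0 40000 z≤n) exponent

select-sound : ∀ r μ a b (d : Dec (a < b)) (h : BoolFun n) → 0 < supportSize h →
  (∀ h′ → IsFactoredDNF r μ h′ → mkℚᵘ (+ suc a) b <ℚ reldist h h′) → nineTenths ≤ℚ rejProb (select r μ a b d) h
select-sound r μ a b (yes _)  h 0<u far = Choice.chosen-sound r μ a b h 0<u far
select-sound r μ a b (no a≮b) h 0<u far = ⊥-elim (a≮b (≤-pred (*-cancelʳ-< (supportSize h) (suc a) (suc b) (begin-strict
  suc a * supportSize h                <⟨ far⇒ h (λ _ → false) (suc a) b 0<u (far (λ _ → false) (zero-factored r μ)) ⟩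
  distance h (λ _ → false) * suc b     ≡⟨ cong (_* suc b) (distance-zero h) ⟩
  supportSize h * suc b                ≡⟨ *-comm (supportSize h) (suc b) ⟩
  suc b * supportSize h                ∎))))
  where open ≤-Reasoning

select-complete : ∀ r μ a b (d : Dec (a < b)) (h : BoolFun n) → 0 < supportSize h → IsFactoredDNF r μ h → nineTenths ≤ℚ accProb (select r μ a b d) h
select-complete r μ a b (yes _) h 0<u fact = Choice.chosen-complete r μ a b h 0<u fact
select-complete r μ a b (no _)  h 0<u fact = ℚ.*≤* (ℤ.+≤+ (≤ᵇ⇒≤ 9 10 _))

theorem20 : Σ ((n r μ : ℕ) → ℚᵘ → Alg n) λ A →
    Σ ℕ λ c → Σ ℕ λ k →
    ((n r μ : ℕ) (ε : ℚᵘ) .{{_ : Positive ε}} → 1 ≤ r → 1 ≤ μ →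
    Σ ℕ λ q → CallsWithin q (A n r μ ε) × ((+ q / 1) ≤ℚ polyBound c k r μ ε))
    ×
    ((n r μ : ℕ) (ε : ℚᵘ) .{{_ : Positive ε}} → 1 ≤ r → 1 ≤ μ →
    (h : BoolFun n) → 0 < supportSize h →
    (IsFactoredDNF r μ h → nineTenths ≤ℚ accProb (A n r μ ε) h)
    ×
    (((h′ : BoolFun n) → IsFactoredDNF r μ h′ → ε <ℚ reldist h h′) →
    nineTenths ≤ℚ rejProb (A n r μ ε) h))
theorem20 = testFactoredDNF , 40000 ^ exponent , exponent , calls-bound , correct
  where
  calls-bound : (n r μ : ℕ) (ε : ℚᵘ) .{{_ : Positive ε}} → 1 ≤ r → 1 ≤ μ →
    Σ ℕ λ q → CallsWithin q (testFactoredDNF n r μ ε) × ⟪ q ⟫ ≤ℚ polyBound (40000 ^ exponent) exponent r μ ε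
  calls-bound n r μ (mkℚᵘ (+ suc a) b)      1≤r 1≤μ = select-calls r μ a b 1≤r 1≤μ (a <? b)
  calls-bound n r μ (mkℚᵘ (+ zero) b) {{p}} 1≤r 1≤μ = ⊥-elim-irr (ℤ.Positive.pos p)
  calls-bound n r μ (mkℚᵘ -[1+ _ ] b) {{p}} 1≤r 1≤μ = ⊥-elim-irr (ℤ.Positive.pos p)
  correct : (n r μ : ℕ) (ε : ℚᵘ) .{{_ : Positive ε}} → 1 ≤ r → 1 ≤ μ → (h : BoolFun n) → 0 < supportSize h →
    (IsFactoredDNF r μ h → nineTenths ≤ℚ accProb (testFactoredDNF n r μ ε) h) ×
    ((∀ h′ → IsFactoredDNF r μ h′ → ε <ℚ reldist h h′) → nineTenths ≤ℚ rejProb (testFactoredDNF n r μ ε) h)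
  correct n r μ (mkℚᵘ (+ suc a) b)      _ _ h 0<u = select-complete r μ a b (a <? b) h 0<u , select-sound r μ a b (a <? b) h 0<u
  correct n r μ (mkℚᵘ (+ zero) b) {{p}} _ _ h 0<u = ⊥-elim-irr (ℤ.Positive.pos p)
  correct n r μ (mkℚᵘ -[1+ _ ] b) {{p}} _ _ h 0<u = ⊥-elim-irr (ℤ.Positive.pos p)
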